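{- For all integers $n\geq 2$, $$5n-\frac{1+(-1)^{n}}{2}\leq R(W_{2n})\leq 8n+664.$$
   Context: For $k\ge 3$, the wheel $W_k$ is the graph on $k+1$ vertices obtained by joining one vertex (the center) to every vertex of a cycle of length $k$; also $W_2=K_3$. For a graph $H$, the Ramsey number $R(H)$ is the smallest integer $N$ such that every $2$-coloring of the edges of the complete graph $K_N$ contains a monochromatic copy of $H$. -}

module Defs where

open import Data.Nat using (ℕ; zero; suc; _+_; _*_; _∸_; _<_; _≤_; _%_)
open import Data.Fin using (Fin; zero; suc; toℕ)
open import Data.Bool using (Bool)
open import Data.Product using (Σ; _×_)
open import Data.Sum using (_⊎_)
open import Data.Unit using (⊤)
open import Data.Empty using (⊥)
open import Relation.Nullary using (¬_)
open import Relation.Binary.PropositionalEquality using (_≡_)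
open import Function.Definitions using (Injective)

Graph : ℕ → Set₁
Graph v = Fin v → Fin v → Set

-- Adjacency of the cycle C_k on vertices 0,…,k-1 (i ~ i+1 mod k); meant for k ≥ 3.
CycleAdj : (k : ℕ) → Fin k → Fin k → Set
CycleAdj k i j =
  (toℕ j ≡ suc (toℕ i)) ⊎ (toℕ i ≡ suc (toℕ j))
  ⊎ ((toℕ i ≡ 0 × suc (toℕ j) ≡ k) ⊎ (toℕ j ≡ 0 × suc (toℕ i) ≡ k))

Wheel : (k : ℕ) → Graph (suc k)
Wheel k zero    zero    = ⊥
Wheel k zero    (suc j) = ⊤
Wheel k (suc i) zero    = ⊤
Wheel k (suc i) (suc j) = CycleAdj k i j

-- A 2-colouring of the edges of K_N: a symmetric colour function on pairs
-- (values on the diagonal are irrelevant).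
Colouring : ℕ → Set
Colouring N = Σ (Fin N → Fin N → Bool) (λ c → ∀ x y → c x y ≡ c y x)

HasMonoCopy : ∀ {v N} → Graph v → Colouring N → Set
HasMonoCopy {v} {N} H (c Data.Product., _) =
  Σ Bool λ b → Σ (Fin v → Fin N) λ f →
    Injective _≡_ _≡_ f × (∀ i j → H i j → c (f i) (f j) ≡ b)

Arrows : ∀ {v} → ℕ → Graph v → Set
Arrows N H = (col : Colouring N) → HasMonoCopy H col

IsRamseyNumber : ∀ {v} → Graph v → ℕ → Set
IsRamseyNumber H N = Arrows N H × (∀ M → M < N → ¬ Arrows M H)

{-# OPTIONS --safe #-}

-- Upper bound.  Put M = 8(n + 82) and suppose that some colouring of K_{M+1}
-- has no monochromatic wheel.  Then the red neighbourhood A_v of a vertex v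
-- contains no red C_{2n}, and its blue neighbourhood B_v no blue one.  Since a
-- triangle that is not monochromatic has exactly two bichromatic corners,
-- Goodman's count gives
--   Σ_v (2 e_red(A_v) + 2 e_blue(B_v) + 3 |A_v| |B_v|) ≥ (M + 1) M (M - 1),
-- whereas two extremal bounds make each summand less than M (M - 1).  Let G be
-- a graph on m vertices without C_{2n}, X = max(0, 48(n + 82) - 280000) and
-- Y = 16(n + 82) + 1 + X.  If m ≥ M/2 then 4 e(G) + Y ≤ m², and if m = M/2 - t
-- then 4 e(G) ≤ m² + 4t² + X.  For these, take a longest cycle C of G.  When
-- |C| ≥ 2n, chords of C closing a cycle of length 2n with an arc or two arcs
-- of C exclude each other, so C spans few edges; in any case a vertex outside
-- C has at most |C|/2 neighbours on it.  Peeling off vertices of small degree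
-- accounts for the other edges, unless it stops at a set of large minimum
-- degree.  That set contains a second long cycle, which is disjoint from C and,
-- C being longest, joined to it by few edges.
--
-- The argument is classical and refutes the absence of a wheel; as copies of a
-- wheel can be searched for, one is found, and so is the least R.
--
-- Lower bound.  A red clique on 2n vertices is joined in blue to a colouring
-- whose blue graph is a clique K_n beside a circulant graph of degree less
-- than n on at most 2n - 1 vertices.

module Submission where

-- The constants come from one balance. If the two neighbourhoods of a vertex have M/2 + t and M/2 -
-- t vertices, then their squares, six times their product and 4t² add up to exactly 2M². So the
-- term 4t² is free, X is a debt of the smaller neighbourhood that the larger one pays, and the rest
-- of Y is the 2M + 1 that makes the sum less than 2M(M - 1). X is needed because a second long
-- cycle causes an error of order 48n in the bound for 4e(G); of this, 4t² absorbs about 280000 when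
-- t is around 270 or more, and smaller t leave other slack.
--
-- For the smaller neighbourhood the critical range is |C| near 2n and t near 2n/5: a cycle shorter
-- than 2n may span a clique, and the estimate |C|² for twice its edges is too weak there. What
-- helps is that the successors of the neighbours of an outside vertex are independent: either C
-- lacks edges, or a set of |C|/4 vertices sends few edges to C. The larger neighbourhood needs the
-- same fact when |C| is close to 4n and few vertices lie outside C, where the chord bounds alone
-- fall short.

open import Defs
open import Data.Nat using (ℕ; zero; suc; _+_; _*_; _∸_; _≤_; _<_; z≤n; s≤s; _/_; _%_; NonZero; >-nonZero; _≤?_; _<?_; ⌊_/2⌋; _≡ᵇ_; _≤ᵇ_; _≟_; ∣_-_∣)
open import Data.Nat.Properties hiding (_≟_)
open import Data.Nat.DivMod using (m%n<n; m≡m%n+[m/n]*n; m<n⇒m%n≡m; [m+n]%n≡m%n; %-distribˡ-+; m%n%n≡m%n; n%n≡0)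
open import Data.Bool using (Bool; true; false; _∧_; _∨_; not; if_then_else_; T)
open import Data.Bool.Properties using (∨-zeroʳ)
open import Data.Maybe using (Maybe; just; nothing)
import Data.Bool as Bool
import Data.Fin as Fin
open import Data.Fin using (Fin; zero; suc; toℕ; fromℕ<; splitAt; inject≤)
open import Data.Fin.Properties using (toℕ<n; toℕ-injective; toℕ-fromℕ<; fromℕ<-injective; fromℕ<-toℕ; all?; pigeonhole; inject≤-injective)
import Data.Fin.Properties as Fin
import Data.Vec.Functional as Vector
open import Data.List using (List; []; _∷_; _++_; [_]; length; reverse; applyUpTo; filter; allFin; tabulate)
open import Data.List.Properties using (length-++; length-reverse; length-applyUpTo; length-tabulate; unfold-reverse; ++-assoc; ++-identityʳ)
open import Data.List.Membership.Propositional using (_∈_; _∉_; find; lose)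
open import Data.List.Membership.Propositional.Properties using (∈-++⁺ˡ; ∈-++⁺ʳ; ∈-++⁻; ∈-∃++; ∈-allFin; ∈-applyUpTo⁺; ∈-applyUpTo⁻; ∈-filter⁻)
open import Data.List.Relation.Unary.Any using (here; there; any?)
open import Data.List.Relation.Unary.All using (All; []; _∷_)
import Data.List.Relation.Unary.All as All
open import Data.List.Relation.Unary.AllPairs using ([]; _∷_)
open import Data.List.Relation.Unary.Unique.Propositional using (Unique)
import Data.List.Relation.Unary.Unique.Propositional.Properties as Unique
open import Data.List.Relation.Binary.Permutation.Propositional using (_↭_; prep; swap; ↭-refl; ↭-sym; ↭-trans; ↭-reflexive)
import Data.List.Relation.Binary.Permutation.Propositional as Perm
import Data.List.Relation.Binary.Permutation.Propositional.Properties as Perm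
open import Data.Product using (Σ; ∃; ∃₂; _×_; _,_; proj₁; proj₂)
open import Data.Sum using (_⊎_; inj₁; inj₂)
open import Data.Sum.Properties using (inj₂-injective)
open import Data.Empty using (⊥; ⊥-elim)
open import Data.Unit using (tt)
open import Function using (_∘_; id; case_of_)
open import Relation.Nullary using (¬_; Dec; yes; no; does)
open import Function.Definitions using (Injective)
open import Relation.Nullary.Decidable using (decidable-stable; map′; _×-dec_; _⊎-dec_; _→-dec_; ¬?)
open import Relation.Binary.Definitions using (DecidableEquality; tri<; tri≈; tri>)
open import Relation.Binary.PropositionalEquality using (_≡_; _≢_; refl; sym; trans; cong; cong₂; subst; subst₂; module ≡-Reasoning)

-- Arithmetic

-- Inequalities between polynomials over ℕ are proved from hypotheses A ≤ B
-- by Positivstellensatz certificates: after adding suitable multiples of the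
-- hypotheses to both sides, the coefficients of the left side are at most
-- those of the right side.

infixl 6 _⊕_
infixl 7 _⊛_

data Exp : Set where
  # : ℕ → Exp
  con : ℕ → Exp
  _⊕_ _⊛_ : Exp → Exp → Exp

x0 x1 x2 x3 x4 x5 x6 x7 x8 x9 x10 x11 x12 x13 x14 x15 x16 x17 : Exp
x0 = # 0
x1 = # 1
x2 = # 2
x3 = # 3
x4 = # 4
x5 = # 5
x6 = # 6
x7 = # 7
x8 = # 8
x9 = # 9
x10 = # 10
x11 = # 11
x12 = # 12
x13 = # 13
x14 = # 14
x15 = # 15
x16 = # 16
x17 = # 17

-- Normal forms of polynomials and their comparison

Mono Poly : Set
Mono = List ℕ
Poly = List (Mono × ℕ)

module _ (ρ : List ℕ) where

  value : ℕ → ℕ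
  value i = go ρ i
    where
    go : List ℕ → ℕ → ℕ
    go [] _ = 0
    go (x ∷ _) zero = x
    go (_ ∷ xs) (suc i) = go xs i

  eval : Exp → ℕ
  eval (# i) = value i
  eval (con c) = c
  eval (a ⊕ b) = eval a + eval b
  eval (a ⊛ b) = eval a * eval b

  evalM : Mono → ℕ
  evalM [] = 1
  evalM (i ∷ m) = value i * evalM m

  evalP : Poly → ℕ
  evalP [] = 0
  evalP ((m , c) ∷ p) = c * evalM m + evalP p

_==_ : Mono → Mono → Bool
[] == [] = true
(i ∷ m) == (j ∷ n) = (i ≡ᵇ j) ∧ (m == n)
_ == _ = false

insertVar : ℕ → Mono → Mono
insertVar i [] = i ∷ []
insertVar i (j ∷ m) = if i ≤ᵇ j then i ∷ j ∷ m else j ∷ insertVar i m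

mulM : Mono → Mono → Mono
mulM [] n = n
mulM (i ∷ m) n = insertVar i (mulM m n)

insertMono : Mono → ℕ → Poly → Poly
insertMono m c [] = (m , c) ∷ []
insertMono m c ((n , d) ∷ p) = if m == n then (n , c + d) ∷ p else (n , d) ∷ insertMono m c p

addP : Poly → Poly → Poly
addP [] q = q
addP ((m , c) ∷ p) q = insertMono m c (addP p q)

scaleP : Mono → ℕ → Poly → Poly
scaleP m c [] = []
scaleP m c ((n , d) ∷ p) = insertMono (mulM m n) (c * d) (scaleP m c p)

mulP : Poly → Poly → Poly
mulP [] q = []
mulP ((m , c) ∷ p) q = addP (scaleP m c q) (mulP p q)

norm : Exp → Poly
norm (# i) = (i ∷ [] , 1) ∷ []
norm (con c) = ([] , c) ∷ []
norm (a ⊕ b) = addP (norm a) (norm b)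
norm (a ⊛ b) = mulP (norm a) (norm b)

-- The empty right side is accepted for `c = 0`, since a factor `con 0` leaves monomials with
-- coefficient zero behind.
remove : Mono → ℕ → Poly → Maybe Poly
remove m c [] = if c ≡ᵇ 0 then just [] else nothing
remove m c ((n , d) ∷ p) with m == n
... | true = if c ≤ᵇ d then just ((n , d ∸ c) ∷ p) else nothing
... | false with remove m c p
...   | just q = just ((n , d) ∷ q)
...   | nothing = nothing

coeffs≤ : Poly → Poly → Bool
coeffs≤ [] q = true
coeffs≤ ((m , c) ∷ p) q with remove m c q
... | just q′ = coeffs≤ p q′
... | nothing = false

==-sound : ∀ m n → (m == n) ≡ true → m ≡ n
==-sound [] [] _ = refl
==-sound (i ∷ m) (j ∷ n) eq with i ≡ᵇ j in eq′
... | true = cong₂ _∷_ (≡ᵇ⇒≡ i j (subst T (sym eq′) tt)) (==-sound m n eq)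

-- Soundness of the normal forms

module _ (ρ : List ℕ) where

  private
    ev = evalP ρ
    mo = evalM ρ
    va = value ρ

  insertVar-sound : ∀ i m → mo (insertVar i m) ≡ va i * mo m
  insertVar-sound i [] = refl
  insertVar-sound i (j ∷ m) with i ≤ᵇ j
  ... | true = refl
  ... | false = trans (cong (va j *_) (insertVar-sound i m)) (x*yz≡y*xz (va j) (va i) (mo m))
    where
    x*yz≡y*xz : ∀ x y z → x * (y * z) ≡ y * (x * z)
    x*yz≡y*xz x y z = trans (sym (*-assoc x y z)) (trans (cong (_* z) (*-comm x y)) (*-assoc y x z))

  mulM-sound : ∀ m n → mo (mulM m n) ≡ mo m * mo n
  mulM-sound [] n = sym (*-identityˡ (mo n))
  mulM-sound (i ∷ m) n = trans (insertVar-sound i (mulM m n))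
    (trans (cong (va i *_) (mulM-sound m n)) (sym (*-assoc (va i) (mo m) (mo n))))

  insertMono-sound : ∀ m c p → ev (insertMono m c p) ≡ c * mo m + ev p
  insertMono-sound m c [] = refl
  insertMono-sound m c ((n , d) ∷ p) with m == n in eq
  ... | true rewrite ==-sound m n eq =
        trans (cong (_+ ev p) (*-distribʳ-+ (mo n) c d)) (+-assoc (c * mo n) (d * mo n) (ev p))
  ... | false = trans (cong (d * mo n +_) (insertMono-sound m c p))
        (x+yz≡y+xz (d * mo n) (c * mo m) (ev p))
    where
    x+yz≡y+xz : ∀ x y z → x + (y + z) ≡ y + (x + z)
    x+yz≡y+xz x y z = trans (sym (+-assoc x y z)) (trans (cong (_+ z) (+-comm x y)) (+-assoc y x z))

  addP-sound : ∀ p q → ev (addP p q) ≡ ev p + ev q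
  addP-sound [] q = refl
  addP-sound ((m , c) ∷ p) q = trans (insertMono-sound m c (addP p q))
    (trans (cong (c * mo m +_) (addP-sound p q)) (sym (+-assoc (c * mo m) (ev p) (ev q))))

  scaleP-sound : ∀ m c p → ev (scaleP m c p) ≡ c * mo m * ev p
  scaleP-sound m c [] = sym (*-zeroʳ (c * mo m))
  scaleP-sound m c ((n , d) ∷ p) = begin
    ev (insertMono (mulM m n) (c * d) (scaleP m c p))  ≡⟨ insertMono-sound (mulM m n) (c * d) (scaleP m c p) ⟩
    c * d * mo (mulM m n) + ev (scaleP m c p)          ≡⟨ cong₂ _+_ (cong (c * d *_) (mulM-sound m n))
        (scaleP-sound m c p) ⟩
    c * d * (mo m * mo n) + c * mo m * ev p            ≡⟨ cong (_+ c * mo m * ev p)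
        ([m*n]*[o*p]≡[m*o]*[n*p] c d (mo m) (mo n)) ⟩
    c * mo m * (d * mo n) + c * mo m * ev p            ≡⟨ sym (*-distribˡ-+ (c * mo m) (d * mo n) (ev p)) ⟩
    c * mo m * (d * mo n + ev p)                       ∎
    where open ≡-Reasoning

  mulP-sound : ∀ p q → ev (mulP p q) ≡ ev p * ev q
  mulP-sound [] q = refl
  mulP-sound ((m , c) ∷ p) q = trans (addP-sound (scaleP m c q) (mulP p q))
    (trans (cong₂ _+_ (scaleP-sound m c q) (mulP-sound p q)) (sym (*-distribʳ-+ (ev q) (c * mo m) (ev p))))

  norm-sound : ∀ e → ev (norm e) ≡ eval ρ e
  norm-sound (# i) = trans (+-identityʳ _) (trans (+-identityʳ _) (*-identityʳ (va i)))
  norm-sound (con c) = trans (+-identityʳ (c * 1)) (*-identityʳ c)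
  norm-sound (a ⊕ b) = trans (addP-sound (norm a) (norm b)) (cong₂ _+_ (norm-sound a) (norm-sound b))
  norm-sound (a ⊛ b) = trans (mulP-sound (norm a) (norm b)) (cong₂ _*_ (norm-sound a) (norm-sound b))

  remove-sound : ∀ m c p q → remove m c p ≡ just q → ev p ≡ c * mo m + ev q
  remove-sound m c [] q eq with c ≡ᵇ 0 in eq′
  remove-sound m c [] .[] refl | true rewrite ≡ᵇ⇒≡ c 0 (subst T (sym eq′) tt) = refl
  remove-sound m c ((n , d) ∷ p) q eq with m == n in eq′
  remove-sound m c ((n , d) ∷ p) q eq | true with c ≤ᵇ d in eq″
  remove-sound m c ((n , d) ∷ p) .((n , d ∸ c) ∷ p) refl | true | true rewrite ==-sound m n eq′ =
    trans (cong (λ x → x * mo n + ev p) (sym (m+[n∸m]≡n (≤ᵇ⇒≤ c d (subst T (sym eq″) tt)))))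
      (trans (cong (_+ ev p) (*-distribʳ-+ (mo n) c (d ∸ c))) (+-assoc (c * mo n) _ (ev p)))
  remove-sound m c ((n , d) ∷ p) q eq | false with remove m c p in eq″
  remove-sound m c ((n , d) ∷ p) .((n , d) ∷ r) refl | false | just r =
    trans (cong (d * mo n +_) (remove-sound m c p r eq″))
      (trans (sym (+-assoc (d * mo n) (c * mo m) (ev r)))
        (trans (cong (_+ ev r) (+-comm (d * mo n) (c * mo m))) (+-assoc (c * mo m) (d * mo n) (ev r))))

  coeffs≤-sound : ∀ p q → coeffs≤ p q ≡ true → ev p ≤ ev q
  coeffs≤-sound [] q _ = z≤n
  coeffs≤-sound ((m , c) ∷ p) q eq with remove m c q in eq′
  ... | just q′ = ≤-trans (+-monoʳ-≤ (c * mo m) (coeffs≤-sound p q′ eq)) (≤-reflexive (sym (remove-sound m c q q′ eq′)))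

-- The weight is an expression and not a numeral: a hypothesis may be multiplied by a polynomial
-- with natural coefficients, which is how certificates of degree two arise.
record Weighted≤ (ρ : List ℕ) : Set where
  constructor hyp
  field
    weight small large : Exp
    holds : eval ρ small ≤ eval ρ large

module _ {ρ : List ℕ} where

  sumˡ sumʳ : List (Weighted≤ ρ) → Exp
  sumˡ [] = con 0
  sumˡ (hyp c A B _ ∷ H) = c ⊛ A ⊕ sumˡ H
  sumʳ [] = con 0
  sumʳ (hyp c A B _ ∷ H) = c ⊛ B ⊕ sumʳ H

  sum-≤ : ∀ H → eval ρ (sumˡ H) ≤ eval ρ (sumʳ H)
  sum-≤ [] = z≤n
  sum-≤ (hyp c A B h ∷ H) = +-mono-≤ (*-monoʳ-≤ (eval ρ c) h) (sum-≤ H)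

-- The multiplier suc d of the conclusion allows the certificate to round.
linear : ∀ ρ d a b (H : List (Weighted≤ ρ)) →
  coeffs≤ (norm (con (suc d) ⊛ a ⊕ sumʳ H)) (norm (con (suc d) ⊛ b ⊕ con d ⊕ sumˡ H)) ≡ true →
  eval ρ a ≤ eval ρ b
linear ρ d a b H ok = ≤-pred (*-cancelˡ-< (suc d) (eval ρ a) (suc (eval ρ b)) step₂)
  where
  open ≤-Reasoning
  x = eval ρ a
  y = eval ρ b
  left right : Exp
  left = con (suc d) ⊛ a ⊕ sumʳ H
  right = con (suc d) ⊛ b ⊕ con d ⊕ sumˡ H
  step₁ : suc d * x ≤ suc d * y + d
  step₁ = +-cancelʳ-≤ (eval ρ (sumʳ H)) (suc d * x) (suc d * y + d) (begin
    eval ρ left                          ≡⟨ sym (norm-sound ρ left) ⟩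
    evalP ρ (norm left)                  ≤⟨ coeffs≤-sound ρ (norm left) (norm right) ok ⟩
    evalP ρ (norm right)                 ≡⟨ norm-sound ρ right ⟩
    suc d * y + d + eval ρ (sumˡ H)      ≤⟨ +-monoʳ-≤ (suc d * y + d) (sum-≤ H) ⟩
    suc d * y + d + eval ρ (sumʳ H)      ∎)
  step₂ : suc d * x < suc d * suc y
  step₂ = begin-strict
    suc d * x          ≤⟨ step₁ ⟩
    suc d * y + d      <⟨ +-monoʳ-< (suc d * y) (n<1+n d) ⟩
    suc d * y + suc d  ≡⟨ +-comm (suc d * y) (suc d) ⟩
    suc d + suc d * y  ≡⟨ sym (*-suc (suc d) y) ⟩
    suc d * suc y      ∎

-- (b - a) (d - c) ≥ 0
_⊗_ : ∀ {a b c d} → a ≤ b → c ≤ d → a * d + b * c ≤ b * d + a * c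
_⊗_ {a} {b} {c} {d} a≤b c≤d with m≤n⇒∃[o]m+o≡n a≤b | m≤n⇒∃[o]m+o≡n c≤d
... | x , refl | y , refl = linear (a ∷ c ∷ x ∷ y ∷ []) 0
  (x0 ⊛ (x1 ⊕ x3) ⊕ (x0 ⊕ x2) ⊛ x1) ((x0 ⊕ x2) ⊛ (x1 ⊕ x3) ⊕ x0 ⊛ x1) [] refl

square-≤ : ∀ a b → 2 * (a * b) ≤ a * a + b * b
square-≤ a b with ≤-total a b
... | inj₁ a≤b with m≤n⇒∃[o]m+o≡n a≤b
...   | x , refl = linear (a ∷ x ∷ []) 0 (con 2 ⊛ (x0 ⊛ (x0 ⊕ x1))) (x0 ⊛ x0 ⊕ (x0 ⊕ x1) ⊛ (x0 ⊕ x1)) [] refl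
square-≤ a b | inj₂ b≤a with m≤n⇒∃[o]m+o≡n b≤a
...   | x , refl = linear (b ∷ x ∷ []) 0 (con 2 ⊛ ((x0 ⊕ x1) ⊛ x0)) ((x0 ⊕ x1) ⊛ (x0 ⊕ x1) ⊕ x0 ⊛ x0) [] refl

module _ {ρ : List ℕ} where

  equ : ∀ (c A B : Exp) → eval ρ A ≡ eval ρ B → Weighted≤ ρ
  equ c A B e = hyp c A B (≤-reflexive e)

  sq : ∀ (c A B : Exp) → Weighted≤ ρ
  sq c A B = hyp c (con 2 ⊛ (A ⊛ B)) (A ⊛ A ⊕ B ⊛ B) (square-≤ (eval ρ A) (eval ρ B))

  prod : ∀ (c A B : Exp) → eval ρ A ≤ eval ρ B → ∀ C D → eval ρ C ≤ eval ρ D → Weighted≤ ρ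
  prod c A B h C D k = hyp c (A ⊛ D ⊕ B ⊛ C) (B ⊛ D ⊕ A ⊛ C) (h ⊗ k)

1≰0 : 1 ≤ 0 → ⊥
1≰0 ()

-- Finite sums

-- Each `arith` lemma, here and in the later parts, is the arithmetic of one step of the proof, with
-- the sums, degrees and lengths that occur in it generalised to variables. An equation is certified
-- as two inequalities.
arith-1 : ∀ v1 v2 v3 v4 v5 → v1 ≡ v2 + v3 → v4 + v5 + v1 ≡ v4 + v2 + (v5 + v3)
arith-1 v1 v2 v3 v4 v5 h1 = ≤-antisym (linear (v1 ∷ v2 ∷ v3 ∷ v4 ∷ v5 ∷ []) 0 (x3 ⊕ x4 ⊕ x0) (x3 ⊕ x1 ⊕ (x4 ⊕ x2))
    (equ (con 1) x0 (x1 ⊕ x2) h1 ∷ []) refl) (linear (v1 ∷ v2 ∷ v3 ∷ v4 ∷ v5 ∷ []) 0 (x3 ⊕ x1 ⊕ (x4 ⊕ x2))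
        (x3 ⊕ x4 ⊕ x0)
    (equ (con 1) (x1 ⊕ x2) x0 (sym h1) ∷ []) refl)

arith-2 : ∀ v1 v2 v3 v4 → v1 ≡ v2 → v3 + (v4 + v1) ≡ v4 + (v3 + v2)
arith-2 v1 v2 v3 v4 h1 = ≤-antisym (linear (v1 ∷ v2 ∷ v3 ∷ v4 ∷ []) 0 (x2 ⊕ (x3 ⊕ x0)) (x3 ⊕ (x2 ⊕ x1))
    (equ (con 1) x0 x1 h1 ∷ []) refl) (linear (v1 ∷ v2 ∷ v3 ∷ v4 ∷ []) 0 (x3 ⊕ (x2 ⊕ x1)) (x2 ⊕ (x3 ⊕ x0))
    (equ (con 1) x1 x0 (sym h1) ∷ []) refl)

arith-3 : ∀ b k fuel j → b ≤ k + suc fuel → k < j → b ≤ j + fuel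
arith-3 b k fuel j h1 h2 = linear (b ∷ k ∷ fuel ∷ j ∷ []) 0 x0 (x3 ⊕ x2)
    (hyp (con 1) x0 (x1 ⊕ (con 1 ⊕ x2)) h1 ∷ hyp (con 1) (con 1 ⊕ x1) x3 h2 ∷ []) refl

⟦_⟧ : Bool → ℕ
⟦ true ⟧ = 1
⟦ false ⟧ = 0

⟦⟧≤1 : ∀ b → ⟦ b ⟧ ≤ 1
⟦⟧≤1 true = ≤-refl
⟦⟧≤1 false = z≤n

∧-true : ∀ {b c} → b ∧ c ≡ true → b ≡ true × c ≡ true
∧-true {true} {true} _ = refl , refl

bool-excl : ∀ {b c} → (b ≡ true → c ≡ true → ⊥) → ⟦ b ⟧ + ⟦ c ⟧ ≤ 1
bool-excl {false} {c} _ = ⟦⟧≤1 c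
bool-excl {true} {false} _ = ≤-refl
bool-excl {true} {true} h = ⊥-elim (h refl refl)

bool-excl₃ : ∀ {b c d} → (b ≡ true → c ≡ true → ⊥) → (b ≡ true → d ≡ true → ⊥) →
  (c ≡ true → d ≡ true → ⊥) → ⟦ b ⟧ + ⟦ c ⟧ + ⟦ d ⟧ ≤ 1
bool-excl₃ {true} {false} {false} _ _ _ = ≤-refl
bool-excl₃ {true} {true} h _ _ = ⊥-elim (h refl refl)
bool-excl₃ {true} {false} {true} _ h _ = ⊥-elim (h refl refl)
bool-excl₃ {false} {c} {d} _ _ h = bool-excl {c} {d} h

∑ : ℕ → (ℕ → ℕ) → ℕ
∑ zero f = 0
∑ (suc n) f = f 0 + ∑ n (f ∘ suc)

∑-cong : ∀ n {f g : ℕ → ℕ} → (∀ i → i < n → f i ≡ g i) → ∑ n f ≡ ∑ n g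
∑-cong zero h = refl
∑-cong (suc n) h = cong₂ _+_ (h 0 (s≤s z≤n)) (∑-cong n (λ i i<n → h (suc i) (s≤s i<n)))

∑-mono : ∀ n {f g : ℕ → ℕ} → (∀ i → i < n → f i ≤ g i) → ∑ n f ≤ ∑ n g
∑-mono zero h = z≤n
∑-mono (suc n) h = +-mono-≤ (h 0 (s≤s z≤n)) (∑-mono n (λ i i<n → h (suc i) (s≤s i<n)))

∑-+ : ∀ n (f g : ℕ → ℕ) → ∑ n (λ i → f i + g i) ≡ ∑ n f + ∑ n g
∑-+ zero f g = refl
∑-+ (suc n) f g = arith-1 (∑ n (λ i → f (suc i) + g (suc i))) (∑ n (f ∘ suc)) (∑ n (g ∘ suc)) (f 0) (g 0)
    (∑-+ n (f ∘ suc) (g ∘ suc))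

∑-const : ∀ n c → ∑ n (λ _ → c) ≡ n * c
∑-const zero c = refl
∑-const (suc n) c = cong (c +_) (∑-const n c)

∑-≤const : ∀ n {f : ℕ → ℕ} c → (∀ i → i < n → f i ≤ c) → ∑ n f ≤ n * c
∑-≤const n c h = ≤-trans (∑-mono n h) (≤-reflexive (∑-const n c))

∑-pair≤ : ∀ n c (f g : ℕ → ℕ) → (∀ i → i < n → f i + g i ≤ c) → ∑ n f + ∑ n g ≤ n * c
∑-pair≤ n c f g h = ≤-trans (≤-reflexive (sym (∑-+ n f g))) (∑-≤const n c h)

∑-triple≤ : ∀ n c (f g h : ℕ → ℕ) → (∀ i → i < n → f i + g i + h i ≤ c) → ∑ n f + ∑ n g + ∑ n h ≤ n * c
∑-triple≤ n c f g h k = ≤-trans (≤-reflexive (cong (_+ ∑ n h) (sym (∑-+ n f g)))) (∑-pair≤ n c (λ i → f i + g i) h k)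

∑-split : ∀ m n (f : ℕ → ℕ) → ∑ (m + n) f ≡ ∑ m f + ∑ n (λ i → f (m + i))
∑-split zero n f = refl
∑-split (suc m) n f = trans (cong (f 0 +_) (∑-split m n (f ∘ suc))) (sym (+-assoc (f 0) _ _))

∑-last : ∀ n (f : ℕ → ℕ) → ∑ (suc n) f ≡ ∑ n f + f n
∑-last n f = begin
  ∑ (suc n) f                 ≡⟨ cong (λ k → ∑ k f) (+-comm 1 n) ⟩
  ∑ (n + 1) f                 ≡⟨ ∑-split n 1 f ⟩
  ∑ n f + (f (n + 0) + 0)     ≡⟨ cong (∑ n f +_) (trans (+-identityʳ _) (cong f (+-identityʳ n))) ⟩
  ∑ n f + f n                 ∎
  where open ≡-Reasoning

∑-extend : ∀ {m n} (f : ℕ → ℕ) → m ≤ n → ∑ m f ≤ ∑ n f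
∑-extend {m} f m≤n with m≤n⇒∃[o]m+o≡n m≤n
... | k , refl = ≤-trans (m≤m+n _ _) (≤-reflexive (sym (∑-split m k f)))

∑-swap : ∀ m n (f : ℕ → ℕ → ℕ) → ∑ m (λ i → ∑ n (f i)) ≡ ∑ n (λ j → ∑ m (λ i → f i j))
∑-swap zero n f = sym (trans (∑-const n 0) (*-zeroʳ n))
∑-swap (suc m) n f = trans (cong (∑ n (f 0) +_) (∑-swap m n (f ∘ suc)))
  (sym (∑-+ n (f 0) (λ j → ∑ m (λ i → f (suc i) j))))

∑-reverse : ∀ n (f : ℕ → ℕ) → ∑ n (λ i → f (n ∸ suc i)) ≡ ∑ n f
∑-reverse zero f = refl
∑-reverse (suc n) f = trans (cong (f n +_) (∑-reverse n f)) (trans (+-comm (f n) _) (sym (∑-last n f)))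

Periodic : {A : Set} → ℕ → (ℕ → A) → Set
Periodic L f = ∀ i → f (i + L) ≡ f i

∑-shift : ∀ {L} {f : ℕ → ℕ} → Periodic L f → ∀ k → ∑ L (λ i → f (k + i)) ≡ ∑ L f
∑-shift per zero = refl
∑-shift {L} {f} per (suc k) = trans (+-cancelˡ-≡ (f k) _ _ step) (∑-shift per k)
  where
  open ≡-Reasoning
  g : ℕ → ℕ
  g i = f (k + i)
  step : f k + ∑ L (λ i → f (suc k + i)) ≡ f k + ∑ L (λ i → f (k + i))
  step = begin
    f k + ∑ L (λ i → f (suc k + i))  ≡⟨ cong₂ _+_ (cong f (sym (+-identityʳ k)))
        (∑-cong L (λ i _ → cong f (sym (+-suc k i)))) ⟩
    ∑ (suc L) g                      ≡⟨ ∑-last L g ⟩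
    ∑ L g + f (k + L)                ≡⟨ cong (∑ L g +_) (per k) ⟩
    ∑ L g + f k                      ≡⟨ +-comm (∑ L g) (f k) ⟩
    f k + ∑ L g                      ∎

-- Sums over lists, and lists without repetition

module _ {A : Set} where

  Σl : List A → (A → ℕ) → ℕ
  Σl [] f = 0
  Σl (x ∷ xs) f = f x + Σl xs f

  Σl-cong : ∀ xs {f g : A → ℕ} → (∀ x → x ∈ xs → f x ≡ g x) → Σl xs f ≡ Σl xs g
  Σl-cong [] h = refl
  Σl-cong (x ∷ xs) h = cong₂ _+_ (h x (here refl)) (Σl-cong xs (λ y y∈ → h y (there y∈)))

  Σl-mono : ∀ xs {f g : A → ℕ} → (∀ x → x ∈ xs → f x ≤ g x) → Σl xs f ≤ Σl xs g
  Σl-mono [] h = z≤n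
  Σl-mono (x ∷ xs) h = +-mono-≤ (h x (here refl)) (Σl-mono xs (λ y y∈ → h y (there y∈)))

  Σl-+ : ∀ xs (f g : A → ℕ) → Σl xs (λ x → f x + g x) ≡ Σl xs f + Σl xs g
  Σl-+ [] f g = refl
  Σl-+ (x ∷ xs) f g = arith-1 (Σl xs (λ x → f x + g x)) (Σl xs f) (Σl xs g) (f x) (g x) (Σl-+ xs f g)

  Σl-const : ∀ xs c → Σl xs (λ _ → c) ≡ length xs * c
  Σl-const [] c = refl
  Σl-const (x ∷ xs) c = cong (c +_) (Σl-const xs c)

  Σl-≤const : ∀ xs {f : A → ℕ} c → (∀ x → x ∈ xs → f x ≤ c) → Σl xs f ≤ length xs * c
  Σl-≤const xs c h = ≤-trans (Σl-mono xs h) (≤-reflexive (Σl-const xs c))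

  Σl-*ˡ : ∀ xs c (f : A → ℕ) → Σl xs (λ x → c * f x) ≡ c * Σl xs f
  Σl-*ˡ [] c f = sym (*-zeroʳ c)
  Σl-*ˡ (x ∷ xs) c f = trans (cong (c * f x +_) (Σl-*ˡ xs c f)) (sym (*-distribˡ-+ c (f x) _))

  Σl-++ : ∀ xs ys (f : A → ℕ) → Σl (xs ++ ys) f ≡ Σl xs f + Σl ys f
  Σl-++ [] ys f = refl
  Σl-++ (x ∷ xs) ys f = trans (cong (f x +_) (Σl-++ xs ys f)) (sym (+-assoc (f x) _ _))

  Σl-↭ : ∀ {xs ys} (f : A → ℕ) → xs ↭ ys → Σl xs f ≡ Σl ys f
  Σl-↭ f Perm.refl = refl
  Σl-↭ f (prep x p) = cong (f x +_) (Σl-↭ f p)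
  Σl-↭ f (swap {xs} {ys} x y p) = arith-2 (Σl xs f) (Σl ys f) (f x) (f y) (Σl-↭ f p)
  Σl-↭ f (Perm.trans p q) = trans (Σl-↭ f p) (Σl-↭ f q)

  -- Inside this module `Σl` sums only over lists of elements of `A`, so the sum over `ys` is
  -- represented by a function `Σl′` with the two defining equations of `Σl`.
  Σl-swap : ∀ {B : Set} (xs : List A) (ys : List B) (f : A → B → ℕ) (Σl′ : List B → (B → ℕ) → ℕ) →
    (∀ c → Σl′ [] c ≡ 0) → (∀ y ys c → Σl′ (y ∷ ys) c ≡ c y + Σl′ ys c) →
    Σl xs (λ x → Σl′ ys (f x)) ≡ Σl′ ys (λ y → Σl xs (λ x → f x y))
  Σl-swap xs [] f Σl′ nil cons = trans
      (trans (Σl-cong xs (λ x _ → nil (f x))) (trans (Σl-const xs 0) (*-zeroʳ (length xs)))) (sym (nil _))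
  Σl-swap xs (y ∷ ys) f Σl′ nil cons = trans (trans (Σl-cong xs (λ x _ → cons y ys (f x)))
    (trans (Σl-+ xs (λ x → f x y) (λ x → Σl′ ys (f x)))
        (cong (Σl xs (λ x → f x y) +_) (Σl-swap xs ys f Σl′ nil cons)))) (sym (cons y ys _))

  Σl-applyUpTo : ∀ (g : ℕ → A) n (f : A → ℕ) → Σl (applyUpTo g n) f ≡ ∑ n (f ∘ g)
  Σl-applyUpTo g zero f = refl
  Σl-applyUpTo g (suc n) f = cong (f (g 0) +_) (Σl-applyUpTo (g ∘ suc) n f)

  Σl-∈ : ∀ {xs x} (f : A → ℕ) → x ∈ xs → f x ≤ Σl xs f
  Σl-∈ f (here refl) = m≤m+n _ _
  Σl-∈ {y ∷ xs} f (there x∈) = ≤-trans (Σl-∈ f x∈) (m≤n+m _ (f y))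

  Σl-≤1 : ∀ xs (P : A → Bool) → Unique xs →
    (∀ x y → x ∈ xs → y ∈ xs → P x ≡ true → P y ≡ true → x ≡ y) → Σl xs (⟦_⟧ ∘ P) ≤ 1
  Σl-≤1 [] P u h = z≤n
  Σl-≤1 (x ∷ xs) P (x∉ ∷ u) h with P x in eq
  ... | false = Σl-≤1 xs P u (λ y z y∈ z∈ → h y z (there y∈) (there z∈))
  ... | true = s≤s (≤-trans (Σl-mono xs zero-rest) (≤-reflexive (trans (Σl-const xs 0) (*-zeroʳ (length xs)))))
    where
    zero-rest : ∀ y → y ∈ xs → ⟦ P y ⟧ ≤ 0
    zero-rest y y∈ with P y in eq′
    ... | false = z≤n
    ... | true = ⊥-elim (All.lookup x∉ y∈ (h x y (here refl) (there y∈) eq eq′))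

  Σl-witness : ∀ xs (f g : A → ℕ) → Σl xs f < Σl xs g → ∃ λ x → x ∈ xs × f x < g x
  Σl-witness (x ∷ xs) f g lt with f x <? g x
  ... | yes p = x , here refl , p
  ... | no ¬p with Σl-witness xs f g (+-cancelˡ-< (g x) _ _ (≤-<-trans (+-monoˡ-≤ (Σl xs f) (≮⇒≥ ¬p)) lt))
  ...   | y , y∈ , q = y , there y∈ , q

  Σl-positive : ∀ xs (f : A → ℕ) → 1 ≤ Σl xs f → ∃ λ x → x ∈ xs × 1 ≤ f x
  Σl-positive xs f pos with Σl-witness xs (λ _ → 0) f
      (≤-trans (s≤s (≤-reflexive (trans (Σl-const xs 0) (*-zeroʳ (length xs))))) pos)
  ... | x , x∈ , p = x , x∈ , p

  -- The list `zs` plays the part of the complement: in this way a set of vertices is divided into a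
  -- cycle and the rest.
  ⊆-split : ∀ {xs ys : List A} → Unique xs → (∀ {x} → x ∈ xs → x ∈ ys) → ∃ λ zs → ys ↭ xs ++ zs
  ⊆-split {[]} {ys} _ _ = ys , ↭-refl
  ⊆-split {x ∷ xs} {ys} (x∉ ∷ u) sub with ∈-∃++ (sub (here refl))
  ... | as , bs , refl with ⊆-split {xs} {as ++ bs} u sub′
    where
    sub′ : ∀ {y} → y ∈ xs → y ∈ as ++ bs
    sub′ {y} y∈ with ∈-++⁻ as (sub (there y∈))
    ... | inj₁ q = ∈-++⁺ˡ q
    ... | inj₂ (here refl) = ⊥-elim (All.lookup x∉ y∈ refl)
    ... | inj₂ (there q) = ∈-++⁺ʳ as q
  ... | zs , p = zs , ↭-trans (Perm.shift x as bs) (prep x p)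

  unique-length : ∀ {xs ys : List A} → Unique xs → (∀ {x} → x ∈ xs → x ∈ ys) → length xs ≤ length ys
  unique-length {xs} {ys} u sub with ⊆-split u sub
  ... | zs , p = ≤-trans (m≤m+n (length xs) (length zs)) (≤-reflexive (sym (trans (Perm.↭-length p) (length-++ xs))))

  Unique-↭ : ∀ {xs ys : List A} → xs ↭ ys → Unique xs → Unique ys
  Unique-↭ Perm.refl u = u
  Unique-↭ (prep x p) (x∉ ∷ u) = Perm.All-resp-↭ p x∉ ∷ Unique-↭ p u
  Unique-↭ (swap x y p) ((x≢y ∷ x∉) ∷ (y∉ ∷ u)) =
    ((x≢y ∘ sym) ∷ Perm.All-resp-↭ p y∉) ∷ (Perm.All-resp-↭ p x∉ ∷ Unique-↭ p u)
  Unique-↭ (Perm.trans p q) u = Unique-↭ q (Unique-↭ p u)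

  Unique-++⁻ : ∀ (xs : List A) {ys} → Unique (xs ++ ys) → Unique xs × Unique ys × (∀ {x} → x ∈ xs → x ∈ ys → ⊥)
  Unique-++⁻ [] u = [] , u , λ ()
  Unique-++⁻ (x ∷ xs) {ys} (x∉ ∷ u) with Unique-++⁻ xs u
  ... | ux , uy , dis = All.tabulate (λ y∈ → All.lookup x∉ (∈-++⁺ˡ y∈)) ∷ ux , uy ,
        λ { (here refl) y∈ → All.lookup x∉ (∈-++⁺ʳ xs y∈) refl ; (there x∈) y∈ → dis x∈ y∈ }

Σl-comm : ∀ {A B : Set} (xs : List A) (ys : List B) (f : A → B → ℕ) →
  Σl xs (λ x → Σl ys (f x)) ≡ Σl ys (λ y → Σl xs (λ x → f x y))
Σl-comm xs ys f = Σl-swap xs ys f Σl (λ _ → refl) (λ _ _ _ → refl)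

-- Double-negation reasoning about bounded searches

-- Without a maximum every witness would yield a larger one, which the bound `b` permits only
-- finitely often; `fuel` bounds the steps that are left.
∃-max : (P : ℕ → Set) (b : ℕ) → (∀ k → P k → k ≤ b) → ∀ k → P k →
  ¬ ¬ (∃ λ m → P m × (∀ j → P j → j ≤ m))
∃-max P b bnd k pk none = go b k (m≤n+m b k) pk
  where
  go : ∀ fuel k → b ≤ k + fuel → P k → ⊥
  go zero k b≤ pk = none (k , pk , λ j pj → ≤-trans (bnd j pj) (≤-trans b≤ (≤-reflexive (+-identityʳ k))))
  go (suc fuel) k b≤ pk = none (k , pk , λ j pj → decidable-stable (j ≤? k)
    (λ j≰k → go fuel j (arith-3 b k fuel j b≤ (≰⇒> j≰k)) pj))

-- Graphs, paths and cycles

arith-4 : ∀ v1 v2 v3 v4 v5 v6 v7 → v1 ≡ v2 + v3 → v2 ≡ v4 + v5 → v3 ≡ v6 + v7 → v6 ≡ v5 → v1 ≡ v4 + (2 * v5 + v7)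
arith-4 v1 v2 v3 v4 v5 v6 v7 h1 h2 h3 h4 = ≤-antisym (linear (v1 ∷ v2 ∷ v3 ∷ v4 ∷ v5 ∷ v6 ∷ v7 ∷ []) 0 x0
    (x3 ⊕ (con 2 ⊛ x4 ⊕ x6))
    (equ (con 1) x0 (x1 ⊕ x2) h1 ∷ equ (con 1) x1 (x3 ⊕ x4) h2 ∷ equ (con 1) x2 (x5 ⊕ x6) h3 ∷ equ (con 1) x5 x4 h4 ∷
    []) refl) (linear (v1 ∷ v2 ∷ v3 ∷ v4 ∷ v5 ∷ v6 ∷ v7 ∷ []) 0 (x3 ⊕ (con 2 ⊛ x4 ⊕ x6)) x0
    (equ (con 1) (x1 ⊕ x2) x0 (sym h1) ∷ equ (con 1) (x3 ⊕ x4) x1 (sym h2) ∷ equ (con 1) (x5 ⊕ x6) x2 (sym h3) ∷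
    equ (con 1) x4 x5 (sym h4) ∷ []) refl)

arith-5 : ∀ v1 v2 v3 v4 v5 v6 v7 v8 v9 v10 → v1 ≡ v2 + v3 → v2 ≡ v4 + 0 → v5 ≡ v6 → v7 ≡ v8 + v9 →
    v8 ≡ v6 + 0 → v10 ≡ v4 + v6 → 2 * v1 + (v5 + v7) ≡ 2 * v3 + v9 + 2 * v10
arith-5 v1 v2 v3 v4 v5 v6 v7 v8 v9 v10 h1 h2 h3 h4 h5 h6 =
    ≤-antisym (linear (v1 ∷ v2 ∷ v3 ∷ v4 ∷ v5 ∷ v6 ∷ v7 ∷ v8 ∷ v9 ∷ v10 ∷ []) 0 (con 2 ⊛ x0 ⊕ (x4 ⊕ x6))
    (con 2 ⊛ x2 ⊕ x8 ⊕ con 2 ⊛ x9)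
    (equ (con 2) x0 (x1 ⊕ x2) h1 ∷ equ (con 2) x1 (x3 ⊕ con 0) h2 ∷ equ (con 1) x4 x5 h3 ∷
    equ (con 1) x6 (x7 ⊕ x8) h4 ∷ equ (con 1) x7 (x5 ⊕ con 0) h5 ∷ equ (con 2) (x3 ⊕ x5) x9 (sym h6) ∷ [])
        refl) (linear (v1 ∷ v2 ∷ v3 ∷ v4 ∷ v5 ∷ v6 ∷ v7 ∷ v8 ∷ v9 ∷ v10 ∷ []) 0
        (con 2 ⊛ x2 ⊕ x8 ⊕ con 2 ⊛ x9) (con 2 ⊛ x0 ⊕ (x4 ⊕ x6))
    (equ (con 2) (x1 ⊕ x2) x0 (sym h1) ∷ equ (con 2) (x3 ⊕ con 0) x1 (sym h2) ∷ equ (con 1) x5 x4 (sym h3) ∷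
    equ (con 1) (x7 ⊕ x8) x6 (sym h4) ∷ equ (con 1) (x5 ⊕ con 0) x7 (sym h5) ∷ equ (con 2) x9 (x3 ⊕ x5) h6 ∷ []) refl)

arith-6 : ∀ j i L v1 v2 v3 v4 → j < i + L → i ≡ v1 + v2 * L → j ≡ v3 + v4 * L → suc v2 * L ≤ v4 * L → v1 ≡ v3 → ⊥
arith-6 j i L v1 v2 v3 v4 h1 h2 h3 h4 h5 = 1≰0 (linear (j ∷ i ∷ L ∷ v1 ∷ v2 ∷ v3 ∷ v4 ∷ []) 0 (con 1) (con 0)
    (hyp (con 1) (con 1 ⊕ x0) (x1 ⊕ x2) h1 ∷ equ (con 1) x1 (x3 ⊕ x4 ⊛ x2) h2 ∷
    equ (con 1) (x5 ⊕ x6 ⊛ x2) x0 (sym h3) ∷ hyp (con 1) ((con 1 ⊕ x4) ⊛ x2) (x6 ⊛ x2) h4 ∷ equ (con 1) x3 x5 h5 ∷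
    []) refl)

arith-7 : ∀ i j v1 v2 L v3 v4 → i < j → i ≡ v1 + v2 * L → j ≡ v3 + v4 * L → v4 * L ≤ v2 * L → v1 ≡ v3 → ⊥
arith-7 i j v1 v2 L v3 v4 h1 h2 h3 h4 h5 = 1≰0 (linear (i ∷ j ∷ v1 ∷ v2 ∷ L ∷ v3 ∷ v4 ∷ []) 0 (con 1) (con 0)
    (hyp (con 1) (con 1 ⊕ x0) x1 h1 ∷ equ (con 1) (x2 ⊕ x3 ⊛ x4) x0 (sym h2) ∷ equ (con 1) x1 (x5 ⊕ x6 ⊛ x4) h3 ∷
    hyp (con 1) (x6 ⊛ x4) (x3 ⊛ x4) h4 ∷ equ (con 1) x5 x2 (sym h5) ∷ []) refl)

arith-8 : ∀ i L q → i + (L + q * L) ≡ i + q * L + L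
arith-8 i L q = ≤-antisym (linear (i ∷ L ∷ q ∷ []) 0 (x0 ⊕ (x1 ⊕ x2 ⊛ x1)) (x0 ⊕ x2 ⊛ x1 ⊕ x1) [] refl)
    (linear (i ∷ L ∷ q ∷ []) 0 (x0 ⊕ x2 ⊛ x1 ⊕ x1) (x0 ⊕ (x1 ⊕ x2 ⊛ x1)) [] refl)

arith-9 : ∀ j k L x i → j < k → k ≤ L → x + j < x + i + L
arith-9 j k L x i h1 h2 = linear (j ∷ k ∷ L ∷ x ∷ i ∷ []) 0 (con 1 ⊕ (x3 ⊕ x0)) (x3 ⊕ x4 ⊕ x2)
    (hyp (con 1) (con 1 ⊕ x0) x1 h1 ∷ hyp (con 1) x1 x2 h2 ∷ []) refl

arith-10 : ∀ x p y i j → x + p ≤ y → i < p → x + i < y + j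
arith-10 x p y i j h1 h2 = linear (x ∷ p ∷ y ∷ i ∷ j ∷ []) 0 (con 1 ⊕ (x0 ⊕ x3)) (x2 ⊕ x4)
    (hyp (con 1) (x0 ⊕ x1) x2 h1 ∷ hyp (con 1) (con 1 ⊕ x3) x1 h2 ∷ []) refl

arith-11 : ∀ y q x L j i → y + q ≤ x + L → j < q → y + j < x + i + L
arith-11 y q x L j i h1 h2 = linear (y ∷ q ∷ x ∷ L ∷ j ∷ i ∷ []) 0 (con 1 ⊕ (x0 ⊕ x4)) (x2 ⊕ x5 ⊕ x3)
    (hyp (con 1) (x0 ⊕ x1) (x2 ⊕ x3) h1 ∷ hyp (con 1) (con 1 ⊕ x4) x1 h2 ∷ []) refl

record SimpleGraph : Set₁ where
  field
    Vertex : Set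
    _≟ᵥ_ : DecidableEquality Vertex
    E : Vertex → Vertex → Bool
    E-sym : ∀ x y → E x y ≡ E y x
    E-irrefl : ∀ x → E x x ≡ false

nth : {A : Set} → A → List A → ℕ → A
nth d [] _ = d
nth d (x ∷ xs) zero = x
nth d (x ∷ xs) (suc i) = nth d xs i

applyUpTo-nth : ∀ {A : Set} (d : A) xs → applyUpTo (nth d xs) (length xs) ≡ xs
applyUpTo-nth d [] = refl
applyUpTo-nth d (x ∷ xs) = cong (x ∷_) (applyUpTo-nth d xs)

applyUpTo-cong : ∀ {A : Set} {f g : ℕ → A} n → (∀ i → i < n → f i ≡ g i) → applyUpTo f n ≡ applyUpTo g n
applyUpTo-cong zero h = refl
applyUpTo-cong (suc n) h = cong₂ _∷_ (h 0 (s≤s z≤n)) (applyUpTo-cong n (λ i i<n → h (suc i) (s≤s i<n)))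

nth-∈ : ∀ {A : Set} {d : A} xs {i} → i < length xs → nth d xs i ∈ xs
nth-∈ (x ∷ xs) {zero} _ = here refl
nth-∈ (x ∷ xs) {suc i} (s≤s i<) = there (nth-∈ xs i<)

nth-injective : ∀ {A : Set} {d : A} {xs} → Unique xs → ∀ {i j} → i < length xs → j < length xs →
  nth d xs i ≡ nth d xs j → i ≡ j
nth-injective (x∉ ∷ u) {zero} {zero} _ _ _ = refl
nth-injective {xs = x ∷ xs} (x∉ ∷ u) {zero} {suc j} _ (s≤s j<) eq = ⊥-elim (All.lookup x∉ (nth-∈ xs j<) eq)
nth-injective {xs = x ∷ xs} (x∉ ∷ u) {suc i} {zero} (s≤s i<) _ eq = ⊥-elim (All.lookup x∉ (nth-∈ xs i<) (sym eq))
nth-injective (x∉ ∷ u) {suc i} {suc j} (s≤s i<) (s≤s j<) eq = cong suc (nth-injective u i< j< eq)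

module GraphTheory (G : SimpleGraph) where

  open SimpleGraph G public

  infix 4 _~_ _⊆_

  _~_ : Vertex → Vertex → Set
  x ~ y = E x y ≡ true

  ~-sym : ∀ {x y} → x ~ y → y ~ x
  ~-sym {x} {y} h = trans (E-sym y x) h

  ~⇒≢ : ∀ {x y} → x ~ y → x ≢ y
  ~⇒≢ {x} h refl = case trans (sym h) (E-irrefl x) of λ ()

  _⊆_ : List Vertex → List Vertex → Set
  xs ⊆ ys = ∀ {x} → x ∈ xs → x ∈ ys

  deg : Vertex → List Vertex → ℕ
  deg x ys = Σl ys (λ y → ⟦ E x y ⟧)

  e : List Vertex → List Vertex → ℕ
  e xs ys = Σl xs (λ x → deg x ys)

  -- twice the number of edges inside xs
  ee : List Vertex → ℕ
  ee xs = e xs xs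

  -- twice the number of edges inside B ++ U that are not inside B
  out : List Vertex → List Vertex → ℕ
  out B U = 2 * e B U + ee U

  deg-≤length : ∀ x ys → deg x ys ≤ length ys
  deg-≤length x ys = ≤-trans (Σl-≤const ys 1 (λ y _ → ⟦⟧≤1 (E x y))) (≤-reflexive (*-identityʳ _))

  deg-++ : ∀ x ys zs → deg x (ys ++ zs) ≡ deg x ys + deg x zs
  deg-++ x ys zs = Σl-++ ys zs _

  deg-↭ : ∀ x {ys zs} → ys ↭ zs → deg x ys ≡ deg x zs
  deg-↭ x = Σl-↭ _

  deg-self : ∀ x ys → deg x (x ∷ ys) ≡ deg x ys
  deg-self x ys rewrite E-irrefl x = refl

  deg-positive : ∀ {x ys} → 1 ≤ deg x ys → ∃ λ y → y ∈ ys × x ~ y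
  deg-positive {x} {ys} pos with Σl-positive ys _ pos
  ... | y , y∈ , p with E x y in eq
  ...   | true = y , y∈ , eq

  e-≤length : ∀ xs ys → e xs ys ≤ length xs * length ys
  e-≤length xs ys = Σl-≤const xs _ (λ x _ → deg-≤length x ys)

  e-++ʳ : ∀ xs ys zs → e xs (ys ++ zs) ≡ e xs ys + e xs zs
  e-++ʳ xs ys zs = trans (Σl-cong xs (λ x _ → deg-++ x ys zs)) (Σl-+ xs _ _)

  e-++ˡ : ∀ xs ys zs → e (xs ++ ys) zs ≡ e xs zs + e ys zs
  e-++ˡ xs ys zs = Σl-++ xs ys _

  e-sym : ∀ xs ys → e xs ys ≡ e ys xs
  e-sym xs ys = trans (Σl-comm xs ys _) (Σl-cong ys (λ y _ → Σl-cong xs (λ x _ → cong ⟦_⟧ (E-sym x y))))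

  e-↭ : ∀ {xs xs′ ys ys′} → xs ↭ xs′ → ys ↭ ys′ → e xs ys ≡ e xs′ ys′
  e-↭ {xs} p q = trans (Σl-cong xs (λ x _ → deg-↭ x q)) (Σl-↭ _ p)

  ee-++ : ∀ B U → ee (B ++ U) ≡ ee B + out B U
  ee-++ B U = arith-4 (ee (B ++ U)) (e B (B ++ U)) (e U (B ++ U)) (ee B) (e B U) (e U B) (ee U)
      (e-++ˡ B U (B ++ U)) (e-++ʳ B B U) (e-++ʳ U B U) (e-sym U B)

  -- This is the cost of a vertex in the peeling process: as there are no loops, `w` accounts for
  -- exactly twice its degree into the other vertices.
  out-∷ : ∀ B w U → out B (w ∷ U) ≡ out B U + 2 * deg w (B ++ U)
  out-∷ B w U = arith-5 (e B (w ∷ U)) (e B (w ∷ [])) (e B U) (deg w B) (deg w (w ∷ U)) (deg w U)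
      (e U (w ∷ U)) (e U (w ∷ [])) (ee U) (deg w (B ++ U)) (e-++ʳ B (w ∷ []) U) (e-sym B (w ∷ []))
      (deg-self w U) (e-++ʳ U (w ∷ []) U) (e-sym U (w ∷ [])) (deg-++ w B U)

  data Path : Vertex → Vertex → List Vertex → Set where
    single : ∀ {a} → Path a a (a ∷ [])
    _∷_ : ∀ {a b c xs} → a ~ b → Path b c xs → Path a c (a ∷ xs)

  Path-++ : ∀ {a b c d xs ys} → Path a b xs → b ~ c → Path c d ys → Path a d (xs ++ ys)
  Path-++ single h q = h ∷ q
  Path-++ (g ∷ p) h q = g ∷ Path-++ p h q

  Path-reverse : ∀ {a b xs} → Path a b xs → Path b a (reverse xs)
  Path-reverse single = single
  Path-reverse {xs = a ∷ xs} (h ∷ p) = subst (Path _ _) (sym (unfold-reverse a xs))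
      (Path-++ (Path-reverse p) (~-sym h) single)

  Path-first : ∀ {a b xs} → Path a b xs → a ∈ xs
  Path-first single = here refl
  Path-first (_ ∷ _) = here refl

  Path-last : ∀ {a b xs} → Path a b xs → b ∈ xs
  Path-last single = here refl
  Path-last (_ ∷ p) = there (Path-last p)

  Path-split : ∀ {a b} xs {y ys} → Path a b (xs ++ y ∷ ys) → Path a y (xs ++ [ y ]) × Path y b (y ∷ ys)
  Path-split [] single = single , single
  Path-split [] (h ∷ p) = single , (h ∷ p)
  Path-split (x ∷ []) (h ∷ p) with p
  ... | single = (h ∷ single) , p
  ... | _ ∷ _ = (h ∷ single) , p
  Path-split (x ∷ x′ ∷ xs) (h ∷ p) with Path-split (x′ ∷ xs) p
  ... | q , r = (h ∷ q) , r

  Path-nonempty : ∀ {a b xs} → Path a b xs → 1 ≤ length xs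
  Path-nonempty single = s≤s z≤n
  Path-nonempty (_ ∷ _) = s≤s z≤n

  Path-nth-first : ∀ {a b xs} d → Path a b xs → nth d xs 0 ≡ a
  Path-nth-first d single = refl
  Path-nth-first d (_ ∷ _) = refl

  Path-nth-last : ∀ {a b xs} d i → Path a b xs → suc i ≡ length xs → nth d xs i ≡ b
  Path-nth-last d zero single refl = refl
  Path-nth-last d zero (h ∷ single) ()
  Path-nth-last d zero (h ∷ (_ ∷ _)) ()
  Path-nth-last d (suc i) (h ∷ p) eq = Path-nth-last d i p (suc-injective eq)

  Path-nth-step : ∀ {a b xs} d i → Path a b xs → suc i < length xs → nth d xs i ~ nth d xs (suc i)
  Path-nth-step d i single (s≤s ())
  Path-nth-step d zero (h ∷ single) _ = h
  Path-nth-step d zero (h ∷ (_ ∷ _)) _ = h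
  Path-nth-step d (suc i) (_ ∷ p) (s≤s lt) = Path-nth-step d i p lt

  record Cycle (xs : List Vertex) : Set where
    constructor mkCycle
    field
      {first last} : Vertex
      path : Path first last xs
      closed : last ~ first
      unique : Unique xs
      long : 3 ≤ length xs

  -- a cycle of length L as an L-periodic sequence
  record Circuit (L : ℕ) : Set where
    field
      c : ℕ → Vertex
      periodic : Periodic L c
      step : ∀ i → c i ~ c (suc i)
      distinct : ∀ {i j} → i < j → j < i + L → c i ≢ c j
      L≥3 : 3 ≤ L

  circuit : ∀ {xs} → Cycle xs → Σ (Circuit (length xs)) λ C → applyUpTo (Circuit.c C) (length xs) ≡ xs
  circuit {x ∷ xs} (mkCycle {a} {b} path closed unique long) = record
    { c = c ; periodic = λ i → cong (nth x (x ∷ xs)) ([m+n]%n≡m%n i L)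
    ; step = step ; distinct = distinct ; L≥3 = long } ,
    trans (applyUpTo-cong L (λ i i<L → cong (nth x (x ∷ xs)) (m<n⇒m%n≡m i<L))) (applyUpTo-nth x (x ∷ xs))
    where
    L = suc (length xs)
    c : ℕ → Vertex
    c i = nth x (x ∷ xs) (i % L)
    suc% : ∀ i → suc i % L ≡ suc (i % L) % L
    suc% i = trans (%-distribˡ-+ 1 i L)
        (sym (trans (%-distribˡ-+ 1 (i % L) L) (cong (λ r → (1 % L + r) % L) (m%n%n≡m%n i L))))
    step : ∀ i → c i ~ c (suc i)
    step i with suc (i % L) <? L
    ... | yes lt = subst (λ r → c i ~ nth x (x ∷ xs) r) (sym (trans (suc% i) (m<n⇒m%n≡m lt)))
        (Path-nth-step x (i % L) path lt)
    ... | no ¬lt = subst₂ _~_ (sym (Path-nth-last x (i % L) path end))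
                     (sym (trans (cong (nth x (x ∷ xs)) (trans (suc% i) (trans (cong (_% L) end) (n%n≡0 L))))
                         (Path-nth-first x path))) closed
      where
      end : suc (i % L) ≡ L
      end = ≤-antisym (m%n<n i L) (≮⇒≥ ¬lt)
    distinct : ∀ {i j} → i < j → j < i + L → c i ≢ c j
    distinct {i} {j} i<j j<i+L eq = contra (nth-injective unique (m%n<n i L) (m%n<n j L) eq)
      where
      -- With equal remainders, a larger quotient puts `j` at least `L` after `i`, and a quotient
      -- that is not larger contradicts `i < j`.
      contra : i % L ≡ j % L → ⊥
      contra r≡ with i / L <? j / L
      ... | yes q< = arith-6 j i L (i % L) (i / L) (j % L) (j / L) j<i+L (m≡m%n+[m/n]*n i L)
          (m≡m%n+[m/n]*n j L) (*-monoˡ-≤ L q<) r≡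
      ... | no q≮ = arith-7 i j (i % L) (i / L) L (j % L) (j / L) i<j (m≡m%n+[m/n]*n i L) (m≡m%n+[m/n]*n j L)
          (*-monoˡ-≤ L (≮⇒≥ q≮)) r≡

  module Arcs {L : ℕ} (C : Circuit L) where

    open Circuit C public

    arc : ℕ → ℕ → List Vertex
    arc x k = applyUpTo (λ i → c (x + i)) k

    verts : List Vertex
    verts = applyUpTo c L

    L>0 : 1 ≤ L
    L>0 = ≤-trans (s≤s z≤n) L≥3

    c-multiple : ∀ q i → c (i + q * L) ≡ c i
    c-multiple zero i = cong c (+-identityʳ i)
    c-multiple (suc q) i = trans (cong c (arith-8 i L q)) (trans (periodic (i + q * L)) (c-multiple q i))

    reduced : ∀ i → ∃ λ r → r < L × c i ≡ c r
    reduced i = i % L , m%n<n i L , trans (cong c (m≡m%n+[m/n]*n i L)) (c-multiple (i / L) (i % L))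
      where
      instance
        L≢0 : NonZero L
        L≢0 = >-nonZero L>0

    c-∈ : ∀ i → c i ∈ verts
    c-∈ i with reduced i
    ... | r , r<L , eq = subst (_∈ verts) (sym eq) (∈-applyUpTo⁺ c r<L)

    ∈-verts : ∀ {v} → v ∈ verts → ∃ λ i → i < L × v ≡ c i
    ∈-verts v∈ with ∈-applyUpTo⁻ c v∈
    ... | i , i<L , eq = i , i<L , eq

    verts-unique : Unique verts
    verts-unique = Unique.applyUpTo⁺₁ c L (λ i<j j<L → distinct i<j (≤-trans j<L (m≤n+m L _)))

    verts-length : length verts ≡ L
    verts-length = length-applyUpTo c L

    arc-length : ∀ x k → length (arc x k) ≡ k
    arc-length x k = length-applyUpTo _ k

    arc-path : ∀ x k → Path (c x) (c (x + k)) (arc x (suc k))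
    arc-path x zero = subst (λ v → Path (c x) v (v ∷ [])) (cong c (sym (+-identityʳ x))) (single {c x})
    arc-path x (suc k) = subst₂ (λ v w → Path v w (arc x (suc (suc k)))) (cong c (+-identityʳ x))
        (cong c (sym (+-suc x k)))
      (subst₂ (λ v ys → c (x + 0) ~ v → Path (c (x + 0)) (c (suc x + k)) (c (x + 0) ∷ ys)) refl
        (applyUpTo-cong (suc k) (λ i _ → cong c (sym (+-suc x i))))
        (λ h → h ∷ arc-path (suc x) k) (subst (λ v → c v ~ c (suc x)) (sym (+-identityʳ x)) (step x)))

    ∈-arc : ∀ {x k v} → v ∈ arc x k → ∃ λ i → i < k × v ≡ c (x + i)
    ∈-arc v∈ with ∈-applyUpTo⁻ _ v∈
    ... | i , i<k , eq = i , i<k , eq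

    arc-⊆ : ∀ {x k v} → v ∈ arc x k → v ∈ verts
    arc-⊆ {x} v∈ with ∈-arc {x} v∈
    ... | i , _ , refl = c-∈ (x + i)

    arc-unique : ∀ x k → k ≤ L → Unique (arc x k)
    arc-unique x k k≤L = Unique.applyUpTo⁺₁ _ k (λ {i} {j} i<j j<k →
      distinct (+-monoʳ-< x i<j) (arith-9 j k L x i j<k k≤L))

    arcs-disjoint : ∀ {x y p q v} → x + p ≤ y → y + q ≤ x + L → v ∈ arc x p → v ∈ arc y q → ⊥
    arcs-disjoint {x} {y} {p} {q} h₁ h₂ v∈ v∈′ with ∈-arc {x} v∈ | ∈-arc {y} v∈′
    ... | i , i<p , refl | j , j<q , eq =
      distinct (arith-10 x p y i j h₁ i<p) (arith-11 y q x L j i h₂ j<q) eq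

    ∑-rotate : ∀ (f : Vertex → ℕ) x → ∑ L (λ i → f (c (x + i))) ≡ Σl verts f
    ∑-rotate f x = trans (∑-shift (λ i → cong f (periodic i)) x) (sym (Σl-applyUpTo c L f))

-- Chords of a circuit in a graph without cycles of length 2n

arith-12 : ∀ v1 v2 v3 p v4 q n₁ → v1 ≡ v2 + v3 → v2 ≡ suc p → v3 ≡ v4 → v4 ≡ suc q → p + q + 2 ≡ 2 * suc n₁ →
    v1 ≡ 2 * suc n₁
arith-12 v1 v2 v3 p v4 q n₁ h1 h2 h3 h4 h5 = ≤-antisym (linear (v1 ∷ v2 ∷ v3 ∷ p ∷ v4 ∷ q ∷ n₁ ∷ []) 0 x0
    (con 2 ⊛ (con 1 ⊕ x6))
    (equ (con 1) x0 (x1 ⊕ x2) h1 ∷ equ (con 1) x1 (con 1 ⊕ x3) h2 ∷ equ (con 1) x2 x4 h3 ∷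
    equ (con 1) x4 (con 1 ⊕ x5) h4 ∷ equ (con 1) (x3 ⊕ x5 ⊕ con 2) (con 2 ⊛ (con 1 ⊕ x6)) h5 ∷ []) refl)
        (linear (v1 ∷ v2 ∷ v3 ∷ p ∷ v4 ∷ q ∷ n₁ ∷ []) 0 (con 2 ⊛ (con 1 ⊕ x6)) x0
    (equ (con 1) (x1 ⊕ x2) x0 (sym h1) ∷ equ (con 1) (con 1 ⊕ x3) x1 (sym h2) ∷ equ (con 1) x4 x2 (sym h3) ∷
    equ (con 1) (con 1 ⊕ x5) x4 (sym h4) ∷ equ (con 1) (con 2 ⊛ (con 1 ⊕ x6)) (x3 ⊕ x5 ⊕ con 2) (sym h5) ∷ []) refl)

arith-13 : ∀ x p y q L → x + p < y → y + q < x + L → suc p ≤ L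
arith-13 x p y q L h1 h2 = linear (x ∷ p ∷ y ∷ q ∷ L ∷ []) 0 (con 1 ⊕ x1) x4
    (hyp (con 1) (con 1 ⊕ (x0 ⊕ x1)) x2 h1 ∷ hyp (con 1) (con 1 ⊕ (x2 ⊕ x3)) (x0 ⊕ x4) h2 ∷ []) refl

arith-14 : ∀ x p y q L → x + p < y → y + q < x + L → suc q ≤ L
arith-14 x p y q L h1 h2 = linear (x ∷ p ∷ y ∷ q ∷ L ∷ []) 0 (con 1 ⊕ x3) x4
    (hyp (con 1) (con 1 ⊕ (x0 ⊕ x1)) x2 h1 ∷ hyp (con 1) (con 1 ⊕ (x2 ⊕ x3)) (x0 ⊕ x4) h2 ∷ []) refl

arith-15 : ∀ x p y → x + p < y → x + suc p ≤ y
arith-15 x p y h1 = linear (x ∷ p ∷ y ∷ []) 0 (x0 ⊕ (con 1 ⊕ x1)) x2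
    (hyp (con 1) (con 1 ⊕ (x0 ⊕ x1)) x2 h1 ∷ []) refl

arith-16 : ∀ y q x L → y + q < x + L → y + suc q ≤ x + L
arith-16 y q x L h1 = linear (y ∷ q ∷ x ∷ L ∷ []) 0 (x0 ⊕ (con 1 ⊕ x1)) (x2 ⊕ x3)
    (hyp (con 1) (con 1 ⊕ (x0 ⊕ x1)) (x2 ⊕ x3) h1 ∷ []) refl

arith-17 : ∀ v1 n₁ → v1 ≡ 2 * suc n₁ → 1 ≤ n₁ → 3 ≤ v1
arith-17 v1 n₁ h1 h2 = linear (v1 ∷ n₁ ∷ []) 0 (con 3) x0
    (equ (con 1) (con 2 ⊛ (con 1 ⊕ x1)) x0 (sym h1) ∷ hyp (con 1) (con 1) x1 h2 ∷ []) refl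

arith-18 : ∀ i L d → i + L + d ≡ i + d + L
arith-18 i L d = ≤-antisym (linear (i ∷ L ∷ d ∷ []) 0 (x0 ⊕ x1 ⊕ x2) (x0 ⊕ x2 ⊕ x1) [] refl)
    (linear (i ∷ L ∷ d ∷ []) 0 (x0 ⊕ x2 ⊕ x1) (x0 ⊕ x1 ⊕ x2) [] refl)

arith-19 : ∀ d d′ L i → d + d′ ≡ L → d + i + d′ ≡ i + L
arith-19 d d′ L i h1 = ≤-antisym (linear (d ∷ d′ ∷ L ∷ i ∷ []) 0 (x0 ⊕ x3 ⊕ x1) (x3 ⊕ x2)
    (equ (con 1) (x0 ⊕ x1) x2 h1 ∷ []) refl) (linear (d ∷ d′ ∷ L ∷ i ∷ []) 0 (x3 ⊕ x2) (x0 ⊕ x3 ⊕ x1)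
    (equ (con 1) x2 (x0 ⊕ x1) (sym h1) ∷ []) refl)

arith-20 : ∀ a b k L j v1 → a + b + k ≡ suc L → suc j + v1 ≡ k → a + j + (b + v1) ≡ L
arith-20 a b k L j v1 h1 h2 = ≤-antisym (linear (a ∷ b ∷ k ∷ L ∷ j ∷ v1 ∷ []) 0 (x0 ⊕ x4 ⊕ (x1 ⊕ x5)) x3
    (equ (con 1) (x0 ⊕ x1 ⊕ x2) (con 1 ⊕ x3) h1 ∷ equ (con 1) (con 1 ⊕ x4 ⊕ x5) x2 h2 ∷ []) refl)
        (linear (a ∷ b ∷ k ∷ L ∷ j ∷ v1 ∷ []) 0 x3 (x0 ⊕ x4 ⊕ (x1 ⊕ x5))
    (equ (con 1) (con 1 ⊕ x3) (x0 ⊕ x1 ⊕ x2) (sym h1) ∷ equ (con 1) x2 (con 1 ⊕ x4 ⊕ x5) (sym h2) ∷ []) refl)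

arith-21 : ∀ i v → i + v < i + suc v
arith-21 i v = linear (i ∷ v ∷ []) 0 (con 1 ⊕ (x0 ⊕ x1)) (x0 ⊕ (con 1 ⊕ x1)) [] refl

arith-22 : ∀ u v n₁ L i → u + v ≡ 2 * n₁ → 2 * suc n₁ ≤ L → i + suc v + u < i + L
arith-22 u v n₁ L i h1 h2 = linear (u ∷ v ∷ n₁ ∷ L ∷ i ∷ []) 0 (con 1 ⊕ (x4 ⊕ (con 1 ⊕ x1) ⊕ x0)) (x4 ⊕ x3)
    (equ (con 1) (x0 ⊕ x1) (con 2 ⊛ x2) h1 ∷ hyp (con 1) (con 2 ⊛ (con 1 ⊕ x2)) x3 h2 ∷ []) refl

arith-23 : ∀ u v n₁ → u + v ≡ 2 * n₁ → v + u + 2 ≡ 2 * suc n₁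
arith-23 u v n₁ h1 = ≤-antisym (linear (u ∷ v ∷ n₁ ∷ []) 0 (x1 ⊕ x0 ⊕ con 2) (con 2 ⊛ (con 1 ⊕ x2))
    (equ (con 1) (x0 ⊕ x1) (con 2 ⊛ x2) h1 ∷ []) refl) (linear (u ∷ v ∷ n₁ ∷ []) 0 (con 2 ⊛ (con 1 ⊕ x2))
        (x1 ⊕ x0 ⊕ con 2)
    (equ (con 1) (con 2 ⊛ x2) (x0 ⊕ x1) (sym h1) ∷ []) refl)

arith-24 : ∀ v i u → v + i + suc u ≡ i + suc v + u
arith-24 v i u = ≤-antisym (linear (v ∷ i ∷ u ∷ []) 0 (x0 ⊕ x1 ⊕ (con 1 ⊕ x2)) (x1 ⊕ (con 1 ⊕ x0) ⊕ x2) []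
    refl) (linear (v ∷ i ∷ u ∷ []) 0 (x1 ⊕ (con 1 ⊕ x0) ⊕ x2) (x0 ⊕ x1 ⊕ (con 1 ⊕ x2)) [] refl)

arith-25 : ∀ i u → i + 0 < i + suc u
arith-25 i u = linear (i ∷ u ∷ []) 0 (con 1 ⊕ (x0 ⊕ con 0)) (x0 ⊕ (con 1 ⊕ x1)) [] refl

arith-26 : ∀ u n₁ L i → suc u + 2 * n₁ < L → i + suc u + 2 * n₁ < i + L
arith-26 u n₁ L i h1 = linear (u ∷ n₁ ∷ L ∷ i ∷ []) 0 (con 1 ⊕ (x3 ⊕ (con 1 ⊕ x0) ⊕ con 2 ⊛ x1)) (x3 ⊕ x2)
    (hyp (con 1) (con 1 ⊕ (con 1 ⊕ x0 ⊕ con 2 ⊛ x1)) x2 h1 ∷ []) refl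

arith-27 : ∀ n₁ → 0 + 2 * n₁ + 2 ≡ 2 * suc n₁
arith-27 n₁ = ≤-antisym (linear (n₁ ∷ []) 0 (con 0 ⊕ con 2 ⊛ x0 ⊕ con 2) (con 2 ⊛ (con 1 ⊕ x0)) [] refl)
    (linear (n₁ ∷ []) 0 (con 2 ⊛ (con 1 ⊕ x0)) (con 0 ⊕ con 2 ⊛ x0 ⊕ con 2) [] refl)

arith-28 : ∀ n₁ k → 2 * suc n₁ + k ≡ suc (suc (2 * n₁) + k)
arith-28 n₁ k = ≤-antisym (linear (n₁ ∷ k ∷ []) 0 (con 2 ⊛ (con 1 ⊕ x0) ⊕ x1) (con 1 ⊕ (con 1 ⊕ con 2 ⊛ x0 ⊕ x1))
    [] refl) (linear (n₁ ∷ k ∷ []) 0 (con 1 ⊕ (con 1 ⊕ con 2 ⊛ x0 ⊕ x1)) (con 2 ⊛ (con 1 ⊕ x0) ⊕ x1)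
    [] refl)

arith-29 : ∀ n₁ k → 1 + suc (2 * n₁) + suc k ≡ suc (2 * suc n₁ + k)
arith-29 n₁ k = ≤-antisym (linear (n₁ ∷ k ∷ []) 0 (con 1 ⊕ (con 1 ⊕ con 2 ⊛ x0) ⊕ (con 1 ⊕ x1))
    (con 1 ⊕ (con 2 ⊛ (con 1 ⊕ x0) ⊕ x1))
    [] refl) (linear (n₁ ∷ k ∷ []) 0 (con 1 ⊕ (con 2 ⊛ (con 1 ⊕ x0) ⊕ x1)) (con 1 ⊕ (con 1 ⊕ con 2 ⊛ x0) ⊕ (con 1 ⊕ x1))
    [] refl)

arith-30 : ∀ v1 v2 v3 v4 n₁ k v5 v6 v7 v8 → v1 ≡ v2 → v2 ≡ v3 + v4 → 2 * v3 ≤ suc (2 * n₁) * (2 * suc n₁ + k)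
    → v5 + v6 ≤ suc k * (2 * suc n₁ + k) → v5 ≡ v6 → v6 ≡ v7 + v8 → v8 ≡ v4 → 2 * v1 ≤ (2 * suc n₁ + k) *
    (2 * suc n₁ + k)
arith-30 v1 v2 v3 v4 n₁ k v5 v6 v7 v8 h1 h2 h3 h4 h5 h6 h7 =
    linear (v1 ∷ v2 ∷ v3 ∷ v4 ∷ n₁ ∷ k ∷ v5 ∷ v6 ∷ v7 ∷ v8 ∷ []) 0 (con 2 ⊛ x0)
    ((con 2 ⊛ (con 1 ⊕ x4) ⊕ x5) ⊛ (con 2 ⊛ (con 1 ⊕ x4) ⊕ x5))
    (equ (con 2) x0 x1 h1 ∷ equ (con 2) x1 (x2 ⊕ x3) h2 ∷
    hyp (con 1) (con 2 ⊛ x2) ((con 1 ⊕ con 2 ⊛ x4) ⊛ (con 2 ⊛ (con 1 ⊕ x4) ⊕ x5)) h3 ∷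
    hyp (con 1) (x6 ⊕ x7) ((con 1 ⊕ x5) ⊛ (con 2 ⊛ (con 1 ⊕ x4) ⊕ x5)) h4 ∷ equ (con 1) x7 x6 (sym h5) ∷
    equ (con 2) (x8 ⊕ x9) x7 (sym h6) ∷ equ (con 2) x3 x9 (sym h7) ∷ []) refl

arith-31 : ∀ n₁ j → suc (2 * n₁) + j ≡ suc j + 2 * n₁
arith-31 n₁ j = ≤-antisym (linear (n₁ ∷ j ∷ []) 0 (con 1 ⊕ con 2 ⊛ x0 ⊕ x1) (con 1 ⊕ x1 ⊕ con 2 ⊛ x0) []
    refl) (linear (n₁ ∷ j ∷ []) 0 (con 1 ⊕ x1 ⊕ con 2 ⊛ x0) (con 1 ⊕ con 2 ⊛ x0 ⊕ x1) [] refl)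

arith-32 : ∀ j k n₁ → j < suc k → suc j + 2 * n₁ < 2 * suc n₁ + k
arith-32 j k n₁ h1 = linear (j ∷ k ∷ n₁ ∷ []) 0 (con 1 ⊕ (con 1 ⊕ x0 ⊕ con 2 ⊛ x2)) (con 2 ⊛ (con 1 ⊕ x2) ⊕ x1)
    (hyp (con 1) (con 1 ⊕ x0) (con 1 ⊕ x1) h1 ∷ []) refl

arith-33 : ∀ i u w → i + (u + 2 * w) < i + (suc u + 2 * w)
arith-33 i u w = linear (i ∷ u ∷ w ∷ []) 0 (con 1 ⊕ (x0 ⊕ (x1 ⊕ con 2 ⊛ x2))) (x0 ⊕ (con 1 ⊕ x1 ⊕ con 2 ⊛ x2))
    [] refl

arith-34 : ∀ u w L i → 3 * (u + w) + 2 ≤ L → i + (suc u + 2 * w) + u < i + L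
arith-34 u w L i h1 = linear (u ∷ w ∷ L ∷ i ∷ []) 0 (con 1 ⊕ (x3 ⊕ (con 1 ⊕ x0 ⊕ con 2 ⊛ x1) ⊕ x0)) (x3 ⊕ x2)
    (hyp (con 1) (con 3 ⊛ (x0 ⊕ x1) ⊕ con 2) x2 h1 ∷ []) refl

arith-35 : ∀ u w → u + 2 * w + u + 2 ≡ 2 * suc (u + w)
arith-35 u w = ≤-antisym (linear (u ∷ w ∷ []) 0 (x0 ⊕ con 2 ⊛ x1 ⊕ x0 ⊕ con 2) (con 2 ⊛ (con 1 ⊕ (x0 ⊕ x1)))
    [] refl) (linear (u ∷ w ∷ []) 0 (con 2 ⊛ (con 1 ⊕ (x0 ⊕ x1))) (x0 ⊕ con 2 ⊛ x1 ⊕ x0 ⊕ con 2) [] refl)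

arith-36 : ∀ u w i → u + 2 * w + i + suc u ≡ i + (suc u + 2 * w) + u
arith-36 u w i = ≤-antisym (linear (u ∷ w ∷ i ∷ []) 0 (x0 ⊕ con 2 ⊛ x1 ⊕ x2 ⊕ (con 1 ⊕ x0))
    (x2 ⊕ (con 1 ⊕ x0 ⊕ con 2 ⊛ x1) ⊕ x0)
    [] refl) (linear (u ∷ w ∷ i ∷ []) 0 (x2 ⊕ (con 1 ⊕ x0 ⊕ con 2 ⊛ x1) ⊕ x0) (x0 ⊕ con 2 ⊛ x1 ⊕ x2 ⊕ (con 1 ⊕ x0))
    [] refl)

arith-37 : ∀ i w u → i + w < i + (suc u + 2 * w)
arith-37 i w u = linear (i ∷ w ∷ u ∷ []) 0 (con 1 ⊕ (x0 ⊕ x1)) (x0 ⊕ (con 1 ⊕ x2 ⊕ con 2 ⊛ x1)) [] refl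

arith-38 : ∀ u w L i → 3 * (u + w) + 2 ≤ L → i + (suc u + 2 * w) + (2 * u + w) < i + L
arith-38 u w L i h1 = linear (u ∷ w ∷ L ∷ i ∷ []) 0
    (con 1 ⊕ (x3 ⊕ (con 1 ⊕ x0 ⊕ con 2 ⊛ x1) ⊕ (con 2 ⊛ x0 ⊕ x1))) (x3 ⊕ x2)
    (hyp (con 1) (con 3 ⊛ (x0 ⊕ x1) ⊕ con 2) x2 h1 ∷ []) refl

arith-39 : ∀ w u → w + (2 * u + w) + 2 ≡ 2 * suc (u + w)
arith-39 w u = ≤-antisym (linear (w ∷ u ∷ []) 0 (x0 ⊕ (con 2 ⊛ x1 ⊕ x0) ⊕ con 2) (con 2 ⊛ (con 1 ⊕ (x1 ⊕ x0)))
    [] refl) (linear (w ∷ u ∷ []) 0 (con 2 ⊛ (con 1 ⊕ (x1 ⊕ x0))) (x0 ⊕ (con 2 ⊛ x1 ⊕ x0) ⊕ con 2)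
    [] refl)

arith-40 : ∀ w i u → w + i + (3 * u + 1 + 2 * w) ≡ i + (suc u + 2 * w) + (2 * u + w)
arith-40 w i u = ≤-antisym (linear (w ∷ i ∷ u ∷ []) 0 (x0 ⊕ x1 ⊕ (con 3 ⊛ x2 ⊕ con 1 ⊕ con 2 ⊛ x0))
    (x1 ⊕ (con 1 ⊕ x2 ⊕ con 2 ⊛ x0) ⊕ (con 2 ⊛ x2 ⊕ x0))
    [] refl) (linear (w ∷ i ∷ u ∷ []) 0 (x1 ⊕ (con 1 ⊕ x2 ⊕ con 2 ⊛ x0) ⊕ (con 2 ⊛ x2 ⊕ x0))
        (x0 ⊕ x1 ⊕ (con 3 ⊛ x2 ⊕ con 1 ⊕ con 2 ⊛ x0))
    [] refl)

arith-41 : ∀ w i u → w + i + (u + w) < u + 2 * w + i + suc u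
arith-41 w i u = linear (w ∷ i ∷ u ∷ []) 0 (con 1 ⊕ (x0 ⊕ x1 ⊕ (x2 ⊕ x0))) (x2 ⊕ con 2 ⊛ x0 ⊕ x1 ⊕ (con 1 ⊕ x2))
    [] refl

arith-42 : ∀ u w L i → 3 * (u + w) + 2 ≤ L → u + 2 * w + i + suc u + (u + w) < w + i + L
arith-42 u w L i h1 = linear (u ∷ w ∷ L ∷ i ∷ []) 0
    (con 1 ⊕ (x0 ⊕ con 2 ⊛ x1 ⊕ x3 ⊕ (con 1 ⊕ x0) ⊕ (x0 ⊕ x1))) (x1 ⊕ x3 ⊕ x2)
    (hyp (con 1) (con 3 ⊛ (x0 ⊕ x1) ⊕ con 2) x2 h1 ∷ []) refl

arith-43 : ∀ u w → u + w + (u + w) + 2 ≡ 2 * suc (u + w)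
arith-43 u w = ≤-antisym (linear (u ∷ w ∷ []) 0 (x0 ⊕ x1 ⊕ (x0 ⊕ x1) ⊕ con 2) (con 2 ⊛ (con 1 ⊕ (x0 ⊕ x1)))
    [] refl) (linear (u ∷ w ∷ []) 0 (con 2 ⊛ (con 1 ⊕ (x0 ⊕ x1))) (x0 ⊕ x1 ⊕ (x0 ⊕ x1) ⊕ con 2) [] refl)

arith-44 : ∀ u w i → u + 2 * w + i ≡ w + i + (u + w)
arith-44 u w i = ≤-antisym (linear (u ∷ w ∷ i ∷ []) 0 (x0 ⊕ con 2 ⊛ x1 ⊕ x2) (x1 ⊕ x2 ⊕ (x0 ⊕ x1)) [] refl)
    (linear (u ∷ w ∷ i ∷ []) 0 (x1 ⊕ x2 ⊕ (x0 ⊕ x1)) (x0 ⊕ con 2 ⊛ x1 ⊕ x2) [] refl)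

arith-45 : ∀ w i u → w + i + (3 * u + 1 + 2 * w) ≡ u + 2 * w + i + suc u + (u + w)
arith-45 w i u = ≤-antisym (linear (w ∷ i ∷ u ∷ []) 0 (x0 ⊕ x1 ⊕ (con 3 ⊛ x2 ⊕ con 1 ⊕ con 2 ⊛ x0))
    (x2 ⊕ con 2 ⊛ x0 ⊕ x1 ⊕ (con 1 ⊕ x2) ⊕ (x2 ⊕ x0))
    [] refl) (linear (w ∷ i ∷ u ∷ []) 0 (x2 ⊕ con 2 ⊛ x0 ⊕ x1 ⊕ (con 1 ⊕ x2) ⊕ (x2 ⊕ x0))
        (x0 ⊕ x1 ⊕ (con 3 ⊛ x2 ⊕ con 1 ⊕ con 2 ⊛ x0))
    [] refl)

arith-46 : ∀ u v1 n₁ → u + v1 ≡ n₁ → suc n₁ + v1 ≡ suc u + 2 * v1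
arith-46 u v1 n₁ h1 = ≤-antisym (linear (u ∷ v1 ∷ n₁ ∷ []) 0 (con 1 ⊕ x2 ⊕ x1) (con 1 ⊕ x0 ⊕ con 2 ⊛ x1)
    (equ (con 1) x2 (x0 ⊕ x1) (sym h1) ∷ []) refl) (linear (u ∷ v1 ∷ n₁ ∷ []) 0 (con 1 ⊕ x0 ⊕ con 2 ⊛ x1)
        (con 1 ⊕ x2 ⊕ x1)
    (equ (con 1) (x0 ⊕ x1) x2 h1 ∷ []) refl)

arith-47 : ∀ u v1 n₁ → u + v1 ≡ n₁ → suc (2 * n₁) + u ≡ 3 * u + 1 + 2 * v1
arith-47 u v1 n₁ h1 = ≤-antisym (linear (u ∷ v1 ∷ n₁ ∷ []) 0 (con 1 ⊕ con 2 ⊛ x2 ⊕ x0) (con 3 ⊛ x0 ⊕ con 1 ⊕ con 2 ⊛ x1)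
    (equ (con 2) x2 (x0 ⊕ x1) (sym h1) ∷ []) refl)
        (linear (u ∷ v1 ∷ n₁ ∷ []) 0 (con 3 ⊛ x0 ⊕ con 1 ⊕ con 2 ⊛ x1) (con 1 ⊕ con 2 ⊛ x2 ⊕ x0)
    (equ (con 2) (x0 ⊕ x1) x2 h1 ∷ []) refl)

arith-48 : ∀ v1 v2 v3 v4 v5 v6 v7 v8 v9 v10 → v1 ≡ v2 + v3 + v4 → v5 ≡ v6 + v7 → v7 ≡ v3 → v8 ≡ v9 + v10 →
    v10 ≡ v4 → v1 ≤ v2 + v5 + v8
arith-48 v1 v2 v3 v4 v5 v6 v7 v8 v9 v10 h1 h2 h3 h4 h5 = linear (v1 ∷ v2 ∷ v3 ∷ v4 ∷ v5 ∷ v6 ∷ v7 ∷ v8 ∷ v9 ∷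
    v10 ∷ []) 0 x0 (x1 ⊕ x4 ⊕ x7)
    (equ (con 1) x0 (x1 ⊕ x2 ⊕ x3) h1 ∷ equ (con 1) (x5 ⊕ x6) x4 (sym h2) ∷ equ (con 1) x2 x6 (sym h3) ∷
    equ (con 1) (x8 ⊕ x9) x7 (sym h4) ∷ equ (con 1) x3 x9 (sym h5) ∷ []) refl

arith-49 : ∀ n₁ → 3 * n₁ + 1 ≡ suc n₁ + n₁ + n₁
arith-49 n₁ = ≤-antisym (linear (n₁ ∷ []) 0 (con 3 ⊛ x0 ⊕ con 1) (con 1 ⊕ x0 ⊕ x0 ⊕ x0) [] refl)
    (linear (n₁ ∷ []) 0 (con 1 ⊕ x0 ⊕ x0 ⊕ x0) (con 3 ⊛ x0 ⊕ con 1) [] refl)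

arith-50 : ∀ n₁ → 1 + (suc n₁ + n₁) ≡ suc (suc (2 * n₁))
arith-50 n₁ = ≤-antisym (linear (n₁ ∷ []) 0 (con 1 ⊕ (con 1 ⊕ x0 ⊕ x0)) (con 1 ⊕ (con 1 ⊕ con 2 ⊛ x0)) []
    refl) (linear (n₁ ∷ []) 0 (con 1 ⊕ (con 1 ⊕ con 2 ⊛ x0)) (con 1 ⊕ (con 1 ⊕ x0 ⊕ x0)) [] refl)

arith-51 : ∀ n₁ g → 3 * n₁ + 2 + g ≡ suc (3 * n₁ + 1 + g)
arith-51 n₁ g = ≤-antisym (linear (n₁ ∷ g ∷ []) 0 (con 3 ⊛ x0 ⊕ con 2 ⊕ x1) (con 1 ⊕ (con 3 ⊛ x0 ⊕ con 1 ⊕ x1))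
    [] refl) (linear (n₁ ∷ g ∷ []) 0 (con 1 ⊕ (con 3 ⊛ x0 ⊕ con 1 ⊕ x1)) (con 3 ⊛ x0 ⊕ con 2 ⊕ x1)
    [] refl)

arith-52 : ∀ n₁ g → 1 + (3 * n₁ + 1) + 1 + g ≡ suc (3 * n₁ + 2 + g)
arith-52 n₁ g = ≤-antisym (linear (n₁ ∷ g ∷ []) 0 (con 1 ⊕ (con 3 ⊛ x0 ⊕ con 1) ⊕ con 1 ⊕ x1)
    (con 1 ⊕ (con 3 ⊛ x0 ⊕ con 2 ⊕ x1))
    [] refl) (linear (n₁ ∷ g ∷ []) 0 (con 1 ⊕ (con 3 ⊛ x0 ⊕ con 2 ⊕ x1)) (con 1 ⊕ (con 3 ⊛ x0 ⊕ con 1) ⊕ con 1 ⊕ x1)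
    [] refl)

arith-53 : ∀ n₁ g → 3 * n₁ + 2 + g ≤ 6 * n₁ + 3 → g ≤ 3 * n₁ + 1
arith-53 n₁ g h1 = linear (n₁ ∷ g ∷ []) 0 x1 (con 3 ⊛ x0 ⊕ con 1)
    (hyp (con 1) (con 3 ⊛ x0 ⊕ con 2 ⊕ x1) (con 6 ⊛ x0 ⊕ con 3) h1 ∷ []) refl

arith-54 : ∀ v1 v2 v3 v4 v5 n₁ g → v1 ≡ v2 → v2 ≡ v3 + v4 → v4 ≡ v5 → v5 ≤ v3 → v3 ≤ suc n₁ *
    (3 * n₁ + 2 + g) → v1 ≤ 2 * suc n₁ * (3 * n₁ + 2 + g)
arith-54 v1 v2 v3 v4 v5 n₁ g h1 h2 h3 h4 h5 = linear (v1 ∷ v2 ∷ v3 ∷ v4 ∷ v5 ∷ n₁ ∷ g ∷ []) 0 x0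
    (con 2 ⊛ (con 1 ⊕ x5) ⊛ (con 3 ⊛ x5 ⊕ con 2 ⊕ x6))
    (equ (con 1) x0 x1 h1 ∷ equ (con 1) x1 (x2 ⊕ x3) h2 ∷ equ (con 1) x3 x4 h3 ∷ hyp (con 1) x4 x2 h4 ∷
    hyp (con 2) x2 ((con 1 ⊕ x5) ⊛ (con 3 ⊛ x5 ⊕ con 2 ⊕ x6)) h5 ∷ []) refl

arith-55 : ∀ d n₁ L i → d + n₁ < L → i + d + n₁ < i + L
arith-55 d n₁ L i h1 = linear (d ∷ n₁ ∷ L ∷ i ∷ []) 0 (con 1 ⊕ (x3 ⊕ x0 ⊕ x1)) (x3 ⊕ x2)
    (hyp (con 1) (con 1 ⊕ (x0 ⊕ x1)) x2 h1 ∷ []) refl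

arith-56 : ∀ n₁ → n₁ + n₁ + 2 ≡ 2 * suc n₁
arith-56 n₁ = ≤-antisym (linear (n₁ ∷ []) 0 (x0 ⊕ x0 ⊕ con 2) (con 2 ⊛ (con 1 ⊕ x0)) [] refl)
    (linear (n₁ ∷ []) 0 (con 2 ⊛ (con 1 ⊕ x0)) (x0 ⊕ x0 ⊕ con 2) [] refl)

arith-57 : ∀ n₁ i d → n₁ + i + d ≡ i + d + n₁
arith-57 n₁ i d = ≤-antisym (linear (n₁ ∷ i ∷ d ∷ []) 0 (x0 ⊕ x1 ⊕ x2) (x1 ⊕ x2 ⊕ x0) [] refl)
    (linear (n₁ ∷ i ∷ d ∷ []) 0 (x1 ⊕ x2 ⊕ x0) (x0 ⊕ x1 ⊕ x2) [] refl)

arith-58 : ∀ i n₁ d → i + 2 * n₁ < i + (suc d + 2 * n₁)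
arith-58 i n₁ d = linear (i ∷ n₁ ∷ d ∷ []) 0 (con 1 ⊕ (x0 ⊕ con 2 ⊛ x1)) (x0 ⊕ (con 1 ⊕ x2 ⊕ con 2 ⊛ x1))
    [] refl

arith-59 : ∀ n₁ d L i → 3 * n₁ + suc d < L → i + (suc d + 2 * n₁) + 0 < i + L
arith-59 n₁ d L i h1 = linear (n₁ ∷ d ∷ L ∷ i ∷ []) 0 (con 1 ⊕ (x3 ⊕ (con 1 ⊕ x1 ⊕ con 2 ⊛ x0) ⊕ con 0)) (x3 ⊕ x2)
    (hyp (con 1) (con 1 ⊕ (con 3 ⊛ x0 ⊕ (con 1 ⊕ x1))) x2 h1 ∷ []) refl

arith-60 : ∀ n₁ → 2 * n₁ + 0 + 2 ≡ 2 * suc n₁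
arith-60 n₁ = ≤-antisym (linear (n₁ ∷ []) 0 (con 2 ⊛ x0 ⊕ con 0 ⊕ con 2) (con 2 ⊛ (con 1 ⊕ x0)) [] refl)
    (linear (n₁ ∷ []) 0 (con 2 ⊛ (con 1 ⊕ x0)) (con 2 ⊛ x0 ⊕ con 0 ⊕ con 2) [] refl)

arith-61 : ∀ n₁ i d → 2 * n₁ + i + suc d ≡ i + (suc d + 2 * n₁) + 0
arith-61 n₁ i d = ≤-antisym (linear (n₁ ∷ i ∷ d ∷ []) 0 (con 2 ⊛ x0 ⊕ x1 ⊕ (con 1 ⊕ x2))
    (x1 ⊕ (con 1 ⊕ x2 ⊕ con 2 ⊛ x0) ⊕ con 0)
    [] refl) (linear (n₁ ∷ i ∷ d ∷ []) 0 (x1 ⊕ (con 1 ⊕ x2 ⊕ con 2 ⊛ x0) ⊕ con 0) (con 2 ⊛ x0 ⊕ x1 ⊕ (con 1 ⊕ x2))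
    [] refl)

arith-62 : ∀ n₁ d L i → 3 * n₁ + suc d < L → i + (suc d + 2 * n₁) + n₁ < i + L
arith-62 n₁ d L i h1 = linear (n₁ ∷ d ∷ L ∷ i ∷ []) 0 (con 1 ⊕ (x3 ⊕ (con 1 ⊕ x1 ⊕ con 2 ⊛ x0) ⊕ x0)) (x3 ⊕ x2)
    (hyp (con 1) (con 1 ⊕ (con 3 ⊛ x0 ⊕ (con 1 ⊕ x1))) x2 h1 ∷ []) refl

arith-63 : ∀ n₁ i d → n₁ + i + (suc d + 2 * n₁) ≡ i + (suc d + 2 * n₁) + n₁
arith-63 n₁ i d = ≤-antisym (linear (n₁ ∷ i ∷ d ∷ []) 0 (x0 ⊕ x1 ⊕ (con 1 ⊕ x2 ⊕ con 2 ⊛ x0))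
    (x1 ⊕ (con 1 ⊕ x2 ⊕ con 2 ⊛ x0) ⊕ x0)
    [] refl) (linear (n₁ ∷ i ∷ d ∷ []) 0 (x1 ⊕ (con 1 ⊕ x2 ⊕ con 2 ⊛ x0) ⊕ x0) (x0 ⊕ x1 ⊕ (con 1 ⊕ x2 ⊕ con 2 ⊛ x0))
    [] refl)

arith-64 : ∀ n₁ i d → n₁ + i + n₁ < i + (suc d + 2 * n₁)
arith-64 n₁ i d = linear (n₁ ∷ i ∷ d ∷ []) 0 (con 1 ⊕ (x0 ⊕ x1 ⊕ x0)) (x1 ⊕ (con 1 ⊕ x2 ⊕ con 2 ⊛ x0))
    [] refl

arith-65 : ∀ n₁ d L i → 3 * n₁ + suc d < L → i + (suc d + 2 * n₁) + n₁ < n₁ + i + L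
arith-65 n₁ d L i h1 = linear (n₁ ∷ d ∷ L ∷ i ∷ []) 0 (con 1 ⊕ (x3 ⊕ (con 1 ⊕ x1 ⊕ con 2 ⊛ x0) ⊕ x0)) (x0 ⊕ x3 ⊕ x2)
    (hyp (con 1) (con 1 ⊕ (con 3 ⊛ x0 ⊕ (con 1 ⊕ x1))) x2 h1 ∷ []) refl

arith-66 : ∀ n₁ i → 2 * n₁ + i ≡ n₁ + i + n₁
arith-66 n₁ i = ≤-antisym (linear (n₁ ∷ i ∷ []) 0 (con 2 ⊛ x0 ⊕ x1) (x0 ⊕ x1 ⊕ x0) [] refl)
    (linear (n₁ ∷ i ∷ []) 0 (x0 ⊕ x1 ⊕ x0) (con 2 ⊛ x0 ⊕ x1) [] refl)

arith-67 : ∀ n₁ i d → 2 * n₁ + i + suc d ≡ i + (suc d + 2 * n₁)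
arith-67 n₁ i d = ≤-antisym (linear (n₁ ∷ i ∷ d ∷ []) 0 (con 2 ⊛ x0 ⊕ x1 ⊕ (con 1 ⊕ x2))
    (x1 ⊕ (con 1 ⊕ x2 ⊕ con 2 ⊛ x0))
    [] refl) (linear (n₁ ∷ i ∷ d ∷ []) 0 (x1 ⊕ (con 1 ⊕ x2 ⊕ con 2 ⊛ x0)) (con 2 ⊛ x0 ⊕ x1 ⊕ (con 1 ⊕ x2))
    [] refl)

arith-68 : ∀ n₁ g → 6 * n₁ + 4 + g ≡ suc (3 * n₁ + 1 + suc g + (3 * n₁ + 1))
arith-68 n₁ g = ≤-antisym (linear (n₁ ∷ g ∷ []) 0 (con 6 ⊛ x0 ⊕ con 4 ⊕ x1)
    (con 1 ⊕ (con 3 ⊛ x0 ⊕ con 1 ⊕ (con 1 ⊕ x1) ⊕ (con 3 ⊛ x0 ⊕ con 1)))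
    [] refl) (linear (n₁ ∷ g ∷ []) 0 (con 1 ⊕ (con 3 ⊛ x0 ⊕ con 1 ⊕ (con 1 ⊕ x1) ⊕ (con 3 ⊛ x0 ⊕ con 1)))
        (con 6 ⊛ x0 ⊕ con 4 ⊕ x1)
    [] refl)

arith-69 : ∀ n₁ g → 1 + (3 * n₁ + 1 + suc g) + 1 + (3 * n₁ + 1) ≡ suc (6 * n₁ + 4 + g)
arith-69 n₁ g = ≤-antisym (linear (n₁ ∷ g ∷ []) 0 (con 1 ⊕ (con 3 ⊛ x0 ⊕ con 1 ⊕ (con 1 ⊕ x1)) ⊕ con 1 ⊕
    (con 3 ⊛ x0 ⊕ con 1)) (con 1 ⊕ (con 6 ⊛ x0 ⊕ con 4 ⊕ x1))
    [] refl) (linear (n₁ ∷ g ∷ []) 0 (con 1 ⊕ (con 6 ⊛ x0 ⊕ con 4 ⊕ x1))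
        (con 1 ⊕ (con 3 ⊛ x0 ⊕ con 1 ⊕ (con 1 ⊕ x1)) ⊕ con 1 ⊕ (con 3 ⊛ x0 ⊕ con 1))
    [] refl)

arith-70 : ∀ n₁ g → 3 * n₁ + 2 ≤ 6 * n₁ + 4 + g
arith-70 n₁ g = linear (n₁ ∷ g ∷ []) 0 (con 3 ⊛ x0 ⊕ con 2) (con 6 ⊛ x0 ⊕ con 4 ⊕ x1) [] refl

arith-71 : ∀ n₁ → 1 + (3 * n₁ + 1) ≡ 3 * n₁ + 2
arith-71 n₁ = ≤-antisym (linear (n₁ ∷ []) 0 (con 1 ⊕ (con 3 ⊛ x0 ⊕ con 1)) (con 3 ⊛ x0 ⊕ con 2) [] refl)
    (linear (n₁ ∷ []) 0 (con 3 ⊛ x0 ⊕ con 2) (con 1 ⊕ (con 3 ⊛ x0 ⊕ con 1)) [] refl)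

arith-72 : ∀ v1 v2 v3 v4 v5 v6 n₁ g v7 v8 → v1 ≡ v2 → v2 ≡ v3 + v4 → v3 ≡ v5 + v6 → v4 ≡ v5 → v5 ≤ suc n₁ *
    (6 * n₁ + 4 + g) → v6 ≡ v7 → v7 + v8 + v7 ≤ suc g * (6 * n₁ + 4 + g) → 2 * v7 ≤ 2 * v8 + 2 * n₁ *
    (6 * n₁ + 4 + g) → 3 * v1 ≤ (6 * n₁ + 4 + g) * (6 * n₁ + 4 + g + suc n₁ + 2)
arith-72 v1 v2 v3 v4 v5 v6 n₁ g v7 v8 h1 h2 h3 h4 h5 h6 h7 h8 =
    linear (v1 ∷ v2 ∷ v3 ∷ v4 ∷ v5 ∷ v6 ∷ n₁ ∷ g ∷ v7 ∷ v8 ∷ []) 1 (con 3 ⊛ x0)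
    ((con 6 ⊛ x6 ⊕ con 4 ⊕ x7) ⊛ (con 6 ⊛ x6 ⊕ con 4 ⊕ x7 ⊕ (con 1 ⊕ x6) ⊕ con 2))
    (equ (con 6) x0 x1 h1 ∷ equ (con 6) x1 (x2 ⊕ x3) h2 ∷ equ (con 6) x2 (x4 ⊕ x5) h3 ∷ equ (con 6) x3 x4 h4 ∷
    hyp (con 12) x4 ((con 1 ⊕ x6) ⊛ (con 6 ⊛ x6 ⊕ con 4 ⊕ x7)) h5 ∷ equ (con 6) x5 x8 h6 ∷
    hyp (con 2) (x8 ⊕ x9 ⊕ x8) ((con 1 ⊕ x7) ⊛ (con 6 ⊛ x6 ⊕ con 4 ⊕ x7)) h7 ∷
    hyp (con 1) (con 2 ⊛ x8) (con 2 ⊛ x9 ⊕ con 2 ⊛ x6 ⊛ (con 6 ⊛ x6 ⊕ con 4 ⊕ x7)) h8 ∷ []) refl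

arith-73 : ∀ n₁ j → 3 * n₁ + 2 + j ≡ suc (n₁ + 1 + j) + 2 * n₁
arith-73 n₁ j = ≤-antisym (linear (n₁ ∷ j ∷ []) 0 (con 3 ⊛ x0 ⊕ con 2 ⊕ x1) (con 1 ⊕ (x0 ⊕ con 1 ⊕ x1) ⊕ con 2 ⊛ x0)
    [] refl) (linear (n₁ ∷ j ∷ []) 0 (con 1 ⊕ (x0 ⊕ con 1 ⊕ x1) ⊕ con 2 ⊛ x0) (con 3 ⊛ x0 ⊕ con 2 ⊕ x1)
    [] refl)

arith-74 : ∀ n₁ j → n₁ + 2 + j ≡ suc (n₁ + 1 + j)
arith-74 n₁ j = ≤-antisym (linear (n₁ ∷ j ∷ []) 0 (x0 ⊕ con 2 ⊕ x1) (con 1 ⊕ (x0 ⊕ con 1 ⊕ x1)) [] refl)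
    (linear (n₁ ∷ j ∷ []) 0 (con 1 ⊕ (x0 ⊕ con 1 ⊕ x1)) (x0 ⊕ con 2 ⊕ x1) [] refl)

arith-75 : ∀ j g n₁ → j < suc g → 1 ≤ n₁ → 3 * n₁ + suc (n₁ + 1 + j) < 6 * n₁ + 4 + g
arith-75 j g n₁ h1 h2 = linear (j ∷ g ∷ n₁ ∷ []) 0 (con 1 ⊕ (con 3 ⊛ x2 ⊕ (con 1 ⊕ (x2 ⊕ con 1 ⊕ x0))))
    (con 6 ⊛ x2 ⊕ con 4 ⊕ x1)
    (hyp (con 1) (con 1 ⊕ x0) (con 1 ⊕ x1) h1 ∷ []) refl

arith-76 : ∀ n₁ g j → n₁ < n₁ + 2 + suc g + j
arith-76 n₁ g j = linear (n₁ ∷ g ∷ j ∷ []) 0 (con 1 ⊕ x0) (x0 ⊕ con 2 ⊕ (con 1 ⊕ x1) ⊕ x2) [] refl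

arith-77 : ∀ j n₁ g → j < 2 * n₁ → n₁ + 2 + suc g + j + n₁ < 6 * n₁ + 4 + g
arith-77 j n₁ g h1 = linear (j ∷ n₁ ∷ g ∷ []) 0 (con 1 ⊕ (x1 ⊕ con 2 ⊕ (con 1 ⊕ x2) ⊕ x0 ⊕ x1))
    (con 6 ⊛ x1 ⊕ con 4 ⊕ x2)
    (hyp (con 1) (con 1 ⊕ x0) (con 2 ⊛ x1) h1 ∷ []) refl

arith-78 : ∀ n₁ → n₁ + 2 + 2 * n₁ ≡ 3 * n₁ + 2
arith-78 n₁ = ≤-antisym (linear (n₁ ∷ []) 0 (x0 ⊕ con 2 ⊕ con 2 ⊛ x0) (con 3 ⊛ x0 ⊕ con 2) [] refl)
    (linear (n₁ ∷ []) 0 (con 3 ⊛ x0 ⊕ con 2) (x0 ⊕ con 2 ⊕ con 2 ⊛ x0) [] refl)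

arith-79 : ∀ v1 v2 v3 v4 v5 v6 v7 n₁ g → v1 ≡ v2 + v3 → v3 ≡ v4 → v1 ≡ v5 → v5 ≡ v6 + v7 → 2 * v7 ≤ 2 * n₁ *
    (6 * n₁ + 4 + g) → 2 * v4 ≤ 2 * v6 + 2 * n₁ * (6 * n₁ + 4 + g)
arith-79 v1 v2 v3 v4 v5 v6 v7 n₁ g h1 h2 h3 h4 h5 = linear (v1 ∷ v2 ∷ v3 ∷ v4 ∷ v5 ∷ v6 ∷ v7 ∷ n₁ ∷ g ∷ []) 0
    (con 2 ⊛ x3) (con 2 ⊛ x5 ⊕ con 2 ⊛ x7 ⊛ (con 6 ⊛ x7 ⊕ con 4 ⊕ x8))
    (equ (con 2) (x1 ⊕ x2) x0 (sym h1) ∷ equ (con 2) x3 x2 (sym h2) ∷ equ (con 2) x0 x4 h3 ∷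
    equ (con 2) x4 (x5 ⊕ x6) h4 ∷ hyp (con 1) (con 2 ⊛ x6) (con 2 ⊛ x7 ⊛ (con 6 ⊛ x7 ⊕ con 4 ⊕ x8)) h5 ∷ []) refl

module Chords (G : SimpleGraph) where

  open GraphTheory G

  -- From here on `n₁` is n - 1, which keeps the arithmetic free of subtraction. Chords of span d
  -- join positions `i` and `i + d` of the circuit.
  module _ {L : ℕ} (C : Circuit L) (n₁ : ℕ) (1≤n₁ : 1 ≤ n₁) where

    open Arcs C

    private
      n = suc n₁

    module _ (free : ∀ {xs} → Cycle xs → xs ⊆ verts → length xs ≢ 2 * n) where

      private
        -- The path `ys` runs through the second arc in one direction or the other. With the first
        -- arc it forms a cycle on `suc p` plus `suc q` vertices.
        two-arcs : ∀ x y p q {s t ys} → x + p < y → y + q < x + L → p + q + 2 ≡ 2 * n →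
          Path s t ys → ys ↭ arc y (suc q) → c (x + p) ~ s → t ~ c x → ⊥
        two-arcs x y p q {s} {t} {ys} h₁ h₂ eq path perm h₃ h₄ = free cycle sub len
          where
          zs = arc x (suc p) ++ ys
          len : length zs ≡ 2 * n
          len = arith-12 (length zs) (length (arc x (suc p))) (length ys) p (length (arc y (suc q))) q n₁
              (length-++ (arc x (suc p))) (arc-length x (suc p)) (Perm.↭-length perm) (arc-length y (suc q))
              eq
          unique : Unique zs
          unique = Unique-↭ (Perm.++⁺ˡ (arc x (suc p)) (↭-sym perm))
            (Unique.++⁺ (arc-unique x (suc p) (arith-13 x p y q L h₁ h₂))
              (arc-unique y (suc q) (arith-14 x p y q L h₁ h₂))
              (λ (v∈ , v∈′) → arcs-disjoint {x} {y} (arith-15 x p y h₁) (arith-16 y q x L h₂) v∈ v∈′))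
          cycle : Cycle zs
          cycle = mkCycle (Path-++ (arc-path x p) h₃ path) h₄ unique
            (arith-17 (length zs) n₁ len 1≤n₁)
          sub : zs ⊆ verts
          sub v∈ with ∈-++⁻ (arc x (suc p)) v∈
          ... | inj₁ v∈′ = arc-⊆ {x} v∈′
          ... | inj₂ v∈′ = arc-⊆ {y} (Perm.∈-resp-↭ perm v∈′)

      -- The cycle runs forwards along the first arc and backwards along the second. For `p = 0` the
      -- first arc is the single vertex `c x`, at which both chords end.
      crossing : ∀ x y p q → x + p < y → y + q < x + L → p + q + 2 ≡ 2 * n →
        c x ~ c y → c (x + p) ~ c (y + q) → ⊥
      crossing x y p q h₁ h₂ eq h₃ h₄ =
        two-arcs x y p q h₁ h₂ eq (Path-reverse (arc-path y q)) (Perm.↭-reverse _) h₄ (~-sym h₃)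

      -- Of two chords that do not cross, one leads from the end of the first arc to the start of
      -- the second, so here the second arc is run forwards.
      nested : ∀ x y p q → x + p < y → y + q < x + L → p + q + 2 ≡ 2 * n →
        c (x + p) ~ c y → c x ~ c (y + q) → ⊥
      nested x y p q h₁ h₂ eq h₃ h₄ = two-arcs x y p q h₁ h₂ eq (arc-path y q) ↭-refl h₃ (~-sym h₄)

      -- the number of chords of span d (each chord counted once for d < L / 2)
      D : ℕ → ℕ
      D d = ∑ L (λ i → ⟦ E (c i) (c (i + d)) ⟧)

      D-≤L : ∀ d → D d ≤ L
      D-≤L d = ≤-trans (∑-≤const L 1 (λ i _ → ⟦⟧≤1 (E (c i) (c (i + d))))) (≤-reflexive (*-identityʳ L))

      D-0 : D 0 ≡ 0
      D-0 = trans (∑-cong L (λ i _ → trans (cong (λ v → ⟦ E (c i) (c v) ⟧) (+-identityʳ i))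
          (cong ⟦_⟧ (E-irrefl (c i)))))
        (trans (∑-const L 0) (*-zeroʳ L))

      D-shift : ∀ k d → ∑ L (λ i → ⟦ E (c (k + i)) (c (k + i + d)) ⟧) ≡ D d
      D-shift k d = ∑-shift {f = λ i → ⟦ E (c i) (c (i + d)) ⟧} (λ i → cong ⟦_⟧ (cong₂ E (periodic i)
        (trans (cong c (arith-18 i L d)) (periodic (i + d))))) k

      -- Seen from its other end, a chord of span `d` has span `d′`.
      D-mirror : ∀ d d′ → d + d′ ≡ L → D d ≡ D d′
      D-mirror d d′ eq = trans (∑-cong L (λ i _ → cong ⟦_⟧ (trans (E-sym _ _) (cong₂ E (cong c (+-comm i d))
        (sym (trans (cong c (arith-19 d d′ L i eq)) (periodic i))))))) (D-shift d d′)

      -- A forbidden pair of chords remains forbidden under all `L` rotations of the circuit, and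
      -- each rotation admits at most one of the two. The offsets `α` and `β` are the starts of the
      -- two chords within the pattern.
      D-excl : ∀ α β d d′ → (∀ i → c (α + i) ~ c (α + i + d) → c (β + i) ~ c (β + i + d′) → ⊥) → D d + D d′ ≤ L
      D-excl α β d d′ h = ≤-trans (≤-reflexive (cong₂ _+_ (sym (D-shift α d)) (sym (D-shift β d′))))
        (≤-trans (∑-pair≤ L 1 (λ i → ⟦ E (c (α + i)) (c (α + i + d)) ⟧) (λ i → ⟦ E (c (β + i)) (c (β + i + d′)) ⟧)
          (λ i _ → bool-excl (h i))) (≤-reflexive (*-identityʳ L)))

      D-excl₃ : ∀ α β γ d d′ d″ → (∀ i → c (α + i) ~ c (α + i + d) → c (β + i) ~ c (β + i + d′) → ⊥) →
        (∀ i → c (α + i) ~ c (α + i + d) → c (γ + i) ~ c (γ + i + d″) → ⊥) →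
        (∀ i → c (β + i) ~ c (β + i + d′) → c (γ + i) ~ c (γ + i + d″) → ⊥) → D d + D d′ + D d″ ≤ L
      D-excl₃ α β γ d d′ d″ h₁ h₂ h₃ = ≤-trans (≤-reflexive
          (cong₂ _+_ (cong₂ _+_ (sym (D-shift α d)) (sym (D-shift β d′))) (sym (D-shift γ d″))))
        (≤-trans (∑-triple≤ L 1 (λ i → ⟦ E (c (α + i)) (c (α + i + d)) ⟧) (λ i → ⟦ E (c (β + i)) (c (β + i + d′)) ⟧)
          (λ i → ⟦ E (c (γ + i)) (c (γ + i + d″)) ⟧) (λ i _ → bool-excl₃ (h₁ i) (h₂ i) (h₃ i)))
              (≤-reflexive (*-identityʳ L)))

      spans : ℕ → ℕ → ℕ
      spans a k = ∑ k (λ j → D (a + j))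

      S-split : ∀ a k m → spans a (k + m) ≡ spans a k + spans (a + k) m
      S-split a k m = trans (∑-split k m (λ j → D (a + j)))
        (cong (spans a k +_) (∑-cong m (λ j _ → cong D (sym (+-assoc a k j)))))

      S-mono : ∀ a {k m} → k ≤ m → spans a k ≤ spans a m
      S-mono a = ∑-extend (λ j → D (a + j))

      S-mirror : ∀ a b k → a + b + k ≡ suc L → spans a k ≡ spans b k
      S-mirror a b k eq = trans (∑-cong k (λ j j<k → D-mirror (a + j) (b + (k ∸ suc j))
          (arith-20 a b k L j (k ∸ suc j) eq (m+[n∸m]≡n j<k))))
        (∑-reverse k (λ j → D (b + j)))

      -- The ordered pairs of vertices of the circuit are sorted by the number of steps from the
      -- first to the second.
      ee-verts : ∀ {L₁} → L ≡ suc L₁ → ee verts ≡ spans 1 L₁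
      ee-verts {L₁} refl = begin
        ee verts
          ≡⟨ Σl-applyUpTo c L (λ x → deg x verts) ⟩
        ∑ L (λ i → deg (c i) verts)
          ≡⟨ ∑-cong L (λ i _ → sym (∑-rotate (λ y → ⟦ E (c i) y ⟧) i)) ⟩
        ∑ L (λ i → ∑ L (λ d → ⟦ E (c i) (c (i + d)) ⟧))
          ≡⟨ ∑-swap L L (λ i d → ⟦ E (c i) (c (i + d)) ⟧) ⟩
        D 0 + spans 1 L₁
          ≡⟨ cong (_+ spans 1 L₁) D-0 ⟩
        spans 1 L₁ ∎
        where open ≡-Reasoning

      -- The two spans add up to 2n. Chords starting at `i` and at `i + v` overlap in a single step
      -- of the circuit, so the arc between their starts and the arc between their ends have 2n
      -- vertices in all.
      window : 2 * n ≤ L → ∀ u v → u + v ≡ 2 * n₁ → D (suc u) + D (suc v) ≤ L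
      window 2n≤L u v eq = ≤-trans (≤-reflexive (+-comm (D (suc u)) _)) (D-excl 0 v (suc v) (suc u) (λ i h₁ h₂ →
        crossing i (i + suc v) v u (arith-21 i v) (arith-22 u v n₁ L i eq 2n≤L)
          (arith-23 u v n₁ eq) h₁
          (subst₂ (λ s t → c s ~ c t) (+-comm v i) (arith-24 v i u) h₂)))

      -- Both chords start at `c i`, and their other ends are `2 * n₁` steps apart: the arc between
      -- these closes through `c i` to a cycle of length 2n.
      star : ∀ u → suc u + 2 * n₁ < L → D (suc u) + D (suc u + 2 * n₁) ≤ L
      star u lt = D-excl 0 0 (suc u) (suc u + 2 * n₁) (λ i h₁ h₂ →
        crossing i (i + suc u) 0 (2 * n₁) (arith-25 i u) (arith-26 u n₁ L i lt) (arith-27 n₁) h₁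
          (subst₂ (λ s t → c s ~ c t) (sym (+-identityʳ i)) (sym (+-assoc i (suc u) _)) h₂))

      -- Bondy: the windows and the stars together meet every chord twice.
      edges-quadratic : 2 * n ≤ L → 2 * ee verts ≤ L * L
      edges-quadratic 2n≤L with m≤n⇒∃[o]m+o≡n 2n≤L
      ... | k , refl = arith-30 (ee verts) (spans 1 (suc (2 * n₁) + k)) (spans 1 (suc (2 * n₁)))
          (spans (suc (suc (2 * n₁))) k) n₁ k (spans 1 (suc k)) (spans (suc (2 * n₁)) (suc k))
          (spans (suc (2 * n₁)) 1) (spans (suc (2 * n₁) + 1) k) (ee-verts {suc (2 * n₁) + k} (arith-28 n₁ k))
          (S-split 1 (suc (2 * n₁)) k) windows stars (S-mirror 1 (suc (2 * n₁)) (suc k) (arith-29 n₁ k))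
          (S-split (suc (2 * n₁)) 1 k) (cong (λ a → spans a k) (+-comm (suc (2 * n₁)) 1))
        where
        windows : 2 * spans 1 (suc (2 * n₁)) ≤ suc (2 * n₁) * L
        windows = ≤-trans (≤-reflexive (cong (spans 1 (suc (2 * n₁)) +_) (trans (+-identityʳ _)
            (sym (∑-reverse (suc (2 * n₁)) (D ∘ suc))))))
          (∑-pair≤ (suc (2 * n₁)) L (D ∘ suc) (λ j → D (suc (2 * n₁ ∸ j)))
              (λ j j< → window 2n≤L j (2 * n₁ ∸ j) (m+[n∸m]≡n (≤-pred j<))))
        -- The two intervals of `suc k` spans are mirror images of each other, so this bounds twice
        -- the second sum.
        stars : spans 1 (suc k) + spans (suc (2 * n₁)) (suc k) ≤ suc k * L
        stars = ∑-pair≤ (suc k) L (D ∘ suc) (λ j → D (suc (2 * n₁) + j)) (λ j j< →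
          ≤-trans (≤-reflexive (cong (λ d → D (suc j) + D d) (arith-31 n₁ j)))
            (star j (arith-32 j k n₁ j<)))

      -- the three chords (0, 2n-u), (2n-1-u, 2n-1), (n-u, 3n-2) pairwise close a cycle of length 2n
      triple : 3 * n₁ + 2 ≤ L → ∀ u w → u + w ≡ n₁ → D (suc u + 2 * w) + D (suc u) + D (3 * u + 1 + 2 * w) ≤ L
      triple bound u w refl = D-excl₃ 0 (u + 2 * w) w _ _ _
        (λ i h₁ h₂ → crossing i (i + (suc u + 2 * w)) (u + 2 * w) u (arith-33 i u w)
           (arith-34 u w L i bound) (arith-35 u w) h₁
           (subst₂ (λ s t → c s ~ c t) (+-comm _ i) (arith-36 u w i) h₂))
        (λ i h₁ h₂ → crossing i (i + (suc u + 2 * w)) w (2 * u + w) (arith-37 i w u)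
           (arith-38 u w L i bound) (arith-39 w u) h₁
           (subst₂ (λ s t → c s ~ c t) (+-comm _ i) (arith-40 w i u) h₂))
        (λ i h₁ h₂ → nested (w + i) (u + 2 * w + i + suc u) (u + w) (u + w) (arith-41 w i u)
           (arith-42 u w L i bound) (arith-43 u w)
           (subst (λ s → c s ~ c (u + 2 * w + i + suc u)) (arith-44 u w i) h₁)
           (subst (λ t → c (w + i) ~ c t) (arith-45 w i u) h₂))

      -- As `u` runs from 0 to `n₁`, the spans in `triple` run through the intervals from 1 to n,
      -- from 2n - 1 down to n, and from 2n - 1 to 3n - 2.
      triples : 3 * n₁ + 2 ≤ L → spans 1 n + spans n n + spans (suc (2 * n₁)) n ≤ n * L
      triples bound = ≤-trans (≤-reflexive (cong (λ t → spans 1 n + t + spans (suc (2 * n₁)) n)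
          (sym (∑-reverse n (λ j → D (n + j))))))
        (∑-triple≤ n L (D ∘ suc) (λ j → D (n + (n ∸ suc j))) (λ j → D (suc (2 * n₁) + j))
          (λ u u<n → ≤-trans (≤-reflexive (cong₂ _+_ (trans (+-comm (D (suc u)) _) (cong (_+ D (suc u))
            (cong D (arith-46 u (n₁ ∸ u) n₁ (m+[n∸m]≡n (≤-pred u<n))))))
            (cong D (arith-47 u (n₁ ∸ u) n₁ (m+[n∸m]≡n (≤-pred u<n))))))
          (triple bound u (n₁ ∸ u) (m+[n∸m]≡n (≤-pred u<n)))))

      -- The three intervals of `triples` cover all spans up to 3n - 2, which is `3 * n₁ + 1`; the
      -- spans n and 2n - 1, counted twice there, are dropped once.
      short-chords : 3 * n₁ + 2 ≤ L → spans 1 (3 * n₁ + 1) ≤ n * L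
      short-chords bound = ≤-trans (arith-48 (spans 1 (3 * n₁ + 1)) (spans 1 n) (spans (suc n) n₁)
          (spans (suc (suc (2 * n₁))) n₁) (spans n n) (spans n 1) (spans (n + 1) n₁) (spans (suc (2 * n₁)) n)
          (spans (suc (2 * n₁)) 1) (spans (suc (2 * n₁) + 1) n₁) split (S-split n 1 n₁)
          (cong (λ a → spans a n₁) (+-comm n 1)) (S-split (suc (2 * n₁)) 1 n₁)
          (cong (λ a → spans a n₁) (+-comm (suc (2 * n₁)) 1))) (triples bound)
        where
        split : spans 1 (3 * n₁ + 1) ≡ spans 1 n + spans (suc n) n₁ + spans (suc (suc (2 * n₁))) n₁
        split = begin
          spans 1 (3 * n₁ + 1)                                 ≡⟨ cong (spans 1) (arith-49 n₁) ⟩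
          spans 1 (n + n₁ + n₁)                                ≡⟨ S-split 1 (n + n₁) n₁ ⟩
          spans 1 (n + n₁) + spans (1 + (n + n₁)) n₁               ≡⟨ cong₂ _+_ (S-split 1 n n₁)
              (cong (λ a → spans a n₁) (arith-50 n₁)) ⟩
          spans 1 n + spans (suc n) n₁ + spans (suc (suc (2 * n₁))) n₁ ∎
          where open ≡-Reasoning

      -- The upper bound on `L` makes the `g` spans beyond `3 * n₁ + 1` the mirror images of spans
      -- that do not exceed `3 * n₁ + 1`, so `short-chords` counts twice.
      edges-linear : 3 * n₁ + 2 ≤ L → L ≤ 6 * n₁ + 3 → ee verts ≤ 2 * n * L
      edges-linear bound upper with m≤n⇒∃[o]m+o≡n bound
      ... | g , refl = arith-54 (ee verts) (spans 1 (3 * n₁ + 1 + g)) (spans 1 (3 * n₁ + 1))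
          (spans (1 + (3 * n₁ + 1)) g) (spans 1 g) n₁ g (ee-verts {3 * n₁ + 1 + g} (arith-51 n₁ g))
          (S-split 1 (3 * n₁ + 1) g) (S-mirror (1 + (3 * n₁ + 1)) 1 g (arith-52 n₁ g))
          (S-mono 1 (arith-53 n₁ g upper)) (short-chords bound)

      -- A chord crosses its own rotation by `n₁` steps; the arcs between the starts and between the
      -- ends have n vertices each.
      rotation : ∀ d → n₁ < d → d + n₁ < L → D d + D d ≤ L
      rotation d n₁<d lt = D-excl 0 n₁ d d (λ i h₁ h₂ → crossing i (i + d) n₁ n₁ (+-monoʳ-< i n₁<d)
        (arith-55 d n₁ L i lt) (arith-56 n₁) h₁
        (subst₂ (λ s t → c s ~ c t) (+-comm n₁ i) (arith-57 n₁ i d) h₂))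

      -- the chords (i, j), (i+2n-2, j), (i+n-1, j+n-1)
      long-triple : ∀ d → 3 * n₁ + suc d < L → D (suc d + 2 * n₁) + D (suc d) + D (suc d + 2 * n₁) ≤ L
      long-triple d lt = D-excl₃ 0 (2 * n₁) n₁ _ _ _
        (λ i h₁ h₂ → crossing i (i + (suc d + 2 * n₁)) (2 * n₁) 0 (arith-58 i n₁ d)
           (arith-59 n₁ d L i lt) (arith-60 n₁) h₁
           (subst₂ (λ s t → c s ~ c t) (+-comm _ i) (arith-61 n₁ i d) h₂))
        (λ i h₁ h₂ → crossing i (i + (suc d + 2 * n₁)) n₁ n₁ (arith-37 i n₁ d)
           (arith-62 n₁ d L i lt) (arith-56 n₁) h₁
           (subst₂ (λ s t → c s ~ c t) (+-comm _ i) (arith-63 n₁ i d) h₂))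
        (λ i h₁ h₂ → nested (n₁ + i) (i + (suc d + 2 * n₁)) n₁ n₁ (arith-64 n₁ i d)
           (arith-65 n₁ d L i lt) (arith-56 n₁)
           (subst₂ (λ s t → c s ~ c t) (arith-66 n₁ i) (arith-67 n₁ i d) h₁)
           (subst (λ t → c (n₁ + i) ~ c t) (arith-63 n₁ i d) h₂))

      -- Between the short spans and their mirror images lie `suc g` spans d, for which
      -- `long-triple` bounds 2 D(d) + D(d - 2n₁). Shifting this interval of spans by 2n₁ affects
      -- the sum only near the ends, and there `rotation` bounds each D by L/2. The gain over
      -- `edges-quadratic` is a leading term L²/3 in place of L²/2.
      edges-long : 6 * n₁ + 4 ≤ L → 3 * ee verts ≤ L * (L + n + 2)
      edges-long bound with m≤n⇒∃[o]m+o≡n bound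
      ... | g , refl = arith-72 (ee verts) (spans 1 (3 * n₁ + 1 + suc g + (3 * n₁ + 1)))
          (spans 1 (3 * n₁ + 1 + suc g)) (spans (1 + (3 * n₁ + 1 + suc g)) (3 * n₁ + 1))
          (spans 1 (3 * n₁ + 1)) (spans (1 + (3 * n₁ + 1)) (suc g)) n₁ g (spans (3 * n₁ + 2) (suc g))
          (spans (n₁ + 2) (suc g)) (ee-verts {3 * n₁ + 1 + suc g + (3 * n₁ + 1)} (arith-68 n₁ g))
          (S-split 1 (3 * n₁ + 1 + suc g) (3 * n₁ + 1)) (S-split 1 (3 * n₁ + 1) (suc g))
          (S-mirror (1 + (3 * n₁ + 1 + suc g)) 1 (3 * n₁ + 1) (arith-69 n₁ g)) (short-chords (arith-70 n₁ g))
          (cong (λ a → spans a (suc g)) (arith-71 n₁)) middle₁ middle₂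
        where
        middle₁ : spans (3 * n₁ + 2) (suc g) + spans (n₁ + 2) (suc g) + spans (3 * n₁ + 2) (suc g) ≤ suc g * L
        middle₁ = ∑-triple≤ (suc g) L (λ j → D (3 * n₁ + 2 + j)) (λ j → D (n₁ + 2 + j)) (λ j → D (3 * n₁ + 2 + j))
          (λ j j< → ≤-trans (≤-reflexive (cong₂ _+_ (cong₂ _+_
              (cong D (arith-73 n₁ j)) (cong D (arith-74 n₁ j)))
              (cong D (arith-73 n₁ j))))
            (long-triple (n₁ + 1 + j) (arith-75 j g n₁ j< 1≤n₁)))
        tail : 2 * spans (n₁ + 2 + suc g) (2 * n₁) ≤ 2 * n₁ * L
        tail = ≤-trans (≤-reflexive (cong (spans (n₁ + 2 + suc g) (2 * n₁) +_) (+-identityʳ _)))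
          (∑-pair≤ (2 * n₁) L (λ j → D (n₁ + 2 + suc g + j)) (λ j → D (n₁ + 2 + suc g + j))
            (λ j j< → rotation (n₁ + 2 + suc g + j) (arith-76 n₁ g j)
              (arith-77 j n₁ g j<)))
        middle₂ : 2 * spans (3 * n₁ + 2) (suc g) ≤ 2 * spans (n₁ + 2) (suc g) + 2 * n₁ * L
        middle₂ = arith-79 (spans (n₁ + 2) (2 * n₁ + suc g)) (spans (n₁ + 2) (2 * n₁))
            (spans (n₁ + 2 + 2 * n₁) (suc g)) (spans (3 * n₁ + 2) (suc g)) (spans (n₁ + 2) (suc g + 2 * n₁))
            (spans (n₁ + 2) (suc g)) (spans (n₁ + 2 + suc g) (2 * n₁)) n₁ g
            (S-split (n₁ + 2) (2 * n₁) (suc g)) (cong (λ a → spans a (suc g)) (arith-78 n₁))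
            (cong (spans (n₁ + 2)) (+-comm (2 * n₁) (suc g))) (S-split (n₁ + 2) (suc g) (2 * n₁)) tail

-- Longest cycles

arith-80 : ∀ v1 v2 v3 ℓ → v1 + v2 ≤ 2 → v3 ≤ ℓ → v1 + (v2 + v3) ≤ suc (suc ℓ)
arith-80 v1 v2 v3 ℓ h1 h2 = linear (v1 ∷ v2 ∷ v3 ∷ ℓ ∷ []) 0 (x0 ⊕ (x1 ⊕ x2)) (con 1 ⊕ (con 1 ⊕ x3))
    (hyp (con 1) (x0 ⊕ x1) (con 2) h1 ∷ hyp (con 1) x2 x3 h2 ∷ []) refl

arith-81 : ∀ v1 v2 → v1 ≡ 1 → 1 ≤ v2 + v1
arith-81 v1 v2 h1 = linear (v1 ∷ v2 ∷ []) 0 (con 1) (x1 ⊕ x0) (equ (con 1) (con 1) x0 (sym h1) ∷ []) refl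

arith-82 : ∀ m r B → m + r ≤ B → m + 0 ≤ B
arith-82 m r B h1 = linear (m ∷ r ∷ B ∷ []) 0 (x0 ⊕ con 0) x2 (hyp (con 1) (x0 ⊕ x1) x2 h1 ∷ []) refl

arith-83 : ∀ v1 r p m → v1 ≤ r → p < m + 0 → v1 + p < m + r
arith-83 v1 r p m h1 h2 = linear (v1 ∷ r ∷ p ∷ m ∷ []) 0 (con 1 ⊕ (x0 ⊕ x2)) (x3 ⊕ x1)
    (hyp (con 1) x0 x1 h1 ∷ hyp (con 1) (con 1 ⊕ x2) (x3 ⊕ con 0) h2 ∷ []) refl

arith-84 : ∀ m r B → m + suc r ≤ B → 1 + r ≤ B
arith-84 m r B h1 = linear (m ∷ r ∷ B ∷ []) 0 (con 1 ⊕ x1) x2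
    (hyp (con 1) (x0 ⊕ (con 1 ⊕ x1)) x2 h1 ∷ []) refl

arith-85 : ∀ v1 p r v2 m → v1 + p < 1 + r → v2 ≡ 1 → 1 ≤ m → v2 + v1 + p < m + suc r
arith-85 v1 p r v2 m h1 h2 h3 = linear (v1 ∷ p ∷ r ∷ v2 ∷ m ∷ []) 0 (con 1 ⊕ (x3 ⊕ x0 ⊕ x1)) (x4 ⊕ (con 1 ⊕ x2))
    (hyp (con 1) (con 1 ⊕ (x0 ⊕ x1)) (con 1 ⊕ x2) h1 ∷ equ (con 1) x3 (con 1) h2 ∷ hyp (con 1) (con 1) x4 h3 ∷
    []) refl

arith-86 : ∀ m r B → m + suc r ≤ B → suc m + r ≤ B
arith-86 m r B h1 = linear (m ∷ r ∷ B ∷ []) 0 (con 1 ⊕ x0 ⊕ x1) x2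
    (hyp (con 1) (x0 ⊕ (con 1 ⊕ x1)) x2 h1 ∷ []) refl

arith-87 : ∀ m i B → suc m + i ≤ B → m + suc i ≤ B
arith-87 m i B h1 = linear (m ∷ i ∷ B ∷ []) 0 (x0 ⊕ (con 1 ⊕ x1)) x2
    (hyp (con 1) (con 1 ⊕ x0 ⊕ x1) x2 h1 ∷ []) refl

arith-88 : ∀ m i → m + suc i ≤ suc m + i
arith-88 m i = linear (m ∷ i ∷ []) 0 (x0 ⊕ (con 1 ⊕ x1)) (con 1 ⊕ x0 ⊕ x1) [] refl

arith-89 : ∀ v1 p m r v2 → v1 + p < suc m + r → v2 ≡ 0 → v2 + v1 + p < m + suc r
arith-89 v1 p m r v2 h1 h2 = linear (v1 ∷ p ∷ m ∷ r ∷ v2 ∷ []) 0 (con 1 ⊕ (x4 ⊕ x0 ⊕ x1)) (x2 ⊕ (con 1 ⊕ x3))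
    (hyp (con 1) (con 1 ⊕ (x0 ⊕ x1)) (con 1 ⊕ x2 ⊕ x3) h1 ∷ equ (con 1) x4 (con 0) h2 ∷ []) refl

arith-90 : ∀ v1 d r v2 → v1 ≤ d + r → v1 ≡ suc r + v2 → v2 < d
arith-90 v1 d r v2 h1 h2 = linear (v1 ∷ d ∷ r ∷ v2 ∷ []) 0 (con 1 ⊕ x3) x1
    (hyp (con 1) x0 (x1 ⊕ x2) h1 ∷ equ (con 1) (con 1 ⊕ x2 ⊕ x3) x0 (sym h2) ∷ []) refl

arith-91 : ∀ d r → 1 ≤ d → suc r ≤ d + r
arith-91 d r h1 = linear (d ∷ r ∷ []) 0 (con 1 ⊕ x1) (x0 ⊕ x1) (hyp (con 1) (con 1) x0 h1 ∷ []) refl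

arith-92 : ∀ v1 r v2 d → v1 ≡ suc r + v2 → 1 ≤ v2 → d < d + r → 3 ≤ v1
arith-92 v1 r v2 d h1 h2 h3 = linear (v1 ∷ r ∷ v2 ∷ d ∷ []) 0 (con 3) x0
    (equ (con 1) (con 1 ⊕ x1 ⊕ x2) x0 (sym h1) ∷ hyp (con 1) (con 1) x2 h2 ∷ hyp (con 1) (con 1 ⊕ x3) (x3 ⊕ x1) h3 ∷
    []) refl

arith-93 : ∀ v1 p q → v1 ≤ suc (suc p) + q → v1 ≡ suc p + suc q + 1 → ⊥
arith-93 v1 p q h1 h2 = 1≰0 (linear (v1 ∷ p ∷ q ∷ []) 0 (con 1) (con 0)
    (hyp (con 1) x0 (con 1 ⊕ (con 1 ⊕ x1) ⊕ x2) h1 ∷ equ (con 1) (con 1 ⊕ x1 ⊕ (con 1 ⊕ x2) ⊕ con 1) x0 (sym h2) ∷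
    []) refl)

arith-94 : ∀ v1 v2 v3 v4 p v5 q → v1 ≡ v2 + v3 → v2 ≡ v4 → v4 ≡ suc p → v3 ≡ v5 + 1 → v5 ≡ suc q →
    v1 ≡ suc p + suc q + 1
arith-94 v1 v2 v3 v4 p v5 q h1 h2 h3 h4 h5 = ≤-antisym (linear (v1 ∷ v2 ∷ v3 ∷ v4 ∷ p ∷ v5 ∷ q ∷ []) 0 x0
    (con 1 ⊕ x4 ⊕ (con 1 ⊕ x6) ⊕ con 1)
    (equ (con 1) x0 (x1 ⊕ x2) h1 ∷ equ (con 1) x1 x3 h2 ∷ equ (con 1) x3 (con 1 ⊕ x4) h3 ∷
    equ (con 1) x2 (x5 ⊕ con 1) h4 ∷ equ (con 1) x5 (con 1 ⊕ x6) h5 ∷ []) refl)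
        (linear (v1 ∷ v2 ∷ v3 ∷ v4 ∷ p ∷ v5 ∷ q ∷ []) 0 (con 1 ⊕ x4 ⊕ (con 1 ⊕ x6) ⊕ con 1) x0
    (equ (con 1) (x1 ⊕ x2) x0 (sym h1) ∷ equ (con 1) x3 x1 (sym h2) ∷ equ (con 1) (con 1 ⊕ x4) x3 (sym h3) ∷
    equ (con 1) (x5 ⊕ con 1) x2 (sym h4) ∷ equ (con 1) (con 1 ⊕ x6) x5 (sym h5) ∷ []) refl)

arith-95 : ∀ x p q → suc (x + suc p) + q ≡ x + (suc (suc p) + q)
arith-95 x p q = ≤-antisym (linear (x ∷ p ∷ q ∷ []) 0 (con 1 ⊕ (x0 ⊕ (con 1 ⊕ x1)) ⊕ x2)
    (x0 ⊕ (con 1 ⊕ (con 1 ⊕ x1) ⊕ x2))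
    [] refl) (linear (x ∷ p ∷ q ∷ []) 0 (x0 ⊕ (con 1 ⊕ (con 1 ⊕ x1) ⊕ x2)) (con 1 ⊕ (x0 ⊕ (con 1 ⊕ x1)) ⊕ x2)
    [] refl)

arith-96 : ∀ p q → suc p ≤ suc (suc p) + q
arith-96 p q = linear (p ∷ q ∷ []) 0 (con 1 ⊕ x0) (con 1 ⊕ (con 1 ⊕ x0) ⊕ x1) [] refl

arith-97 : ∀ q p → suc q ≤ suc (suc p) + q
arith-97 q p = linear (q ∷ p ∷ []) 0 (con 1 ⊕ x0) (con 1 ⊕ (con 1 ⊕ x1) ⊕ x0) [] refl

arith-98 : ∀ x p → suc x + suc p ≤ suc (x + suc p)
arith-98 x p = linear (x ∷ p ∷ []) 0 (con 1 ⊕ x0 ⊕ (con 1 ⊕ x1)) (con 1 ⊕ (x0 ⊕ (con 1 ⊕ x1))) [] refl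

arith-99 : ∀ x p q → suc (x + suc p) + suc q ≤ suc x + (suc (suc p) + q)
arith-99 x p q = linear (x ∷ p ∷ q ∷ []) 0 (con 1 ⊕ (x0 ⊕ (con 1 ⊕ x1)) ⊕ (con 1 ⊕ x2))
    (con 1 ⊕ x0 ⊕ (con 1 ⊕ (con 1 ⊕ x1) ⊕ x2))
    [] refl

arith-100 : ∀ v1 p q → v1 ≡ suc p + suc q + 1 → 3 ≤ v1
arith-100 v1 p q h1 = linear (v1 ∷ p ∷ q ∷ []) 0 (con 3) x0
    (equ (con 1) (con 1 ⊕ x1 ⊕ (con 1 ⊕ x2) ⊕ con 1) x0 (sym h1) ∷ []) refl

arith-101 : ∀ i d → i < i + d → 1 ≤ d
arith-101 i d h1 = linear (i ∷ d ∷ []) 0 (con 1) x1 (hyp (con 1) (con 1 ⊕ x0) (x0 ⊕ x1) h1 ∷ []) refl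

arith-102 : ∀ i d L → i + d < L → d < L
arith-102 i d L h1 = linear (i ∷ d ∷ L ∷ []) 0 (con 1 ⊕ x1) x2
    (hyp (con 1) (con 1 ⊕ (x0 ⊕ x1)) x2 h1 ∷ []) refl

arith-103 : ∀ v1 v2 r v3 v4 → v1 + v2 < 1 + r → v3 ≤ 1 → v4 ≤ 1 → v3 + v4 + v1 + v2 ≤ suc r + 1
arith-103 v1 v2 r v3 v4 h1 h2 h3 = linear (v1 ∷ v2 ∷ r ∷ v3 ∷ v4 ∷ []) 0 (x3 ⊕ x4 ⊕ x0 ⊕ x1) (con 1 ⊕ x2 ⊕ con 1)
    (hyp (con 1) (con 1 ⊕ (x0 ⊕ x1)) (con 1 ⊕ x2) h1 ∷ hyp (con 1) x3 (con 1) h2 ∷ hyp (con 1) x4 (con 1) h3 ∷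
    []) refl

arith-104 : ∀ v1 → v1 < 1 → 1 ≤ v1 → ⊥
arith-104 v1 h1 h2 = 1≰0 (linear (v1 ∷ []) 0 (con 1) (con 0)
    (hyp (con 1) (con 1 ⊕ x0) (con 1) h1 ∷ hyp (con 1) (con 1) x0 h2 ∷ []) refl)

arith-105 : ∀ d r → 1 ≤ d → r < d + r
arith-105 d r h1 = linear (d ∷ r ∷ []) 0 (con 1 ⊕ x1) (x0 ⊕ x1) (hyp (con 1) (con 1) x0 h1 ∷ []) refl

arith-106 : ∀ v1 v2 d v3 r v4 v5 → v1 + v2 ≤ d + 1 → v3 + v2 ≤ r + 1 → v4 + v5 ≡ v1 + v3 → v4 + v5 + 2 * v2 ≤ d + r + 2
arith-106 v1 v2 d v3 r v4 v5 h1 h2 h3 = linear (v1 ∷ v2 ∷ d ∷ v3 ∷ r ∷ v4 ∷ v5 ∷ []) 0 (x5 ⊕ x6 ⊕ con 2 ⊛ x1)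
    (x2 ⊕ x4 ⊕ con 2)
    (hyp (con 1) (x0 ⊕ x1) (x2 ⊕ con 1) h1 ∷ hyp (con 1) (x3 ⊕ x1) (x4 ⊕ con 1) h2 ∷
    equ (con 1) (x5 ⊕ x6) (x0 ⊕ x3) h3 ∷ []) refl

-- Positions are taken in pairs, and of two neighbouring ones at most one is occupied. If a single
-- position is left over, it precedes the occupied position `ℓ` and is empty.
chain : ∀ ℓ (s : ℕ → ℕ) → (∀ i → s i ≤ 2) → (∀ i → 1 ≤ s (suc i) → s i ≡ 0) → 1 ≤ s ℓ → ∑ ℓ s ≤ ℓ
chain zero s ≤2 gap _ = z≤n
chain (suc zero) s ≤2 gap pos = ≤-trans (≤-reflexive (trans (+-identityʳ (s 0)) (gap 0 pos))) z≤n
chain (suc (suc ℓ)) s ≤2 gap pos = arith-80 (s 0) (s 1) (∑ ℓ (λ i → s (suc (suc i)))) ℓ pair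
    (chain ℓ (λ i → s (suc (suc i))) (λ i → ≤2 _) (λ i → gap _) pos)
  where
  pair : s 0 + s 1 ≤ 2
  pair with s 1 in eq
  ... | zero = ≤-trans (≤-reflexive (+-identityʳ (s 0))) (≤2 0)
  ... | suc k rewrite gap 0 (≤-trans (s≤s z≤n) (≤-reflexive (sym eq))) = ≤-trans (≤-reflexive (sym eq)) (≤2 1)

-- Two sets f, g of positions without neighbouring elements, at distance more
-- than p from each other: on the way from an f-position (m steps back) to a
-- g-position, p positions are lost.
scan : ∀ B p r m (f g : ℕ → Bool) → (∀ i → 1 ≤ ⟦ f (suc i) ⟧ + ⟦ g (suc i) ⟧ → ⟦ f i ⟧ + ⟦ g i ⟧ ≡ 0) →
  (∀ i d → f i ≡ true → g (i + d) ≡ true → 1 ≤ d → d ≤ B → p < d) →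
  m + r ≤ B → 1 ≤ m → (∀ i → g i ≡ true → m + i ≤ B → p < m + i) → g r ≡ true →
  ∑ r (λ i → ⟦ f i ⟧ + ⟦ g i ⟧) + p < m + r
scan B p r m f g gap fg m+r≤B 1≤m last gr with g 0 in g0 | f 0 in f0
-- A `g`-position has been reached: `last` shows that more than `p` steps were made since the last
-- `f`-position, and `chain` bounds what follows.
scan B p r m f g gap fg m+r≤B 1≤m last gr | true | _ =
  arith-83 (∑ r (λ i → ⟦ f i ⟧ + ⟦ g i ⟧)) r p m
      (chain r (λ i → ⟦ f i ⟧ + ⟦ g i ⟧) (λ i → +-mono-≤ (⟦⟧≤1 (f i)) (⟦⟧≤1 (g i))) gap
      (arith-81 (⟦ g r ⟧) (⟦ f r ⟧) (cong ⟦_⟧ gr))) (last 0 g0 (arith-82 m r B m+r≤B))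
scan B p zero m f g gap fg m+r≤B 1≤m last gr | false | _ = case trans (sym g0) gr of λ ()
scan B p (suc r) m f g gap fg m+r≤B 1≤m last gr | false | true =
  arith-85 (∑ r (λ i → ⟦ f (suc i) ⟧ + ⟦ g (suc i) ⟧)) p r (⟦ f 0 ⟧ + ⟦ g 0 ⟧) m
      (scan B p r 1 (f ∘ suc) (g ∘ suc) (λ i → gap (suc i)) (λ i d → fg (suc i) d) (arith-84 m r B m+r≤B)
      ≤-refl (λ i gi → fg 0 (suc i) f0 gi (s≤s z≤n)) gr) (cong₂ (λ a b → ⟦ a ⟧ + ⟦ b ⟧) f0 g0) 1≤m
scan B p (suc r) m f g gap fg m+r≤B 1≤m last gr | false | false =
  arith-89 (∑ r (λ i → ⟦ f (suc i) ⟧ + ⟦ g (suc i) ⟧)) p m r (⟦ f 0 ⟧ + ⟦ g 0 ⟧)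
      (scan B p r (suc m) (f ∘ suc) (g ∘ suc) (λ i → gap (suc i)) (λ i d → fg (suc i) d)
      (arith-86 m r B m+r≤B) (s≤s z≤n) (λ i gi h → ≤-trans (last (suc i) gi (arith-87 m i B h))
      (arith-88 m i)) gr) (cong₂ (λ a b → ⟦ a ⟧ + ⟦ b ⟧) f0 g0)

module LongestCycles (G : SimpleGraph) where

  open GraphTheory G

  CyclesIn : List Vertex → ℕ → Set
  CyclesIn S L = ∀ {xs} → Cycle xs → xs ⊆ S → length xs ≤ L

  module Longest {L : ℕ} (C : Circuit L) {S : List Vertex} (verts⊆S : Arcs.verts C ⊆ S) (longest : CyclesIn S L) where

    open Arcs C

    Outside : List Vertex → Set
    Outside P = P ⊆ S × (∀ {v} → v ∈ P → v ∉ verts)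

    reverse-outside : ∀ {P} → Outside P → Outside (reverse P)
    reverse-outside {P} (P⊆ , P∉) = (λ v∈ → P⊆ (Perm.∈-resp-↭ (Perm.↭-reverse P) v∈)) ,
        (λ v∈ → P∉ (Perm.∈-resp-↭ (Perm.↭-reverse P) v∈))

    -- The path could replace the `d - 1` vertices of C strictly between `c x` and `c (x + d)`. As C
    -- is longest, it has no more vertices than these.
    detour : ∀ {s t P} → Path s t P → Unique P → Outside P → ∀ x d → 1 ≤ d → d < L →
      s ~ c x → t ~ c (x + d) → length P < d
    detour {s} {t} {P} path unique (P⊆ , P∉) x d 1≤d d<L s~ t~ with m≤n⇒∃[o]m+o≡n (<⇒≤ d<L)
    ... | r , refl = arith-90 (length (as ++ P)) d r (length P) (longest cycle sub) len
      where
      as = arc (x + d) (suc r)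
      len : length (as ++ P) ≡ suc r + length P
      len = trans (length-++ as) (cong (_+ length P) (arc-length (x + d) (suc r)))
      end : c (x + d + r) ≡ c x
      end = trans (cong c (+-assoc x d r)) (periodic x)
      cycle : Cycle (as ++ P)
      cycle = mkCycle (Path-++ (arc-path (x + d) r) (subst (_~ s) (sym end) (~-sym s~)) path) t~
        (Unique.++⁺ (arc-unique (x + d) (suc r) (arith-91 d r 1≤d)) unique (λ (v∈ , v∈′) → P∉ v∈′ (arc-⊆ {x + d} v∈)))
        (arith-92 (length (as ++ P)) r (length P) d len (Path-nonempty path) d<L)
      sub : as ++ P ⊆ S
      sub v∈ with ∈-++⁻ as v∈
      ... | inj₁ v∈′ = verts⊆S (arc-⊆ {x + d} v∈′)
      ... | inj₂ v∈′ = P⊆ v∈′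

    module _ {w : Vertex} (w∈S : w ∈ S) (w∉ : w ∉ verts) where

      singleton-outside : Outside [ w ]
      singleton-outside = (λ { (here refl) → w∈S }) , (λ { (here refl) → w∉ })

      no-consecutive : ∀ x → w ~ c x → w ~ c (suc x) → ⊥
      no-consecutive x h h′ = <-irrefl refl (detour single ([] ∷ []) singleton-outside x 1 ≤-refl
        (≤-trans (s≤s (s≤s z≤n)) L≥3) h (subst (λ y → w ~ c y) (+-comm 1 x) h′))

      deg-half : 2 * deg w verts ≤ L
      deg-half = ≤-trans (≤-reflexive (trans (cong (deg w verts +_) (+-identityʳ _))
          (cong₂ _+_ (sym (∑-rotate (λ v → ⟦ E w v ⟧) 0)) (sym (∑-rotate (λ v → ⟦ E w v ⟧) 1)))))
        (≤-trans (∑-pair≤ L 1 (λ i → ⟦ E w (c i) ⟧) (λ i → ⟦ E w (c (suc i)) ⟧)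
            (λ i _ → bool-excl (no-consecutive i))) (≤-reflexive (*-identityʳ L)))

      -- Otherwise C could be enlarged by `w`: from `w` to `c (x + d)`, backwards to `c (suc x)`, by
      -- the supposed edge to `c (suc (x + d))`, forwards round to `c x` and back to `w`.
      successors-independent : ∀ x d → 1 ≤ d → d < L → w ~ c x → w ~ c (x + d) → c (suc x) ~ c (suc (x + d)) → ⊥
      successors-independent x (suc p) (s≤s z≤n) d<L h₁ h₂ h₃ with m≤n⇒∃[o]m+o≡n d<L
      ... | q , refl = arith-93 (length zs) p q (longest cycle sub) len
        where
        as = arc (suc x) (suc p)
        y = suc (x + suc p)
        bs = arc y (suc q)
        zs = reverse as ++ (bs ++ [ w ])
        len : length zs ≡ suc p + suc q + 1
        len = arith-94 (length zs) (length (reverse as)) (length (bs ++ [ w ])) (length as) p (length bs) q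
            (length-++ (reverse as)) (length-reverse as) (arc-length (suc x) (suc p)) (length-++ bs)
            (arc-length y (suc q))
        end : c (y + q) ≡ c x
        end = trans (cong c (arith-95 x p q)) (periodic x)
        path₁ : Path (c (x + suc p)) (c (suc x)) (reverse as)
        path₁ = subst (λ v → Path (c v) (c (suc x)) (reverse as)) (sym (+-suc x p)) (Path-reverse (arc-path (suc x) p))
        unique : Unique zs
        unique = Unique.++⁺ (Unique-↭ (↭-sym (Perm.↭-reverse as)) (arc-unique (suc x) (suc p) (arith-96 p q)))
          (Unique.++⁺ (arc-unique y (suc q) (arith-97 q p)) ([] ∷ [])
              (λ { (v∈ , here refl) → w∉ (arc-⊆ {y} v∈) })) disjoint
          where
          disjoint : ∀ {v} → v ∈ reverse as × v ∈ bs ++ [ w ] → ⊥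
          disjoint (v∈ , v∈′) with Perm.∈-resp-↭ (Perm.↭-reverse as) v∈ | ∈-++⁻ bs v∈′
          ... | v∈as | inj₁ v∈bs = arcs-disjoint {suc x} {y} (arith-98 x p) (arith-99 x p q) v∈as v∈bs
          ... | v∈as | inj₂ (here refl) = w∉ (arc-⊆ {suc x} v∈as)
        cycle : Cycle zs
        cycle = mkCycle (Path-++ path₁ h₃ (Path-++ (arc-path y q) (subst (_~ w) (sym end) (~-sym h₁)) single)) h₂ unique
          (arith-100 (length zs) p q len)
        sub : zs ⊆ S
        sub v∈ with ∈-++⁻ (reverse as) v∈
        ... | inj₁ v∈′ = verts⊆S (arc-⊆ {suc x} (Perm.∈-resp-↭ (Perm.↭-reverse as) v∈′))
        ... | inj₂ v∈′ with ∈-++⁻ bs v∈′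
        ...   | inj₁ v∈″ = verts⊆S (arc-⊆ {y} v∈″)
        ...   | inj₂ (here refl) = w∈S

      successors-independent′ : ∀ i j → i < L → j < L → w ~ c i → w ~ c j → c (suc i) ~ c (suc j) → ⊥
      successors-independent′ i j i<L j<L h₁ h₂ h₃ with <-cmp i j
      ... | tri≈ _ refl _ = ~⇒≢ h₃ refl
      ... | tri< i<j _ _ with m≤n⇒∃[o]m+o≡n (<⇒≤ i<j)
      ...   | d , refl = successors-independent i d (arith-101 i d i<j) (arith-102 i d L j<L) h₁ h₂ h₃
      successors-independent′ i j i<L j<L h₁ h₂ h₃ | tri> _ _ j<i with m≤n⇒∃[o]m+o≡n (<⇒≤ j<i)
      ...   | d , refl = successors-independent j d (arith-101 j d j<i) (arith-102 j d L i<L) h₂ h₁ (~-sym h₃)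

      -- For each ordered pair of positions, either both are neighbours of `w` or their successors
      -- may be adjacent, but not both. The square counts the pairs of the first kind.
      edges-independent : ee verts + deg w verts * deg w verts ≤ L * L
      edges-independent = begin
        ee verts + deg w verts * deg w verts
          ≡⟨ cong₂ _+_ rows squares ⟩
        ∑ L (λ i → ∑ L (λ j → ⟦ E (c (suc i)) (c (suc j)) ⟧)) + ∑ L (λ i → ∑ L (λ j → ⟦ E w (c i) ∧ E w (c j) ⟧))
          ≡⟨ sym (∑-+ L _ _) ⟩
        ∑ L (λ i → ∑ L (λ j → ⟦ E (c (suc i)) (c (suc j)) ⟧) + ∑ L (λ j → ⟦ E w (c i) ∧ E w (c j) ⟧))
          ≤⟨ ∑-≤const L L (λ i i<L → ≤-trans (∑-pair≤ L 1 (λ j → ⟦ E (c (suc i)) (c (suc j)) ⟧)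
              (λ j → ⟦ E w (c i) ∧ E w (c j) ⟧) (λ j j<L → excl i j i<L j<L)) (≤-reflexive (*-identityʳ L))) ⟩
        L * L ∎
        where
        open ≤-Reasoning
        excl : ∀ i j → i < L → j < L → ⟦ E (c (suc i)) (c (suc j)) ⟧ + ⟦ E w (c i) ∧ E w (c j) ⟧ ≤ 1
        excl i j i<L j<L = bool-excl λ h₃ h → case ∧-true h of λ (h₁ , h₂) → successors-independent′ i j i<L
            j<L h₁ h₂ h₃
        rows : ee verts ≡ ∑ L (λ i → ∑ L (λ j → ⟦ E (c (suc i)) (c (suc j)) ⟧))
        rows = trans (sym (∑-rotate (λ x → deg x verts) 1))
            (∑-cong L (λ i _ → sym (∑-rotate (λ y → ⟦ E (c (suc i)) y ⟧) 1)))
        product : ∀ b k (f : ℕ → Bool) → ∑ k (λ j → ⟦ b ∧ f j ⟧) ≡ ⟦ b ⟧ * ∑ k (λ j → ⟦ f j ⟧)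
        product true k f = sym (+-identityʳ _)
        product false k f = trans (∑-const k 0) (*-zeroʳ k)
        factor : ∀ k (f : ℕ → ℕ) a → ∑ k (λ i → f i * a) ≡ ∑ k f * a
        factor zero f a = refl
        factor (suc k) f a = trans (cong (f 0 * a +_) (factor k (f ∘ suc) a)) (sym (*-distribʳ-+ a (f 0) _))
        squares : deg w verts * deg w verts ≡ ∑ L (λ i → ∑ L (λ j → ⟦ E w (c i) ∧ E w (c j) ⟧))
        squares = sym (trans (∑-cong L (λ i _ → trans (product (E w (c i)) L (λ j → E w (c j)))
            (cong (⟦ E w (c i) ⟧ *_) (∑-rotate (λ v → ⟦ E w v ⟧) 0))))
          (trans (factor L (λ i → ⟦ E w (c i) ⟧) (deg w verts)) (cong (_* deg w verts) (∑-rotate (λ v → ⟦ E w v ⟧) 0))))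

    module _ {s t P} (path : Path s t P) (unique : Unique P) (outside : Outside P) where

      private
        p = length P
        path′ = Path-reverse path
        unique′ = Unique-↭ (↭-sym (Perm.↭-reverse P)) unique
        outside′ = reverse-outside outside
        s∈ = Path-first path
        t∈ = Path-last path

        half : ∀ {u v Q} → Path u v Q → Unique Q → Outside Q → length Q ≡ p → ∀ x ℓ → 1 ≤ ℓ → ℓ < L →
            u ~ c x → v ~ c (x + ℓ) →
          ∑ ℓ (λ i → ⟦ E u (c (x + i)) ⟧ + ⟦ E v (c (x + i)) ⟧) + p ≤ ℓ + 1
        half {u} {v} {Q} path unique outside eq x (suc r) _ lt u~ v~ =
          -- The position `x`, at which `u` is attached, is set aside with a count of at most 2; the
          -- scan starts one step after it, hence with `m = 1`.
          arith-103 (∑ r (λ i → ⟦ E u (c (x + suc i)) ⟧ + ⟦ E v (c (x + suc i)) ⟧)) (length P) r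
              (⟦ E u (c (x + 0)) ⟧) (⟦ E v (c (x + 0)) ⟧) (scan (suc r) p r 1 (λ i → E u (c (x + suc i)))
              (λ i → E v (c (x + suc i))) gap (λ i d h₁ h₂ 1≤d d≤ → ≤-trans (≤-reflexive (cong suc (sym eq)))
              (detour path unique outside (x + suc i) d 1≤d (≤-trans (s≤s d≤) lt) h₁
              (subst (λ z → v ~ c z) (sym (+-assoc x (suc i) d)) h₂))) ≤-refl ≤-refl
              (λ i h h≤ → ≤-trans (≤-reflexive (cong suc (sym eq)))
              (detour path unique outside x (suc i) (s≤s z≤n) (≤-trans (s≤s h≤) lt) u~ h)) v~)
              (⟦⟧≤1 (E u (c (x + 0)))) (⟦⟧≤1 (E v (c (x + 0))))
          where
          u∈S = proj₁ outside (Path-first path)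
          u∉ = proj₂ outside (Path-first path)
          v∈S = proj₁ outside (Path-last path)
          v∉ = proj₂ outside (Path-last path)
          short : ∀ {a b R} → Path a b R → Unique R → Outside R → ∀ z → a ~ c z → b ~ c (suc z) → ⊥
          short {b = b} {R} π uq od z h₁ h₂ = arith-104 (length R)
              (detour π uq od z 1 ≤-refl (≤-trans (s≤s (s≤s z≤n)) L≥3) h₁
              (subst (λ y → b ~ c y) (+-comm 1 z) h₂)) (Path-nonempty π)
          gap : ∀ i → 1 ≤ ⟦ E u (c (x + suc (suc i))) ⟧ + ⟦ E v (c (x + suc (suc i))) ⟧ →
              ⟦ E u (c (x + suc i)) ⟧ + ⟦ E v (c (x + suc i)) ⟧ ≡ 0
          gap i pos rewrite +-suc x (suc i) with E u (c (x + suc i)) in a | E v (c (x + suc i)) in b | E u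
              (c (suc (x + suc i))) in a′ | E v (c (suc (x + suc i))) in b′
          ... | false | false | _ | _ = refl
          ... | true | _ | true | _ = ⊥-elim (no-consecutive u∈S u∉ (x + suc i) a a′)
          ... | true | _ | false | true = ⊥-elim (short path unique outside (x + suc i) a b′)
          ... | false | true | true | _ =
              ⊥-elim (short (Path-reverse path) (Unique-↭ (↭-sym (Perm.↭-reverse Q)) unique)
              (reverse-outside outside) (x + suc i) b a′)
          ... | false | true | false | true = ⊥-elim (no-consecutive v∈S v∉ (x + suc i) b b′)
          ... | true | _ | false | false = case pos of λ ()
          ... | false | true | false | false = case pos of λ ()

      -- The attachments cut C into two arcs, one from a neighbour of `s` to a neighbour of `t` and
      -- one back. On either arc a neighbour of one end is somewhere followed by a neighbour of the
      -- other, and by `detour` at least `length P` positions lie between them. Elsewhere positions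
      -- adjacent to `s` or `t` are never consecutive.
      ends-bound : ∀ x d → 1 ≤ d → d < L → s ~ c x → t ~ c (x + d) → deg s verts + deg t verts + 2 * p ≤ L + 2
      ends-bound x d 1≤d d<L s~ t~ with m≤n⇒∃[o]m+o≡n (<⇒≤ d<L)
      ... | r , refl = arith-106 (∑ d (λ i → ⟦ E s (c (x + i)) ⟧ + ⟦ E t (c (x + i)) ⟧)) (length P) d
          (∑ r (λ i → ⟦ E t (c (x + d + i)) ⟧ + ⟦ E s (c (x + d + i)) ⟧)) r (deg s verts) (deg t verts)
          (half path unique outside refl x d 1≤d d<L s~ t~) (half path′ unique′ outside′ (length-reverse P)
          (x + d) r (arith-101 d r d<L) (arith-105 d r 1≤d) t~
          (subst (λ v → s ~ v) (sym (trans (cong c (+-assoc x d r)) (periodic x))) s~)) total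
        where
        f : ℕ → ℕ
        f i = ⟦ E s (c (x + i)) ⟧ + ⟦ E t (c (x + i)) ⟧
        total : deg s verts + deg t verts ≡ ∑ d f + ∑ r (λ i → ⟦ E t (c (x + d + i)) ⟧ + ⟦ E s (c (x + d + i)) ⟧)
        total = trans (cong₂ _+_ (sym (∑-rotate (λ v → ⟦ E s v ⟧) x)) (sym (∑-rotate (λ v → ⟦ E t v ⟧) x)))
          (trans (sym (∑-+ (d + r) (λ i → ⟦ E s (c (x + i)) ⟧) (λ i → ⟦ E t (c (x + i)) ⟧)))
            (trans (∑-split d r f) (cong (∑ d f +_) (∑-cong r (λ i _ → trans (+-comm ⟦ E s (c (x + (d + i))) ⟧ _)
              (cong (λ z → ⟦ E t (c z) ⟧ + ⟦ E s (c z) ⟧) (sym (+-assoc x d i))))))))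

-- Cycles from minimum degree conditions

arith-107 : ∀ v1 v2 v3 v4 v5 D v6 → v1 ≤ v2 + v3 → v4 ≡ v1 + 2 * v5 → 2 * v5 ≤ D → v6 ≡ D + v3 → v4 ≤ v2 + v6
arith-107 v1 v2 v3 v4 v5 D v6 h1 h2 h3 h4 = linear (v1 ∷ v2 ∷ v3 ∷ v4 ∷ v5 ∷ D ∷ v6 ∷ []) 0 x3 (x1 ⊕ x6)
    (hyp (con 1) x0 (x1 ⊕ x2) h1 ∷ equ (con 1) x3 (x0 ⊕ con 2 ⊛ x4) h2 ∷ hyp (con 1) (con 2 ⊛ x4) x5 h3 ∷
    equ (con 1) (x5 ⊕ x2) x6 (sym h4) ∷ []) refl

arith-108 : ∀ v1 v2 fuel → suc v1 ≡ v2 → v2 ≤ suc fuel → v1 ≤ fuel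
arith-108 v1 v2 fuel h1 h2 = linear (v1 ∷ v2 ∷ fuel ∷ []) 0 x0 x2
    (equ (con 1) (con 1 ⊕ x0) x1 h1 ∷ hyp (con 1) x1 (con 1 ⊕ x2) h2 ∷ []) refl

arith-109 : ∀ v1 v2 ℓ v3 v4 v5 → v1 ≤ v2 + 2 * ℓ * v3 → v2 ≤ v4 * v4 → v5 ≡ v4 + v3 → v4 ≡ suc ℓ →
    v1 + suc ℓ * suc ℓ ≤ 2 * (suc ℓ * v5)
arith-109 v1 v2 ℓ v3 v4 v5 h1 h2 h3 h4 = linear (v1 ∷ v2 ∷ ℓ ∷ v3 ∷ v4 ∷ v5 ∷ []) 0
    (x0 ⊕ (con 1 ⊕ x2) ⊛ (con 1 ⊕ x2)) (con 2 ⊛ ((con 1 ⊕ x2) ⊛ x5))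
    (hyp (con 1) x0 (x1 ⊕ con 2 ⊛ x2 ⊛ x3) h1 ∷ hyp (con 1) x1 (x4 ⊛ x4) h2 ∷
    equ (con 2 ⊛ (con 1 ⊕ x2)) (x4 ⊕ x3) x5 (sym h3) ∷ equ x4 x4 (con 1 ⊕ x2) h4 ∷
    equ (con 1 ⊕ x2) (con 1 ⊕ x2) x4 (sym h4) ∷ []) refl

arith-110 : ∀ ℓ v1 → 2 * ℓ < 2 * v1 → suc ℓ ≤ v1
arith-110 ℓ v1 h1 = linear (ℓ ∷ v1 ∷ []) 1 (con 1 ⊕ x0) x1
    (hyp (con 1) (con 1 ⊕ con 2 ⊛ x0) (con 2 ⊛ x1) h1 ∷ []) refl

arith-111 : ∀ D v1 v2 v3 v4 → suc D ≤ v1 → v1 ≡ v2 + v3 → v2 ≤ 1 → v3 ≡ v4 → D ≤ v4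
arith-111 D v1 v2 v3 v4 h1 h2 h3 h4 = linear (D ∷ v1 ∷ v2 ∷ v3 ∷ v4 ∷ []) 0 x0 x4
    (hyp (con 1) (con 1 ⊕ x0) x1 h1 ∷ equ (con 1) x1 (x2 ⊕ x3) h2 ∷ hyp (con 1) x2 (con 1) h3 ∷ equ (con 1) x3 x4 h4 ∷
    []) refl

arith-112 : ∀ v1 v2 v3 L D v4 v5 v6 v7 v8 v9 → v1 + v2 + 2 * v3 ≤ L + 2 → suc D ≤ v4 → v4 ≡ v1 + v5 →
    v5 ≡ v6 → v6 < v3 → suc D ≤ v7 → v7 ≡ v2 + v8 → v8 ≡ v9 → v9 < v3 → L < 2 * suc D → ⊥
arith-112 v1 v2 v3 L D v4 v5 v6 v7 v8 v9 h1 h2 h3 h4 h5 h6 h7 h8 h9 h10 =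
    1≰0 (linear (v1 ∷ v2 ∷ v3 ∷ L ∷ D ∷ v4 ∷ v5 ∷ v6 ∷ v7 ∷ v8 ∷ v9 ∷ []) 0 (con 1) (con 0)
    (hyp (con 1) (x0 ⊕ x1 ⊕ con 2 ⊛ x2) (x3 ⊕ con 2) h1 ∷ hyp (con 1) (con 1 ⊕ x4) x5 h2 ∷
    equ (con 1) x5 (x0 ⊕ x6) h3 ∷ equ (con 1) x6 x7 h4 ∷ hyp (con 1) (con 1 ⊕ x7) x2 h5 ∷
    hyp (con 1) (con 1 ⊕ x4) x8 h6 ∷ equ (con 1) x8 (x1 ⊕ x9) h7 ∷ equ (con 1) x9 x10 h8 ∷
    hyp (con 1) (con 1 ⊕ x10) x2 h9 ∷ hyp (con 1) (con 1 ⊕ x3) (con 2 ⊛ (con 1 ⊕ x4)) h10 ∷ []) refl)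

arith-113 : ∀ i d j L → i + d ≡ j + L → i < L → 1 ≤ d
arith-113 i d j L h1 h2 = linear (i ∷ d ∷ j ∷ L ∷ []) 0 (con 1) x1
    (equ (con 1) (x2 ⊕ x3) (x0 ⊕ x1) (sym h1) ∷ hyp (con 1) (con 1 ⊕ x0) x3 h2 ∷ []) refl

arith-114 : ∀ i d j L → i + d ≡ j + L → j < i → d < L
arith-114 i d j L h1 h2 = linear (i ∷ d ∷ j ∷ L ∷ []) 0 (con 1 ⊕ x1) x3
    (equ (con 1) (x0 ⊕ x1) (x2 ⊕ x3) h1 ∷ hyp (con 1) (con 1 ⊕ x2) x0 h2 ∷ []) refl

module MinDegree (G : SimpleGraph) where

  open GraphTheory G
  open LongestCycles G public

  last-neighbour : ∀ s xs → 1 ≤ deg s xs → ∃ λ as → ∃ λ u → ∃ λ bs → xs ≡ as ++ u ∷ bs × s ~ u × deg s bs ≡ 0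
  last-neighbour s (x ∷ xs) pos with deg s xs in eq
  ... | suc k with last-neighbour s xs (≤-trans (s≤s z≤n) (≤-reflexive (sym eq)))
  ...   | as , u , bs , refl , s~u , none = x ∷ as , u , bs , refl , s~u , none
  last-neighbour s (x ∷ xs) pos | zero with E s x in eq′
  ...   | true = [] , x , xs , refl , eq′ , eq
  ...   | false = case pos of λ ()

  Path-head : ∀ {s t xs} → Path s t xs → ∃ λ ys → xs ≡ s ∷ ys
  Path-head single = [] , refl
  Path-head (_ ∷ _) = _ , refl

  deg-first : ∀ {s t xs} → Path s t xs → deg s xs < length xs
  deg-first {s} path with Path-head path
  ... | ys , refl = s≤s (≤-trans (≤-reflexive (deg-self s ys)) (deg-≤length s ys))

  -- The part of the path up to the last neighbour of `s` contains `s` and all its neighbours on the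
  -- path, and the edge from that neighbour back to `s` closes it.
  path-cycle : ∀ {s t xs d} → Path s t xs → Unique xs → d ≤ deg s xs → 2 ≤ d →
    ∃ λ ys → Cycle ys × ys ⊆ xs × d < length ys
  path-cycle {s} {xs = xs} {d} path unique d≤ 2≤d with last-neighbour s xs (≤-trans (s≤s z≤n) (≤-trans 2≤d d≤))
  ... | as , u , bs , refl , s~u , none = as ++ [ u ] ,
        mkCycle path₁ (~-sym s~u) (proj₁ (Unique-++⁻ (as ++ [ u ]) (subst Unique assoc unique)))
            (≤-trans (s≤s 2≤d) long) ,
        (λ v∈ → subst (_ ∈_) (sym assoc) (∈-++⁺ˡ v∈)) , long
    where
    assoc : as ++ u ∷ bs ≡ (as ++ [ u ]) ++ bs
    assoc = sym (++-assoc as [ u ] bs)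
    path₁ = proj₁ (Path-split as path)
    long : d < length (as ++ [ u ])
    long = ≤-trans (s≤s (≤-trans d≤ (≤-reflexive (trans (cong (deg s) assoc)
      (trans (deg-++ s (as ++ [ u ]) bs) (trans (cong (deg s (as ++ [ u ]) +_) none) (+-identityʳ _)))))))
          (deg-first path₁)

  -- Of maximality only this is recorded: within `U`, all neighbours of the two ends lie on the
  -- path.
  record LongestPath (U : List Vertex) : Set where
    field
      {s t} : Vertex
      {P} : List Vertex
      path : Path s t P
      unique : Unique P
      P⊆U : P ⊆ U
      deg-s : deg s U ≡ deg s P
      deg-t : deg t U ≡ deg t P

  longest-path : ∀ {U} → Unique U → 1 ≤ length U → ¬ ¬ LongestPath U
  longest-path {u ∷ U} uniqueU _ none = ∃-max PathOfLength (length (u ∷ U))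
      (λ { _ (_ , _ , P , _ , uP , P⊆ , refl) → unique-length uP P⊆ })
      1 (u , u , [ u ] , single , [] ∷ [] , (λ { (here refl) → here refl }) , refl)
      (λ { (_ , (s , t , P , path , uP , P⊆ , refl) , max) → none (record { path = path ; unique = uP ; P⊆U = P⊆
         ; deg-s = ends path uP P⊆ max
         ; deg-t = trans (ends (Path-reverse path) (Unique-↭ (↭-sym (Perm.↭-reverse P)) uP)
             (λ v∈ → P⊆ (Perm.∈-resp-↭ (Perm.↭-reverse P) v∈))
              (λ k q → ≤-trans (max k q) (≤-reflexive (sym (length-reverse P))))) (deg-↭ t (Perm.↭-reverse P)) }) })
    where
    PathOfLength : ℕ → Set
    PathOfLength k = ∃₂ λ s t → ∃ λ P → Path s t P × Unique P × P ⊆ (u ∷ U) × length P ≡ k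
    ends : ∀ {s t P} → Path s t P → Unique P → P ⊆ (u ∷ U) → (∀ k → PathOfLength k → k ≤ length P) →
        deg s (u ∷ U) ≡ deg s P
    ends {s} {t} {P} path uP P⊆ max with ⊆-split uP P⊆
    ... | zs , perm = trans (deg-↭ s perm) (trans (deg-++ s P zs) (trans (cong (deg s P +_) no-more) (+-identityʳ _)))
      where
      disjoint = proj₂ (proj₂ (Unique-++⁻ P (Unique-↭ perm uniqueU)))
      no-more : deg s zs ≡ 0
      no-more with deg s zs in eq
      ... | zero = refl
      ... | suc k with deg-positive {s} {zs} (≤-trans (s≤s z≤n) (≤-reflexive (sym eq)))
      ...   | y , y∈ , s~y = ⊥-elim (<-irrefl refl (max (suc (length P)) (y , t , y ∷ P , ~-sym s~y ∷ path ,
                All.tabulate (λ v∈ y≡v → disjoint v∈ (subst (_∈ zs) y≡v y∈)) ∷ uP ,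
                (λ { (here refl) → Perm.∈-resp-↭ (↭-sym perm) (∈-++⁺ʳ P y∈) ; (there v∈) → P⊆ v∈ }) , refl)))

  min-degree-cycle : ∀ {U d} → Unique U → 1 ≤ length U → 2 ≤ d → (∀ w → w ∈ U → d ≤ deg w U) →
    ¬ ¬ (∃ λ ys → Cycle ys × ys ⊆ U × d < length ys)
  min-degree-cycle uU pos 2≤d min none = longest-path uU pos λ lp → let open LongestPath lp in
    case path-cycle path unique (≤-trans (min s (P⊆U (Path-first path))) (≤-reflexive deg-s)) 2≤d of
      λ (ys , cyc , ys⊆ , long) → none (ys , cyc , (λ v∈ → P⊆U (ys⊆ v∈)) , long)

  out-↭ : ∀ B {U U′} → U ↭ U′ → out B U ≡ out B U′
  out-↭ B p = cong₂ _+_ (cong (2 *_) (e-↭ {B} ↭-refl p)) (e-↭ p p)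

  -- The threshold `D` is compared with twice the degree, because that is the amount by which the
  -- removal of a vertex lowers `out`.
  record Peeling (B U : List Vertex) (D k : ℕ) : Set where
    field
      U₁ U₂ : List Vertex
      perm : U ↭ U₁ ++ U₂
      outcome : length U₁ ≡ k ⊎ (1 ≤ length U₁ × k ≤ length U₁ × (∀ w → w ∈ U₁ → D < 2 * deg w (B ++ U₁)))
      bound : out B U ≤ out B U₁ + D * length U₂

  peel : ∀ B U D k → k ≤ length U → Peeling B U D k
  peel B U D k k≤ = go (length U) U ≤-refl k≤
    where
    go : ∀ fuel U → length U ≤ fuel → k ≤ length U → Peeling B U D k
    go fuel U ≤fuel k≤ with length U ≟ k
    ... | yes eq = record { U₁ = U ; U₂ = [] ; perm = ↭-reflexive (sym (++-identityʳ U)) ; outcome =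
        inj₁ eq ; bound = m≤m+n _ _ }
    ... | no neq with any? (λ w → 2 * deg w (B ++ U) ≤? D) U
    ...   | no none = record { U₁ = U ; U₂ = [] ; perm = ↭-reflexive (sym (++-identityʳ U))
              ; outcome = inj₂ (≤-trans (s≤s z≤n) (≤∧≢⇒< k≤ (neq ∘ sym)) , k≤ , λ w w∈ →
                  ≰⇒> (λ h → none (lose w∈ h))) ; bound = m≤m+n _ _ }
    go zero [] ≤fuel k≤ | no neq | yes ()
    go (suc fuel) U ≤fuel k≤ | no neq | yes some with find some
    ... | w , w∈ , low with ∈-∃++ w∈
    ...   | as , bs , refl = record { U₁ = rec.U₁ ; U₂ = w ∷ rec.U₂
              ; perm = ↭-trans shift (↭-trans (prep w rec.perm) (↭-sym (Perm.shift w rec.U₁ rec.U₂)))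
              ; outcome = rec.outcome
              ; bound = (arith-107 (out B U′) (out B rec.U₁) (D * length rec.U₂) (out B (as ++ w ∷ bs))
                  (deg w (B ++ U′)) D (D * suc (length rec.U₂)) rec.bound step low′
                  (*-suc D (length rec.U₂))) }
      where
      U′ = as ++ bs
      shift : as ++ w ∷ bs ↭ w ∷ U′
      shift = Perm.shift w as bs
      len : suc (length U′) ≡ length (as ++ w ∷ bs)
      len = sym (Perm.↭-length shift)
      module rec = Peeling (go fuel U′ (arith-108 (length U′) (length (as ++ w ∷ bs)) fuel len ≤fuel)
        (≤-pred (≤-trans (≤∧≢⇒< k≤ (neq ∘ sym)) (≤-reflexive (sym len)))))
      step : out B (as ++ w ∷ bs) ≡ out B U′ + 2 * deg w (B ++ U′)
      step = trans (out-↭ B shift) (out-∷ B w U′)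
      low′ : 2 * deg w (B ++ U′) ≤ D
      low′ = ≤-trans (≤-reflexive (cong (2 *_)
          (trans (deg-++ w B U′) (trans (cong (deg w B +_)
          (trans (sym (deg-self w U′)) (deg-↭ w (↭-sym shift))))
        (sym (deg-++ w B (as ++ w ∷ bs))))))) low

  -- Vertices of degree less than `L` are peeled off until `L` vertices remain. If this stops early,
  -- the minimum degree is at least `L` and gives a cycle longer than `L`. This is a weak form of
  -- the theorem of Erdős and Gallai on long cycles.
  few-edges : ∀ {S L} → Unique S → CyclesIn S L → 2 ≤ L → L ≤ length S → ee S + L * L ≤ 2 * (L * length S)
  few-edges {S} {suc ℓ} uS cyc 2≤L L≤ = decidable-stable (_ ≤? _) λ contra →
    case outcome of λ
      { (inj₁ eq) → contra (arith-109 (ee S) (ee U₁) ℓ (length U₂) (length U₁) (length S) bound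
          (e-≤length U₁ U₁) total eq)
      ; (inj₂ (pos , _ , high)) → min-degree-cycle {U₁} {suc ℓ} (proj₁ (Unique-++⁻ U₁ (Unique-↭ perm uS))) pos 2≤L
           (λ w w∈ → (arith-110 ℓ (deg w U₁) (high w w∈)))
           (λ (ys , c , ys⊆ , long) → <-irrefl refl
               (≤-trans long (cyc c (λ v∈ → Perm.∈-resp-↭ (↭-sym perm) (∈-++⁺ˡ (ys⊆ v∈)))))) }
    where
    open Peeling (peel [] S (2 * ℓ) (suc ℓ) L≤)
    total : length S ≡ length U₁ + length U₂
    total = trans (Perm.↭-length perm) (length-++ U₁)

  module _ {L : ℕ} (C : Circuit L) {S : List Vertex} (verts⊆S : Arcs.verts C ⊆ S) (longest : CyclesIn S L) where

    open Arcs C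
    open Longest C verts⊆S longest

    -- The ends of a longest path in U are attached to C in such a way that
    -- their degrees sum to at most L, unless one of them has almost all its
    -- neighbours on the path.
    second-cycle : ∀ {U D} → Unique U → U ⊆ S → (∀ {v} → v ∈ U → v ∉ verts) → 1 ≤ length U → 3 ≤ D → L < 2 * D →
      (∀ w → w ∈ U → D ≤ deg w (verts ++ U)) → ¬ ¬ (∃ λ Q → Cycle Q × Q ⊆ U × D ≤ length Q)
    second-cycle {U} {suc D} uU U⊆S U∉ pos (s≤s 2≤D) L<2D min none = longest-path uU pos contra
      where
      contra : ¬ LongestPath U
      contra lp = split (deg s verts ≤? 1) (deg t verts ≤? 1)
        where
        open LongestPath lp
        -- An end with at most one neighbour on C keeps at least `D` neighbours on the path, so the
        -- cycle obtained has more than `D` vertices, as required for `suc D`.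
        finish : ∀ {a b R} → Path a b R → Unique R → R ⊆ U → deg a U ≡ deg a R → deg a verts ≤ 1 → ⊥
        finish {a} {b} {R} π uR R⊆ deg-a few = case path-cycle {d = D} π uR
            (arith-111 D (deg a (verts ++ U)) (deg a verts) (deg a U) (deg a R) (min a (R⊆ (Path-first π)))
            (deg-++ a verts U) few deg-a) 2≤D of
          λ (Q , cyc , Q⊆ , long) → none (Q , cyc , (λ v∈ → R⊆ (Q⊆ v∈)) , long)
        outside : Outside P
        outside = (λ v∈ → U⊆S (P⊆U v∈)) , (λ v∈ → U∉ (P⊆U v∈))
        -- Each end has fewer than `length P` neighbours in `U`. If both are attached to C at
        -- different vertices, then `ends-bound` limits the sum of their degrees to less than twice
        -- the minimum.
        impossible : ∀ x d → 1 ≤ d → d < L → s ~ c x → t ~ c (x + d) → ⊥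
        impossible x d 1≤d d<L s~ t~ =
          arith-112 (deg s verts) (deg t verts) (length P) L D (deg s (verts ++ U)) (deg s U) (deg s P)
              (deg t (verts ++ U)) (deg t U) (deg t P) (ends-bound path unique outside x d 1≤d d<L s~ t~)
              (min s (P⊆U (Path-first path))) (deg-++ s verts U) deg-s (deg-first path)
              (min t (P⊆U (Path-last path))) (deg-++ t verts U) deg-t
              (≤-trans (≤-reflexive (cong suc (sym (deg-↭ t (Perm.↭-reverse P)))))
              (≤-trans (deg-first (Path-reverse path)) (≤-reflexive (length-reverse P)))) L<2D
        two-attachments : ∀ i j → i < L → j < L → i ≢ j → s ~ c i → t ~ c j → ⊥
        two-attachments i j i<L j<L i≢j s~ t~ with <-cmp i j
        ... | tri≈ _ eq _ = i≢j eq
        ... | tri< i<j _ _ with m≤n⇒∃[o]m+o≡n (<⇒≤ i<j)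
        ...   | d , refl = impossible i d (arith-101 i d i<j) (arith-102 i d L j<L) s~ t~
        -- Here the arc from `i` to the attachment of `t` passes the end of the period and leads to
        -- `j + L`.
        two-attachments i j i<L j<L i≢j s~ t~ | tri> _ _ j<i with m≤n⇒∃[o]m+o≡n (≤-trans (<⇒≤ i<L) (m≤n+m L j))
        ...   | d , eq = impossible i d (arith-113 i d j L eq i<L) (arith-114 i d j L eq j<i) s~
                (subst (λ v → t ~ v) (sym (trans (cong c eq) (periodic j))) t~)
        split : Dec (deg s verts ≤ 1) → Dec (deg t verts ≤ 1) → ⊥
        split (yes few) _ = finish path unique P⊆U deg-s few
        split _ (yes few) = finish (Path-reverse path) (Unique-↭ (↭-sym (Perm.↭-reverse P)) unique)
          (λ v∈ → P⊆U (Perm.∈-resp-↭ (Perm.↭-reverse P) v∈)) (trans deg-t (sym (deg-↭ t (Perm.↭-reverse P)))) few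
        split (no many) (no many′) with deg-positive {s} {verts} (≤-trans (s≤s z≤n) (≰⇒> many))
        ... | u , u∈ , s~u = many′ (Σl-≤1 verts (E t) verts-unique
            (λ x y x∈ y∈ h₁ h₂ → trans (at x x∈ h₁) (sym (at y y∈ h₂))))
          where
          at : ∀ x → x ∈ verts → t ~ x → x ≡ u
          at x x∈ t~x with x ≟ᵥ u
          ... | yes eq = eq
          ... | no neq with ∈-verts u∈ | ∈-verts x∈
          ...   | i , i<L , refl | j , j<L , refl = ⊥-elim (two-attachments i j i<L j<L (λ { refl → neq refl }) s~u t~x)

-- Two disjoint long cycles

arith-115 : ∀ v1 q → 2 * suc v1 ≤ q + 2 → 2 * suc (suc v1) ≤ suc (suc q) + 2
arith-115 v1 q h1 = linear (v1 ∷ q ∷ []) 0 (con 2 ⊛ (con 1 ⊕ (con 1 ⊕ x0))) (con 1 ⊕ (con 1 ⊕ x1) ⊕ con 2)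
    (hyp (con 1) (con 2 ⊛ (con 1 ⊕ x0)) (x1 ⊕ con 2) h1 ∷ []) refl

arith-116 : ∀ q v1 → q < 2 * suc v1 → suc (suc q) < 2 * suc (suc v1)
arith-116 q v1 h1 = linear (q ∷ v1 ∷ []) 0 (con 1 ⊕ (con 1 ⊕ (con 1 ⊕ x0))) (con 2 ⊛ (con 1 ⊕ (con 1 ⊕ x1)))
    (hyp (con 1) (con 1 ⊕ x0) (con 2 ⊛ (con 1 ⊕ x1)) h1 ∷ []) refl

arith-117 : ∀ v1 d r → v1 ≡ suc d → r ≤ d → d + r + 2 ≤ 2 * v1
arith-117 v1 d r h1 h2 = linear (v1 ∷ d ∷ r ∷ []) 0 (x1 ⊕ x2 ⊕ con 2) (con 2 ⊛ x0)
    (equ (con 2) (con 1 ⊕ x1) x0 (sym h1) ∷ hyp (con 1) x2 x1 h2 ∷ []) refl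

arith-118 : ∀ v1 r d → v1 ≡ suc r → d < r → d + r + 2 ≤ 2 * v1
arith-118 v1 r d h1 h2 = linear (v1 ∷ r ∷ d ∷ []) 0 (x2 ⊕ x1 ⊕ con 2) (con 2 ⊛ x0)
    (equ (con 2) (con 1 ⊕ x1) x0 (sym h1) ∷ hyp (con 1) (con 1 ⊕ x2) x1 h2 ∷ []) refl

arith-119 : ∀ h q → 2 * h ≤ q + 2 → 3 ≤ q → h ≤ q
arith-119 h q h1 h2 = linear (h ∷ q ∷ []) 5 x0 x1
    (hyp (con 3) (con 2 ⊛ x0) (x1 ⊕ con 2) h1 ∷ hyp (con 2) (con 3) x1 h2 ∷ []) refl

arith-120 : ∀ L q h → L ≤ 2 * q → q < 2 * h → L ≤ h + (h + (h + h))
arith-120 L q h h1 h2 = linear (L ∷ q ∷ h ∷ []) 0 x0 (x2 ⊕ (x2 ⊕ (x2 ⊕ x2)))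
    (hyp (con 1) x0 (con 2 ⊛ x1) h1 ∷ hyp (con 2) (con 1 ⊕ x1) (con 2 ⊛ x2) h2 ∷ []) refl

arith-121 : ∀ i d h q L → i + d < h → h ≤ q → q ≤ L → d < L
arith-121 i d h q L h1 h2 h3 = linear (i ∷ d ∷ h ∷ q ∷ L ∷ []) 0 (con 1 ⊕ x1) x4
    (hyp (con 1) (con 1 ⊕ (x0 ⊕ x1)) x2 h1 ∷ hyp (con 1) x2 x3 h2 ∷ hyp (con 1) x3 x4 h3 ∷ []) refl

arith-122 : ∀ v1 d h i → v1 < d → h ≤ v1 → i + d < h → ⊥
arith-122 v1 d h i h1 h2 h3 = 1≰0 (linear (v1 ∷ d ∷ h ∷ i ∷ []) 1 (con 1) (con 0)
    (hyp (con 1) (con 1 ⊕ x0) x1 h1 ∷ hyp (con 1) x2 x0 h2 ∷ hyp (con 1) (con 1 ⊕ (x3 ⊕ x1)) x2 h3 ∷ []) refl)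

arith-123 : ∀ v1 d v2 h j → v1 < d → v1 ≡ v2 → h ≤ v2 → j + d < h → ⊥
arith-123 v1 d v2 h j h1 h2 h3 h4 = 1≰0 (linear (v1 ∷ d ∷ v2 ∷ h ∷ j ∷ []) 1 (con 1) (con 0)
    (hyp (con 1) (con 1 ⊕ x0) x1 h1 ∷ equ (con 1) x2 x0 (sym h2) ∷ hyp (con 1) x3 x2 h3 ∷
    hyp (con 1) (con 1 ⊕ (x4 ⊕ x1)) x3 h4 ∷ []) refl)

arith-124 : ∀ q v1 h → q + 2 ≤ 2 * v1 → 2 * h ≤ q + 2 → h ≤ v1
arith-124 q v1 h h1 h2 = linear (q ∷ v1 ∷ h ∷ []) 1 x2 x1
    (hyp (con 1) (x0 ⊕ con 2) (con 2 ⊛ x1) h1 ∷ hyp (con 1) (con 2 ⊛ x2) (x0 ⊕ con 2) h2 ∷ []) refl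

arith-125 : ∀ v1 L v2 q v3 → 2 * v1 ≤ L → 2 * v2 ≤ q → 1 ≤ v3 → 2 * (v1 + v2) ≤ L + 8 + q * v3
arith-125 v1 L v2 q v3 h1 h2 h3 = linear (v1 ∷ L ∷ v2 ∷ q ∷ v3 ∷ []) 0 (con 2 ⊛ (x0 ⊕ x2)) (x1 ⊕ con 8 ⊕ x3 ⊛ x4)
    (hyp (con 1) (con 2 ⊛ x0) x1 h1 ∷ hyp (con 1) (con 2 ⊛ x2) x3 h2 ∷ hyp x3 (con 1) x4 h3 ∷ []) refl

arith-126 : ∀ v1 L v2 v3 → 2 * v1 ≤ L → v2 < 2 → 2 * (v1 + v2) ≤ L + 8 + v3
arith-126 v1 L v2 v3 h1 h2 = linear (v1 ∷ L ∷ v2 ∷ v3 ∷ []) 0 (con 2 ⊛ (x0 ⊕ x2)) (x1 ⊕ con 8 ⊕ x3)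
    (hyp (con 1) (con 2 ⊛ x0) x1 h1 ∷ hyp (con 2) (con 1 ⊕ x2) (con 2) h2 ∷ []) refl

arith-127 : ∀ v1 v2 v3 v4 v5 v6 q L v7 → v1 ≤ v2 + (v3 + (v4 + v5)) → v2 ≤ 1 → v3 ≤ 1 → v4 ≤ 1 → v5 ≤ 1 →
    2 * v6 ≤ q → q ≤ L → 2 * (v1 + v6) ≤ L + 8 + v7
arith-127 v1 v2 v3 v4 v5 v6 q L v7 h1 h2 h3 h4 h5 h6 h7 = linear (v1 ∷ v2 ∷ v3 ∷ v4 ∷ v5 ∷ v6 ∷ q ∷ L ∷ v7 ∷
    []) 0 (con 2 ⊛ (x0 ⊕ x5)) (x7 ⊕ con 8 ⊕ x8)
    (hyp (con 2) x0 (x1 ⊕ (x2 ⊕ (x3 ⊕ x4))) h1 ∷ hyp (con 2) x1 (con 1) h2 ∷ hyp (con 2) x2 (con 1) h3 ∷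
    hyp (con 2) x3 (con 1) h4 ∷ hyp (con 2) x4 (con 1) h5 ∷ hyp (con 1) (con 2 ⊛ x5) x6 h6 ∷ hyp (con 1) x6 x7 h7 ∷
    []) refl

arith-128 : ∀ v1 v2 v3 v4 q v5 v6 v7 v8 v9 v10 v11 v12 L → v1 ≡ v2 → v2 ≡ v3 + v4 → v3 ≤ q + (q + (q + q)) →
    v5 ≡ v6 → v6 ≡ v7 + (2 * v8 + v9) → v7 ≤ q * q → v4 ≡ v10 → v8 ≡ v11 → 2 * (v10 + v11) ≤ v12 * (L + 8) +
    q * 4 → 2 * v1 + v5 ≤ q * q + v12 * L + v9 + 12 * q + 8 * v12
arith-128 v1 v2 v3 v4 q v5 v6 v7 v8 v9 v10 v11 v12 L h1 h2 h3 h4 h5 h6 h7 h8 h9 =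
    linear (v1 ∷ v2 ∷ v3 ∷ v4 ∷ q ∷ v5 ∷ v6 ∷ v7 ∷ v8 ∷ v9 ∷ v10 ∷ v11 ∷ v12 ∷ L ∷ []) 0 (con 2 ⊛ x0 ⊕ x5)
    (x4 ⊛ x4 ⊕ x12 ⊛ x13 ⊕ x9 ⊕ con 12 ⊛ x4 ⊕ con 8 ⊛ x12)
    (equ (con 2) x0 x1 h1 ∷ equ (con 2) x1 (x2 ⊕ x3) h2 ∷ hyp (con 2) x2 (x4 ⊕ (x4 ⊕ (x4 ⊕ x4))) h3 ∷
    equ (con 1) x5 x6 h4 ∷ equ (con 1) x6 (x7 ⊕ (con 2 ⊛ x8 ⊕ x9)) h5 ∷ hyp (con 1) x7 (x4 ⊛ x4) h6 ∷
    equ (con 2) x3 x10 h7 ∷ equ (con 2) x8 x11 h8 ∷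
    hyp (con 1) (con 2 ⊛ (x10 ⊕ x11)) (x12 ⊛ (x13 ⊕ con 8) ⊕ x4 ⊛ con 4) h9 ∷ []) refl

-- Either no value exceeds 1 and the number of terms bounds the sum, or one value is at least 2 and
-- all the others vanish.
Σl-star : ∀ {A : Set} (xs : List A) q (F : A → ℕ) → Unique xs → length xs ≤ q → (∀ x → x ∈ xs → F x ≤ q) →
  (∀ x y → x ∈ xs → y ∈ xs → x ≢ y → 1 ≤ F x → 2 ≤ F y → ⊥) → Σl xs F ≤ q
Σl-star [] q F u l b h = z≤n
Σl-star (x ∷ xs) q F (x∉ ∷ u) l b h with F x in eq
... | zero = Σl-star xs q F u (≤-trans (n≤1+n _) l) (λ y y∈ → b y (there y∈))
    (λ y z y∈ z∈ → h y z (there y∈) (there z∈))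
... | suc zero = ≤-trans (s≤s (≤-trans (Σl-≤const xs 1 at-most-1) (≤-reflexive (*-identityʳ _)))) l
  where
  at-most-1 : ∀ y → y ∈ xs → F y ≤ 1
  at-most-1 y y∈ = ≮⇒≥ (λ 2≤ → h x y (here refl) (there y∈) (All.lookup x∉ y∈) (≤-reflexive (sym eq)) 2≤)
... | suc (suc k) = ≤-trans (+-monoʳ-≤ (suc (suc k)) (Σl-≤const xs 0 none))
    (≤-trans (≤-reflexive (trans (cong (suc (suc k) +_) (*-zeroʳ (length xs)))
        (trans (+-identityʳ _) (sym eq)))) (b x (here refl)))
  where
  none : ∀ y → y ∈ xs → F y ≤ 0
  none y y∈ = ≮⇒≥ (λ 1≤ → h y x (there y∈) (here refl) (λ y≡x → All.lookup x∉ y∈ (sym y≡x)) 1≤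
      (≤-trans (s≤s (s≤s z≤n)) (≤-reflexive (sym eq))))

≤ᵇ-true : ∀ {m n} → m ≤ n → (m ≤ᵇ n) ≡ true
≤ᵇ-true {m} {n} h with m ≤ᵇ n | ≤⇒≤ᵇ h
... | true | _ = refl

≤ᵇ-sound : ∀ {m n} → (m ≤ᵇ n) ≡ true → m ≤ n
≤ᵇ-sound {m} {n} eq = ≤ᵇ⇒≤ m n (subst T (sym eq) tt)

⟦⟧-zero : ∀ {b} → ⟦ b ⟧ ≡ 0 → b ≡ false
⟦⟧-zero {false} _ = refl

half-bounds : ∀ q → 2 * suc ⌊ q /2⌋ ≤ q + 2 × q < 2 * suc ⌊ q /2⌋
half-bounds zero = ≤-refl , s≤s z≤n
half-bounds (suc zero) = s≤s (s≤s z≤n) , ≤-refl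
half-bounds (suc (suc q)) with half-bounds q
... | a , b = (arith-115 (⌊ q /2⌋) q a) , (arith-116 q (⌊ q /2⌋) b)

module TwoCycles (G : SimpleGraph) where

  open GraphTheory G
  open MinDegree G public

  another : ∀ w xs v → Unique xs → 2 ≤ deg w xs → ∃ λ u → u ∈ xs × u ≢ v × w ~ u
  another w (x ∷ xs) v (x∉ ∷ ux) 2≤ with E w x in eq
  ... | false with another w xs v ux 2≤
  ...   | u , u∈ , u≢v , w~u = u , there u∈ , u≢v , w~u
  another w (x ∷ xs) v (x∉ ∷ ux) 2≤ | true with x ≟ᵥ v
  ...   | no x≢v = x , here refl , x≢v , eq
  ...   | yes refl with deg-positive {w} {xs} (≤-pred 2≤)
  ...     | u , u∈ , w~u = u , there u∈ , (λ u≡x → All.lookup x∉ u∈ (sym u≡x)) , w~u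

  module _ {q : ℕ} (K : Circuit q) where

    open Arcs K

    -- The two arcs between `u` and `v` share just these ends, so they have q + 2 vertices together
    -- and the larger one at least half of them.
    long-arc : ∀ {u v} → u ∈ verts → v ∈ verts → u ≢ v → ∃ λ P → Path u v P × Unique P × P ⊆ verts × q + 2 ≤
        2 * length P
    long-arc {u} {v} u∈ v∈ u≢v with ∈-verts u∈ | ∈-verts v∈
    ... | i , i<q , refl | j , j<q , refl = choose (<-cmp i j)
      where
      arcs : ∀ i d → 1 ≤ d → d < q → ∃ λ P → Path (c i) (c (i + d)) P × Unique P × P ⊆ verts × q + 2 ≤ 2 * length P
      arcs i d 1≤d d<q with m≤n⇒∃[o]m+o≡n (<⇒≤ d<q)
      ... | r , refl with r ≤? d
      ...   | yes r≤d = arc i (suc d) , arc-path i d , arc-unique i (suc d) d<q , arc-⊆ {i} ,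
                (arith-117 (length (arc i (suc d))) d r (arc-length i (suc d)) r≤d)
      ...   | no r≰d = reverse A , subst (λ x → Path x (c (i + d)) (reverse A)) end
          (Path-reverse (arc-path (i + d) r)) ,
                Unique-↭ (↭-sym (Perm.↭-reverse A)) (arc-unique (i + d) (suc r) (arith-91 d r 1≤d)) ,
                (λ v∈ → arc-⊆ {i + d} (Perm.∈-resp-↭ (Perm.↭-reverse A) v∈)) ,
                (arith-118 (length (reverse A)) r d (trans (length-reverse A) (arc-length (i + d) (suc r))) (≰⇒> r≰d))
        where
        A = arc (i + d) (suc r)
        end : c (i + d + r) ≡ c i
        end = trans (cong c (+-assoc i d r)) (periodic i)
      choose : _ → ∃ λ P → Path (c i) (c j) P × Unique P × P ⊆ verts × q + 2 ≤ 2 * length P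
      choose (tri≈ _ refl _) = ⊥-elim (u≢v refl)
      choose (tri< i<j _ _) with m≤n⇒∃[o]m+o≡n (<⇒≤ i<j)
      ... | d , refl = arcs i d (arith-101 i d i<j) (arith-102 i d q j<q)
      choose (tri> _ _ j<i) with m≤n⇒∃[o]m+o≡n (<⇒≤ j<i)
      ... | d , refl with arcs j d (arith-101 j d j<i) (arith-102 j d q i<q)
      ...   | P , path , uP , P⊆ , long = reverse P , Path-reverse path , Unique-↭ (↭-sym (Perm.↭-reverse P)) uP ,
                (λ v∈ → P⊆ (Perm.∈-resp-↭ (Perm.↭-reverse P) v∈)) , subst (λ l → q + 2 ≤ 2 * l)
                    (sym (length-reverse P)) long

  module _ {L : ℕ} (C : Circuit L) {S : List Vertex} (verts⊆S : Arcs.verts C ⊆ S) (longest : CyclesIn S L) where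

    open Arcs C
    open Longest C verts⊆S longest

    -- The number `h` is q/2 + 1 rounded down: small enough that Q joins any two of its vertices by
    -- a path with `h` vertices, and large enough that four arcs of `h` vertices cover C.
    module _ {W : List Vertex} (uW : Unique W) (W⊆S : W ⊆ S) (W∉ : ∀ {v} → v ∈ W → v ∉ verts)
             {Q : List Vertex} (cycQ : Cycle Q) (Q⊆W : Q ⊆ W) (longestQ : CyclesIn W (length Q))
                 (L≤2q : L ≤ 2 * length Q)
             {R : List Vertex} (perm : W ↭ Q ++ R) (h : ℕ) (2h≤q+2 : 2 * h ≤ length Q + 2)
                 (q<2h : length Q < 2 * h) where

      private
        q = length Q
        K = proj₁ (circuit cycQ)
        module K = Arcs K
        vK : K.verts ≡ Q
        vK = proj₂ (circuit cycQ)
        uQ = Cycle.unique cycQ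

        q≤L : q ≤ L
        q≤L = longest cycQ (λ v∈ → W⊆S (Q⊆W v∈))

        h≤q : h ≤ q
        h≤q = arith-119 h q 2h≤q+2 (Cycle.long cycQ)

        L≤4h : L ≤ h + (h + (h + h))
        L≤4h = arith-120 L q h L≤2q q<2h

        block : ℕ → List Vertex
        block β = arc β h

        -- Two vertices of a block are fewer than `h` steps apart on C, so a path with `h` vertices
        -- between them would be a detour that lengthens C.
        no-connection : ∀ β {x y s t P} → x ∈ block β → y ∈ block β → x ≢ y → Path s t P → Unique P →
            Outside P → h ≤ length P →
          s ~ x → t ~ y → ⊥
        no-connection β {s = s} {t} {P} x∈ y∈ x≢y path uP out long s~ t~ with ∈-arc {β} x∈ | ∈-arc {β} y∈
        ... | i , i<h , refl | j , j<h , refl with <-cmp i j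
        ... | tri≈ _ refl _ = x≢y refl
        ... | tri< i<j _ _ with m≤n⇒∃[o]m+o≡n (<⇒≤ i<j)
        ...   | d , refl = arith-122 (length P) d h i (detour path uP out (β + i) d (arith-101 i d i<j)
            (arith-121 i d h q L j<h h≤q q≤L) s~ (subst (λ v → t ~ c v) (sym (+-assoc β i d)) t~)) long j<h
        no-connection β {s = s} {t} {P} x∈ y∈ x≢y path uP out long s~ t~ | i , i<h , refl | j , j<h ,
            refl | tri> _ _ j<i with m≤n⇒∃[o]m+o≡n (<⇒≤ j<i)
        ...   | d , refl = arith-123 (length (reverse P)) d (length P) h j
            (detour (Path-reverse path) (Unique-↭ (↭-sym (Perm.↭-reverse P)) uP) (reverse-outside out)
            (β + j) d (arith-101 j d j<i) (arith-121 j d h q L i<h h≤q q≤L) t~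
            (subst (λ v → s ~ c v) (sym (+-assoc β j d)) s~)) (length-reverse P) long i<h

        Q-path : ∀ {u v} → u ∈ Q → v ∈ Q → u ≢ v → ∃ λ P → Path u v P × Unique P × P ⊆ Q × h ≤ length P
        Q-path u∈ v∈ u≢v with long-arc K (subst (_ ∈_) (sym vK) u∈) (subst (_ ∈_) (sym vK) v∈) u≢v
        ... | P , path , uP , P⊆ , long = P , path , uP , (λ x∈ → subst (_ ∈_) vK (P⊆ x∈)) ,
              (arith-124 q (length P) h long 2h≤q+2)

        Q-outside : ∀ {P} → P ⊆ Q → Outside P
        Q-outside P⊆ = (λ v∈ → W⊆S (Q⊆W (P⊆ v∈))) , (λ v∈ → W∉ (Q⊆W (P⊆ v∈)))

        -- If one vertex of the block has two neighbours on Q and another has one, there are two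
        -- disjoint edges to Q, and a long path of Q between their ends is a forbidden connection.
        -- So the degrees satisfy the condition of `Σl-star`.
        block-edges : ∀ β → e (block β) Q ≤ q
        block-edges β = Σl-star (block β) q (λ x → deg x Q) (arc-unique β h (≤-trans h≤q q≤L))
            (≤-trans (≤-reflexive (arc-length β h)) h≤q)
          (λ x _ → deg-≤length x Q) disjoint-edges
          where
          disjoint-edges : ∀ x y → x ∈ block β → y ∈ block β → x ≢ y → 1 ≤ deg x Q → 2 ≤ deg y Q → ⊥
          disjoint-edges x y x∈ y∈ x≢y 1≤ 2≤ =
            let u , u∈ , x~u = deg-positive {x} {Q} 1≤
                v , v∈ , v≢u , y~v = another y Q u uQ 2≤
                P , path , uP , P⊆ , long = Q-path u∈ v∈ (v≢u ∘ sym)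
            in no-connection β x∈ y∈ x≢y path uP (Q-outside P⊆) long (~-sym x~u) (~-sym y~v)

        -- The blocks may overlap, as `4h` can exceed `L` and the last block then continues round
        -- the circuit.
        four-blocks : ∀ (f : Vertex → ℕ) → Σl verts f ≤ Σl (block 0) f +
            (Σl (block h) f + (Σl (block (h + h)) f + Σl (block (h + h + h)) f))
        four-blocks f = begin
          Σl verts f                                             ≡⟨ Σl-applyUpTo c L f ⟩
          ∑ L g                                                  ≤⟨ ∑-extend g L≤4h ⟩
          ∑ (h + (h + (h + h))) g                                ≡⟨ ∑-split h (h + (h + h)) g ⟩
          ∑ h g + ∑ (h + (h + h)) (λ i → g (h + i))              ≡⟨ cong (∑ h g +_)
              (∑-split h (h + h) (λ i → g (h + i))) ⟩
          ∑ h g + (∑ h (λ i → g (h + i)) + ∑ (h + h) (λ i → g (h + (h + i))))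
            ≡⟨ cong (λ z → ∑ h g + (∑ h (λ i → g (h + i)) + z)) (∑-split h h (λ i → g (h + (h + i)))) ⟩
          ∑ h g + (∑ h (λ i → g (h + i)) + (∑ h (λ i → g (h + (h + i))) + ∑ h (λ i → g (h + (h + (h + i))))))
            ≡⟨ cong₂ _+_ (sym (Σl-applyUpTo _ h f)) (cong₂ _+_ (sym (Σl-applyUpTo _ h f)) (cong₂ _+_
                 (trans (∑-cong h (λ i _ → cong g (sym (+-assoc h h i)))) (sym (Σl-applyUpTo _ h f)))
                 (trans (∑-cong h (λ i _ → cong g
                     (trans (cong (h +_) (sym (+-assoc h h i)))
                     (trans (sym (+-assoc h (h + h) i)) (cong (_+ i) (sym (+-assoc h h h)))))))
                     (sym (Σl-applyUpTo _ h f))))) ⟩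
          Σl (block 0) f + (Σl (block h) f + (Σl (block (h + h)) f + Σl (block (h + h + h)) f)) ∎
          where
          open ≤-Reasoning
          g : ℕ → ℕ
          g i = f (c i)

        verts-Q : e verts Q ≤ q + (q + (q + q))
        verts-Q = ≤-trans (four-blocks (λ x → deg x Q))
            (+-mono-≤ (block-edges _) (+-mono-≤ (block-edges _) (+-mono-≤ (block-edges _) (block-edges _))))

        W-split = Unique-++⁻ Q (Unique-↭ perm uW)
        R⊆W : R ⊆ W
        R⊆W v∈ = Perm.∈-resp-↭ (↭-sym perm) (∈-++⁺ʳ Q v∈)
        R∉Q : ∀ {v} → v ∈ R → v ∉ Q
        R∉Q v∈ v∈′ = proj₂ (proj₂ W-split) v∈′ v∈

        -- Rich vertices are the exceptions to the rule that a vertex of R has at most one neighbour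
        -- on Q or at most one in each block.
        rich : ℕ → Vertex → Bool
        rich β w = (2 ≤ᵇ deg w (block β)) ∧ (2 ≤ᵇ deg w Q)

        -- The vertices `w` and `w′` extend a long path of Q to a forbidden connection of the block
        -- with itself. Having two neighbours both in the block and on Q, `w` can avoid the ones
        -- chosen for `w′`.
        two-rich : ∀ β {w w′} → w ∈ R → w′ ∈ R → w ≢ w′ → 2 ≤ deg w (block β) → 2 ≤ deg w Q →
          1 ≤ deg w′ (block β) → 1 ≤ deg w′ Q → ⊥
        two-rich β {w} {w′} w∈ w′∈ w≢w′ r₁ r₂ r₁′ r₂′ =
          let y , y∈ , w′~y = deg-positive {w′} {block β} r₁′
              v , v∈ , w′~v = deg-positive {w′} {Q} r₂′
              x , x∈ , x≢y , w~x = another w (block β) y (arc-unique β h (≤-trans h≤q q≤L)) r₁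
              u , u∈ , u≢v , w~u = another w Q v uQ r₂
              P , path , uP , P⊆ , long = Q-path u∈ v∈ u≢v
          in no-connection β x∈ y∈ x≢y (w~u ∷ Path-++ path (~-sym w′~v) single) (unique uP P⊆) (outside P⊆)
               (≤-trans long (≤-trans (m≤m+n (length P) 1)
                   (≤-trans (≤-reflexive (sym (length-++ P))) (n≤1+n _)))) w~x w′~y
          where
          unique : ∀ {P} → Unique P → P ⊆ Q → Unique (w ∷ P ++ [ w′ ])
          unique {P} uP P⊆ = All.tabulate (λ z∈ w≡z → not-w (∈-++⁻ P z∈) w≡z) ∷ Unique.++⁺ uP ([] ∷ [])
              (λ { (z∈ , here refl) → R∉Q w′∈ (P⊆ z∈) })
            where
            not-w : ∀ {z} → z ∈ P ⊎ z ∈ [ w′ ] → w ≢ z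
            not-w (inj₁ z∈) refl = R∉Q w∈ (P⊆ z∈)
            not-w (inj₂ (here refl)) w≡z = w≢w′ w≡z
          outside : ∀ {P} → P ⊆ Q → Outside (w ∷ P ++ [ w′ ])
          outside {P} P⊆ = (λ z∈ → W⊆S (inW z∈)) , (λ z∈ → W∉ (inW z∈))
            where
            inW : (w ∷ P ++ [ w′ ]) ⊆ W
            inW (here refl) = R⊆W w∈
            inW (there z∈) with ∈-++⁻ P z∈
            ... | inj₁ z∈′ = Q⊆W (P⊆ z∈′)
            ... | inj₂ (here refl) = R⊆W w′∈

        rich-unique : ∀ β → Σl R (⟦_⟧ ∘ rich β) ≤ 1
        rich-unique β = Σl-≤1 R (rich β) (proj₁ (proj₂ W-split)) same
          where
          same : ∀ w w′ → w ∈ R → w′ ∈ R → rich β w ≡ true → rich β w′ ≡ true → w ≡ w′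
          same w w′ w∈ w′∈ r r′ = decidable-stable (w ≟ᵥ w′)
              (λ w≢w′ → two-rich β w∈ w′∈ w≢w′ (≤ᵇ-sound (proj₁ (∧-true r))) (≤ᵇ-sound (proj₂ (∧-true r)))
            (≤-trans (s≤s z≤n) (≤ᵇ-sound (proj₁ (∧-true r′)))) (≤-trans (s≤s z≤n) (≤ᵇ-sound (proj₂ (∧-true r′)))))

        richness : Vertex → ℕ
        richness w = ⟦ rich 0 w ⟧ + (⟦ rich h w ⟧ + (⟦ rich (h + h) w ⟧ + ⟦ rich (h + h + h) w ⟧))

        -- A vertex that is rich for no block has at most one neighbour on Q or at most four on C,
        -- while the other degree is at most L/2; this gives the summand 8. For a rich vertex both
        -- degrees can be half of the maximum, and `q` covers the one into Q.
        split-degree : ∀ w → w ∈ R → 2 * (deg w verts + deg w Q) ≤ L + 8 + q * richness w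
        split-degree w w∈ = cases (2 ≤? deg w Q)
          where
          half-C : 2 * deg w verts ≤ L
          half-C = deg-half (W⊆S (R⊆W w∈)) (W∉ (R⊆W w∈))
          half-Q : 2 * deg w Q ≤ q
          half-Q = ≤-trans (≤-reflexive (cong (λ z → 2 * deg w z) (sym vK)))
            (Longest.deg-half K (λ v∈ → Q⊆W (subst (_ ∈_) vK v∈)) longestQ (R⊆W w∈)
                (λ v∈ → R∉Q w∈ (subst (w ∈_) vK v∈)))
          poor : ∀ β → 2 ≤ deg w Q → rich β w ≡ false → deg w (block β) ≤ 1
          poor β 2≤ eq with 2 ≤? deg w (block β)
          ... | no ¬p = ≤-pred (≰⇒> ¬p)
          ... | yes p = case trans (sym eq) (cong₂ _∧_ (≤ᵇ-true p) (≤ᵇ-true 2≤)) of λ ()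
          some-rich : 1 ≤ richness w → 2 * (deg w verts + deg w Q) ≤ L + 8 + q * richness w
          some-rich pos = arith-125 (deg w verts) L (deg w Q) q (richness w) half-C half-Q pos
          cases : Dec (2 ≤ deg w Q) → 2 * (deg w verts + deg w Q) ≤ L + 8 + q * richness w
          cases (no few) = arith-126 (deg w verts) L (deg w Q) (q * richness w) half-C (≰⇒> few)
          cases (yes 2≤) = by-richness (1 ≤? richness w)
            where
            by-richness : Dec (1 ≤ richness w) → 2 * (deg w verts + deg w Q) ≤ L + 8 + q * richness w
            by-richness (yes pos) = some-rich pos
            by-richness (no none) =
                  arith-127 (deg w verts) (deg w (block 0)) (deg w (block h)) (deg w (block (h + h)))
                      (deg w (block (h + h + h))) (deg w Q) q L (q * richness w)
                      (four-blocks (λ v → ⟦ E w v ⟧)) (poor 0 2≤ (⟦⟧-zero (m+n≡0⇒m≡0 r₀ eq)))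
                      (poor h 2≤ (⟦⟧-zero (m+n≡0⇒m≡0 r₁ eq₁))) (poor (h + h) 2≤ (⟦⟧-zero (m+n≡0⇒m≡0 r₂ eq₂)))
                      (poor (h + h + h) 2≤ (⟦⟧-zero (m+n≡0⇒n≡0 r₂ eq₂))) half-Q q≤L
              where
              r₀ = ⟦ rich 0 w ⟧
              r₁ = ⟦ rich h w ⟧
              r₂ = ⟦ rich (h + h) w ⟧
              r₃ = ⟦ rich (h + h + h) w ⟧
              eq : r₀ + (r₁ + (r₂ + r₃)) ≡ 0
              eq = n<1⇒n≡0 (≰⇒> none)
              eq₁ : r₁ + (r₂ + r₃) ≡ 0
              eq₁ = m+n≡0⇒n≡0 r₀ eq
              eq₂ : r₂ + r₃ ≡ 0
              eq₂ = m+n≡0⇒n≡0 r₁ eq₁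

        total-richness : Σl R richness ≤ 4
        total-richness = ≤-trans (≤-reflexive (trans (Σl-+ R _ _) (cong (Σl R (⟦_⟧ ∘ rich 0) +_) (trans (Σl-+ R _ _)
            (cong (Σl R (⟦_⟧ ∘ rich h) +_) (Σl-+ R _ _))))))
          (+-mono-≤ (rich-unique 0) (+-mono-≤ (rich-unique h)
              (+-mono-≤ (rich-unique (h + h)) (rich-unique (h + h + h)))))

        R-edges : 2 * (e R verts + e R Q) ≤ length R * (L + 8) + q * 4
        R-edges = begin
          2 * (e R verts + e R Q)                              ≡⟨ cong (2 *_) (sym (Σl-+ R _ _)) ⟩
          2 * Σl R (λ w → deg w verts + deg w Q)               ≡⟨ sym (Σl-*ˡ R 2 _) ⟩
          Σl R (λ w → 2 * (deg w verts + deg w Q))             ≤⟨ Σl-mono R split-degree ⟩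
          Σl R (λ w → L + 8 + q * richness w)                  ≡⟨ trans (Σl-+ R _ _)
              (cong₂ _+_ (Σl-const R (L + 8)) (Σl-*ˡ R q richness)) ⟩
          length R * (L + 8) + q * Σl R richness               ≤⟨ +-monoʳ-≤ (length R * (L + 8))
              (*-monoʳ-≤ q total-richness) ⟩
          length R * (L + 8) + q * 4                           ∎
          where open ≤-Reasoning

      -- Of the term `12 * length Q`, eight parts come from twice the edges between C and Q, at most
      -- `q` for each of four blocks, and four parts from the at most four rich incidences. The
      -- edges from R to C and Q together cost about as much as C alone could receive.
      two-cycles-bound : out verts W ≤ length Q * length Q + length R * L + ee R + 12 * length Q + 8 * length R
      two-cycles-bound =
        arith-128 (e verts W) (e verts (Q ++ R)) (e verts Q) (e verts R) q (ee W) (ee (Q ++ R)) (ee Q)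
            (e Q R) (ee R) (e R verts) (e R Q) (length R) L (e-↭ {verts} ↭-refl perm) (e-++ʳ verts Q R)
            verts-Q (e-↭ perm perm) (ee-++ Q R) (e-≤length Q Q) (e-sym verts R) (e-sym Q R) R-edges

-- The structure around a longest cycle

arith-129 : ∀ v1 v2 → 2 * v1 + v2 ≡ v2 * v2 → 2 * (v2 + v1) + (1 + v2) ≡ (1 + v2) * (1 + v2)
arith-129 v1 v2 h1 = ≤-antisym (linear (v1 ∷ v2 ∷ []) 0 (con 2 ⊛ (x1 ⊕ x0) ⊕ (con 1 ⊕ x1)) ((con 1 ⊕ x1) ⊛ (con 1 ⊕ x1))
    (equ (con 1) (con 2 ⊛ x0 ⊕ x1) (x1 ⊛ x1) h1 ∷ []) refl)
        (linear (v1 ∷ v2 ∷ []) 0 ((con 1 ⊕ x1) ⊛ (con 1 ⊕ x1)) (con 2 ⊛ (x1 ⊕ x0) ⊕ (con 1 ⊕ x1))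
    (equ (con 1) (x1 ⊛ x1) (con 2 ⊛ x0 ⊕ x1) (sym h1) ∷ []) refl)

arith-130 : ∀ o μ p → o ≤ μ → 2 * p + o ≡ o * o → 2 * (μ * o) ≤ 2 * p + μ * μ + μ
arith-130 o μ p h1 h2 = linear (o ∷ μ ∷ p ∷ []) 0 (con 2 ⊛ (x1 ⊛ x0)) (con 2 ⊛ x2 ⊕ x1 ⊛ x1 ⊕ x1)
    (hyp (con 1) x0 x1 h1 ∷ equ (con 1) (x0 ⊛ x0) (con 2 ⊛ x2 ⊕ x0) (sym h2) ∷ prod (con 1) x0 x1 h1 x0 x1 h1 ∷
    []) refl

arith-131 : ∀ μ o p → μ < o → 2 * p + o ≡ o * o → 2 * (μ * o) ≤ 2 * p + μ * μ + μ
arith-131 μ o p h1 h2 = linear (μ ∷ o ∷ p ∷ []) 0 (con 2 ⊛ (x0 ⊛ x1)) (con 2 ⊛ x2 ⊕ x0 ⊛ x0 ⊕ x0)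
    (hyp (con 1) (con 1 ⊕ x0) x1 h1 ∷ equ (con 1) (x1 ⊛ x1) (con 2 ⊛ x2 ⊕ x1) (sym h2) ∷
    prod (con 1) (con 1 ⊕ x0) x1 h1 (con 1 ⊕ x0) x1 h1 ∷ []) refl

arith-132 : ∀ v1 v2 v3 a k L′ ρ → v1 ≤ v2 + v3 → v2 ≤ 2 * (a * k) + k * k → v3 ≡ L′ * ρ → v1 ≤ L′ * ρ +
    (2 * (a * k) + k * k)
arith-132 v1 v2 v3 a k L′ ρ h1 h2 h3 = linear (v1 ∷ v2 ∷ v3 ∷ a ∷ k ∷ L′ ∷ ρ ∷ []) 0 x0
    (x5 ⊛ x6 ⊕ (con 2 ⊛ (x3 ⊛ x4) ⊕ x4 ⊛ x4))
    (hyp (con 1) x0 (x1 ⊕ x2) h1 ∷ hyp (con 1) x1 (con 2 ⊛ (x3 ⊛ x4) ⊕ x4 ⊛ x4) h2 ∷ equ (con 1) x2 (x5 ⊛ x6) h3 ∷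
    []) refl

arith-133 : ∀ L′ v1 → 4 ≤ L′ → L′ < 2 * suc v1 → 3 ≤ suc v1
arith-133 L′ v1 h1 h2 = linear (L′ ∷ v1 ∷ []) 2999 (con 3) (con 1 ⊕ x1)
    (hyp (con 1001) (con 4) x0 h1 ∷ hyp (con 1001) (con 1 ⊕ x0) (con 2 ⊛ (con 1 ⊕ x1)) h2 ∷ []) refl

arith-134 : ∀ L′ v1 v2 → L′ < 2 * v1 → 2 * suc v2 ≤ L′ + 2 → suc v2 ≤ v1
arith-134 L′ v1 v2 h1 h2 = linear (L′ ∷ v1 ∷ v2 ∷ []) 1 (con 1 ⊕ x2) x1
    (hyp (con 1) (con 1 ⊕ x0) (con 2 ⊛ x1) h1 ∷ hyp (con 1) (con 2 ⊛ (con 1 ⊕ x2)) (x0 ⊕ con 2) h2 ∷ []) refl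

arith-135 : ∀ v1 v2 n₁ L v3 v4 v5 v6 v7 v8 v9 v10 v11 v12 μ → v1 + v2 ≤ n₁ * L + (suc n₁ * L + 32 * L) →
    v3 ≤ v2 → v4 ≤ v5 + (v6 + (v7 + v8)) + 30 → v3 ≡ v9 + (v10 + (v11 + v12)) → 2 * (μ * v5) ≤ 2 * v9 + μ * μ
    + μ → 2 * (μ * v6) ≤ 2 * v10 + μ * μ + μ → 2 * (μ * v7) ≤ 2 * v11 + μ * μ + μ → 2 * (μ * v8) ≤ 2 * v12 +
    μ * μ + μ → 2 * v1 + 2 * (μ * v4) ≤ 2 * (n₁ * L + suc n₁ * L + 32 * L) + 4 * (μ * μ) + 64 * μ
arith-135 v1 v2 n₁ L v3 v4 v5 v6 v7 v8 v9 v10 v11 v12 μ h1 h2 h3 h4 h5 h6 h7 h8 =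
    linear (v1 ∷ v2 ∷ n₁ ∷ L ∷ v3 ∷ v4 ∷ v5 ∷ v6 ∷ v7 ∷ v8 ∷ v9 ∷ v10 ∷ v11 ∷ v12 ∷ μ ∷ []) 0
    (con 2 ⊛ x0 ⊕ con 2 ⊛ (x14 ⊛ x5)) (con 2 ⊛ (x2 ⊛ x3 ⊕ (con 1 ⊕ x2) ⊛ x3 ⊕ con 32 ⊛ x3) ⊕ con 4 ⊛
    (x14 ⊛ x14) ⊕ con 64 ⊛ x14)
    (hyp (con 2) (x0 ⊕ x1) (x2 ⊛ x3 ⊕ ((con 1 ⊕ x2) ⊛ x3 ⊕ con 32 ⊛ x3)) h1 ∷ hyp (con 2) x4 x1 h2 ∷
    equ (con 2) (x10 ⊕ (x11 ⊕ (x12 ⊕ x13))) x4 (sym h4) ∷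
    hyp (con 1) (con 2 ⊛ (x14 ⊛ x6)) (con 2 ⊛ x10 ⊕ x14 ⊛ x14 ⊕ x14) h5 ∷
    hyp (con 1) (con 2 ⊛ (x14 ⊛ x7)) (con 2 ⊛ x11 ⊕ x14 ⊛ x14 ⊕ x14) h6 ∷
    hyp (con 1) (con 2 ⊛ (x14 ⊛ x8)) (con 2 ⊛ x12 ⊕ x14 ⊛ x14 ⊕ x14) h7 ∷
    hyp (con 1) (con 2 ⊛ (x14 ⊛ x9)) (con 2 ⊛ x13 ⊕ x14 ⊛ x14 ⊕ x14) h8 ∷
    hyp (con 2 ⊛ x14) x5 (x6 ⊕ (x7 ⊕ (x8 ⊕ x9)) ⊕ con 30) h3 ∷ []) refl

arith-136 : ∀ b → b + (b + (b + b)) ≤ 4 * b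
arith-136 b = linear (b ∷ []) 0 (x0 ⊕ (x0 ⊕ (x0 ⊕ x0))) (con 4 ⊛ x0) [] refl

arith-137 : ∀ b i → b + (b + (b + i)) ≡ b + (b + b) + i
arith-137 b i = ≤-antisym (linear (b ∷ i ∷ []) 0 (x0 ⊕ (x0 ⊕ (x0 ⊕ x1))) (x0 ⊕ (x0 ⊕ x0) ⊕ x1) [] refl)
    (linear (b ∷ i ∷ []) 0 (x0 ⊕ (x0 ⊕ x0) ⊕ x1) (x0 ⊕ (x0 ⊕ (x0 ⊕ x1))) [] refl)

arith-138 : ∀ L b → L ≤ 4 * b + 30 → L ≤ b + (b + (b + b)) + 30
arith-138 L b h1 = linear (L ∷ b ∷ []) 0 x0 (x1 ⊕ (x1 ⊕ (x1 ⊕ x1)) ⊕ con 30)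
    (hyp (con 1) x0 (con 4 ⊛ x1 ⊕ con 30) h1 ∷ []) refl

arith-139 : ∀ d n₁ L → d < n₁ → 3 * n₁ + 2 ≤ L → suc d < L
arith-139 d n₁ L h1 h2 = linear (d ∷ n₁ ∷ L ∷ []) 4 (con 1 ⊕ (con 1 ⊕ x0)) x2
    (hyp (con 6) (con 1 ⊕ x0) x1 h1 ∷ hyp (con 2) (con 3 ⊛ x1 ⊕ con 2) x2 h2 ∷ []) refl

arith-140 : ∀ n₁ g → 3 * n₁ + 2 + g ≡ suc (n₁ + suc n₁ + g + n₁)
arith-140 n₁ g = ≤-antisym (linear (n₁ ∷ g ∷ []) 0 (con 3 ⊛ x0 ⊕ con 2 ⊕ x1) (con 1 ⊕ (x0 ⊕ (con 1 ⊕ x0) ⊕ x1 ⊕ x0))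
    [] refl) (linear (n₁ ∷ g ∷ []) 0 (con 1 ⊕ (x0 ⊕ (con 1 ⊕ x0) ⊕ x1 ⊕ x0)) (con 3 ⊛ x0 ⊕ con 2 ⊕ x1)
    [] refl)

arith-141 : ∀ n₁ g → 1 + (n₁ + suc n₁ + g) + 1 + n₁ ≡ suc (3 * n₁ + 2 + g)
arith-141 n₁ g = ≤-antisym (linear (n₁ ∷ g ∷ []) 0 (con 1 ⊕ (x0 ⊕ (con 1 ⊕ x0) ⊕ x1) ⊕ con 1 ⊕ x0)
    (con 1 ⊕ (con 3 ⊛ x0 ⊕ con 2 ⊕ x1))
    [] refl) (linear (n₁ ∷ g ∷ []) 0 (con 1 ⊕ (con 3 ⊛ x0 ⊕ con 2 ⊕ x1)) (con 1 ⊕ (x0 ⊕ (con 1 ⊕ x0) ⊕ x1) ⊕ con 1 ⊕ x0)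
    [] refl)

arith-142 : ∀ n₁ → 1 + (n₁ + suc n₁) ≡ suc (2 * n₁) + 1
arith-142 n₁ = ≤-antisym (linear (n₁ ∷ []) 0 (con 1 ⊕ (x0 ⊕ (con 1 ⊕ x0))) (con 1 ⊕ con 2 ⊛ x0 ⊕ con 1) []
    refl) (linear (n₁ ∷ []) 0 (con 1 ⊕ con 2 ⊛ x0 ⊕ con 1) (con 1 ⊕ (x0 ⊕ (con 1 ⊕ x0))) [] refl)

arith-143 : ∀ n₁ g → 3 * n₁ + 2 + g ≤ 4 * suc n₁ + 30 → 1 + g ≤ suc n₁ + 32
arith-143 n₁ g h1 = linear (n₁ ∷ g ∷ []) 0 (con 1 ⊕ x1) (con 1 ⊕ x0 ⊕ con 32)
    (hyp (con 1) (con 3 ⊛ x0 ⊕ con 2 ⊕ x1) (con 4 ⊛ (con 1 ⊕ x0) ⊕ con 30) h1 ∷ []) refl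

arith-144 : ∀ v1 v2 n₁ g v3 v4 v5 v6 v7 v8 v9 v10 v11 v12 v13 v14 v15 v16 → v1 + v2 ≤ n₁ * (3 * n₁ + 2 + g) →
    v3 ≡ v4 → v4 ≡ v5 + v6 → v6 ≡ v1 → v5 ≡ v7 + v8 → v7 ≡ v1 + v9 → v1 ≤ v10 → v10 + v9 + v11 ≤ suc n₁ *
    (3 * n₁ + 2 + g) → v8 ≡ v12 → v13 ≡ v14 + v12 → v13 ≤ v15 → v15 ≡ v11 + v16 → v16 ≤ 32 * (3 * n₁ + 2 + g)
    → v3 + v2 ≤ n₁ * (3 * n₁ + 2 + g) + (suc n₁ * (3 * n₁ + 2 + g) + 32 * (3 * n₁ + 2 + g))
arith-144 v1 v2 n₁ g v3 v4 v5 v6 v7 v8 v9 v10 v11 v12 v13 v14 v15 v16 h1 h2 h3 h4 h5 h6 h7 h8 h9 h10 h11 h12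
    h13 = linear (v1 ∷ v2 ∷ n₁ ∷ g ∷ v3 ∷ v4 ∷ v5 ∷ v6 ∷ v7 ∷ v8 ∷ v9 ∷ v10 ∷ v11 ∷ v12 ∷ v13 ∷ v14 ∷ v15 ∷
    v16 ∷ []) 0 (x4 ⊕ x1) (x2 ⊛ (con 3 ⊛ x2 ⊕ con 2 ⊕ x3) ⊕
    ((con 1 ⊕ x2) ⊛ (con 3 ⊛ x2 ⊕ con 2 ⊕ x3) ⊕ con 32 ⊛ (con 3 ⊛ x2 ⊕ con 2 ⊕ x3)))
    (hyp (con 1) (x0 ⊕ x1) (x2 ⊛ (con 3 ⊛ x2 ⊕ con 2 ⊕ x3)) h1 ∷ equ (con 1) x4 x5 h2 ∷ equ (con 1) x5 (x6 ⊕ x7) h3 ∷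
    equ (con 1) x7 x0 h4 ∷ equ (con 1) x6 (x8 ⊕ x9) h5 ∷ equ (con 1) x8 (x0 ⊕ x10) h6 ∷ hyp (con 1) x0 x11 h7 ∷
    hyp (con 1) (x11 ⊕ x10 ⊕ x12) ((con 1 ⊕ x2) ⊛ (con 3 ⊛ x2 ⊕ con 2 ⊕ x3)) h8 ∷ equ (con 1) x9 x13 h9 ∷
    equ (con 1) (x15 ⊕ x13) x14 (sym h10) ∷ hyp (con 1) x14 x16 h11 ∷ equ (con 1) x16 (x12 ⊕ x17) h12 ∷
    hyp (con 1) x17 (con 32 ⊛ (con 3 ⊛ x2 ⊕ con 2 ⊕ x3)) h13 ∷ []) refl

pairs : ℕ → (ℕ → Bool) → ℕ
pairs zero f = 0
pairs (suc b) f = ∑ b (λ d → ⟦ f 0 ∧ f (suc d) ⟧) + pairs b (f ∘ suc)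

pairs-square : ∀ b f → 2 * pairs b f + ∑ b (⟦_⟧ ∘ f) ≡ ∑ b (⟦_⟧ ∘ f) * ∑ b (⟦_⟧ ∘ f)
pairs-square zero f = refl
pairs-square (suc b) f with f 0
... | true = arith-129 (pairs b (f ∘ suc)) (∑ b (⟦_⟧ ∘ f ∘ suc)) (pairs-square b (f ∘ suc))
... | false = trans (cong (λ z → 2 * (z + pairs b (f ∘ suc)) + ∑ b (⟦_⟧ ∘ f ∘ suc))
    (trans (∑-const b 0) (*-zeroʳ b))) (pairs-square b (f ∘ suc))

pairs-rows : ∀ b k f → b ≤ suc k → pairs b f ≤ ∑ b (λ i → ∑ k (λ d → ⟦ f i ∧ f (i + suc d) ⟧))
pairs-rows zero k f _ = z≤n
pairs-rows (suc b) k f (s≤s b≤k) = +-mono-≤ (∑-extend (λ d → ⟦ f 0 ∧ f (suc d) ⟧) b≤k)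
    (pairs-rows b k (f ∘ suc) (≤-trans b≤k (n≤1+n k)))

-- With o for the sum, `2 * pairs b f` is o² - o, and the claim becomes (o - μ)(o - μ - 1) ≥ 0,
-- which holds for integers. Being linear in o, the bound can be added over several blocks with one
-- μ.
pairs-tangent : ∀ b f μ → 2 * (μ * ∑ b (⟦_⟧ ∘ f)) ≤ 2 * pairs b f + μ * μ + μ
pairs-tangent b f μ with ∑ b (⟦_⟧ ∘ f) | pairs b f | pairs-square b f
... | o | p | eq with o ≤? μ
...   | yes h = arith-130 o μ p h eq
...   | no h = arith-131 μ o p (≰⇒> h) eq

module Structure (G : SimpleGraph) where

  open GraphTheory G
  open TwoCycles G public
  open Chords G public

  longest-cycle : ∀ {S xs} → Cycle xs → xs ⊆ S →
    ¬ ¬ (∃ λ ys → Cycle ys × ys ⊆ S × length xs ≤ length ys × CyclesIn S (length ys))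
  longest-cycle {S} {xs} cyc xs⊆ none = ∃-max (λ k → ∃ λ ys → Cycle ys × ys ⊆ S × length ys ≡ k) (length S)
    (λ { _ (ys , c , ys⊆ , refl) → unique-length (Cycle.unique c) ys⊆ }) (length xs) (xs , cyc , xs⊆ , refl)
    λ { (_ , (ys , c , ys⊆ , refl) , max) → none (ys , c , ys⊆ , max _ (xs , cyc , xs⊆ , refl) , λ c′ zs⊆ →
        max _ (_ , c′ , zs⊆ , refl)) }

  max-degree : ∀ w ws (ys : List Vertex) → ∃ λ v → v ∈ w ∷ ws × (∀ u → u ∈ w ∷ ws → deg u ys ≤ deg v ys)
  max-degree w [] ys = w , here refl , λ { u (here refl) → ≤-refl }
  max-degree w (x ∷ ws) ys with max-degree x ws ys
  ... | v , v∈ , max with deg w ys ≤? deg v ys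
  ...   | yes p = v , there v∈ , λ { u (here refl) → p ; u (there u∈) → max u u∈ }
  ...   | no ¬p = w , here refl , λ { u (here refl) → ≤-refl ; u (there u∈) → ≤-trans (max u u∈) (<⇒≤ (≰⇒> ¬p)) }

  out-small : ∀ B U a → (∀ u → u ∈ U → deg u B ≤ a) → out B U ≤ 2 * (a * length U) + length U * length U
  out-small B U a h = +-mono-≤ (*-monoʳ-≤ 2
      (≤-trans (≤-reflexive (e-sym B U)) (≤-trans (Σl-≤const U a h) (≤-reflexive (*-comm (length U) a)))))
      (e-≤length U U)

  module _ {L : ℕ} (C : Circuit L) {S W : List Vertex} (uS : Unique S) (perm : S ↭ Arcs.verts C ++ W)
      (longest : CyclesIn S L) where

    open Arcs C

    verts⊆S : verts ⊆ S
    verts⊆S v∈ = Perm.∈-resp-↭ (↭-sym perm) (∈-++⁺ˡ v∈)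

    W⊆S : W ⊆ S
    W⊆S v∈ = Perm.∈-resp-↭ (↭-sym perm) (∈-++⁺ʳ verts v∈)

    uW : Unique W
    uW = proj₁ (proj₂ (Unique-++⁻ verts (Unique-↭ perm uS)))

    W∉ : ∀ {v} → v ∈ W → v ∉ verts
    W∉ v∈ v∈′ = proj₂ (proj₂ (Unique-++⁻ verts (Unique-↭ perm uS))) v∈′ v∈

    open Longest C verts⊆S longest

    -- The outcome of peeling `W` with threshold `L′` down to `k` vertices, after `ρ` removals; `a`
    -- is the largest degree into C among the vertices that remain.
    record Sparse (L′ k ρ : ℕ) : Set where
      field
        a : ℕ
        a-half : 2 * a ≤ L
        a-edges : ee verts + a * a ≤ L * L
        bound : out verts W ≤ L′ * ρ + (2 * (a * k) + k * k)

    -- Here `q` is the length of a longest cycle Q of `W`, `ρ` the number of other vertices of `W`,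
    -- and `r` twice the number of edges among these. Their cycles are no longer than `q`, whence
    -- `r-linear`.
    record Dense (L′ : ℕ) : Set where
      field
        q ρ r : ℕ
        total : q + ρ ≡ length W
        q-large : L′ < 2 * q
        q-small : q ≤ L
        r-square : r ≤ ρ * ρ
        r-linear : q ≤ ρ → r + q * q ≤ 2 * (q * ρ)
        bound : out verts W ≤ q * q + ρ * L + r + 12 * q + 8 * ρ

    dense : ∀ L′ → L ≤ L′ → ∀ {Q} → Cycle Q → Q ⊆ W → CyclesIn W (length Q) → L′ < 2 * length Q → Dense L′
    dense L′ L≤L′ {Q} cycQ Q⊆W longestQ long =
      let R , permR = ⊆-split (Cycle.unique cycQ) Q⊆W
          h₁ , h₂ = half-bounds (length Q)
      in record
        { q = length Q ; ρ = length R ; r = ee R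
        ; total = trans (sym (length-++ Q)) (sym (Perm.↭-length permR))
        ; q-large = long ; q-small = longest cycQ (λ v∈ → W⊆S (Q⊆W v∈))
        ; r-square = e-≤length R R
        ; r-linear = few-edges (proj₁ (proj₂ (Unique-++⁻ Q (Unique-↭ permR uW))))
            (λ c R⊆ → longestQ c (λ v∈ → Perm.∈-resp-↭ (↭-sym permR) (∈-++⁺ʳ Q (R⊆ v∈))))
                (≤-trans (s≤s (s≤s z≤n)) (Cycle.long cycQ))
        ; bound = two-cycles-bound C verts⊆S longest uW W⊆S W∉ cycQ Q⊆W longestQ (≤-trans L≤L′ (<⇒≤ long))
            permR (suc ⌊ length Q /2⌋) h₁ h₂ }

    -- Peeling stops early only when every remaining vertex has more than L′/2 neighbours on C and
    -- among the remaining vertices. As L ≤ L′, `second-cycle` then provides a cycle longer than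
    -- L′/2, and a longest cycle of `W` is at least as long.
    sparse-or-dense : ∀ L′ k ρ → L ≤ L′ → 4 ≤ L′ → k + ρ ≡ length W → ¬ ¬ (Sparse L′ k ρ ⊎ Dense L′)
    sparse-or-dense L′ k ρ L≤L′ 4≤L′ k+ρ none = cases outcome
      where
      open Peeling (peel verts W L′ k (≤-trans (m≤m+n k ρ) (≤-reflexive k+ρ))) renaming (perm to permU)
      U₁⊆W : U₁ ⊆ W
      U₁⊆W v∈ = Perm.∈-resp-↭ (↭-sym permU) (∈-++⁺ˡ v∈)
      len : length W ≡ length U₁ + length U₂
      len = trans (Perm.↭-length permU) (length-++ U₁)
      sparse : ∀ a → 2 * a ≤ L → ee verts + a * a ≤ L * L → (∀ u → u ∈ U₁ → deg u verts ≤ a) → length U₁ ≡ k → ⊥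
      sparse a a-half a-edges max eq = none (inj₁ (record { a = a ; a-half = a-half ; a-edges = a-edges
        ; bound = (arith-132 (out verts W) (out verts U₁) (L′ * length U₂) a k L′ ρ bound
            (subst (λ j → out verts U₁ ≤ 2 * (a * j) + j * j) eq (out-small verts U₁ a max))
            (cong (L′ *_) (+-cancelˡ-≡ (length U₁) _ _
            (trans (sym len) (trans (sym k+ρ) (cong (_+ ρ) (sym eq))))))) }))
      no-vertices : U₁ ≡ [] → length U₁ ≡ k → ⊥
      -- With nothing left there is no vertex of largest degree, and `a = 0` serves.
      no-vertices U₁≡[] eq = sparse 0 z≤n
          (≤-trans (≤-reflexive (+-identityʳ _))
          (≤-trans (e-≤length verts verts) (≤-reflexive (cong₂ _*_ verts-length verts-length))))
        (λ u u∈ → case subst (u ∈_) U₁≡[] u∈ of λ ()) eq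
      some-vertices : ∀ w ws → U₁ ≡ w ∷ ws → length U₁ ≡ k → ⊥
      some-vertices w ws U₁≡ eq =
        let v , v∈ , max = max-degree w ws verts
            v∈W = U₁⊆W (subst (v ∈_) (sym U₁≡) v∈)
        in sparse (deg v verts) (deg-half (W⊆S v∈W) (W∉ v∈W)) (edges-independent (W⊆S v∈W) (W∉ v∈W))
            (λ u u∈ → max u (subst (u ∈_) U₁≡ u∈)) eq
      by-list : ∀ xs → U₁ ≡ xs → length U₁ ≡ k → ⊥
      by-list [] = no-vertices
      by-list (w ∷ ws) = some-vertices w ws
      cases : _ → ⊥
      cases (inj₁ eq) = by-list U₁ refl eq
      cases (inj₂ (pos , _ , high)) =
        second-cycle C verts⊆S longest {U₁} {suc ⌊ L′ /2⌋} (proj₁ (Unique-++⁻ U₁ (Unique-↭ permU uW)))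
            (λ v∈ → W⊆S (U₁⊆W v∈)) (λ v∈ → W∉ (U₁⊆W v∈)) pos
          (arith-133 L′ (⌊ L′ /2⌋) 4≤L′ (proj₂ (half-bounds L′)))
          (≤-trans (s≤s L≤L′) (proj₂ (half-bounds L′)))
          (λ w w∈ → (arith-134 L′ (deg w (verts ++ U₁)) (⌊ L′ /2⌋) (high w w∈) (proj₁ (half-bounds L′))))
          λ (Q₀ , cyc₀ , Q₀⊆ , D≤) → longest-cycle cyc₀ (λ v∈ → U₁⊆W (Q₀⊆ v∈)) λ (Q , cyc , Q⊆ , Q₀≤Q , max) →
            none (inj₂ (dense L′ L≤L′ cyc Q⊆ max (≤-trans (proj₂ (half-bounds L′)) (*-monoʳ-≤ 2 (≤-trans D≤ Q₀≤Q)))))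

    module _ (n₁ : ℕ) (1≤n₁ : 1 ≤ n₁) (free : ∀ {xs} → Cycle xs → xs ⊆ verts → length xs ≢ 2 * suc n₁) where

      private
        n = suc n₁

      -- If w has many neighbours on C, their successors span many pairs at
      -- distance less than n, none of which is a chord.
      missing-chords : 3 * n₁ + 2 ≤ L → L ≤ 4 * n + 30 → ∀ b → b ≤ n → 4 * b ≤ L → L ≤ 4 * b + 30 → ∀ w → w ∈ W → ∀ μ →
        2 * ee verts + 2 * (μ * deg w verts) ≤ 2 * (n₁ * L + n * L + 32 * L) + 4 * (μ * μ) + 64 * μ
      missing-chords bound upper b b≤n 4b≤L L≤4b w w∈ μ = arith-135 (ee verts) miss n₁ L blockpairs
          (deg w verts) (∑ b (⟦_⟧ ∘ f)) (∑ b (⟦_⟧ ∘ f₁)) (∑ b (⟦_⟧ ∘ f₂)) (∑ b (⟦_⟧ ∘ f₃)) (pairs b f)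
          (pairs b f₁) (pairs b f₂) (pairs b f₃) μ total blocks degree refl (pairs-tangent b f μ)
          (pairs-tangent b f₁ μ) (pairs-tangent b f₂ μ) (pairs-tangent b f₃ μ)
        where
        f f₁ f₂ f₃ : ℕ → Bool
        f i = E w (c i)
        f₁ i = f (b + i)
        f₂ i = f (b + (b + i))
        f₃ i = f (b + (b + (b + i)))
        blockpairs = pairs b f + (pairs b f₁ + (pairs b f₂ + pairs b f₃))
        row : ℕ → ℕ
        row i = ∑ n₁ (λ d → ⟦ f i ∧ f (i + suc d) ⟧)
        miss = ∑ L row
        Dˢ : ℕ → ℕ
        Dˢ = D C n₁ 1≤n₁ free
        Sˢ : ℕ → ℕ → ℕ
        Sˢ = spans C n₁ 1≤n₁ free
        4b : b + (b + (b + b)) ≤ L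
        4b = ≤-trans (arith-136 b) 4b≤L
        split₄ : ∀ (g : ℕ → ℕ) → ∑ (b + (b + (b + b))) g ≡ ∑ b g +
            (∑ b (λ i → g (b + i)) + (∑ b (λ i → g (b + (b + i))) + ∑ b (λ i → g (b + (b + (b + i))))))
        split₄ g = trans (∑-split b (b + (b + b)) g)
            (cong (∑ b g +_) (trans (∑-split b (b + b) (λ i → g (b + i)))
            (cong (∑ b (λ i → g (b + i)) +_) (∑-split b b (λ i → g (b + (b + i)))))))
        rows : ∀ x → pairs b (λ i → f (x + i)) ≤ ∑ b (λ i → row (x + i))
        rows x = ≤-trans (pairs-rows b n₁ (λ i → f (x + i)) b≤n)
            (≤-reflexive (∑-cong b (λ i _ →
            ∑-cong n₁ (λ d _ → cong (λ z → ⟦ f (x + i) ∧ f z ⟧) (sym (+-assoc x i (suc d)))))))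
        -- Positions in the same block are less than n apart, so each pair in a block is counted in
        -- the row of its first position.
        blocks : blockpairs ≤ miss
        blocks = ≤-trans (+-mono-≤ (rows 0) (+-mono-≤ (rows b) (+-mono-≤
            (≤-trans (pairs-cong b f₂ (λ i → f (b + b + i)) (λ i → cong f (sym (+-assoc b b i))))
                (≤-trans (rows (b + b)) (≤-reflexive (∑-cong b (λ i _ → cong row (+-assoc b b i))))))
            (≤-trans (pairs-cong b f₃ (λ i → f (b + (b + b) + i)) (λ i → cong f (shift i)))
                (≤-trans (rows (b + (b + b))) (≤-reflexive (∑-cong b (λ i _ → cong row (sym (shift i))))))))))
          (≤-trans (≤-reflexive (sym (split₄ row))) (∑-extend row 4b))
          where
          shift : ∀ i → b + (b + (b + i)) ≡ b + (b + b) + i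
          shift i = arith-137 b i
          pairs-cong : ∀ b (f g : ℕ → Bool) → (∀ i → f i ≡ g i) → pairs b f ≤ pairs b g
          pairs-cong zero f g h = z≤n
          pairs-cong (suc b) f g h = +-mono-≤
              (≤-reflexive (∑-cong b (λ d _ → cong ⟦_⟧ (cong₂ _∧_ (h 0) (h (suc d))))))
              (pairs-cong b (f ∘ suc) (g ∘ suc) (h ∘ suc))
        degree : deg w verts ≤ ∑ b (⟦_⟧ ∘ f) + (∑ b (⟦_⟧ ∘ f₁) + (∑ b (⟦_⟧ ∘ f₂) + ∑ b (⟦_⟧ ∘ f₃))) + 30
        degree = begin
          deg w verts                                ≡⟨ Σl-applyUpTo c L (λ v → ⟦ E w v ⟧) ⟩
          ∑ L (⟦_⟧ ∘ f)                              ≤⟨ ∑-extend (⟦_⟧ ∘ f) (arith-138 L b L≤4b) ⟩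
          ∑ (b + (b + (b + b)) + 30) (⟦_⟧ ∘ f)       ≡⟨ ∑-split (b + (b + (b + b))) 30 (⟦_⟧ ∘ f) ⟩
          ∑ (b + (b + (b + b))) (⟦_⟧ ∘ f) + ∑ 30 (λ i → ⟦ f (b + (b + (b + b)) + i) ⟧)
            ≤⟨ +-mono-≤ (≤-reflexive (split₄ (⟦_⟧ ∘ f))) (∑-≤const 30 1 (λ i _ → ⟦⟧≤1 (f (b + (b + (b + b)) + i)))) ⟩
          ∑ b (⟦_⟧ ∘ f) + (∑ b (⟦_⟧ ∘ f₁) + (∑ b (⟦_⟧ ∘ f₂) + ∑ b (⟦_⟧ ∘ f₃))) + 30 ∎
          where open ≤-Reasoning
        -- Two neighbours of `w` at distance `suc d` exclude the chord between their successors;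
        -- hence the chords are counted from `c (suc i)`.
        near : Sˢ 1 n₁ + miss ≤ n₁ * L
        near = ≤-trans (≤-reflexive (cong (Sˢ 1 n₁ +_) (∑-swap L n₁ (λ i d → ⟦ f i ∧ f (i + suc d) ⟧))))
          (∑-pair≤ n₁ L (Dˢ ∘ suc) (λ d → ∑ L (λ i → ⟦ f i ∧ f (i + suc d) ⟧)) (λ d d<n₁ →
            ≤-trans (≤-reflexive (cong (_+ ∑ L (λ i → ⟦ f i ∧ f (i + suc d) ⟧))
                (sym (D-shift C n₁ 1≤n₁ free 1 (suc d)))))
              (≤-trans (∑-pair≤ L 1 (λ i → ⟦ E (c (suc i)) (c (suc i + suc d)) ⟧)
                  (λ i → ⟦ f i ∧ f (i + suc d) ⟧) (λ i _ → bool-excl λ h₃ h →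
                 let h₁ , h₂ = ∧-true h in successors-independent (W⊆S w∈) (W∉ w∈) i (suc d) (s≤s z≤n)
                     (arith-139 d n₁ L d<n₁ bound) h₁ h₂ h₃))
                (≤-reflexive (*-identityʳ L)))))
        -- The spans below n occur twice, once directly and once as mirror images of the last `n₁`
        -- spans. One copy is balanced against `miss`, the other belongs to `triples`. As L is at
        -- most 4n + 30, at most 32 spans lie outside the triples, each with at most L chords.
        total : ee verts + miss ≤ n₁ * L + (n * L + 32 * L)
        total with m≤n⇒∃[o]m+o≡n bound
        ... | g , refl = arith-144 (Sˢ 1 n₁) miss n₁ g (ee verts) (Sˢ 1 (n₁ + n + g + n₁))
            (Sˢ 1 (n₁ + n + g)) (Sˢ (1 + (n₁ + n + g)) n₁) (Sˢ 1 (n₁ + n)) (Sˢ (1 + (n₁ + n)) g) (Sˢ n n)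
            (Sˢ 1 n) (Sˢ (suc (2 * n₁)) n) (Sˢ (suc (2 * n₁) + 1) g) (Sˢ (suc (2 * n₁)) (1 + g))
            (Sˢ (suc (2 * n₁)) 1) (Sˢ (suc (2 * n₁)) (n + 32)) (Sˢ (suc (2 * n₁) + n) 32) near
            (ee-verts C n₁ 1≤n₁ free {n₁ + n + g + n₁} (arith-140 n₁ g))
            (S-split C n₁ 1≤n₁ free 1 (n₁ + n + g) n₁) (S-mirror C n₁ 1≤n₁ free (1 + (n₁ + n + g)) 1 n₁
            (arith-141 n₁ g)) (S-split C n₁ 1≤n₁ free 1 (n₁ + n) g) (S-split C n₁ 1≤n₁ free 1 n₁ n)
            (S-mono C n₁ 1≤n₁ free 1 (n≤1+n n₁)) (triples C n₁ 1≤n₁ free bound)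
            (cong (λ a → Sˢ a g) (arith-142 n₁)) (S-split C n₁ 1≤n₁ free (suc (2 * n₁)) 1 g)
            (S-mono C n₁ 1≤n₁ free (suc (2 * n₁)) (arith-143 n₁ g upper))
            (S-split C n₁ 1≤n₁ free (suc (2 * n₁)) n 32)
            (∑-≤const 32 {λ j → Dˢ (suc (2 * n₁) + n + j)} (3 * n₁ + 2 + g)
            (λ j _ → D-≤L C n₁ 1≤n₁ free (suc (2 * n₁) + n + j)))

-- Extremal bounds for graphs without a cycle of length 2n

arith-145 : ∀ k L → 4 * k ≤ L → 4 * suc k ≤ suc (suc (suc (suc L)))
arith-145 k L h1 = linear (k ∷ L ∷ []) 0 (con 4 ⊛ (con 1 ⊕ x0)) (con 1 ⊕ (con 1 ⊕ (con 1 ⊕ (con 1 ⊕ x1))))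
    (hyp (con 1) (con 4 ⊛ x0) x1 h1 ∷ []) refl

arith-146 : ∀ L k → L ≤ 4 * k + 3 → suc (suc (suc (suc L))) ≤ 4 * suc k + 3
arith-146 L k h1 = linear (L ∷ k ∷ []) 0 (con 1 ⊕ (con 1 ⊕ (con 1 ⊕ (con 1 ⊕ x0)))) (con 4 ⊛ (con 1 ⊕ x1) ⊕ con 3)
    (hyp (con 1) x0 (con 4 ⊛ x1 ⊕ con 3) h1 ∷ []) refl

arith-147 : ∀ k m → 2 * k ≤ m → 2 * suc k ≤ suc (suc m)
arith-147 k m h1 = linear (k ∷ m ∷ []) 0 (con 2 ⊛ (con 1 ⊕ x0)) (con 1 ⊕ (con 1 ⊕ x1))
    (hyp (con 1) (con 2 ⊛ x0) x1 h1 ∷ []) refl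

arith-148 : ∀ m k → m ≤ 2 * k + 1 → suc (suc m) ≤ 2 * suc k + 1
arith-148 m k h1 = linear (m ∷ k ∷ []) 0 (con 1 ⊕ (con 1 ⊕ x0)) (con 2 ⊛ (con 1 ⊕ x1) ⊕ con 1)
    (hyp (con 1) x0 (con 2 ⊛ x1 ⊕ con 1) h1 ∷ []) refl

arith-149 : ∀ v1 m → v1 + 48 * 48 ≤ 2 * (48 * m) → 2 * v1 ≤ 192 * m
arith-149 v1 m h1 = linear (v1 ∷ m ∷ []) 0 (con 2 ⊛ x0) (con 192 ⊛ x1)
    (hyp (con 2) (x0 ⊕ con 48 ⊛ con 48) (con 2 ⊛ (con 48 ⊛ x1)) h1 ∷ []) refl

arith-150 : ∀ n₁ m L L′ → 4 * (n₁ + 83) ≤ m → L ≤ 2 * n₁ + 1 → m ≤ 2 * L′ + 1 → L ≤ L′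
arith-150 n₁ m L L′ h1 h2 h3 = linear (n₁ ∷ m ∷ L ∷ L′ ∷ []) 1 x2 x3
    (hyp (con 1) (con 4 ⊛ (x0 ⊕ con 83)) x1 h1 ∷ hyp (con 2) x2 (con 2 ⊛ x0 ⊕ con 1) h2 ∷
    hyp (con 1) x1 (con 2 ⊛ x3 ⊕ con 1) h3 ∷ []) refl

arith-151 : ∀ n₁ m L → 4 * (n₁ + 83) ≤ m → L ≤ 2 * n₁ + 1 → 2 * L + 330 ≤ m
arith-151 n₁ m L h1 h2 = linear (n₁ ∷ m ∷ L ∷ []) 0 (con 2 ⊛ x2 ⊕ con 330) x1
    (hyp (con 1) (con 4 ⊛ (x0 ⊕ con 83)) x1 h1 ∷ hyp (con 2) x2 (con 2 ⊛ x0 ⊕ con 1) h2 ∷ []) refl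

arith-152 : ∀ m L z Y v1 v2 v3 L′ v4 → m ≡ L + z → 2 * L + 330 ≤ m → 49 ≤ L → Y ≤ 16 * m + 1 → v1 ≡ v2 + v3 →
    v2 ≤ L * L → v3 ≤ L′ * z + (2 * (v4 * 0) + 0 * 0) → 2 * L′ ≤ m → 2 * v1 + Y ≤ m * m
arith-152 m L z Y v1 v2 v3 L′ v4 h1 h2 h3 h4 h5 h6 h7 h8 = linear (m ∷ L ∷ z ∷ Y ∷ v1 ∷ v2 ∷ v3 ∷ L′ ∷ v4 ∷
    []) 427 (con 2 ⊛ x4 ⊕ x3) (x0 ⊛ x0)
    (hyp (con 4803) (con 2 ⊛ x1 ⊕ con 330) x0 h2 ∷ hyp (con 108902) (con 49) x1 h3 ∷
    hyp (con 428) x3 (con 16 ⊛ x0 ⊕ con 1) h4 ∷ equ (con 856) x4 (x5 ⊕ x6) h5 ∷ hyp (con 856) x5 (x1 ⊛ x1) h6 ∷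
    hyp (con 856) x6 (x7 ⊛ x2 ⊕ (con 2 ⊛ (x8 ⊛ con 0) ⊕ con 0 ⊛ con 0)) h7 ∷
    hyp (con 9321 ⊕ con 428 ⊛ x2) (con 2 ⊛ x7) x0 h8 ∷ prod (con 428) (con 2 ⊛ x1 ⊕ con 330) x0 h2 (con 49) x1 h3 ∷
    equ (con 428 ⊛ x0) (x1 ⊕ x2) x0 (sym h1) ∷ []) refl

arith-153 : ∀ L′ q m L → L′ < 2 * q → m ≤ 2 * L′ + 1 → 2 * L + 330 ≤ m → L ≤ 2 * q
arith-153 L′ q m L h1 h2 h3 = linear (L′ ∷ q ∷ m ∷ L ∷ []) 1 x3 (con 2 ⊛ x1)
    (hyp (con 2) (con 1 ⊕ x0) (con 2 ⊛ x1) h1 ∷ hyp (con 1) x2 (con 2 ⊛ x0 ⊕ con 1) h2 ∷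
    hyp (con 1) (con 2 ⊛ x3 ⊕ con 330) x2 h3 ∷ []) refl

arith-154 : ∀ m L q ρ → m ≡ L + (q + ρ) → 2 * L + 330 ≤ m → L + 330 ≤ q + ρ
arith-154 m L q ρ h1 h2 = linear (m ∷ L ∷ q ∷ ρ ∷ []) 0 (x1 ⊕ con 330) (x2 ⊕ x3)
    (equ (con 1) x0 (x1 ⊕ (x2 ⊕ x3)) h1 ∷ hyp (con 1) (con 2 ⊛ x1 ⊕ con 330) x0 h2 ∷ []) refl

arith-155 : ∀ m L q ρ Y v1 v2 v3 r L′ → m ≡ L + (q + ρ) → 2 * L + 330 ≤ m → 49 ≤ L → Y ≤ 16 * m + 1 →
    v1 ≡ v2 + v3 → v2 ≤ L * L → v3 ≤ q * q + ρ * L + r + 12 * q + 8 * ρ → r ≤ ρ * ρ → q ≤ L → ρ ≤ q →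
    L′ < 2 * q → m ≤ 2 * L′ + 1 → L ≤ 2 * q → L + 330 ≤ q + ρ → 2 * v1 + Y ≤ m * m
arith-155 m L q ρ Y v1 v2 v3 r L′ h1 h2 h3 h4 h5 h6 h7 h8 h9 h10 h11 h12 h13 h14 =
    linear (m ∷ L ∷ q ∷ ρ ∷ Y ∷ v1 ∷ v2 ∷ v3 ∷ r ∷ L′ ∷ []) 0 (con 2 ⊛ x5 ⊕ x4) (x0 ⊛ x0)
    (equ (con 145) x0 (x1 ⊕ (x2 ⊕ x3)) h1 ∷ hyp (con 129) (con 2 ⊛ x1 ⊕ con 330) x0 h2 ∷ hyp (con 113) (con 49) x1 h3 ∷
    hyp (con 1) x4 (con 16 ⊛ x0 ⊕ con 1) h4 ∷ equ (con 2) x5 (x6 ⊕ x7) h5 ∷ hyp (con 2) x6 (x1 ⊛ x1) h6 ∷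
    hyp (con 2) x7 (x2 ⊛ x2 ⊕ x3 ⊛ x1 ⊕ x8 ⊕ con 12 ⊛ x2 ⊕ con 8 ⊛ x3) h7 ∷ hyp (con 2) x8 (x3 ⊛ x3) h8 ∷
    hyp (con 161 ⊕ x3) x3 x2 h10 ∷ hyp x2 (x1 ⊕ con 330) (x2 ⊕ x3) h14 ∷ prod (con 1) x2 x1 h9 x1 (con 2 ⊛ x2) h13 ∷
    equ (x0 ⊕ x1 ⊕ x2 ⊕ x3) (x1 ⊕ (x2 ⊕ x3)) x0 (sym h1) ∷ []) refl

arith-156 : ∀ L′ q m L → L′ < 2 * q → m ≤ 2 * L′ + 1 → 2 * L + 330 ≤ m → L + 165 ≤ 2 * q
arith-156 L′ q m L h1 h2 h3 = linear (L′ ∷ q ∷ m ∷ L ∷ []) 1 (x3 ⊕ con 165) (con 2 ⊛ x1)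
    (hyp (con 2) (con 1 ⊕ x0) (con 2 ⊛ x1) h1 ∷ hyp (con 1) x2 (con 2 ⊛ x0 ⊕ con 1) h2 ∷
    hyp (con 1) (con 2 ⊛ x3 ⊕ con 330) x2 h3 ∷ []) refl

arith-157 : ∀ m L q ρ Y v1 v2 v3 r → m ≡ L + (q + ρ) → 49 ≤ L → Y ≤ 16 * m + 1 → v1 ≡ v2 + v3 → v2 ≤ L * L →
    v3 ≤ q * q + ρ * L + r + 12 * q + 8 * ρ → r + q * q ≤ 2 * (q * ρ) → q ≤ L → L + 165 ≤ 2 * q →
    2 * v1 + Y ≤ m * m
arith-157 m L q ρ Y v1 v2 v3 r h1 h2 h3 h4 h5 h6 h7 h8 h9 =
    linear (m ∷ L ∷ q ∷ ρ ∷ Y ∷ v1 ∷ v2 ∷ v3 ∷ r ∷ []) 0 (con 2 ⊛ x5 ⊕ x4) (x0 ⊛ x0)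
    (equ (con 16) x0 (x1 ⊕ (x2 ⊕ x3)) h1 ∷ hyp (con 77) (con 49) x1 h2 ∷ hyp (con 1) x4 (con 16 ⊛ x0 ⊕ con 1) h3 ∷
    equ (con 2) x5 (x6 ⊕ x7) h4 ∷ hyp (con 2) x6 (x1 ⊛ x1) h5 ∷
    hyp (con 2) x7 (x2 ⊛ x2 ⊕ x3 ⊛ x1 ⊕ x8 ⊕ con 12 ⊛ x2 ⊕ con 8 ⊛ x3) h6 ∷
    hyp (con 2) (x8 ⊕ x2 ⊛ x2) (con 2 ⊛ (x2 ⊛ x3)) h7 ∷ hyp (con 72) x2 x1 h8 ∷ hyp x1 (x1 ⊕ con 165) (con 2 ⊛ x2) h9 ∷
    sq (con 1) x3 (x2 ⊕ con 16) ∷ equ (x0 ⊕ x1 ⊕ x2 ⊕ x3) (x1 ⊕ (x2 ⊕ x3)) x0 (sym h1) ∷ []) refl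

arith-158 : ∀ n₁ m → 4 * (n₁ + 83) ≤ m → 1 ≤ n₁ → 336 ≤ m
arith-158 n₁ m h1 h2 = linear (n₁ ∷ m ∷ []) 0 (con 336) x1
    (hyp (con 1) (con 4 ⊛ (x0 ⊕ con 83)) x1 h1 ∷ hyp (con 4) (con 1) x0 h2 ∷ []) refl

arith-159 : ∀ L q → 112 ≤ L → L < 2 * q → 57 ≤ q
arith-159 L q h1 h2 = linear (L ∷ q ∷ []) 112999 (con 57) x1
    (hyp (con 56001) (con 112) x0 h1 ∷ hyp (con 56001) (con 1 ⊕ x0) (con 2 ⊛ x1) h2 ∷ []) refl

arith-160 : ∀ m L q ρ Y v1 v2 v3 r → m ≡ L + (q + ρ) → Y ≤ 16 * m + 1 → v1 ≡ v2 + v3 → 2 * v2 ≤ L * L →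
    v3 ≤ q * q + ρ * L + r + 12 * q + 8 * ρ → r ≤ ρ * ρ → q ≤ L → ρ ≤ q → 112 ≤ L → 57 ≤ q → 2 * v1 + Y ≤ m *
    m
arith-160 m L q ρ Y v1 v2 v3 r h1 h2 h3 h4 h5 h6 h7 h8 h9 h10 =
    linear (m ∷ L ∷ q ∷ ρ ∷ Y ∷ v1 ∷ v2 ∷ v3 ∷ r ∷ []) 3210 (con 2 ⊛ x5 ⊕ x4) (x0 ⊛ x0)
    (equ (con 95285) x0 (x1 ⊕ (x2 ⊕ x3)) h1 ∷ hyp (con 3211) x4 (con 16 ⊛ x0 ⊕ con 1) h2 ∷
    equ (con 6422) x5 (x6 ⊕ x7) h3 ∷ hyp (con 3211) (con 2 ⊛ x6) (x1 ⊛ x1) h4 ∷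
    hyp (con 6422) x7 (x2 ⊛ x2 ⊕ x3 ⊛ x1 ⊕ x8 ⊕ con 12 ⊛ x2 ⊕ con 8 ⊛ x3) h5 ∷ hyp (con 6422) x8 (x3 ⊛ x3) h6 ∷
    hyp (con 87742) (con 112) x1 h9 ∷ hyp (con 187283 ⊕ con 2573 ⊛ x3) (con 57) x2 h10 ∷ hyp (con 3211 ⊛ x2) x2 x1 h7 ∷
    hyp (con 3211 ⊛ x3) x3 x2 h8 ∷ prod (con 3211) (con 112) x1 h9 (con 57) x2 h10 ∷
    equ (con 3211 ⊛ x0 ⊕ con 3211 ⊛ x1 ⊕ con 3211 ⊛ x2 ⊕ con 3211 ⊛ x3) (x1 ⊕ (x2 ⊕ x3)) x0 (sym h1) ∷ []) refl

arith-161 : ∀ m L q ρ → m ≡ L + (q + ρ) → q ≤ L → ρ ≤ q → 336 ≤ m → 112 ≤ L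
arith-161 m L q ρ h1 h2 h3 h4 = linear (m ∷ L ∷ q ∷ ρ ∷ []) 2 (con 112) x1
    (equ (con 1) x0 (x1 ⊕ (x2 ⊕ x3)) h1 ∷ hyp (con 2) x2 x1 h2 ∷ hyp (con 1) x3 x2 h3 ∷ hyp (con 1) (con 336) x0 h4 ∷
    []) refl

arith-162 : ∀ L q → 84 ≤ L → L < 2 * q → 43 ≤ q
arith-162 L q h1 h2 = linear (L ∷ q ∷ []) 84999 (con 43) x1
    (hyp (con 42001) (con 84) x0 h1 ∷ hyp (con 42001) (con 1 ⊕ x0) (con 2 ⊛ x1) h2 ∷ []) refl

arith-163 : ∀ m L q ρ Y v1 v2 v3 r → m ≡ L + (q + ρ) → Y ≤ 16 * m + 1 → v1 ≡ v2 + v3 → 2 * v2 ≤ L * L →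
    v3 ≤ q * q + ρ * L + r + 12 * q + 8 * ρ → r + q * q ≤ 2 * (q * ρ) → 84 ≤ L → 43 ≤ q → 2 * v1 + Y ≤ m * m
arith-163 m L q ρ Y v1 v2 v3 r h1 h2 h3 h4 h5 h6 h7 h8 = linear (m ∷ L ∷ q ∷ ρ ∷ Y ∷ v1 ∷ v2 ∷ v3 ∷ r ∷ [])
    515 (con 2 ⊛ x5 ⊕ x4) (x0 ⊛ x0)
    (equ (con 8256) x0 (x1 ⊕ (x2 ⊕ x3)) h1 ∷ hyp (con 516) x4 (con 16 ⊛ x0 ⊕ con 1) h2 ∷
    equ (con 1032) x5 (x6 ⊕ x7) h3 ∷ hyp (con 516) (con 2 ⊛ x6) (x1 ⊛ x1) h4 ∷
    hyp (con 1032) x7 (x2 ⊛ x2 ⊕ x3 ⊛ x1 ⊕ x8 ⊕ con 12 ⊛ x2 ⊕ con 8 ⊛ x3) h5 ∷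
    hyp (con 1032) (x8 ⊕ x2 ⊛ x2) (con 2 ⊛ (x2 ⊛ x3)) h6 ∷ hyp (con 20597) (con 84) x1 h7 ∷
    hyp (con 19212) (con 43) x2 h8 ∷ prod (con 671) (con 84) x1 h7 (con 43) x2 h8 ∷ sq (con 516) x3 (x2 ⊕ con 16) ∷
    equ (con 516 ⊛ x0 ⊕ con 516 ⊛ x1 ⊕ con 516 ⊛ x2 ⊕ con 516 ⊛ x3) (x1 ⊕ (x2 ⊕ x3)) x0 (sym h1) ∷ []) refl

arith-164 : ∀ m L q ρ Y v1 v2 v3 r → m ≡ L + (q + ρ) → Y ≤ 16 * m + 1 → v1 ≡ v2 + v3 → 2 * v2 ≤ L * L →
    v3 ≤ q * q + ρ * L + r + 12 * q + 8 * ρ → r + q * q ≤ 2 * (q * ρ) → 49 ≤ L → q ≤ L → L < 84 → 336 ≤ m →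
    L < 2 * q → 2 * v1 + Y ≤ m * m
arith-164 m L q ρ Y v1 v2 v3 r h1 h2 h3 h4 h5 h6 h7 h8 h9 h10 h11 =
    linear (m ∷ L ∷ q ∷ ρ ∷ Y ∷ v1 ∷ v2 ∷ v3 ∷ r ∷ []) 4066 (con 2 ⊛ x5 ⊕ x4) (x0 ⊛ x0)
    (equ (con 284690) x0 (x1 ⊕ (x2 ⊕ x3)) h1 ∷ hyp (con 4067) x4 (con 16 ⊛ x0 ⊕ con 1) h2 ∷
    equ (con 8134) x5 (x6 ⊕ x7) h3 ∷ hyp (con 4067) (con 2 ⊛ x6) (x1 ⊛ x1) h4 ∷
    hyp (con 8134) x7 (x2 ⊛ x2 ⊕ x3 ⊛ x1 ⊕ x8 ⊕ con 12 ⊛ x2 ⊕ con 8 ⊛ x3) h5 ∷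
    hyp (con 8134) (x8 ⊕ x2 ⊛ x2) (con 2 ⊛ (x2 ⊛ x3)) h6 ∷ hyp (con 513716) x2 x1 h8 ∷
    hyp (con 798406) (con 1 ⊕ x1) (con 84) h9 ∷ hyp (con 219618) (con 336) x0 h10 ∷
    hyp (con 4456 ⊛ x2) (con 49) x1 h7 ∷ sq (con 4067) x3 (x2 ⊕ con 43) ∷
    equ (con 4067 ⊛ x0 ⊕ con 4067 ⊛ x1 ⊕ con 4067 ⊛ x2 ⊕ con 4067 ⊛ x3) (x1 ⊕ (x2 ⊕ x3)) x0 (sym h1) ∷ []) refl

arith-165 : ∀ m L z Y v1 v2 v3 n₁ → m ≡ L + z → Y ≤ 16 * m + 1 → v1 ≡ v2 + v3 → 3 * v2 ≤ L * (L + suc n₁ + 2)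
    → v3 ≤ L * z → 6 * n₁ + 4 ≤ L → 83 ≤ L → 2 * v1 + Y ≤ m * m
arith-165 m L z Y v1 v2 v3 n₁ h1 h2 h3 h4 h5 h6 h7 = linear (m ∷ L ∷ z ∷ Y ∷ v1 ∷ v2 ∷ v3 ∷ n₁ ∷ []) 248
    (con 2 ⊛ x4 ⊕ x3) (x0 ⊛ x0)
    (equ (con 3984) x0 (x1 ⊕ x2) h1 ∷ hyp (con 249) x3 (con 16 ⊛ x0 ⊕ con 1) h2 ∷ equ (con 498) x4 (x5 ⊕ x6) h3 ∷
    hyp (con 166) (con 3 ⊛ x5) (x1 ⊛ (x1 ⊕ (con 1 ⊕ x7) ⊕ con 2)) h4 ∷ hyp (con 498) x6 (x1 ⊛ x2) h5 ∷
    hyp (con 195 ⊕ con 55 ⊛ x1) (con 83) x1 h7 ∷ hyp (con 28 ⊛ x1) (con 6 ⊛ x7 ⊕ con 4) x1 h6 ∷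
    sq (con 249) x2 (con 8) ∷ equ (con 249 ⊛ x0 ⊕ con 249 ⊛ x1 ⊕ con 249 ⊛ x2) (x1 ⊕ x2) x0 (sym h1) ∷ []) refl

arith-166 : ∀ m L z Y v1 v2 v3 n₁ → m ≡ L + z → Y ≤ 16 * m + 1 → v1 ≡ v2 + v3 → 3 * v2 ≤ L * (L + suc n₁ + 2)
    → v3 ≤ L * z → 6 * n₁ + 4 ≤ L → L < 83 → 4 * (n₁ + 83) ≤ m → 49 ≤ L → 2 * v1 + Y ≤ m * m
arith-166 m L z Y v1 v2 v3 n₁ h1 h2 h3 h4 h5 h6 h7 h8 h9 = linear (m ∷ L ∷ z ∷ Y ∷ v1 ∷ v2 ∷ v3 ∷ n₁ ∷ [])
    187451 (con 2 ⊛ x4 ⊕ x3) (x0 ⊛ x0)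
    (equ (con 8180324) x0 (x1 ⊕ x2) h1 ∷ hyp (con 187452) x3 (con 16 ⊛ x0 ⊕ con 1) h2 ∷
    equ (con 374904) x4 (x5 ⊕ x6) h3 ∷ hyp (con 124968) (con 3 ⊛ x5) (x1 ⊛ (x1 ⊕ (con 1 ⊕ x7) ⊕ con 2)) h4 ∷
    hyp (con 374904) x6 (x1 ⊛ x2) h5 ∷ hyp (con 8305292) (con 1 ⊕ x1) (con 83) h7 ∷
    hyp (con 5181092) (con 4 ⊛ (x7 ⊕ con 83)) x0 h8 ∷ hyp (con 62484 ⊛ x1) (con 6 ⊛ x7 ⊕ con 4) x1 h6 ∷
    sq (con 16103) x2 (con 254) ∷ equ (con 187452 ⊛ x0 ⊕ con 187452 ⊛ x1 ⊕ con 187452 ⊛ x2) (x1 ⊕ x2) x0 (sym h1) ∷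
    []) refl

arith-167 : ∀ n₁ L → 4 * n₁ + 34 ≤ L → 3 * n₁ + 2 ≤ L
arith-167 n₁ L h1 = linear (n₁ ∷ L ∷ []) 3 (con 3 ⊛ x0 ⊕ con 2) x1
    (hyp (con 3) (con 4 ⊛ x0 ⊕ con 34) x1 h1 ∷ []) refl

arith-168 : ∀ m L z Y n₁ v1 v2 v3 u → m ≡ L + z → Y ≤ 64 * (n₁ + 83) + 1 → v1 ≡ v2 + v3 → v2 ≤ 2 * suc n₁ *
    L → v3 ≤ L * z → 4 * n₁ + 34 + u ≡ L → 4 * (n₁ + 83) ≤ m → 2 * v1 + Y ≤ m * m
arith-168 m L z Y n₁ v1 v2 v3 u h1 h2 h3 h4 h5 h6 h7 = linear (m ∷ L ∷ z ∷ Y ∷ n₁ ∷ v1 ∷ v2 ∷ v3 ∷ u ∷ [])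
    1132250 (con 2 ⊛ x5 ⊕ x3) (x0 ⊛ x0)
    (equ (con 24159754) x0 (x1 ⊕ x2) h1 ∷ hyp (con 1132251) x3 (con 64 ⊛ (x4 ⊕ con 83) ⊕ con 1) h2 ∷
    equ (con 2264502) x5 (x6 ⊕ x7) h3 ∷ hyp (con 2264502) x6 (con 2 ⊛ (con 1 ⊕ x4) ⊛ x1) h4 ∷
    hyp (con 2264502) x7 (x1 ⊛ x2) h5 ∷ equ (con 6043738) x1 (con 4 ⊛ x4 ⊕ con 34 ⊕ x8) (sym h6) ∷
    hyp (con 24159754) (con 4 ⊛ (x4 ⊕ con 83)) x0 h7 ∷
    equ (con 1132251 ⊛ x1 ⊕ con 177757 ⊛ x8) (con 4 ⊛ x4 ⊕ con 34 ⊕ x8) x1 h6 ∷ sq (con 81073) x2 (con 149) ∷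
    equ (con 1132251 ⊛ x0 ⊕ con 1132251 ⊛ x1 ⊕ con 1132251 ⊛ x2) (x1 ⊕ x2) x0 (sym h1) ∷ []) refl

arith-169 : ∀ m L z n₁ → m ≡ L + z → 4 * (n₁ + 83) ≤ m → 9 * z ≤ 2 * suc n₁ → 3 * n₁ + 2 ≤ L
arith-169 m L z n₁ h1 h2 h3 = linear (m ∷ L ∷ z ∷ n₁ ∷ []) 33 (con 3 ⊛ x3 ⊕ con 2) x1
    (equ (con 27) x0 (x1 ⊕ x2) h1 ∷ hyp (con 27) (con 4 ⊛ (x3 ⊕ con 83)) x0 h2 ∷
    hyp (con 3) (con 9 ⊛ x2) (con 2 ⊛ (con 1 ⊕ x3)) h3 ∷ []) refl

arith-170 : ∀ L n₁ → L ≤ 4 * n₁ + 33 → L ≤ 4 * suc n₁ + 30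
arith-170 L n₁ h1 = linear (L ∷ n₁ ∷ []) 0 x0 (con 4 ⊛ (con 1 ⊕ x1) ⊕ con 30)
    (hyp (con 1) x0 (con 4 ⊛ x1 ⊕ con 33) h1 ∷ []) refl

arith-171 : ∀ v1 z a n₁ L v2 v3 m Y → 2 * v1 + 2 * (2 * z * a) ≤ 2 * (n₁ * L + suc n₁ * L + 32 * L) + 4 *
    (2 * z * (2 * z)) + 64 * (2 * z) → v2 ≤ 2 * (a * z) + z * z → v3 ≡ v1 + v2 → m ≡ L + z → Y ≤ 16 * m + 1 →
    9 * z ≤ 2 * suc n₁ → 4 * (n₁ + 83) ≤ m → 2 * v3 + Y ≤ m * m
arith-171 v1 z a n₁ L v2 v3 m Y h1 h2 h3 h4 h5 h6 h7 = linear (v1 ∷ z ∷ a ∷ n₁ ∷ L ∷ v2 ∷ v3 ∷ m ∷ Y ∷ [])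
    5230 (con 2 ⊛ x6 ⊕ x8) (x7 ⊛ x7)
    (hyp (con 5231) (con 2 ⊛ x0 ⊕ con 2 ⊛ (con 2 ⊛ x1 ⊛ x2))
        (con 2 ⊛ (x3 ⊛ x4 ⊕ (con 1 ⊕ x3) ⊛ x4 ⊕ con 32 ⊛ x4) ⊕ con 4 ⊛ (con 2 ⊛ x1 ⊛ (con 2 ⊛ x1)) ⊕ con 64 ⊛
        (con 2 ⊛ x1)) h1 ∷
    hyp (con 10462) x5 (con 2 ⊛ (x2 ⊛ x1) ⊕ x1 ⊛ x1) h2 ∷ equ (con 10462) x6 (x0 ⊕ x5) h3 ∷
    equ (con 686892 ⊕ con 20924 ⊛ x3) (x4 ⊕ x1) x7 (sym h4) ∷ hyp (con 65600) x8 (con 16 ⊛ x7 ⊕ con 1) h5 ∷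
    hyp (con 400 ⊕ con 10462 ⊛ x1) (con 9 ⊛ x1) (con 2 ⊛ (con 1 ⊕ x3)) h6 ∷
    hyp (con 200 ⊕ con 5231 ⊛ x7) (con 4 ⊛ (x3 ⊕ con 83)) x7 h7 ∷ []) refl

arith-172 : ∀ b L n₁ → 4 * b ≤ L → L < 4 * suc n₁ → b ≤ suc n₁
arith-172 b L n₁ h1 h2 = linear (b ∷ L ∷ n₁ ∷ []) 3 x0 (con 1 ⊕ x2)
    (hyp (con 1) (con 4 ⊛ x0) x1 h1 ∷ hyp (con 1) (con 1 ⊕ x1) (con 4 ⊛ (con 1 ⊕ x2)) h2 ∷ []) refl

arith-173 : ∀ L b → L ≤ 4 * b + 3 → L ≤ 4 * b + 30
arith-173 L b h1 = linear (L ∷ b ∷ []) 0 x0 (con 4 ⊛ x1 ⊕ con 30)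
    (hyp (con 1) x0 (con 4 ⊛ x1 ⊕ con 3) h1 ∷ []) refl

arith-174 : ∀ m L z n₁ → m ≡ L + z → 4 * (n₁ + 83) ≤ m → L ≤ 4 * n₁ + 33 → 299 ≤ z
arith-174 m L z n₁ h1 h2 h3 = linear (m ∷ L ∷ z ∷ n₁ ∷ []) 0 (con 299) x2
    (equ (con 1) x0 (x1 ⊕ x2) h1 ∷ hyp (con 1) (con 4 ⊛ (x3 ⊕ con 83)) x0 h2 ∷
    hyp (con 1) x1 (con 4 ⊛ x3 ⊕ con 33) h3 ∷ []) refl

arith-175 : ∀ m L z v1 v2 v3 n₁ Y → m ≡ L + z → v1 ≡ v2 + v3 → 2 * v2 ≤ L * L → v3 ≤ L * z → 299 ≤ z →
    2 * suc n₁ < 9 * z → Y ≤ 33 * n₁ + 44000 → 2 * v1 + Y ≤ m * m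
arith-175 m L z v1 v2 v3 n₁ Y h1 h2 h3 h4 h5 h6 h7 = linear (m ∷ L ∷ z ∷ v1 ∷ v2 ∷ v3 ∷ n₁ ∷ Y ∷ []) 1
    (con 2 ⊛ x3 ⊕ x7) (x0 ⊛ x0)
    (equ (con 4) x3 (x4 ⊕ x5) h2 ∷ hyp (con 2) (con 2 ⊛ x4) (x1 ⊛ x1) h3 ∷ hyp (con 4) x5 (x1 ⊛ x2) h4 ∷
    hyp (con 301 ⊕ con 2 ⊛ x2) (con 299) x2 h5 ∷ hyp (con 33) (con 1 ⊕ con 2 ⊛ (con 1 ⊕ x6)) (con 9 ⊛ x2) h6 ∷
    hyp (con 2) x7 (con 33 ⊛ x6 ⊕ con 44000) h7 ∷ equ (con 2 ⊛ x0 ⊕ con 2 ⊛ x1 ⊕ con 2 ⊛ x2) (x1 ⊕ x2) x0 (sym h1) ∷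
    []) refl

arith-176 : ∀ m L z v1 v2 v3 n₁ Y → m ≡ L + z → v1 ≡ v2 + v3 → 2 * v2 ≤ L * L → v3 ≤ L * z → 299 ≤ z →
    2 * suc n₁ < 9 * z → Y ≤ 64 * n₁ → 2 * v1 + Y ≤ m * m
arith-176 m L z v1 v2 v3 n₁ Y h1 h2 h3 h4 h5 h6 h7 = linear (m ∷ L ∷ z ∷ v1 ∷ v2 ∷ v3 ∷ n₁ ∷ Y ∷ []) 0
    (con 2 ⊛ x3 ⊕ x7) (x0 ⊛ x0)
    (equ (con 2) x3 (x4 ⊕ x5) h2 ∷ hyp (con 1) (con 2 ⊛ x4) (x1 ⊛ x1) h3 ∷ hyp (con 2) x5 (x1 ⊛ x2) h4 ∷
    hyp (con 11 ⊕ x2) (con 299) x2 h5 ∷ hyp (con 32) (con 1 ⊕ con 2 ⊛ (con 1 ⊕ x6)) (con 9 ⊛ x2) h6 ∷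
    hyp (con 1) x7 (con 64 ⊛ x6) h7 ∷ equ (x0 ⊕ x1 ⊕ x2) (x1 ⊕ x2) x0 (sym h1) ∷ []) refl

arith-177 : ∀ X n₁ m → X ≤ 48 * (n₁ + 83) → 4 * (n₁ + 83) ≤ m → 16 * (n₁ + 83) + 1 + X ≤ 16 * m + 1
arith-177 X n₁ m h1 h2 = linear (X ∷ n₁ ∷ m ∷ []) 0 (con 16 ⊛ (x1 ⊕ con 83) ⊕ con 1 ⊕ x0) (con 16 ⊛ x2 ⊕ con 1)
    (hyp (con 1) x0 (con 48 ⊛ (x1 ⊕ con 83)) h1 ∷ hyp (con 16) (con 4 ⊛ (x1 ⊕ con 83)) x2 h2 ∷ []) refl

arith-178 : ∀ X n₁ → X ≡ 0 → 16 * (n₁ + 83) + 1 + X ≤ 33 * n₁ + 44000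
arith-178 X n₁ h1 = linear (X ∷ n₁ ∷ []) 0 (con 16 ⊛ (x1 ⊕ con 83) ⊕ con 1 ⊕ x0) (con 33 ⊛ x1 ⊕ con 44000)
    (equ (con 1) x0 (con 0) h1 ∷ []) refl

arith-179 : ∀ X n₁ → X + 280000 ≡ 48 * (n₁ + 83) → 16 * (n₁ + 83) + 1 + X ≤ 64 * n₁
arith-179 X n₁ h1 = linear (X ∷ n₁ ∷ []) 0 (con 16 ⊛ (x1 ⊕ con 83) ⊕ con 1 ⊕ x0) (con 64 ⊛ x1)
    (equ (con 1) (x0 ⊕ con 280000) (con 48 ⊛ (x1 ⊕ con 83)) h1 ∷ []) refl

arith-180 : ∀ m L z n₁ → m ≡ L + z → z ≡ 0 → 4 * (n₁ + 83) ≤ m → L ≤ 4 * n₁ + 33 → ⊥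
arith-180 m L z n₁ h1 h2 h3 h4 = 1≰0 (linear (m ∷ L ∷ z ∷ n₁ ∷ []) 298 (con 1) (con 0)
    (equ (con 1) x0 (x1 ⊕ x2) h1 ∷ equ (con 1) x2 (con 0) h2 ∷ hyp (con 1) (con 4 ⊛ (x3 ⊕ con 83)) x0 h3 ∷
    hyp (con 1) x1 (con 4 ⊛ x3 ⊕ con 33) h4 ∷ []) refl)

arith-181 : ∀ L z v1 → L * z + (2 * (v1 * 0) + 0 * 0) ≤ L * z
arith-181 L z v1 = linear (L ∷ z ∷ v1 ∷ []) 0 (x0 ⊛ x1 ⊕ (con 2 ⊛ (x2 ⊛ con 0) ⊕ con 0 ⊛ con 0)) (x0 ⊛ x1)
    [] refl

arith-182 : ∀ n₁ L → 2 * n₁ + 1 < L → 2 * suc n₁ ≤ L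
arith-182 n₁ L h1 = linear (n₁ ∷ L ∷ []) 0 (con 2 ⊛ (con 1 ⊕ x0)) x1
    (hyp (con 1) (con 1 ⊕ (con 2 ⊛ x0 ⊕ con 1)) x1 h1 ∷ []) refl

arith-183 : ∀ X n₁ → X ≤ 48 * (n₁ + 83) → 16 * (n₁ + 83) + 1 + X ≤ 64 * (n₁ + 83) + 1
arith-183 X n₁ h1 = linear (X ∷ n₁ ∷ []) 0 (con 16 ⊛ (x1 ⊕ con 83) ⊕ con 1 ⊕ x0) (con 64 ⊛ (x1 ⊕ con 83) ⊕ con 1)
    (hyp (con 1) x0 (con 48 ⊛ (x1 ⊕ con 83)) h1 ∷ []) refl

arith-184 : ∀ m L z v1 v2 v3 v4 t X → m ≡ L + z → v1 ≡ v2 + v3 → 2 * v2 ≤ L * L → v3 ≤ L * z +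
    (2 * (v4 * 0) + 0 * 0) → 2 * v1 ≤ m * m + 4 * (t * t) + X
arith-184 m L z v1 v2 v3 v4 t X h1 h2 h3 h4 = linear (m ∷ L ∷ z ∷ v1 ∷ v2 ∷ v3 ∷ v4 ∷ t ∷ X ∷ []) 0
    (con 2 ⊛ x3) (x0 ⊛ x0 ⊕ con 4 ⊛ (x7 ⊛ x7) ⊕ x8)
    (equ (con 2) x3 (x4 ⊕ x5) h2 ∷ hyp (con 1) (con 2 ⊛ x4) (x1 ⊛ x1) h3 ∷
    hyp (con 2) x5 (x1 ⊛ x2 ⊕ (con 2 ⊛ (x6 ⊛ con 0) ⊕ con 0 ⊛ con 0)) h4 ∷ equ (x0 ⊕ x1 ⊕ x2) (x1 ⊕ x2) x0 (sym h1) ∷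
    []) refl

arith-185 : ∀ m L q ρ v1 v2 v3 r t X → m ≡ L + (q + ρ) → v1 ≡ v2 + v3 → 2 * v2 ≤ L * L → v3 ≤ q * q + ρ * L +
    r + 12 * q + 8 * ρ → r ≤ ρ * ρ → q ≤ L → ρ ≤ q → 49 ≤ L → L < 2 * q → 2 * v1 ≤ m * m + 4 * (t * t) + X
arith-185 m L q ρ v1 v2 v3 r t X h1 h2 h3 h4 h5 h6 h7 h8 h9 =
    linear (m ∷ L ∷ q ∷ ρ ∷ v1 ∷ v2 ∷ v3 ∷ r ∷ t ∷ X ∷ []) 392 (con 2 ⊛ x4) (x0 ⊛ x0 ⊕ con 4 ⊛ (x8 ⊛ x8) ⊕ x9)
    (equ (con 786) x4 (x5 ⊕ x6) h2 ∷ hyp (con 393) (con 2 ⊛ x5) (x1 ⊛ x1) h3 ∷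
    hyp (con 786) x6 (x2 ⊛ x2 ⊕ x3 ⊛ x1 ⊕ x7 ⊕ con 12 ⊛ x2 ⊕ con 8 ⊛ x3) h4 ∷ hyp (con 786) x7 (x3 ⊛ x3) h5 ∷
    hyp (con 6199 ⊕ con 482 ⊛ x3) x3 x2 h7 ∷ hyp (con 430 ⊛ x2) x2 x1 h6 ∷ hyp (con 319 ⊛ x2) (con 49) x1 h8 ∷
    equ (con 393 ⊛ x0 ⊕ con 393 ⊛ x1 ⊕ con 356 ⊛ x2 ⊕ con 304 ⊛ x3) (x1 ⊕ (x2 ⊕ x3)) x0 (sym h1) ∷
    hyp (con 89 ⊛ x3) (con 1 ⊕ x1) (con 2 ⊛ x2) h9 ∷ []) refl

arith-186 : ∀ m L q ρ v1 v2 v3 r t X → m ≡ L + (q + ρ) → v1 ≡ v2 + v3 → 2 * v2 ≤ L * L → v3 ≤ q * q + ρ * L +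
    r + 12 * q + 8 * ρ → r + q * q ≤ 2 * (q * ρ) → 49 ≤ L → L < 2 * q → 2 * v1 ≤ m * m + 4 * (t * t) + X
arith-186 m L q ρ v1 v2 v3 r t X h1 h2 h3 h4 h5 h6 h7 = linear (m ∷ L ∷ q ∷ ρ ∷ v1 ∷ v2 ∷ v3 ∷ r ∷ t ∷ X ∷
    []) 174 (con 2 ⊛ x4) (x0 ⊛ x0 ⊕ con 4 ⊛ (x8 ⊛ x8) ⊕ x9)
    (equ (con 350) x4 (x5 ⊕ x6) h2 ∷ hyp (con 175) (con 2 ⊛ x5) (x1 ⊛ x1) h3 ∷
    hyp (con 350) x6 (x2 ⊛ x2 ⊕ x3 ⊛ x1 ⊕ x7 ⊕ con 12 ⊛ x2 ⊕ con 8 ⊛ x3) h4 ∷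
    hyp (con 350) (x7 ⊕ x2 ⊛ x2) (con 2 ⊛ (x2 ⊛ x3)) h5 ∷ hyp (con 224 ⊕ con 152 ⊛ x2) (con 49) x1 h6 ∷
    hyp (con 224) (con 1 ⊕ x1) (con 2 ⊛ x2) h7 ∷ sq (con 175) x3 (x2 ⊕ con 8) ∷
    equ (con 175 ⊛ x0 ⊕ con 175 ⊛ x1 ⊕ con 175 ⊛ x2 ⊕ con 175 ⊛ x3) (x1 ⊕ (x2 ⊕ x3)) x0 (sym h1) ∷ []) refl

arith-187 : ∀ L m L′ → 2 * L + 58 ≤ m → m ≤ 2 * L′ + 1 → L ≤ L′
arith-187 L m L′ h1 h2 = linear (L ∷ m ∷ L′ ∷ []) 1 x0 x2
    (hyp (con 1) (con 2 ⊛ x0 ⊕ con 58) x1 h1 ∷ hyp (con 1) x1 (con 2 ⊛ x2 ⊕ con 1) h2 ∷ []) refl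

arith-188 : ∀ m t n₁ L → m + t ≡ 4 * (n₁ + 83) → L ≤ 2 * n₁ + 1 → 2 * L + 330 ≤ m + t
arith-188 m t n₁ L h1 h2 = linear (m ∷ t ∷ n₁ ∷ L ∷ []) 0 (con 2 ⊛ x3 ⊕ con 330) (x0 ⊕ x1)
    (equ (con 1) (con 4 ⊛ (x2 ⊕ con 83)) (x0 ⊕ x1) (sym h1) ∷ hyp (con 2) x3 (con 2 ⊛ x2 ⊕ con 1) h2 ∷ []) refl

arith-189 : ∀ L m t → 2 * L + 330 ≤ m + t → t ≤ 272 → 2 * L + 58 ≤ m
arith-189 L m t h1 h2 = linear (L ∷ m ∷ t ∷ []) 0 (con 2 ⊛ x0 ⊕ con 58) x1
    (hyp (con 1) (con 2 ⊛ x0 ⊕ con 330) (x1 ⊕ x2) h1 ∷ hyp (con 1) x2 (con 272) h2 ∷ []) refl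

arith-190 : ∀ m L z v1 v2 v3 L′ v4 t X → m ≡ L + z → 2 * L + 58 ≤ m → v1 ≡ v2 + v3 → v2 ≤ L * L → v3 ≤ L′ * z
    + (2 * (v4 * 0) + 0 * 0) → 2 * L′ ≤ m → 2 * v1 ≤ m * m + 4 * (t * t) + X
arith-190 m L z v1 v2 v3 L′ v4 t X h1 h2 h3 h4 h5 h6 = linear (m ∷ L ∷ z ∷ v1 ∷ v2 ∷ v3 ∷ L′ ∷ v4 ∷ t ∷ X ∷
    []) 0 (con 2 ⊛ x3) (x0 ⊛ x0 ⊕ con 4 ⊛ (x8 ⊛ x8) ⊕ x9)
    (equ (con 2) x3 (x4 ⊕ x5) h3 ∷ hyp (con 2) x4 (x1 ⊛ x1) h4 ∷
    hyp (con 2) x5 (x6 ⊛ x2 ⊕ (con 2 ⊛ (x7 ⊛ con 0) ⊕ con 0 ⊛ con 0)) h5 ∷ hyp x2 (con 2 ⊛ x6) x0 h6 ∷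
    hyp x1 (con 2 ⊛ x1 ⊕ con 58) x0 h2 ∷ equ x0 (x1 ⊕ x2) x0 (sym h1) ∷ []) refl

arith-191 : ∀ L′ q m L → L′ < 2 * q → m ≤ 2 * L′ + 1 → 2 * L + 58 ≤ m → L ≤ 2 * q
arith-191 L′ q m L h1 h2 h3 = linear (L′ ∷ q ∷ m ∷ L ∷ []) 1 x3 (con 2 ⊛ x1)
    (hyp (con 2) (con 1 ⊕ x0) (con 2 ⊛ x1) h1 ∷ hyp (con 1) x2 (con 2 ⊛ x0 ⊕ con 1) h2 ∷
    hyp (con 1) (con 2 ⊛ x3 ⊕ con 58) x2 h3 ∷ []) refl

arith-192 : ∀ m L q ρ → m ≡ L + (q + ρ) → 2 * L + 58 ≤ m → L + 58 ≤ q + ρ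
arith-192 m L q ρ h1 h2 = linear (m ∷ L ∷ q ∷ ρ ∷ []) 0 (x1 ⊕ con 58) (x2 ⊕ x3)
    (equ (con 1) x0 (x1 ⊕ (x2 ⊕ x3)) h1 ∷ hyp (con 1) (con 2 ⊛ x1 ⊕ con 58) x0 h2 ∷ []) refl

arith-193 : ∀ m L q ρ v1 v2 v3 r t X → m ≡ L + (q + ρ) → v1 ≡ v2 + v3 → v2 ≤ L * L → v3 ≤ q * q + ρ * L + r +
    12 * q + 8 * ρ → r ≤ ρ * ρ → q ≤ L → ρ ≤ q → L ≤ 2 * q → L + 58 ≤ q + ρ → 2 * v1 ≤ m * m + 4 * (t * t) + X
arith-193 m L q ρ v1 v2 v3 r t X h1 h2 h3 h4 h5 h6 h7 h8 h9 =
    linear (m ∷ L ∷ q ∷ ρ ∷ v1 ∷ v2 ∷ v3 ∷ r ∷ t ∷ X ∷ []) 0 (con 2 ⊛ x4) (x0 ⊛ x0 ⊕ con 4 ⊛ (x8 ⊛ x8) ⊕ x9)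
    (equ (con 2) x4 (x5 ⊕ x6) h2 ∷ hyp (con 2) x5 (x1 ⊛ x1) h3 ∷
    hyp (con 2) x6 (x2 ⊛ x2 ⊕ x3 ⊛ x1 ⊕ x7 ⊕ con 12 ⊛ x2 ⊕ con 8 ⊛ x3) h4 ∷ hyp (con 2) x7 (x3 ⊛ x3) h5 ∷
    hyp (con 18) x2 x1 h6 ∷ hyp (con 16 ⊕ x3) x3 x2 h7 ∷ hyp (con 18) x1 (con 2 ⊛ x2) h8 ∷
    hyp x2 (x1 ⊕ con 58) (x2 ⊕ x3) h9 ∷ prod (con 1) x2 x1 h6 x1 (con 2 ⊛ x2) h8 ∷
    equ (x0 ⊕ x1 ⊕ x2 ⊕ x3) (x1 ⊕ (x2 ⊕ x3)) x0 (sym h1) ∷ []) refl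

arith-194 : ∀ L′ q m L t → L′ < 2 * q → m ≤ 2 * L′ + 1 → 2 * L + 330 ≤ m + t → 2 * L + 331 ≤ 4 * q + t
arith-194 L′ q m L t h1 h2 h3 = linear (L′ ∷ q ∷ m ∷ L ∷ t ∷ []) 0 (con 2 ⊛ x3 ⊕ con 331) (con 4 ⊛ x1 ⊕ x4)
    (hyp (con 2) (con 1 ⊕ x0) (con 2 ⊛ x1) h1 ∷ hyp (con 1) x2 (con 2 ⊛ x0 ⊕ con 1) h2 ∷
    hyp (con 1) (con 2 ⊛ x3 ⊕ con 330) (x2 ⊕ x4) h3 ∷ []) refl

arith-195 : ∀ m L q ρ v1 v2 v3 r t X → m ≡ L + (q + ρ) → v1 ≡ v2 + v3 → v2 ≤ L * L → v3 ≤ q * q + ρ * L + r +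
    12 * q + 8 * ρ → r + q * q ≤ 2 * (q * ρ) → q ≤ L → 49 ≤ L → 2 * L + 331 ≤ 4 * q + t → t ≤ 251 →
    2 * v1 ≤ m * m + 4 * (t * t) + X
arith-195 m L q ρ v1 v2 v3 r t X h1 h2 h3 h4 h5 h6 h7 h8 h9 =
    linear (m ∷ L ∷ q ∷ ρ ∷ v1 ∷ v2 ∷ v3 ∷ r ∷ t ∷ X ∷ []) 501 (con 2 ⊛ x4) (x0 ⊛ x0 ⊕ con 4 ⊛ (x8 ⊛ x8) ⊕ x9)
    (equ (con 1004) x4 (x5 ⊕ x6) h2 ∷ hyp (con 1004) x5 (x1 ⊛ x1) h3 ∷
    hyp (con 1004) x6 (x2 ⊛ x2 ⊕ x3 ⊛ x1 ⊕ x7 ⊕ con 12 ⊛ x2 ⊕ con 8 ⊛ x3) h4 ∷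
    hyp (con 1004) (x7 ⊕ x2 ⊛ x2) (con 2 ⊛ (x2 ⊛ x3)) h5 ∷ hyp (con 10040) (con 49) x1 h7 ∷
    hyp (con 7279) (con 2 ⊛ x1 ⊕ con 331) (con 4 ⊛ x2 ⊕ x8) h8 ∷ hyp (con 7511) x8 (con 251) h9 ∷
    prod (con 251) (con 2 ⊛ x1 ⊕ con 331) (con 4 ⊛ x2 ⊕ x8) h8 (con 49) x1 h7 ∷
    prod (con 251) x8 (con 251) h9 (con 49) x1 h7 ∷ sq (con 502) x3 (x2 ⊕ con 8) ∷
    equ (con 502 ⊛ x0 ⊕ con 502 ⊛ x1 ⊕ con 502 ⊛ x2 ⊕ con 502 ⊛ x3) (x1 ⊕ (x2 ⊕ x3)) x0 (sym h1) ∷ []) refl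

arith-196 : ∀ L′ q m L → L′ < 2 * q → m ≤ 2 * L′ + 1 → 2 * L + 58 ≤ m → L + 29 ≤ 2 * q
arith-196 L′ q m L h1 h2 h3 = linear (L′ ∷ q ∷ m ∷ L ∷ []) 1 (x3 ⊕ con 29) (con 2 ⊛ x1)
    (hyp (con 2) (con 1 ⊕ x0) (con 2 ⊛ x1) h1 ∷ hyp (con 1) x2 (con 2 ⊛ x0 ⊕ con 1) h2 ∷
    hyp (con 1) (con 2 ⊛ x3 ⊕ con 58) x2 h3 ∷ []) refl

arith-197 : ∀ m L q ρ v1 v2 v3 r t n₁ X → m ≡ L + (q + ρ) → v1 ≡ v2 + v3 → v2 ≤ L * L → v3 ≤ q * q + ρ * L +
    r + 12 * q + 8 * ρ → r + q * q ≤ 2 * (q * ρ) → q ≤ L → L + 29 ≤ 2 * q → 251 < t → 48 * (n₁ + 83) ≤ X +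
    280000 → L ≤ 2 * n₁ + 1 → 2 * v1 ≤ m * m + 4 * (t * t) + X
arith-197 m L q ρ v1 v2 v3 r t n₁ X h1 h2 h3 h4 h5 h6 h7 h8 h9 h10 =
    linear (m ∷ L ∷ q ∷ ρ ∷ v1 ∷ v2 ∷ v3 ∷ r ∷ t ∷ n₁ ∷ X ∷ []) 190511 (con 2 ⊛ x4)
    (x0 ⊛ x0 ⊕ con 4 ⊛ (x8 ⊛ x8) ⊕ x10)
    (equ (con 381024) x4 (x5 ⊕ x6) h2 ∷ hyp (con 381024) x5 (x1 ⊛ x1) h3 ∷
    hyp (con 381024) x6 (x2 ⊛ x2 ⊕ x3 ⊛ x1 ⊕ x7 ⊕ con 12 ⊛ x2 ⊕ con 8 ⊛ x3) h4 ∷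
    hyp (con 381024) (x7 ⊕ x2 ⊛ x2) (con 2 ⊛ (x2 ⊛ x3)) h5 ∷ hyp (con 7620480) x2 x1 h6 ∷
    hyp (con 191392488) (con 1 ⊕ con 251) x8 h8 ∷ hyp (con 87318) (con 48 ⊛ (x9 ⊕ con 83)) (x10 ⊕ con 280000) h9 ∷
    hyp (con 2095632) x1 (con 2 ⊛ x9 ⊕ con 1) h10 ∷ hyp (con 190512 ⊛ x1) (x1 ⊕ con 29) (con 2 ⊛ x2) h7 ∷
    sq (con 190512) x3 (x2 ⊕ con 8) ∷ sq (con 379747) x8 (con 252) ∷
    equ (con 190512 ⊛ x0 ⊕ con 190512 ⊛ x1 ⊕ con 190512 ⊛ x2 ⊕ con 190512 ⊛ x3) (x1 ⊕ (x2 ⊕ x3)) x0 (sym h1) ∷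
    []) refl

arith-198 : ∀ m t n₁ L z k → m + t ≡ 4 * (n₁ + 83) → 2 * t < m → m ≡ L + z → L ≤ 2 * n₁ + 1 → 4 * k ≤ L → k ≤ z
arith-198 m t n₁ L z k h1 h2 h3 h4 h5 = linear (m ∷ t ∷ n₁ ∷ L ∷ z ∷ k ∷ []) 3 x5 x4
    (equ (con 2) (con 4 ⊛ (x2 ⊕ con 83)) (x0 ⊕ x1) (sym h1) ∷ hyp (con 1) (con 1 ⊕ con 2 ⊛ x1) x0 h2 ∷
    equ (con 3) x0 (x3 ⊕ x4) h3 ∷ hyp (con 4) x3 (con 2 ⊛ x2 ⊕ con 1) h4 ∷ hyp (con 1) (con 4 ⊛ x5) x3 h5 ∷ []) refl

arith-199 : ∀ m t n₁ → m + t ≡ 4 * (n₁ + 83) → 2 * t < m → n₁ + 83 ≤ m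
arith-199 m t n₁ h1 h2 = linear (m ∷ t ∷ n₁ ∷ []) 7 (x2 ⊕ con 83) x0
    (equ (con 2) (con 4 ⊛ (x2 ⊕ con 83)) (x0 ⊕ x1) (sym h1) ∷ hyp (con 1) (con 1 ⊕ con 2 ⊛ x1) x0 h2 ∷ []) refl

arith-200 : ∀ m L z k w v1 v2 v3 a t n₁ X → m ≡ L + z → k + w ≡ z → v1 ≡ v2 + v3 → v2 + a * a ≤ L * L →
    v3 ≤ L * w + (2 * (a * k) + k * k) → 4 * k ≤ L → L ≤ 4 * k + 3 → m + t ≡ 4 * (n₁ + 83) → L ≤ 2 * n₁ + 1 →
    272 < t → n₁ + 83 ≤ m → 2 * v1 ≤ m * m + 4 * (t * t) + X
arith-200 m L z k w v1 v2 v3 a t n₁ X h1 h2 h3 h4 h5 h6 h7 h8 h9 h10 h11 =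
    linear (m ∷ L ∷ z ∷ k ∷ w ∷ v1 ∷ v2 ∷ v3 ∷ a ∷ t ∷ n₁ ∷ X ∷ []) 3 (con 2 ⊛ x5)
    (x0 ⊛ x0 ⊕ con 4 ⊛ (x9 ⊛ x9) ⊕ x11)
    (equ (con 8) x5 (x6 ⊕ x7) h3 ∷ hyp (con 8) (x6 ⊕ x8 ⊛ x8) (x1 ⊛ x1) h4 ∷
    hyp (con 8) x7 (x1 ⊛ x4 ⊕ (con 2 ⊛ (x8 ⊛ x3) ⊕ x3 ⊛ x3)) h5 ∷ hyp (con 29092) (con 4 ⊛ x3) x1 h6 ∷
    hyp (con 29095) x1 (con 4 ⊛ x3 ⊕ con 3) h7 ∷ equ (con 220 ⊕ con 4 ⊛ x9) (x0 ⊕ x9) (con 4 ⊛ (x10 ⊕ con 83)) h8 ∷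
    hyp (con 662 ⊕ con 4 ⊛ x10) x1 (con 2 ⊛ x10 ⊕ con 1) h9 ∷ hyp (con 220) (con 1 ⊕ con 272) x9 h10 ∷
    hyp (con 1540) (x10 ⊕ con 83) x0 h11 ∷ sq (con 8) x8 x3 ∷
    prod (con 1) (con 4 ⊛ x3) x1 h6 x1 (con 4 ⊛ x3 ⊕ con 3) h7 ∷
    prod (con 8) x1 (con 2 ⊛ x10 ⊕ con 1) h9 (x10 ⊕ con 83) x0 h11 ∷
    prod (con 1) x1 (con 2 ⊛ x10 ⊕ con 1) h9 x1 (con 2 ⊛ x10 ⊕ con 1) h9 ∷
    equ (con 4 ⊛ x0) (con 4 ⊛ (x10 ⊕ con 83)) (x0 ⊕ x9) (sym h8) ∷ sq (con 4) (x10 ⊕ con 83) (x9 ⊕ x9) ∷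
    equ (con 8 ⊛ x1) (x1 ⊕ x2) x0 (sym h1) ∷ equ (con 8 ⊛ x1) (x3 ⊕ x4) x2 h2 ∷ []) refl

arith-201 : ∀ L q → 49 ≤ L → L < 2 * q → 25 ≤ q
arith-201 L q h1 h2 = linear (L ∷ q ∷ []) 1 (con 25) x1
    (hyp (con 1) (con 49) x0 h1 ∷ hyp (con 1) (con 1 ⊕ x0) (con 2 ⊛ x1) h2 ∷ []) refl

arith-202 : ∀ m L q ρ v1 v2 v3 r t n₁ X → m ≡ L + (q + ρ) → v1 ≡ v2 + v3 → v2 ≤ L * L → v3 ≤ q * q + ρ * L +
    r + 12 * q + 8 * ρ → r ≤ ρ * ρ → q ≤ L → ρ ≤ q → L ≤ 2 * q → L ≤ q + ρ → 25 ≤ q → 272 < t →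
    48 * (n₁ + 83) ≤ X + 280000 → L ≤ 2 * n₁ + 1 → 2 * v1 ≤ m * m + 4 * (t * t) + X
arith-202 m L q ρ v1 v2 v3 r t n₁ X h1 h2 h3 h4 h5 h6 h7 h8 h9 h10 h11 h12 h13 =
    linear (m ∷ L ∷ q ∷ ρ ∷ v1 ∷ v2 ∷ v3 ∷ r ∷ t ∷ n₁ ∷ X ∷ []) 0 (con 2 ⊛ x4)
    (x0 ⊛ x0 ⊕ con 4 ⊛ (x8 ⊛ x8) ⊕ x10)
    (equ (con 2) x4 (x5 ⊕ x6) h2 ∷ hyp (con 2) x5 (x1 ⊛ x1) h3 ∷
    hyp (con 2) x6 (x2 ⊛ x2 ⊕ x3 ⊛ x1 ⊕ x7 ⊕ con 12 ⊛ x2 ⊕ con 8 ⊛ x3) h4 ∷ hyp (con 2) x7 (x3 ⊛ x3) h5 ∷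
    hyp (con 8) x2 x1 h6 ∷ hyp (con 9) x1 (x2 ⊕ x3) h9 ∷ hyp (con 2184) (con 1 ⊕ con 272) x8 h11 ∷
    hyp (con 1) (con 48 ⊛ (x9 ⊕ con 83)) (x10 ⊕ con 280000) h12 ∷ hyp (con 24) x1 (con 2 ⊛ x9 ⊕ con 1) h13 ∷
    hyp x3 x3 x2 h7 ∷ prod (con 1) x2 x1 h6 x1 (con 2 ⊛ x2) h8 ∷ prod (con 1) x1 (x2 ⊕ x3) h9 (con 25) x2 h10 ∷
    sq (con 4) x8 (con 273) ∷ equ (x0 ⊕ x1 ⊕ x2 ⊕ x3) (x1 ⊕ (x2 ⊕ x3)) x0 (sym h1) ∷ []) refl

arith-203 : ∀ m L q ρ t n₁ → m ≡ L + (q + ρ) → m + t ≡ 4 * (n₁ + 83) → L ≤ 2 * n₁ + 1 → L + 330 ≤ q + ρ + t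
arith-203 m L q ρ t n₁ h1 h2 h3 = linear (m ∷ L ∷ q ∷ ρ ∷ t ∷ n₁ ∷ []) 0 (x1 ⊕ con 330) (x2 ⊕ x3 ⊕ x4)
    (equ (con 1) x0 (x1 ⊕ (x2 ⊕ x3)) h1 ∷ equ (con 1) (con 4 ⊛ (x5 ⊕ con 83)) (x0 ⊕ x4) (sym h2) ∷
    hyp (con 2) x1 (con 2 ⊛ x5 ⊕ con 1) h3 ∷ []) refl

arith-204 : ∀ m L q ρ t n₁ → m ≡ L + (q + ρ) → m + t ≡ 4 * (n₁ + 83) → L ≤ 2 * n₁ + 1 → q + ρ ≤ L → 330 ≤ t
arith-204 m L q ρ t n₁ h1 h2 h3 h4 = linear (m ∷ L ∷ q ∷ ρ ∷ t ∷ n₁ ∷ []) 0 (con 330) x4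
    (equ (con 1) x0 (x1 ⊕ (x2 ⊕ x3)) h1 ∷ equ (con 1) (con 4 ⊛ (x5 ⊕ con 83)) (x0 ⊕ x4) (sym h2) ∷
    hyp (con 2) x1 (con 2 ⊛ x5 ⊕ con 1) h3 ∷ hyp (con 1) (x2 ⊕ x3) x1 h4 ∷ []) refl

arith-205 : ∀ m L q ρ v1 v2 v3 r n₁ X t → m ≡ L + (q + ρ) → v1 ≡ v2 + v3 → v2 ≤ L * L → v3 ≤ q * q + ρ * L +
    r + 12 * q + 8 * ρ → r ≤ ρ * ρ → L ≤ 2 * q → q + ρ ≤ L → 48 * (n₁ + 83) ≤ X + 280000 → L ≤ 2 * n₁ + 1 →
    L + 330 ≤ q + ρ + t → 330 ≤ t → 2 * v1 ≤ m * m + 4 * (t * t) + X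
arith-205 m L q ρ v1 v2 v3 r n₁ X t h1 h2 h3 h4 h5 h6 h7 h8 h9 h10 h11 =
    linear (m ∷ L ∷ q ∷ ρ ∷ v1 ∷ v2 ∷ v3 ∷ r ∷ n₁ ∷ X ∷ t ∷ []) 5444 (con 2 ⊛ x4)
    (x0 ⊛ x0 ⊕ con 4 ⊛ (x10 ⊛ x10) ⊕ x9)
    (equ (con 10890) x4 (x5 ⊕ x6) h2 ∷ hyp (con 10890) x5 (x1 ⊛ x1) h3 ∷
    hyp (con 10890) x6 (x2 ⊛ x2 ⊕ x3 ⊛ x1 ⊕ x7 ⊕ con 12 ⊛ x2 ⊕ con 8 ⊛ x3) h4 ∷ hyp (con 10890) x7 (x3 ⊛ x3) h5 ∷
    hyp (con 9240000) (x2 ⊕ x3) x1 h7 ∷ hyp (con 5445) (con 48 ⊛ (x8 ⊕ con 83)) (x9 ⊕ con 280000) h8 ∷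
    hyp (con 130680) x1 (con 2 ⊛ x8 ⊕ con 1) h9 ∷ hyp (con 9109320) (x1 ⊕ con 330) (x2 ⊕ x3 ⊕ x10) h10 ∷
    hyp (con 10890 ⊛ x3) x1 (con 2 ⊛ x2) h6 ∷ prod (con 5445) (x1 ⊕ con 330) (x2 ⊕ x3 ⊕ x10) h10 (con 330) x10 h11 ∷
    prod (con 5445) (x1 ⊕ con 330) (x2 ⊕ x3 ⊕ x10) h10 (x2 ⊕ x3) x1 h7 ∷ sq (con 8357) x10 (con 330) ∷
    equ (con 5445 ⊛ x0 ⊕ con 5445 ⊛ x1 ⊕ con 5445 ⊛ x2 ⊕ con 5445 ⊛ x3) (x1 ⊕ (x2 ⊕ x3)) x0 (sym h1) ∷ []) refl

arith-206 : ∀ m L q ρ v1 v2 v3 r t n₁ X → m ≡ L + (q + ρ) → v1 ≡ v2 + v3 → v2 ≤ L * L → v3 ≤ q * q + ρ * L +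
    r + 12 * q + 8 * ρ → r + q * q ≤ 2 * (q * ρ) → L ≤ 2 * q → 49 ≤ L → 272 < t → 48 * (n₁ + 83) ≤ X +
    280000 → L ≤ 2 * n₁ + 1 → 2 * v1 ≤ m * m + 4 * (t * t) + X
arith-206 m L q ρ v1 v2 v3 r t n₁ X h1 h2 h3 h4 h5 h6 h7 h8 h9 h10 =
    linear (m ∷ L ∷ q ∷ ρ ∷ v1 ∷ v2 ∷ v3 ∷ r ∷ t ∷ n₁ ∷ X ∷ []) 447173 (con 2 ⊛ x4)
    (x0 ⊛ x0 ⊕ con 4 ⊛ (x8 ⊛ x8) ⊕ x10)
    (equ (con 894348) x4 (x5 ⊕ x6) h2 ∷ hyp (con 894348) x5 (x1 ⊛ x1) h3 ∷
    hyp (con 894348) x6 (x2 ⊛ x2 ⊕ x3 ⊛ x1 ⊕ x7 ⊕ con 12 ⊛ x2 ⊕ con 8 ⊛ x3) h4 ∷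
    hyp (con 894348) (x7 ⊕ x2 ⊛ x2) (con 2 ⊛ (x2 ⊛ x3)) h5 ∷ hyp (con 12968046) x1 (con 2 ⊛ x2) h6 ∷
    hyp (con 753798864) (con 1 ⊕ con 272) x8 h8 ∷ hyp (con 372645) (con 48 ⊛ (x9 ⊕ con 83)) (x10 ⊕ con 280000) h9 ∷
    hyp (con 8943480) x1 (con 2 ⊛ x9 ⊕ con 1) h10 ∷ prod (con 447174) x1 (con 2 ⊛ x2) h6 (con 49) x1 h7 ∷
    sq (con 447174) x3 (x2 ⊕ con 8) ∷ sq (con 1380584) x8 (con 273) ∷
    equ (con 447174 ⊛ x0 ⊕ con 447174 ⊛ x1 ⊕ con 447174 ⊛ x2 ⊕ con 447174 ⊛ x3) (x1 ⊕ (x2 ⊕ x3)) x0 (sym h1) ∷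
    []) refl

arith-207 : ∀ n₁ m → 4 * (n₁ + 83) ≤ m → 48 ≤ m
arith-207 n₁ m h1 = linear (n₁ ∷ m ∷ []) 82 (con 48) x1 (hyp (con 12) (con 4 ⊛ (x0 ⊕ con 83)) x1 h1 ∷ []) refl

arith-208 : ∀ v1 m X n₁ → 2 * v1 ≤ 192 * m → X ≤ 48 * (n₁ + 83) → 4 * (n₁ + 83) ≤ m → 1 ≤ n₁ →
    2 * v1 + (16 * (n₁ + 83) + 1 + X) ≤ m * m
arith-208 v1 m X n₁ h1 h2 h3 h4 = linear (v1 ∷ m ∷ X ∷ n₁ ∷ []) 111551
    (con 2 ⊛ x0 ⊕ (con 16 ⊛ (x3 ⊕ con 83) ⊕ con 1 ⊕ x2)) (x1 ⊛ x1)
    (hyp (con 111552) (con 2 ⊛ x0) (con 192 ⊛ x1) h1 ∷ hyp (con 111552) x2 (con 48 ⊛ (x3 ⊕ con 83)) h2 ∷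
    hyp (con 1785164 ⊕ con 69889 ⊛ x1) (con 4 ⊛ (x3 ⊕ con 83)) x1 h3 ∷ hyp (con 1328) (con 1) x3 h4 ∷ []) refl

arith-209 : ∀ v1 m t X → v1 ≤ m * m → m ≤ 2 * t → 2 * v1 ≤ m * m + 4 * (t * t) + X
arith-209 v1 m t X h1 h2 = linear (v1 ∷ m ∷ t ∷ X ∷ []) 0 (con 2 ⊛ x0) (x1 ⊛ x1 ⊕ con 4 ⊛ (x2 ⊛ x2) ⊕ x3)
    (hyp (con 2) x0 (x1 ⊛ x1) h1 ∷ hyp (x1 ⊕ con 2 ⊛ x2) x1 (con 2 ⊛ x2) h2 ∷ []) refl

arith-210 : ∀ m → 225 ≤ m → 48 ≤ m
arith-210 m h1 = linear (m ∷ []) 74 (con 48) x0 (hyp (con 16) (con 225) x0 h1 ∷ []) refl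

arith-211 : ∀ v1 m t X → 2 * v1 ≤ 192 * m → 225 ≤ m → 2 * v1 ≤ m * m + 4 * (t * t) + X
arith-211 v1 m t X h1 h2 = linear (v1 ∷ m ∷ t ∷ X ∷ []) 74 (con 2 ⊛ x0) (x1 ⊛ x1 ⊕ con 4 ⊛ (x2 ⊛ x2) ⊕ x3)
    (hyp (con 75) (con 2 ⊛ x0) (con 192 ⊛ x1) h1 ∷ hyp (con 64 ⊛ x1) (con 225) x1 h2 ∷ []) refl

arith-212 : ∀ m t n₁ → m + t ≡ 4 * (n₁ + 83) → 2 * t < m → 1 ≤ n₁ → 225 ≤ m
arith-212 m t n₁ h1 h2 h3 = linear (m ∷ t ∷ n₁ ∷ []) 2999 (con 225) x0
    (equ (con 2000) (con 4 ⊛ (x2 ⊕ con 83)) (x0 ⊕ x1) (sym h1) ∷ hyp (con 1000) (con 1 ⊕ con 2 ⊛ x1) x0 h2 ∷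
    hyp (con 7003) (con 1) x2 h3 ∷ []) refl

stable-≤ : ∀ {a b} → ¬ ¬ (a ≤ b) → a ≤ b
stable-≤ {a} {b} = decidable-stable (a ≤? b)

quarter : ∀ L → ∃ λ k → 4 * k ≤ L × L ≤ 4 * k + 3
quarter zero = 0 , z≤n , z≤n
quarter (suc zero) = 0 , z≤n , s≤s z≤n
quarter (suc (suc zero)) = 0 , z≤n , s≤s (s≤s z≤n)
quarter (suc (suc (suc zero))) = 0 , z≤n , ≤-refl
quarter (suc (suc (suc (suc L)))) with quarter L
... | k , a , b = suc k , (arith-145 k L a) , (arith-146 L k b)

halve : ∀ m → ∃ λ k → 2 * k ≤ m × m ≤ 2 * k + 1
halve zero = 0 , z≤n , z≤n
halve (suc zero) = 0 , z≤n , ≤-refl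
halve (suc (suc m)) with halve m
... | k , a , b = suc k , (arith-147 k m a) , (arith-148 m k b)

positive-part : ∀ a b → ∃ λ x → a ≤ x + b × (x ≡ 0 ⊎ x + b ≡ a)
positive-part a b with a ≤? b
... | yes h = 0 , h , inj₁ refl
... | no h = a ∸ b , ≤-reflexive (sym eq) , inj₂ eq
  where
  eq : a ∸ b + b ≡ a
  eq = m∸n+n≡m (<⇒≤ (≰⇒> h))

module Extremal (G : SimpleGraph) (n₁ : ℕ) (1≤n₁ : 1 ≤ n₁) where

  open GraphTheory G
  open Structure G

  module _ {S : List Vertex} (uS : Unique S) (free : ∀ {xs} → Cycle xs → xs ⊆ S → length xs ≢ 2 * suc n₁) where

    private
      m = length S

    -- If no cycle is longer than 48, `few-edges` alone suffices for the sizes that occur; a longer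
    -- one leaves room for the errors that are linear in the cycle lengths.
    by-longest-cycle : ∀ {A : Set} → (CyclesIn S 48 → A) →
      (∀ {L} (C : Circuit L) {W} → 49 ≤ L → S ↭ Arcs.verts C ++ W → CyclesIn S L → A) → ¬ ¬ A
    by-longest-cycle short long none = none (short λ {xs} cyc xs⊆ → stable-≤ λ ≰48 →
      longest-cycle cyc xs⊆ λ (ys , cyc′ , ys⊆ , xs≤ys , max) →
        let C , eq = circuit cyc′
            W , perm = ⊆-split (Cycle.unique cyc′) ys⊆
        in none (long C {W} (≤-trans (≰⇒> ≰48) xs≤ys) (subst (λ zs → S ↭ zs ++ W) (sym eq) perm) max))

    short-cycles : 48 ≤ m → CyclesIn S 48 → 2 * ee S ≤ 192 * m
    short-cycles 48≤m cyc = arith-149 (ee S) m (few-edges uS cyc (s≤s (s≤s z≤n)) 48≤m)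

    module _ {L : ℕ} (C : Circuit L) {W : List Vertex} (49≤L : 49 ≤ L) (perm : S ↭ Arcs.verts C ++ W)
        (longest : CyclesIn S L) where

      open Arcs C

      private
        z = length W
        eC = ee verts
        o = out verts W

      size : m ≡ L + z
      size = trans (Perm.↭-length perm) (trans (length-++ verts) (cong (_+ z) verts-length))

      edges : ee S ≡ eC + o
      edges = trans (e-↭ perm perm) (ee-++ verts W)

      trivial-C : eC ≤ L * L
      trivial-C = ≤-trans (e-≤length verts verts) (≤-reflexive (cong₂ _*_ verts-length verts-length))

      freeC : ∀ {xs} → Cycle xs → xs ⊆ verts → length xs ≢ 2 * suc n₁
      freeC cyc xs⊆ = free cyc (λ v∈ → Perm.∈-resp-↭ (↭-sym perm) (∈-++⁺ˡ (xs⊆ v∈)))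

      -- The alternative is known only up to double negation, which does no harm since the goal is
      -- an inequality between numbers.
      choose : ∀ L′ k ρ → L ≤ L′ → k + ρ ≡ z → ∀ {a b} → (Sparse C uS perm longest L′ k ρ → a ≤ b) →
          (Dense C uS perm longest L′ → a ≤ b) → a ≤ b
      choose L′ k ρ L≤L′ eq f g = stable-≤ λ none → sparse-or-dense C uS perm longest L′ k ρ L≤L′
          (≤-trans (≤-trans (s≤s (s≤s (s≤s (s≤s z≤n)))) 49≤L) L≤L′) eq
        λ { (inj₁ s) → none (f s) ; (inj₂ d) → none (g d) }

      -- Sets of at least M/2 vertices

      module _ (Y : ℕ) (Y≤ : Y ≤ 16 * m + 1) (wide-S : 4 * (n₁ + 83) ≤ m) where

        private
          Goal = 2 * ee S + Y ≤ m * m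

        -- C may span a clique, but it has less than half of the vertices. Peeling with a threshold
        -- of m/2 is still affordable for all of `W`, and if it stops, this high threshold makes the
        -- second cycle longer than m/4.
        large-short : L ≤ 2 * n₁ + 1 → Goal
        large-short L≤ with halve m
        ... | L′ , 2L′≤m , m≤ = choose L′ 0 z (arith-150 n₁ m L L′ wide-S L≤ m≤) refl sparse dense-case
          where
          wide : 2 * L + 330 ≤ m
          wide = arith-151 n₁ m L wide-S L≤
          sparse : Sparse C uS perm longest L′ 0 z → Goal
          sparse s = arith-152 m L z Y (ee S) eC o L′ (Sparse.a s) size wide 49≤L Y≤ edges trivial-C
              (Sparse.bound s) 2L′≤m
          dense-case : Dense C uS perm longest L′ → Goal
          dense-case d with Dense.ρ d ≤? Dense.q d
          ... | yes ρ≤q = let open Dense d in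
              (arith-155 m L q ρ Y (ee S) eC o r L′ (trans size (cong (L +_) (sym total))) wide 49≤L Y≤ edges
              trivial-C bound r-square q-small ρ≤q q-large m≤ (arith-153 L′ q m L q-large m≤ wide)
              (arith-154 m L q ρ (trans size (cong (L +_) (sym total))) wide))
          ... | no ρ≰q = let open Dense d in
              (arith-157 m L q ρ Y (ee S) eC o r (trans size (cong (L +_) (sym total))) 49≤L Y≤ edges
              trivial-C bound (r-linear (<⇒≤ (≰⇒> ρ≰q))) q-small (arith-156 L′ q m L q-large m≤ wide))

        large-dense : 2 * suc n₁ ≤ L → Dense C uS perm longest L → Goal
        large-dense 2n≤L d = by-ρ (Dense.ρ d ≤? Dense.q d) (84 ≤? L)
          where
          open Dense d
          m≡ : m ≡ L + (q + ρ)
          m≡ = trans size (cong (L +_) (sym total))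
          336≤m : 336 ≤ m
          336≤m = arith-158 n₁ m wide-S 1≤n₁
          quadratic : 2 * eC ≤ L * L
          quadratic = edges-quadratic C n₁ 1≤n₁ freeC 2n≤L
          by-ρ : Dec (ρ ≤ q) → Dec (84 ≤ L) → Goal
          by-ρ (yes ρ≤q) _ = arith-160 m L q ρ Y (ee S) eC o r m≡ Y≤ edges quadratic bound r-square q-small
              ρ≤q 112≤L (arith-159 L q 112≤L q-large)
            where
            112≤L : 112 ≤ L
            112≤L = arith-161 m L q ρ m≡ q-small ρ≤q 336≤m
          by-ρ (no ρ≰q) (yes 84≤L) = arith-163 m L q ρ Y (ee S) eC o r m≡ Y≤ edges quadratic bound
              (r-linear (<⇒≤ (≰⇒> ρ≰q))) 84≤L (arith-162 L q 84≤L q-large)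
          by-ρ (no ρ≰q) (no 84≰L) = arith-164 m L q ρ Y (ee S) eC o r m≡ Y≤ edges quadratic bound
              (r-linear (<⇒≤ (≰⇒> ρ≰q))) 49≤L q-small (≰⇒> 84≰L) 336≤m q-large

        -- As n is at most about L/6 here, the chord bound leaves roughly 2/9 of L² to pay for `Y`.
        large-long : 2 * suc n₁ ≤ L → 6 * n₁ + 4 ≤ L → o ≤ L * z → Goal
        large-long 2n≤L long out≤ = by-L (83 ≤? L)
          where
          chords : 3 * eC ≤ L * (L + suc n₁ + 2)
          chords = edges-long C n₁ 1≤n₁ freeC long
          by-L : Dec (83 ≤ L) → Goal
          by-L (yes 83≤L) = arith-165 m L z Y (ee S) eC o n₁ size Y≤ edges chords out≤ long 83≤L
          by-L (no 83≰L) = arith-166 m L z Y (ee S) eC o n₁ size Y≤ edges chords out≤ long (≰⇒> 83≰L) wide-S 49≤L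

        -- Twice the chord bound is 4nL, and L is at least 4n + 30 in this range: the surplus 30L
        -- and the square of `z` pay for `Y`.
        large-middle : L ≤ 6 * n₁ + 3 → 4 * n₁ + 34 ≤ L → Y ≤ 64 * (n₁ + 83) + 1 → o ≤ L * z → Goal
        large-middle L≤ ≤L Y≤′ out≤ with m≤n⇒∃[o]m+o≡n ≤L
        ... | u , eq = arith-168 m L z Y n₁ (ee S) eC o u size Y≤′ edges
            (edges-linear C n₁ 1≤n₁ freeC (arith-167 n₁ L ≤L) L≤) out≤ eq wide-S

        -- A vertex outside C with the most neighbours on C decides: if it has many, they force
        -- missing chords by `missing-chords`, and if it has few, then all of `W` sends few edges to
        -- C.
        large-missing : L ≤ 4 * n₁ + 33 → 9 * z ≤ 2 * suc n₁ → ∀ w ws → W ≡ w ∷ ws → Goal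
        large-missing L≤ 9z≤ w ws W≡ = by-blocks (4 * suc n₁ ≤? L)
          where
          top = max-degree w ws verts
          v = proj₁ top
          v∈ : v ∈ W
          v∈ = subst (v ∈_) (sym W≡) (proj₁ (proj₂ top))
          a = deg v verts
          out≤ : o ≤ 2 * (a * z) + z * z
          out≤ = out-small verts W a (λ u u∈ → proj₂ (proj₂ top) u (subst (u ∈_) W≡ u∈))
          wide : 3 * n₁ + 2 ≤ L
          wide = arith-169 m L z n₁ size wide-S 9z≤
          finish : ∀ b → b ≤ suc n₁ → 4 * b ≤ L → L ≤ 4 * b + 30 → Goal
          -- The choice μ = 2z turns 2μa into 4za, exactly the term in which `a` enters twice the
          -- bound `out≤`.
          finish b b≤n 4b≤L L≤4b = arith-171 eC z a n₁ L o (ee S) m Y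
              (missing-chords C uS perm longest n₁ 1≤n₁ freeC wide (arith-170 L n₁ L≤) b b≤n 4b≤L L≤4b v v∈
              (2 * z)) out≤ edges size Y≤ 9z≤ wide-S
          by-blocks : Dec (4 * suc n₁ ≤ L) → Goal
          -- Blocks must not have more than n positions, and four of them must cover C up to 30
          -- positions: n each will do if C is that long, and a quarter of C otherwise.
          by-blocks (yes h) = finish (suc n₁) ≤-refl h (arith-170 L n₁ L≤)
          by-blocks (no h) with quarter L
          ... | b , 4b≤L , L≤4b = finish b (arith-172 b L n₁ 4b≤L (≰⇒> h)) 4b≤L (arith-173 L b L≤4b)

        -- From m² = L² + 2Lz + z² the quadratic chord bound and the peeling leave z², which is to
        -- pay for `Y`.
        large-gap : 2 * suc n₁ ≤ L → L ≤ 4 * n₁ + 33 → 2 * suc n₁ < 9 * z → Y ≤ 33 * n₁ + 44000 ⊎ Y ≤ 64 *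
            n₁ → o ≤ L * z → Goal
        large-gap 2n≤L L≤ 9z> Ycases out≤ = by-Y Ycases
          where
          299≤z : 299 ≤ z
          299≤z = arith-174 m L z n₁ size wide-S L≤
          -- By `9z>`, n₁ is less than 9z/2, so the two bounds on `Y` are below 149z + 44000 and
          -- 288z. Both are at most z² because z is at least 299.
          by-Y : _ → Goal
          by-Y (inj₁ Y≤) = arith-175 m L z (ee S) eC o n₁ Y size edges (edges-quadratic C n₁ 1≤n₁ freeC 2n≤L)
              out≤ 299≤z 9z> Y≤
          by-Y (inj₂ Y≤) = arith-176 m L z (ee S) eC o n₁ Y size edges (edges-quadratic C n₁ 1≤n₁ freeC 2n≤L)
              out≤ 299≤z 9z> Y≤

      module _ (X : ℕ) (wide-S : 4 * (n₁ + 83) ≤ m) (X-cases : X ≡ 0 ⊎ X + 280000 ≡ 48 * (n₁ + 83)) where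

        private
          Y = 16 * (n₁ + 83) + 1 + X

          X≤ : X ≤ 48 * (n₁ + 83)
          X≤ = upper X-cases
            where
            upper : X ≡ 0 ⊎ X + 280000 ≡ 48 * (n₁ + 83) → X ≤ 48 * (n₁ + 83)
            upper (inj₁ eq) = ≤-trans (≤-reflexive eq) z≤n
            upper (inj₂ eq) = ≤-trans (m≤m+n X 280000) (≤-reflexive eq)

          Y≤ : Y ≤ 16 * m + 1
          Y≤ = arith-177 X n₁ m X≤ wide-S

          Y-cases : Y ≤ 33 * n₁ + 44000 ⊎ Y ≤ 64 * n₁
          Y-cases = split X-cases
            where
            split : X ≡ 0 ⊎ X + 280000 ≡ 48 * (n₁ + 83) → Y ≤ 33 * n₁ + 44000 ⊎ Y ≤ 64 * n₁
            split (inj₁ eq) = inj₁ (arith-178 X n₁ eq)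
            split (inj₂ eq) = inj₂ (arith-179 X n₁ eq)

        large-long-cycle : 2 * ee S + Y ≤ m * m
        large-long-cycle = by-length (L ≤? 2 * n₁ + 1)
          where
          list-case : ∀ xs → W ≡ xs → L ≤ 4 * n₁ + 33 → 9 * z ≤ 2 * suc n₁ → 2 * ee S + Y ≤ m * m
          list-case [] eq L≤ _ = ⊥-elim (arith-180 m L z n₁ size (cong length eq) wide-S L≤)
          list-case (w ∷ ws) eq L≤ 9z≤ = large-missing Y Y≤ wide-S L≤ 9z≤ w ws eq
          by-length : Dec (L ≤ 2 * n₁ + 1) → 2 * ee S + Y ≤ m * m
          by-length (yes L≤) = large-short Y Y≤ wide-S L≤
          by-length (no L≰) = choose L 0 z ≤-refl refl
              (λ s → sparse (≤-trans (Sparse.bound s) (arith-181 L z (Sparse.a s))))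
              (large-dense Y Y≤ wide-S 2n≤L)
            where
            2n≤L : 2 * suc n₁ ≤ L
            2n≤L = arith-182 n₁ L (≰⇒> L≰)
            sparse : o ≤ L * z → 2 * ee S + Y ≤ m * m
            sparse out≤ with L ≤? 6 * n₁ + 3 | L ≤? 4 * n₁ + 33 | 9 * z ≤? 2 * suc n₁
            ... | no h | _ | _ = large-long Y Y≤ wide-S 2n≤L (≤-trans (≤-reflexive (+-suc (6 * n₁) 3)) (≰⇒> h)) out≤
            ... | yes h | no h′ | _ = large-middle Y Y≤ wide-S h
                (≤-trans (≤-reflexive (+-suc (4 * n₁) 33)) (≰⇒> h′)) (arith-183 X n₁ X≤) out≤
            ... | yes h | yes h′ | yes h″ = list-case W refl h′ h″
            ... | yes h | yes h′ | no h″ = large-gap Y Y≤ wide-S 2n≤L h′ (≰⇒> h″) Y-cases out≤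

      -- Sets of at most M/2 vertices

      module _ (X t : ℕ) (m+t : m + t ≡ 4 * (n₁ + 83)) (X-lower : 48 * (n₁ + 83) ≤ X + 280000) (2t<m : 2 * t < m) where

        private
          Goal = 2 * ee S ≤ m * m + 4 * (t * t) + X

          module Sizes (d : ∃ λ L′ → Dense C uS perm longest L′) where
            open Dense (proj₂ d) public
            m≡ : m ≡ L + (q + ρ)
            m≡ = trans size (cong (L +_) (sym total))

        small-long : 2 * suc n₁ ≤ L → Goal
        small-long 2n≤L = choose L 0 z ≤-refl refl sparse dense-case
          where
          quadratic : 2 * eC ≤ L * L
          quadratic = edges-quadratic C n₁ 1≤n₁ freeC 2n≤L
          sparse : Sparse C uS perm longest L 0 z → Goal
          sparse s = arith-184 m L z (ee S) eC o (Sparse.a s) t X size edges quadratic (Sparse.bound s)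
          dense-case : Dense C uS perm longest L → Goal
          dense-case d = by-ρ (ρ ≤? q)
            where
            open Sizes (L , d)
            by-ρ : Dec (ρ ≤ q) → Goal
            by-ρ (yes ρ≤q) = arith-185 m L q ρ (ee S) eC o r t X m≡ edges quadratic bound r-square q-small
                ρ≤q 49≤L q-large
            by-ρ (no ρ≰q) = arith-186 m L q ρ (ee S) eC o r t X m≡ edges quadratic bound
                (r-linear (<⇒≤ (≰⇒> ρ≰q))) 49≤L q-large

        -- For such `t` the cycle C still has less than half of the vertices, and the argument of
        -- `large-short` goes through with less room.
        small-short-wide : L ≤ 2 * n₁ + 1 → t ≤ 272 → Goal
        small-short-wide L≤ t≤ with halve m
        ... | L′ , 2L′≤m , m≤ = choose L′ 0 z (arith-187 L m L′ wide m≤) refl sparse dense-case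
          where
          wide-t : 2 * L + 330 ≤ m + t
          wide-t = arith-188 m t n₁ L m+t L≤
          wide : 2 * L + 58 ≤ m
          wide = arith-189 L m t wide-t t≤
          sparse : Sparse C uS perm longest L′ 0 z → Goal
          sparse s = arith-190 m L z (ee S) eC o L′ (Sparse.a s) t X size wide edges trivial-C (Sparse.bound s) 2L′≤m
          dense-case : Dense C uS perm longest L′ → Goal
          dense-case d = by-ρ (ρ ≤? q) (t ≤? 251)
            where
            open Sizes (L′ , d)
            by-ρ : Dec (ρ ≤ q) → Dec (t ≤ 251) → Goal
            by-ρ (yes ρ≤q) _ = arith-193 m L q ρ (ee S) eC o r t X m≡ edges trivial-C bound r-square q-small
                ρ≤q (arith-191 L′ q m L q-large m≤ wide) (arith-192 m L q ρ m≡ wide)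
            by-ρ (no ρ≰q) (yes t≤251) = arith-195 m L q ρ (ee S) eC o r t X m≡ edges trivial-C bound
                (r-linear (<⇒≤ (≰⇒> ρ≰q))) q-small 49≤L (arith-194 L′ q m L t q-large m≤ wide-t) t≤251
            by-ρ (no ρ≰q) (no t≰251) = arith-197 m L q ρ (ee S) eC o r t n₁ X m≡ edges trivial-C bound
                (r-linear (<⇒≤ (≰⇒> ρ≰q))) q-small (arith-196 L′ q m L q-large m≤ wide) (≰⇒> t≰251) X-lower L≤

        -- The peeling is stopped at k vertices. They add 2ak + k² while C has lost a², so both
        -- together contribute at most L² + 2k² instead of the L² + Lk for peeling to the end. The
        -- saving Lk - 2k² is greatest at k = L/4.
        small-short-narrow : L ≤ 2 * n₁ + 1 → 272 < t → Goal
        small-short-narrow L≤ t> =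
          let k , 4k≤L , L≤4k = quarter L
              w , k+w = m≤n⇒∃[o]m+o≡n {k} {z} (arith-198 m t n₁ L z k m+t 2t<m size L≤ 4k≤L)
          in choose L k w ≤-refl k+w (sparse k w k+w 4k≤L L≤4k) dense-case
          where
          sparse : ∀ k w → k + w ≡ z → 4 * k ≤ L → L ≤ 4 * k + 3 → Sparse C uS perm longest L k w → Goal
          sparse k w k+w 4k≤L L≤4k s = let open Sparse s in
              (arith-200 m L z k w (ee S) eC o a t n₁ X size k+w edges a-edges bound 4k≤L L≤4k m+t L≤ t>
              (arith-199 m t n₁ m+t 2t<m))
          dense-case : Dense C uS perm longest L → Goal
          dense-case d = by-ρ (ρ ≤? q) (L ≤? q + ρ)
            where
            open Sizes (L , d)
            by-ρ : Dec (ρ ≤ q) → Dec (L ≤ q + ρ) → Goal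
            by-ρ (yes ρ≤q) (yes L≤z) = arith-202 m L q ρ (ee S) eC o r t n₁ X m≡ edges trivial-C bound
                r-square q-small ρ≤q (<⇒≤ q-large) L≤z (arith-201 L q 49≤L q-large) t> X-lower L≤
            by-ρ (yes ρ≤q) (no L≰z) = arith-205 m L q ρ (ee S) eC o r n₁ X t m≡ edges trivial-C bound
                r-square (<⇒≤ q-large) (<⇒≤ (≰⇒> L≰z)) X-lower L≤ (arith-203 m L q ρ t n₁ m≡ m+t L≤)
                (arith-204 m L q ρ t n₁ m≡ m+t L≤ (<⇒≤ (≰⇒> L≰z)))
            by-ρ (no ρ≰q) _ = arith-206 m L q ρ (ee S) eC o r t n₁ X m≡ edges trivial-C bound
                (r-linear (<⇒≤ (≰⇒> ρ≰q))) (<⇒≤ q-large) 49≤L t> X-lower L≤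

    large-bound : ∀ X → 4 * (n₁ + 83) ≤ m → X ≡ 0 ⊎ X + 280000 ≡ 48 * (n₁ + 83) →
        2 * ee S + (16 * (n₁ + 83) + 1 + X) ≤ m * m
    large-bound X wide-S X-cases = stable-≤ (by-longest-cycle
        (λ cyc → (arith-208 (ee S) m X n₁ (short-cycles (arith-207 n₁ m wide-S) cyc) (X≤ X-cases) wide-S 1≤n₁))
        (λ C 49≤L perm longest → large-long-cycle C 49≤L perm longest X wide-S X-cases))
      where
      X≤ : X ≡ 0 ⊎ X + 280000 ≡ 48 * (n₁ + 83) → X ≤ 48 * (n₁ + 83)
      X≤ (inj₁ eq) = ≤-trans (≤-reflexive eq) z≤n
      X≤ (inj₂ eq) = ≤-trans (m≤m+n X 280000) (≤-reflexive eq)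

    small-bound : ∀ X t → m + t ≡ 4 * (n₁ + 83) → 48 * (n₁ + 83) ≤ X + 280000 → 2 * ee S ≤ m * m + 4 * (t * t) + X
    small-bound X t m+t X-lower with m ≤? 2 * t
    -- Then m² is at most 4t², and the trivial bound m² on `ee S` is enough.
    ... | yes m≤2t = arith-209 (ee S) m t X (e-≤length S S) m≤2t
    ... | no m≰2t = stable-≤ (by-longest-cycle
        (λ cyc → (arith-211 (ee S) m t X (short-cycles (arith-210 m 225≤m) cyc) 225≤m))
        (λ {L} C 49≤L perm longest → by-size C 49≤L perm longest (L ≤? 2 * n₁ + 1) (t ≤? 272)))
      where
      2t<m : 2 * t < m
      2t<m = ≰⇒> m≰2t
      225≤m : 225 ≤ m
      225≤m = arith-212 m t n₁ m+t 2t<m 1≤n₁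
      by-size : ∀ {L} (C : Circuit L) {W} → 49 ≤ L → S ↭ Arcs.verts C ++ W → CyclesIn S L →
          Dec (L ≤ 2 * n₁ + 1) → Dec (t ≤ 272) → 2 * ee S ≤ m * m + 4 * (t * t) + X
      by-size {L} C 49≤L perm longest (no L≰) _ = small-long C 49≤L perm longest X t m+t X-lower 2t<m
          (arith-182 n₁ L (≰⇒> L≰))
      by-size C 49≤L perm longest (yes L≤) (yes t≤) = small-short-wide C 49≤L perm longest X t m+t X-lower 2t<m L≤ t≤
      by-size C 49≤L perm longest (yes L≤) (no t≰) = small-short-narrow C 49≤L perm longest X t m+t X-lower
          2t<m L≤ (≰⇒> t≰)

-- Counting monochromatic triangles

arith-213 : ∀ v1 v2 → v1 * v2 + v2 * v1 ≡ 2 * (v1 * v2)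
arith-213 v1 v2 = ≤-antisym (linear (v1 ∷ v2 ∷ []) 0 (x0 ⊛ x1 ⊕ x1 ⊛ x0) (con 2 ⊛ (x0 ⊛ x1)) [] refl)
    (linear (v1 ∷ v2 ∷ []) 0 (con 2 ⊛ (x0 ⊛ x1)) (x0 ⊛ x1 ⊕ x1 ⊛ x0) [] refl)

arith-214 : ∀ v1 M₁ v2 v3 → suc v1 ≡ suc (suc M₁) → suc v2 ≡ suc (suc M₁) → v1 + v2 ≤ suc (suc M₁) + v3 → M₁ ≤ v3
arith-214 v1 M₁ v2 v3 h1 h2 h3 = linear (v1 ∷ M₁ ∷ v2 ∷ v3 ∷ []) 0 x1 x3
    (equ (con 1) (con 1 ⊕ (con 1 ⊕ x1)) (con 1 ⊕ x0) (sym h1) ∷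
    equ (con 1) (con 1 ⊕ (con 1 ⊕ x1)) (con 1 ⊕ x2) (sym h2) ∷ hyp (con 1) (x0 ⊕ x2) (con 1 ⊕ (con 1 ⊕ x1) ⊕ x3) h3 ∷
    []) refl

arith-215 : ∀ v1 v2 v3 v4 v5 v6 v7 v8 v9 v10 v11 v12 → v1 ≤ v2 → v3 ≤ v4 → v3 ≡ 2 * v2 → v4 ≡ v5 + v6 →
    v5 ≡ 2 * v7 → v7 ≡ v8 + v9 → v6 ≡ v10 + (v10 + v10) → v10 ≡ 2 * v11 → v12 ≡ v8 + v9 + 3 * v11 → v1 ≤ v12
arith-215 v1 v2 v3 v4 v5 v6 v7 v8 v9 v10 v11 v12 h1 h2 h3 h4 h5 h6 h7 h8 h9 =
    linear (v1 ∷ v2 ∷ v3 ∷ v4 ∷ v5 ∷ v6 ∷ v7 ∷ v8 ∷ v9 ∷ v10 ∷ v11 ∷ v12 ∷ []) 1 x0 x11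
    (hyp (con 2) x0 x1 h1 ∷ hyp (con 1) x2 x3 h2 ∷ equ (con 1) (con 2 ⊛ x1) x2 (sym h3) ∷ equ (con 1) x3 (x4 ⊕ x5) h4 ∷
    equ (con 1) x4 (con 2 ⊛ x6) h5 ∷ equ (con 2) x6 (x7 ⊕ x8) h6 ∷ equ (con 1) x5 (x9 ⊕ (x9 ⊕ x9)) h7 ∷
    equ (con 3) x9 (con 2 ⊛ x10) h8 ∷ equ (con 2) (x7 ⊕ x8 ⊕ con 3 ⊛ x10) x11 (sym h9) ∷ []) refl

arith-216 : ∀ n₁ → suc (8 * (n₁ + 83)) ≡ suc (suc (8 * n₁ + 663))
arith-216 n₁ = ≤-antisym (linear (n₁ ∷ []) 0 (con 1 ⊕ con 8 ⊛ (x0 ⊕ con 83)) (con 1 ⊕ (con 1 ⊕ (con 8 ⊛ x0 ⊕ con 663)))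
    [] refl) (linear (n₁ ∷ []) 0 (con 1 ⊕ (con 1 ⊕ (con 8 ⊛ x0 ⊕ con 663))) (con 1 ⊕ con 8 ⊛ (x0 ⊕ con 83))
    [] refl)

arith-217 : ∀ n₁ t v1 v2 → 4 * (n₁ + 83) + t ≡ v1 → v1 + v2 ≡ 8 * (n₁ + 83) → v2 + t ≡ 4 * (n₁ + 83)
arith-217 n₁ t v1 v2 h1 h2 = ≤-antisym (linear (n₁ ∷ t ∷ v1 ∷ v2 ∷ []) 0 (x3 ⊕ x1) (con 4 ⊛ (x0 ⊕ con 83))
    (equ (con 1) (con 4 ⊛ (x0 ⊕ con 83) ⊕ x1) x2 h1 ∷ equ (con 1) (x2 ⊕ x3) (con 8 ⊛ (x0 ⊕ con 83)) h2 ∷ [])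
        refl) (linear (n₁ ∷ t ∷ v1 ∷ v2 ∷ []) 0 (con 4 ⊛ (x0 ⊕ con 83)) (x3 ⊕ x1)
    (equ (con 1) x2 (con 4 ⊛ (x0 ⊕ con 83) ⊕ x1) (sym h1) ∷ equ (con 1) (con 8 ⊛ (x0 ⊕ con 83)) (x2 ⊕ x3) (sym h2) ∷
    []) refl)

arith-218 : ∀ v1 n₁ v2 v3 v4 v5 t → 2 * v1 + (16 * (n₁ + 83) + 1 + v2) ≤ v3 * v3 → 2 * v4 ≤ v5 * v5 + 4 *
    (t * t) + v2 → 4 * (n₁ + 83) + t ≡ v3 → v5 + t ≡ 4 * (n₁ + 83) → 2 * (v1 + v4) + 6 * (v3 * v5) +
    (16 * (n₁ + 83) + 1) ≤ 2 * (8 * (n₁ + 83) * (8 * (n₁ + 83)))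
arith-218 v1 n₁ v2 v3 v4 v5 t h1 h2 h3 h4 = linear (v1 ∷ n₁ ∷ v2 ∷ v3 ∷ v4 ∷ v5 ∷ t ∷ []) 0
    (con 2 ⊛ (x0 ⊕ x4) ⊕ con 6 ⊛ (x3 ⊛ x5) ⊕ (con 16 ⊛ (x1 ⊕ con 83) ⊕ con 1))
    (con 2 ⊛ (con 8 ⊛ (x1 ⊕ con 83) ⊛ (con 8 ⊛ (x1 ⊕ con 83))))
    (hyp (con 1) (con 2 ⊛ x0 ⊕ (con 16 ⊛ (x1 ⊕ con 83) ⊕ con 1 ⊕ x2)) (x3 ⊛ x3) h1 ∷
    hyp (con 1) (con 2 ⊛ x4) (x5 ⊛ x5 ⊕ con 4 ⊛ (x6 ⊛ x6) ⊕ x2) h2 ∷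
    equ (con 332 ⊕ x3 ⊕ con 6 ⊛ x5 ⊕ x6 ⊕ con 4 ⊛ x1) x3 (con 4 ⊛ (x1 ⊕ con 83) ⊕ x6) (sym h3) ∷
    equ (con 2324 ⊕ x5 ⊕ con 5 ⊛ x6 ⊕ con 28 ⊛ x1) (x5 ⊕ x6) (con 4 ⊛ (x1 ⊕ con 83)) h4 ∷ []) refl

arith-219 : ∀ v1 v2 v3 v4 n₁ v5 v6 → 2 * (v1 + v2) + 6 * (v3 * v4) + (16 * (n₁ + 83) + 1) ≤ 2 *
    (8 * (n₁ + 83) * (8 * (n₁ + 83))) → v5 ≡ v6 → v5 ≡ v3 * v4 → v1 + v2 + 3 * v6 < suc (8 * n₁ + 663) *
    (8 * n₁ + 663)
arith-219 v1 v2 v3 v4 n₁ v5 v6 h1 h2 h3 = linear (v1 ∷ v2 ∷ v3 ∷ v4 ∷ n₁ ∷ v5 ∷ v6 ∷ []) 1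
    (con 1 ⊕ (x0 ⊕ x1 ⊕ con 3 ⊛ x6)) ((con 1 ⊕ (con 8 ⊛ x4 ⊕ con 663)) ⊛ (con 8 ⊛ x4 ⊕ con 663))
    (hyp (con 1) (con 2 ⊛ (x0 ⊕ x1) ⊕ con 6 ⊛ (x2 ⊛ x3) ⊕ (con 16 ⊛ (x4 ⊕ con 83) ⊕ con 1))
        (con 2 ⊛ (con 8 ⊛ (x4 ⊕ con 83) ⊛ (con 8 ⊛ (x4 ⊕ con 83)))) h1 ∷
    equ (con 6) x6 x5 (sym h2) ∷ equ (con 6) x5 (x2 ⊛ x3) h3 ∷ []) refl

arith-220 : ∀ v1 n₁ v2 → v1 < 4 * (n₁ + 83) → v1 + v2 ≡ 8 * (n₁ + 83) → 4 * (n₁ + 83) ≤ v2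
arith-220 v1 n₁ v2 h1 h2 = linear (v1 ∷ n₁ ∷ v2 ∷ []) 0 (con 4 ⊛ (x1 ⊕ con 83)) x2
    (hyp (con 1) (con 1 ⊕ x0) (con 4 ⊛ (x1 ⊕ con 83)) h1 ∷ equ (con 1) (con 8 ⊛ (x1 ⊕ con 83)) (x0 ⊕ x2) (sym h2) ∷
    []) refl

arith-221 : ∀ v1 v2 v3 v4 n₁ v5 v6 → 2 * (v1 + v2) + 6 * (v3 * v4) + (16 * (n₁ + 83) + 1) ≤ 2 *
    (8 * (n₁ + 83) * (8 * (n₁ + 83))) → v5 ≡ v6 → v5 ≡ v4 * v3 → v2 + v1 + 3 * v6 < suc (8 * n₁ + 663) *
    (8 * n₁ + 663)
arith-221 v1 v2 v3 v4 n₁ v5 v6 h1 h2 h3 = linear (v1 ∷ v2 ∷ v3 ∷ v4 ∷ n₁ ∷ v5 ∷ v6 ∷ []) 1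
    (con 1 ⊕ (x1 ⊕ x0 ⊕ con 3 ⊛ x6)) ((con 1 ⊕ (con 8 ⊛ x4 ⊕ con 663)) ⊛ (con 8 ⊛ x4 ⊕ con 663))
    (hyp (con 1) (con 2 ⊛ (x0 ⊕ x1) ⊕ con 6 ⊛ (x2 ⊛ x3) ⊕ (con 16 ⊛ (x4 ⊕ con 83) ⊕ con 1))
        (con 2 ⊛ (con 8 ⊛ (x4 ⊕ con 83) ⊛ (con 8 ⊛ (x4 ⊕ con 83)))) h1 ∷
    equ (con 6) x6 x5 (sym h2) ∷ equ (con 6) x5 (x3 ⊛ x2) h3 ∷ []) refl

arith-222 : ∀ v1 v2 v3 v4 v5 n₁ v6 → v1 ≤ v2 → v1 ≡ v3 + v4 → v3 ≡ v5 → v5 ≡ suc (8 * (n₁ + 83)) → v2 ≡ v6 → v4 < v6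
arith-222 v1 v2 v3 v4 v5 n₁ v6 h1 h2 h3 h4 h5 = linear (v1 ∷ v2 ∷ v3 ∷ v4 ∷ v5 ∷ n₁ ∷ v6 ∷ []) 664 (con 1 ⊕ x3) x6
    (hyp (con 665) x0 x1 h1 ∷ equ (con 665) (x2 ⊕ x3) x0 (sym h2) ∷ equ (con 1) x4 x2 (sym h3) ∷
    equ (con 1) (con 1 ⊕ con 8 ⊛ (x5 ⊕ con 83)) x4 (sym h4) ∷ equ (con 665) x1 x6 h5 ∷ []) refl

module _ {A : Set} where

  Σl-filter : ∀ (p : A → Bool) xs (f : A → ℕ) → Σl (filter (λ x → p x Bool.≟ true) xs) f ≡ Σl xs (λ x → ⟦ p x ⟧ * f x)
  Σl-filter p [] f = refl
  Σl-filter p (x ∷ xs) f with p x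
  ... | true = cong₂ _+_ (sym (+-identityʳ (f x))) (Σl-filter p xs f)
  ... | false = Σl-filter p xs f

  length-filter : ∀ (p : A → Bool) xs → length (filter (λ x → p x Bool.≟ true) xs) ≡ Σl xs (⟦_⟧ ∘ p)
  length-filter p [] = refl
  length-filter p (x ∷ xs) with p x
  ... | true = cong suc (length-filter p xs)
  ... | false = length-filter p xs

  Σl-*ʳ : ∀ xs c (f : A → ℕ) → Σl xs (λ x → f x * c) ≡ Σl xs f * c
  Σl-*ʳ xs c f = trans (Σl-cong xs (λ x _ → *-comm (f x) c)) (trans (Σl-*ˡ xs c f) (*-comm c _))

-- The value `nothing` stands for a pair of equal vertices, so degenerate triples vanish from the
-- sums below.
red blue edge : Maybe Bool → ℕ
red (just true) = 1
red _ = 0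
blue (just false) = 1
blue _ = 0
edge (just _) = 1
edge nothing = 0

edge≡ : ∀ s → edge s ≡ red s + blue s
edge≡ nothing = refl
edge≡ (just true) = refl
edge≡ (just false) = refl

mixed : Maybe Bool → Maybe Bool → ℕ
mixed s t = red s * blue t + blue s * red t

-- a triangle is monochromatic or has exactly two bichromatic corners
triangle : ∀ s t u → 2 * (edge s * (edge t * edge u)) ≤
  2 * (red s * (red t * red u) + blue s * (blue t * blue u)) + (mixed s t + (mixed s u + mixed t u))
triangle nothing t u = z≤n
triangle (just s) nothing u = z≤n
triangle (just s) (just t) nothing = z≤n
triangle (just true) (just true) (just true) = ≤-refl
triangle (just true) (just true) (just false) = ≤-refl
triangle (just true) (just false) (just true) = ≤-refl
triangle (just true) (just false) (just false) = ≤-refl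
triangle (just false) (just true) (just true) = ≤-refl
triangle (just false) (just true) (just false) = ≤-refl
triangle (just false) (just false) (just true) = ≤-refl
triangle (just false) (just false) (just false) = ≤-refl

module Goodman {N : ℕ} (col : Colouring N) where

  private
    c = proj₁ col
    c-sym = proj₂ col
    V = allFin N

  state : Fin N → Fin N → Maybe Bool
  state x y with x Fin.≟ y
  ... | yes _ = nothing
  ... | no _ = just (c x y)

  state-sym : ∀ x y → state x y ≡ state y x
  state-sym x y with x Fin.≟ y | y Fin.≟ x
  ... | yes _ | yes _ = refl
  ... | yes x≡y | no y≢x = ⊥-elim (y≢x (sym x≡y))
  ... | no x≢y | yes y≡x = ⊥-elim (x≢y (sym y≡x))
  ... | no _ | no _ = cong just (c-sym x y)

  has : Bool → Maybe Bool → Bool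
  has b nothing = false
  has true (just d) = d
  has false (just d) = not d

  coloured : Bool → SimpleGraph
  coloured b = record { Vertex = Fin N ; _≟ᵥ_ = Fin._≟_ ; E = λ x y → has b (state x y)
    ; E-sym = λ x y → cong (has b) (state-sym x y) ; E-irrefl = irr }
    where
    irr : ∀ x → has b (state x x) ≡ false
    irr x with x Fin.≟ x
    ... | yes _ = refl
    ... | no x≢x = ⊥-elim (x≢x refl)

  has-red : ∀ s → ⟦ has true s ⟧ ≡ red s
  has-red nothing = refl
  has-red (just true) = refl
  has-red (just false) = refl

  has-blue : ∀ s → ⟦ has false s ⟧ ≡ blue s
  has-blue nothing = refl
  has-blue (just true) = refl
  has-blue (just false) = refl

  has-colour : ∀ b x y → has b (state x y) ≡ true → c x y ≡ b
  has-colour b x y h with x Fin.≟ y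
  has-colour true x y h | no _ = h
  has-colour false x y h | no _ with c x y
  ... | false = refl
  has-colour b x y () | yes _

  nbs : Bool → Fin N → List (Fin N)
  nbs b v = filter (λ y → has b (state v y) Bool.≟ true) V

  nbs-unique : ∀ b v → Unique (nbs b v)
  nbs-unique b v = Unique.filter⁺ _ (Unique.allFin⁺ N)

  ∈-nbs : ∀ {b v y} → y ∈ nbs b v → has b (state v y) ≡ true
  ∈-nbs y∈ = proj₂ (∈-filter⁻ _ {xs = V} y∈)

  ee : Bool → List (Fin N) → ℕ
  ee b = GraphTheory.ee (coloured b)

  length-V : length V ≡ N
  length-V = length-tabulate id

  edges-at : ∀ v → suc (Σl V (λ y → edge (state v y))) ≡ N
  edges-at v = trans (cong (_+ Σl V (λ y → edge (state v y))) (sym loop))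
      (trans (sym (Σl-+ V _ _)) (trans (Σl-cong V (λ y _ → one y))
      (trans (Σl-const V 1) (trans (*-identityʳ _) length-V))))
    where
    here? : Fin N → Bool
    here? y = does (v Fin.≟ y)
    one : ∀ y → ⟦ here? y ⟧ + edge (state v y) ≡ 1
    one y with v Fin.≟ y
    ... | yes _ = refl
    ... | no _ = refl
    here-sound : ∀ y → here? y ≡ true → v ≡ y
    here-sound y h with v Fin.≟ y
    ... | yes eq = eq
    loop : Σl V (⟦_⟧ ∘ here?) ≡ 1
    loop = ≤-antisym (Σl-≤1 V here? (Unique.allFin⁺ N)
        (λ x y _ _ h h′ → trans (sym (here-sound x h)) (here-sound y h′)))
      (≤-trans (≤-reflexive (sym self)) (Σl-∈ (⟦_⟧ ∘ here?) (∈-allFin v)))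
      where
      self : ⟦ here? v ⟧ ≡ 1
      self with v Fin.≟ v
      ... | yes _ = refl
      ... | no v≢v = ⊥-elim (v≢v refl)

  x y : Fin N → ℕ
  x v = Σl V (λ a → red (state v a))
  y v = Σl V (λ a → blue (state v a))

  x+y : ∀ v → suc (x v + y v) ≡ N
  x+y v = trans (cong suc (trans (sym (Σl-+ V _ _)) (Σl-cong V (λ a _ → sym (edge≡ (state v a)))))) (edges-at v)

  length-red : ∀ v → length (nbs true v) ≡ x v
  length-red v = trans (length-filter _ V) (Σl-cong V (λ a _ → has-red (state v a)))

  length-blue : ∀ v → length (nbs false v) ≡ y v
  length-blue v = trans (length-filter _ V) (Σl-cong V (λ a _ → has-blue (state v a)))

  ee-nbs : ∀ b (f : Maybe Bool → ℕ) → (∀ s → ⟦ has b s ⟧ ≡ f s) → ∀ v →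
    ee b (nbs b v) ≡ Σl V (λ a → Σl V (λ a′ → f (state v a) * (f (state v a′) * f (state a a′))))
  ee-nbs b f h v = trans (Σl-filter _ V _) (Σl-cong V (λ a _ → trans (cong₂ _*_ (h (state v a)) (Σl-filter _ V _))
    (trans (sym (Σl-*ˡ V (f (state v a)) _))
        (Σl-cong V (λ a′ _ → cong (f (state v a) *_) (cong₂ _*_ (h (state v a′)) (h (state a a′))))))))

  Σ³ : (Fin N → Fin N → Fin N → ℕ) → ℕ
  Σ³ f = Σl V (λ v → Σl V (λ a → Σl V (f v a)))

  Σ³-+ : ∀ f g → Σ³ (λ v a b → f v a b + g v a b) ≡ Σ³ f + Σ³ g
  Σ³-+ f g = trans (Σl-cong V (λ v _ → trans (Σl-cong V (λ a _ → Σl-+ V (f v a) (g v a))) (Σl-+ V _ _))) (Σl-+ V _ _)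

  Σ³-cong : ∀ {f g} → (∀ v a b → f v a b ≡ g v a b) → Σ³ f ≡ Σ³ g
  Σ³-cong h = Σl-cong V (λ v _ → Σl-cong V (λ a _ → Σl-cong V (λ b _ → h v a b)))

  Σ³-mono : ∀ {f g} → (∀ v a b → f v a b ≤ g v a b) → Σ³ f ≤ Σ³ g
  Σ³-mono h = Σl-mono V (λ v _ → Σl-mono V (λ a _ → Σl-mono V (λ b _ → h v a b)))

  Σ³-2* : ∀ f → Σ³ (λ v a b → 2 * f v a b) ≡ 2 * Σ³ f
  Σ³-2* f = trans (Σl-cong V (λ v _ → trans (Σl-cong V (λ a _ → Σl-*ˡ V 2 (f v a))) (Σl-*ˡ V 2 _))) (Σl-*ˡ V 2 _)

  mixed-sum : Σ³ (λ v a b → mixed (state v a) (state v b)) ≡ Σl V (λ v → 2 * (x v * y v))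
  mixed-sum = Σl-cong V (λ v _ → trans
      (Σl-cong V (λ a _ → trans (Σl-+ V _ _)
      (cong₂ _+_ (Σl-*ˡ V (red (state v a)) _) (Σl-*ˡ V (blue (state v a)) _))))
    (trans (Σl-+ V _ _) (trans (cong₂ _+_ (Σl-*ʳ V (y v) (λ a → red (state v a)))
        (Σl-*ʳ V (x v) (λ a → blue (state v a))))
      (arith-213 (x v) (y v)))))

  -- The corner at `a` becomes the corner at the first vertex once the order of summation is
  -- exchanged.
  mixed-sum₂ : Σ³ (λ v a b → mixed (state v a) (state a b)) ≡ Σl V (λ v → 2 * (x v * y v))
  mixed-sum₂ = trans (Σ³-cong (λ v a b → cong (λ s → mixed s (state a b)) (state-sym v a)))
      (trans (Σl-comm V V _) mixed-sum)

  mixed-sum₃ : Σ³ (λ v a b → mixed (state v b) (state a b)) ≡ Σl V (λ v → 2 * (x v * y v))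
  mixed-sum₃ = trans (Σ³-cong (λ v a b → cong₂ mixed (state-sym v b) (state-sym a b)))
    (trans (Σl-cong V (λ v _ → Σl-comm V V _)) (trans (Σl-comm V V _) mixed-sum))

  triples : ∀ {M₁} → N ≡ suc (suc M₁) → N * (suc M₁ * M₁) ≤ Σ³
      (λ v a b → edge (state v a) * (edge (state v b) * edge (state a b)))
  triples {M₁} eq = ≤-trans (≤-reflexive (trans (cong (_* (suc M₁ * M₁)) (sym length-V))
      (sym (Σl-const V (suc M₁ * M₁))))) (Σl-mono V (λ v _ → rows v))
    where
    open ≤-Reasoning
    pair≤ : ∀ s t → edge s + edge t ≤ 1 + edge s * edge t
    pair≤ nothing nothing = z≤n
    pair≤ nothing (just _) = ≤-refl
    pair≤ (just _) nothing = ≤-refl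
    pair≤ (just _) (just _) = ≤-refl
    -- Inclusion and exclusion: all vertices but one differ from `v`, and all but one from `a`.
    common : ∀ v a → M₁ ≤ Σl V (λ b → edge (state v b) * edge (state a b))
    common v a = arith-214 (Σl V (λ b → edge (state v b))) M₁ (Σl V (λ b → edge (state a b)))
        (Σl V (λ b → edge (state v b) * edge (state a b))) (trans (edges-at v) eq) (trans (edges-at a) eq)
        (≤-trans (≤-reflexive (sym (Σl-+ V (λ b → edge (state v b)) (λ b → edge (state a b)))))
        (≤-trans (Σl-mono V (λ b _ → pair≤ (state v b) (state a b)))
        (≤-reflexive (trans (Σl-+ V (λ _ → 1) (λ b → edge (state v b) * edge (state a b)))
        (cong (_+ Σl V (λ b → edge (state v b) * edge (state a b)))
        (trans (Σl-const V 1) (trans (*-identityʳ _) (trans length-V eq))))))))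
    rows : ∀ v → suc M₁ * M₁ ≤ Σl V (λ a → Σl V (λ b → edge (state v a) * (edge (state v b) * edge (state a b))))
    rows v = begin
      suc M₁ * M₁                                                     ≡⟨ cong (_* M₁)
          (sym (suc-injective (trans (edges-at v) eq))) ⟩
      Σl V (λ a → edge (state v a)) * M₁                              ≡⟨ sym (Σl-*ʳ V M₁ (λ a → edge (state v a))) ⟩
      Σl V (λ a → edge (state v a) * M₁)                              ≤⟨ Σl-mono V
          (λ a _ → *-monoʳ-≤ (edge (state v a)) (common v a)) ⟩
      Σl V (λ a → edge (state v a) * Σl V (λ b → edge (state v b) * edge (state a b)))
        ≡⟨ Σl-cong V (λ a _ → sym (Σl-*ˡ V (edge (state v a)) (λ b → edge (state v b) * edge (state a b)))) ⟩
      Σl V (λ a → Σl V (λ b → edge (state v a) * (edge (state v b) * edge (state a b)))) ∎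

  -- The inequality `triangle` is summed over all ordered triples and halved; each of the three
  -- corners contributes the same sum of `2 * (x v * y v)`.
  goodman : ∀ {M₁} → N ≡ suc (suc M₁) →
    N * (suc M₁ * M₁) ≤ Σl V (λ v → ee true (nbs true v) + ee false (nbs false v) + 3 * (x v * y v))
  goodman {M₁} eq = arith-215 (N * (suc M₁ * M₁)) (Σ³ D) (Σ³ (λ v a b → 2 * D v a b))
      (Σ³ (λ v a b → 2 * (R v a b + B v a b) + (m₁ v a b + (m₂ v a b + m₃ v a b))))
      (Σ³ (λ v a b → 2 * (R v a b + B v a b))) (Σ³ (λ v a b → m₁ v a b + (m₂ v a b + m₃ v a b)))
      (Σ³ (λ v a b → R v a b + B v a b)) (Σ³ R) (Σ³ B) (Σl V (λ v → 2 * (x v * y v)))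
      (Σl V (λ v → x v * y v)) (Σl V (λ v → ee true (nbs true v) + ee false (nbs false v) + 3 * (x v * y v)))
      (triples eq) (Σ³-mono (λ v a b → triangle (state v a) (state v b) (state a b))) (Σ³-2* D)
      (Σ³-+ (λ v a b → 2 * (R v a b + B v a b)) (λ v a b → m₁ v a b + (m₂ v a b + m₃ v a b)))
      (Σ³-2* (λ v a b → R v a b + B v a b)) (Σ³-+ R B)
      (trans (Σ³-+ m₁ _) (cong₂ _+_ mixed-sum (trans (Σ³-+ m₂ m₃) (cong₂ _+_ mixed-sum₂ mixed-sum₃))))
      (Σl-*ˡ V 2 (λ v → x v * y v)) (trans (Σl-+ V (λ v → ee true (nbs true v) + ee false (nbs false v))
      (λ v → 3 * (x v * y v))) (cong₂ _+_
      (trans (Σl-+ V (λ v → ee true (nbs true v)) (λ v → ee false (nbs false v)))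
      (cong₂ _+_ (Σl-cong V (λ v _ → ee-nbs true red has-red v))
      (Σl-cong V (λ v _ → ee-nbs false blue has-blue v)))) (Σl-*ˡ V 3 (λ v → x v * y v))))
    where
    D R B m₁ m₂ m₃ : Fin N → Fin N → Fin N → ℕ
    D v a b = edge (state v a) * (edge (state v b) * edge (state a b))
    R v a b = red (state v a) * (red (state v b) * red (state a b))
    B v a b = blue (state v a) * (blue (state v b) * blue (state a b))
    m₁ v a b = mixed (state v a) (state v b)
    m₂ v a b = mixed (state v a) (state a b)
    m₃ v a b = mixed (state v b) (state a b)

  wheel : ∀ b v k {xs} → GraphTheory.Cycle (coloured b) xs → (∀ {u} → u ∈ xs → u ∈ nbs b v) → length xs ≡ k →
      HasMonoCopy (Wheel k) col
  wheel b v k {xs} cyc xs⊆ refl = b , f , inj , adj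
    where
    open GraphTheory (coloured b)
    open Cycle cyc
    f : Fin (suc (length xs)) → Fin N
    f zero = v
    f (suc i) = nth v xs (toℕ i)
    v~ : ∀ i → v ~ nth v xs (toℕ {length xs} i)
    v~ i = ∈-nbs {b} {v} (xs⊆ (nth-∈ xs (toℕ<n i)))
    inj : Injective _≡_ _≡_ f
    inj {zero} {zero} _ = refl
    inj {zero} {suc j} eq = ⊥-elim (~⇒≢ (v~ j) eq)
    inj {suc i} {zero} eq = ⊥-elim (~⇒≢ (v~ i) (sym eq))
    inj {suc i} {suc j} eq = cong suc (toℕ-injective (nth-injective unique (toℕ<n i) (toℕ<n j) eq))
    consecutive : ∀ (i j : Fin (length xs)) → toℕ j ≡ suc (toℕ i) → f (suc i) ~ f (suc j)
    consecutive i j eq = subst (λ k → f (suc i) ~ nth v xs k) (sym eq)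
        (Path-nth-step v (toℕ i) path (≤-trans (s≤s (≤-reflexive (sym eq))) (toℕ<n j)))
    wrap : ∀ (i j : Fin (length xs)) → toℕ i ≡ 0 → suc (toℕ j) ≡ length xs → f (suc j) ~ f (suc i)
    wrap i j eq eq′ = subst₂ _~_ (sym (Path-nth-last v (toℕ j) path eq′))
        (sym (trans (cong (nth v xs) eq) (Path-nth-first v path))) closed
    rim : ∀ i j → CycleAdj (length xs) i j → f (suc i) ~ f (suc j)
    rim i j (inj₁ eq) = consecutive i j eq
    rim i j (inj₂ (inj₁ eq)) = ~-sym {f (suc j)} {f (suc i)} (consecutive j i eq)
    rim i j (inj₂ (inj₂ (inj₁ (eq , eq′)))) = ~-sym {f (suc j)} {f (suc i)} (wrap i j eq eq′)
    rim i j (inj₂ (inj₂ (inj₂ (eq , eq′)))) = wrap j i eq eq′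
    adj : ∀ i j → Wheel (length xs) i j → c (f i) (f j) ≡ b
    adj zero (suc j) _ = has-colour b _ _ (v~ j)
    adj (suc i) zero _ = has-colour b _ _ (~-sym {v} {f (suc i)} (v~ i))
    adj (suc i) (suc j) h = has-colour b _ _ (rim i j h)

-- Upper bound

arrows : ∀ n₁ → 1 ≤ n₁ → (col : Colouring (suc (8 * (n₁ + 83)))) → ¬ ¬ HasMonoCopy (Wheel (2 * suc n₁)) col
arrows n₁ 1≤n₁ col none = <-irrefl refl (≤-trans Σl-bound (goodman {M₁} refl′))
  where
  N = suc (8 * (n₁ + 83))
  M₁ = 8 * n₁ + 663
  open Goodman col
  refl′ : N ≡ suc (suc M₁)
  refl′ = arith-216 n₁
  V = allFin N
  free : ∀ b v {xs} → GraphTheory.Cycle (coloured b) xs → (∀ {u} → u ∈ xs → u ∈ nbs b v) → length xs ≢ 2 * suc n₁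
  free b v cyc xs⊆ eq = none (wheel b v (2 * suc n₁) cyc xs⊆ eq)
  excess = positive-part (48 * (n₁ + 83)) 280000
  X = proj₁ excess
  F : Fin N → ℕ
  F v = ee true (nbs true v) + ee false (nbs false v) + 3 * (x v * y v)
  sizes : ∀ b v → length (nbs b v) + length (nbs (not b) v) ≡ 8 * (n₁ + 83)
  sizes true v = suc-injective (trans (cong suc (cong₂ _+_ (length-red v) (length-blue v))) (x+y v))
  sizes false v = trans (+-comm (length (nbs false v)) _) (sizes true v)
  -- For sizes p = M/2 + t and q = M/2 - t the identity p² + q² + 4t² + 6pq = 2M² applies, and the
  -- two occurrences of `X` cancel. The summand `16 * (n₁ + 83)` is 2M, and the 1 gives strictness.
  both : ∀ b v → 4 * (n₁ + 83) ≤ length (nbs b v) →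
    2 * (ee b (nbs b v) + ee (not b) (nbs (not b) v)) + 6 * (length (nbs b v) * length (nbs (not b) v)) +
        (16 * (n₁ + 83) + 1) ≤ 2 * (8 * (n₁ + 83) * (8 * (n₁ + 83)))
  both b v big =
    let t , eq = m≤n⇒∃[o]m+o≡n big
        other : length (nbs (not b) v) + t ≡ 4 * (n₁ + 83)
        other = arith-217 n₁ t (length (nbs b v)) (length (nbs (not b) v)) eq (sizes b v)
    in (arith-218 (ee b (nbs b v)) n₁ X (length (nbs b v)) (ee (not b) (nbs (not b) v))
        (length (nbs (not b) v)) t (Extremal.large-bound (coloured b) n₁ 1≤n₁ (nbs-unique b v) (free b v) X
        big (proj₂ (proj₂ excess))) (Extremal.small-bound (coloured (not b)) n₁ 1≤n₁ (nbs-unique (not b) v)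
        (free (not b) v) X t other (proj₁ (proj₂ excess))) eq other)
  pointwise : ∀ v → F v < suc M₁ * M₁
  pointwise v with 4 * (n₁ + 83) ≤? length (nbs true v)
  ... | yes big = arith-219 (ee true (nbs true v)) (ee false (nbs false v)) (length (nbs true v))
      (length (nbs false v)) n₁ (length (nbs true v) * length (nbs false v)) (x v * y v) (both true v big)
      (cong₂ _*_ (length-red v) (length-blue v)) refl
  ... | no small = arith-221 (ee false (nbs false v)) (ee true (nbs true v)) (length (nbs false v))
      (length (nbs true v)) n₁ (length (nbs true v) * length (nbs false v)) (x v * y v)
      (both false v (arith-220 (length (nbs true v)) n₁ (length (nbs false v)) (≰⇒> small) (sizes true v)))
      (cong₂ _*_ (length-red v) (length-blue v)) refl
  Σl-bound : Σl V F < N * (suc M₁ * M₁)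
  Σl-bound = arith-222 (Σl V (λ v → 1 + F v)) (length V * (suc M₁ * M₁)) (Σl V (λ _ → 1)) (Σl V F) (length V)
      n₁ (N * (suc M₁ * M₁)) (Σl-≤const V {λ v → 1 + F v} (suc M₁ * M₁) (λ v _ → pointwise v))
      (Σl-+ V (λ _ → 1) F) (trans (Σl-const V 1) (*-identityʳ _)) length-V (cong (_* (suc M₁ * M₁)) length-V)

-- Lower bound

arith-223 : ∀ b q a → b + b ≤ q → q ≤ suc (a + a) → a < b → ⊥
arith-223 b q a h1 h2 h3 = 1≰0 (linear (b ∷ q ∷ a ∷ []) 0 (con 1) (con 0)
    (hyp (con 1) (x0 ⊕ x0) x1 h1 ∷ hyp (con 1) x1 (con 1 ⊕ (x2 ⊕ x2)) h2 ∷ hyp (con 2) (con 1 ⊕ x2) x0 h3 ∷ []) refl)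

arith-224 : ∀ v1 v2 s v3 v4 → v1 + v2 ≡ s → v1 + v3 ≡ v4 → v4 + v2 ≡ v3 + s
arith-224 v1 v2 s v3 v4 h1 h2 = ≤-antisym (linear (v1 ∷ v2 ∷ s ∷ v3 ∷ v4 ∷ []) 0 (x4 ⊕ x1) (x3 ⊕ x2)
    (equ (con 1) (x0 ⊕ x1) x2 h1 ∷ equ (con 1) x4 (x0 ⊕ x3) (sym h2) ∷ []) refl)
        (linear (v1 ∷ v2 ∷ s ∷ v3 ∷ v4 ∷ []) 0 (x3 ⊕ x2) (x4 ⊕ x1)
    (equ (con 1) x2 (x0 ⊕ x1) (sym h1) ∷ equ (con 1) (x0 ⊕ x3) x4 h2 ∷ []) refl)

arith-225 : ∀ v1 r v2 v3 s → v1 + r ≡ v2 → v1 + r ≡ v3 + s → v2 < s → ⊥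
arith-225 v1 r v2 v3 s h1 h2 h3 = 1≰0 (linear (v1 ∷ r ∷ v2 ∷ v3 ∷ s ∷ []) 0 (con 1) (con 0)
    (equ (con 1) (x0 ⊕ x1) x2 h1 ∷ equ (con 1) (x3 ⊕ x4) (x0 ⊕ x1) (sym h2) ∷ hyp (con 1) (con 1 ⊕ x2) x4 h3 ∷
    []) refl)

arith-226 : ∀ v1 r v2 s v3 → v1 + r ≡ v2 + s → v1 + r ≡ v3 → v3 < s → ⊥
arith-226 v1 r v2 s v3 h1 h2 h3 = 1≰0 (linear (v1 ∷ r ∷ v2 ∷ s ∷ v3 ∷ []) 0 (con 1) (con 0)
    (equ (con 1) (x2 ⊕ x3) (x0 ⊕ x1) (sym h1) ∷ equ (con 1) (x0 ⊕ x1) x4 h2 ∷ hyp (con 1) (con 1 ⊕ x4) x3 h3 ∷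
    []) refl)

arith-227 : ∀ v1 r s k → v1 + r ≡ s → v1 + k < s → k < r
arith-227 v1 r s k h1 h2 = linear (v1 ∷ r ∷ s ∷ k ∷ []) 0 (con 1 ⊕ x3) x1
    (equ (con 1) x2 (x0 ⊕ x1) (sym h1) ∷ hyp (con 1) (con 1 ⊕ (x0 ⊕ x3)) x2 h2 ∷ []) refl

arith-228 : ∀ v1 r s k → v1 + r ≡ s → k < v1 → r + k < s
arith-228 v1 r s k h1 h2 = linear (v1 ∷ r ∷ s ∷ k ∷ []) 0 (con 1 ⊕ (x1 ⊕ x3)) x2
    (equ (con 1) (x0 ⊕ x1) x2 h1 ∷ hyp (con 1) (con 1 ⊕ x3) x0 h2 ∷ []) refl

arith-229 : ∀ v1 v2 s → v1 + 0 ≡ v2 + s → v1 < s → ⊥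
arith-229 v1 v2 s h1 h2 = 1≰0 (linear (v1 ∷ v2 ∷ s ∷ []) 0 (con 1) (con 0)
    (equ (con 1) (x1 ⊕ x2) (x0 ⊕ con 0) (sym h1) ∷ hyp (con 1) (con 1 ⊕ x0) x2 h2 ∷ []) refl)

arith-230 : ∀ v1 r v2 s → v1 + r ≡ v2 → v2 < s → r < s
arith-230 v1 r v2 s h1 h2 = linear (v1 ∷ r ∷ v2 ∷ s ∷ []) 0 (con 1 ⊕ x1) x3
    (equ (con 1) (x0 ⊕ x1) x2 h1 ∷ hyp (con 1) (con 1 ⊕ x2) x3 h2 ∷ []) refl

arith-231 : ∀ v1 r s k → v1 + r ≡ s → v1 ≤ k → s ≤ r + k
arith-231 v1 r s k h1 h2 = linear (v1 ∷ r ∷ s ∷ k ∷ []) 0 x2 (x1 ⊕ x3)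
    (equ (con 1) x2 (x0 ⊕ x1) (sym h1) ∷ hyp (con 1) x0 x3 h2 ∷ []) refl

arith-232 : ∀ v1 r s → v1 + r ≡ s → 0 < v1 → r < s
arith-232 v1 r s h1 h2 = linear (v1 ∷ r ∷ s ∷ []) 0 (con 1 ⊕ x1) x2
    (equ (con 1) (x0 ⊕ x1) x2 h1 ∷ hyp (con 1) (con 1 ⊕ con 0) x0 h2 ∷ []) refl

arith-233 : ∀ v1 r s k → v1 + r ≡ s → s ≤ v1 + k → r ≤ k
arith-233 v1 r s k h1 h2 = linear (v1 ∷ r ∷ s ∷ k ∷ []) 0 x1 x3
    (equ (con 1) (x0 ⊕ x1) x2 h1 ∷ hyp (con 1) x2 (x0 ⊕ x3) h2 ∷ []) refl

arith-234 : ∀ δ k → δ ≤ 1 → suc (4 * k + δ) < 2 * suc (2 * k + δ)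
arith-234 δ k h1 = linear (δ ∷ k ∷ []) 0 (con 1 ⊕ (con 1 ⊕ (con 4 ⊛ x1 ⊕ x0))) (con 2 ⊛ (con 1 ⊕ (con 2 ⊛ x1 ⊕ x0)))
    [] refl

arith-235 : ∀ k δ → 2 * k + δ + suc (2 * k + δ) < 2 * suc (2 * k + δ)
arith-235 k δ = linear (k ∷ δ ∷ []) 0 (con 1 ⊕ (con 2 ⊛ x0 ⊕ x1 ⊕ (con 1 ⊕ (con 2 ⊛ x0 ⊕ x1))))
    (con 2 ⊛ (con 1 ⊕ (con 2 ⊛ x0 ⊕ x1)))
    [] refl

arith-236 : ∀ v1 k r δ → v1 + suc k ≡ r → r + k < suc (4 * k + δ) → v1 < 2 * k + δ
arith-236 v1 k r δ h1 h2 = linear (v1 ∷ k ∷ r ∷ δ ∷ []) 0 (con 1 ⊕ x0) (con 2 ⊛ x1 ⊕ x3)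
    (equ (con 1) (x0 ⊕ (con 1 ⊕ x1)) x2 h1 ∷ hyp (con 1) (con 1 ⊕ (x2 ⊕ x1)) (con 1 ⊕ (con 4 ⊛ x1 ⊕ x3)) h2 ∷
    []) refl

arith-237 : ∀ j n → j < n → suc (j + j) < 2 * n
arith-237 j n h1 = linear (j ∷ n ∷ []) 0 (con 1 ⊕ (con 1 ⊕ (x0 ⊕ x0))) (con 2 ⊛ x1)
    (hyp (con 2) (con 1 ⊕ x0) x1 h1 ∷ []) refl

arith-238 : ∀ k δ → suc (2 * k + δ) < 2 * suc (2 * k + δ)
arith-238 k δ = linear (k ∷ δ ∷ []) 0 (con 1 ⊕ (con 1 ⊕ (con 2 ⊛ x0 ⊕ x1))) (con 2 ⊛ (con 1 ⊕ (con 2 ⊛ x0 ⊕ x1)))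
    [] refl

arith-239 : ∀ k δ → 2 * k < suc (2 * k + δ)
arith-239 k δ = linear (k ∷ δ ∷ []) 0 (con 1 ⊕ con 2 ⊛ x0) (con 1 ⊕ (con 2 ⊛ x0 ⊕ x1)) [] refl

arith-240 : ∀ g r′ k s r → suc g ≡ r′ → r′ ≤ k → g + s ≡ r + 2 * k → s ≤ r + k → ⊥
arith-240 g r′ k s r h1 h2 h3 h4 = 1≰0 (linear (g ∷ r′ ∷ k ∷ s ∷ r ∷ []) 0 (con 1) (con 0)
    (equ (con 1) (con 1 ⊕ x0) x1 h1 ∷ hyp (con 1) x1 x2 h2 ∷ equ (con 1) (x4 ⊕ con 2 ⊛ x2) (x0 ⊕ x3) (sym h3) ∷
    hyp (con 1) x3 (x4 ⊕ x2) h4 ∷ []) refl)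

arith-241 : ∀ v1 r k → v1 + 1 ≡ r → r ≤ k → 1 ≤ r → v1 < 2 * k
arith-241 v1 r k h1 h2 h3 = linear (v1 ∷ r ∷ k ∷ []) 0 (con 1 ⊕ x0) (con 2 ⊛ x2)
    (equ (con 1) (x0 ⊕ con 1) x1 h1 ∷ hyp (con 1) x1 x2 h2 ∷ []) refl

arith-242 : ∀ v1 s r k → v1 + s ≡ r + 2 * k → r < s → v1 < 2 * k
arith-242 v1 s r k h1 h2 = linear (v1 ∷ s ∷ r ∷ k ∷ []) 0 (con 1 ⊕ x0) (con 2 ⊛ x3)
    (equ (con 1) (x0 ⊕ x1) (x2 ⊕ con 2 ⊛ x3) h1 ∷ hyp (con 1) (con 1 ⊕ x2) x1 h2 ∷ []) refl

arith-243 : ∀ s r k → s ≤ r + k → s ≤ r + 2 * k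
arith-243 s r k h1 = linear (s ∷ r ∷ k ∷ []) 0 x0 (x1 ⊕ con 2 ⊛ x2) (hyp (con 1) x0 (x1 ⊕ x2) h1 ∷ []) refl

no-injection : ∀ {m n} → m < n → (g : Fin n → ℕ) → (∀ i → g i < m) → (∀ i j → g i ≡ g j → i ≡ j) → ⊥
no-injection m<n g g<m inj with pigeonhole m<n (λ i → fromℕ< (g<m i))
... | i , j , i<j , eq = <-irrefl (cong toℕ (inj i j (fromℕ<-injective _ _ (g<m i) (g<m j) eq))) i<j

parity-bounds : ∀ {q a} → q ≡ a + a ⊎ q ≡ suc (a + a) → a + a ≤ q × q ≤ suc (a + a)
parity-bounds (inj₁ refl) = ≤-refl , n≤1+n _
parity-bounds (inj₂ refl) = n≤1+n _ , ≤-refl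

halves-≡ : ∀ {q} a b → q ≡ a + a ⊎ q ≡ suc (a + a) → q ≡ b + b ⊎ q ≡ suc (b + b) → a ≡ b
halves-≡ {q} a b h h′ with <-cmp a b
... | tri≈ _ eq _ = eq
... | tri< a<b _ _ = ⊥-elim (arith-223 b q a (proj₁ (parity-bounds {a = b} h′)) (proj₂ (parity-bounds {a = a} h)) a<b)
... | tri> _ _ b<a = ⊥-elim (arith-223 a q b (proj₁ (parity-bounds {a = a} h)) (proj₂ (parity-bounds {a = b} h′)) b<a)

splitAt-injective : ∀ m {n} (i j : Fin (m + n)) → splitAt m i ≡ splitAt m j → i ≡ j
splitAt-injective m {n} i j eq = trans (sym (Fin.join-splitAt m n i))
    (trans (cong (Fin.join m n) eq) (Fin.join-splitAt m n j))

-- n = 2k + 1 + δ: the nodes are a red clique on 2n vertices, joined in blue to the disjoint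
-- union, in blue, of a clique on n vertices and a circulant graph of degree 2k
-- on s = 4k + 1 + δ vertices.
module LowerBound (k δ : ℕ) (δ≤1 : δ ≤ 1) where

  n s : ℕ
  n = suc (2 * k + δ)
  s = suc (4 * k + δ)

  Node : Set
  Node = Fin (2 * n) ⊎ (Fin n ⊎ Fin s)

  -- The distance round the circle is at most `k`. This includes equal vertices, which `near-bounds`
  -- sets apart.
  near : Fin s → Fin s → Bool
  near i j = (∣ toℕ i - toℕ j ∣ ≤ᵇ k) ∨ (s ≤ᵇ ∣ toℕ i - toℕ j ∣ + k)

  near-sym : ∀ i j → near i j ≡ near j i
  near-sym i j rewrite ∣-∣-comm (toℕ i) (toℕ j) = refl

  colour : Node → Node → Bool
  colour (inj₁ _) (inj₁ _) = true
  colour (inj₁ _) (inj₂ _) = false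
  colour (inj₂ _) (inj₁ _) = false
  colour (inj₂ (inj₁ _)) (inj₂ (inj₁ _)) = false
  colour (inj₂ (inj₁ _)) (inj₂ (inj₂ _)) = true
  colour (inj₂ (inj₂ _)) (inj₂ (inj₁ _)) = true
  colour (inj₂ (inj₂ i)) (inj₂ (inj₂ j)) = not (near i j)

  colour-sym : ∀ x y → colour x y ≡ colour y x
  colour-sym (inj₁ _) (inj₁ _) = refl
  colour-sym (inj₁ _) (inj₂ _) = refl
  colour-sym (inj₂ _) (inj₁ _) = refl
  colour-sym (inj₂ (inj₁ _)) (inj₂ (inj₁ _)) = refl
  colour-sym (inj₂ (inj₁ _)) (inj₂ (inj₂ _)) = refl
  colour-sym (inj₂ (inj₂ _)) (inj₂ (inj₁ _)) = refl
  colour-sym (inj₂ (inj₂ i)) (inj₂ (inj₂ j)) = cong not (near-sym i j)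

  -- r is the residue of j - i modulo s
  Residue : Fin s → Fin s → ℕ → Set
  Residue i j r = (toℕ i + r ≡ toℕ j × ∣ toℕ i - toℕ j ∣ ≡ r) ⊎ (toℕ i + r ≡ toℕ j + s × ∣ toℕ i - toℕ j ∣ + r ≡ s)

  residue : ∀ i j → ∃ (Residue i j)
  residue i j with toℕ i ≤? toℕ j
  ... | yes i≤j = toℕ j ∸ toℕ i , inj₁ (m+[n∸m]≡n i≤j , m≤n⇒∣m-n∣≡n∸m i≤j)
  ... | no i≰j = s ∸ d , inj₂ ((arith-224 d (s ∸ d) s (toℕ j) (toℕ i) (m+[n∸m]≡n d≤s) (m∸n+n≡m (<⇒≤ (≰⇒> i≰j)))) ,
        trans (cong (_+ (s ∸ d)) (m≤n⇒∣n-m∣≡n∸m (<⇒≤ (≰⇒> i≰j)))) (m+[n∸m]≡n d≤s))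
    where
    d = toℕ i ∸ toℕ j
    d≤s : d ≤ s
    d≤s = ≤-trans (m∸n≤m (toℕ i) (toℕ j)) (<⇒≤ (toℕ<n i))

  residue-injective : ∀ i j j′ {r} → Residue i j r → Residue i j′ r → j ≡ j′
  residue-injective i j j′ (inj₁ (e , _)) (inj₁ (e′ , _)) = toℕ-injective (trans (sym e) e′)
  residue-injective i j j′ (inj₂ (e , _)) (inj₂ (e′ , _)) = toℕ-injective (+-cancelʳ-≡ s _ _ (trans (sym e) e′))
  residue-injective i j j′ {r} (inj₁ (e , _)) (inj₂ (e′ , _)) =
      ⊥-elim (arith-225 (toℕ i) r (toℕ j) (toℕ j′) s e e′ (toℕ<n j))
  residue-injective i j j′ {r} (inj₂ (e , _)) (inj₁ (e′ , _)) =
      ⊥-elim (arith-226 (toℕ i) r (toℕ j) s (toℕ j′) e e′ (toℕ<n j′))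

  far-bounds : ∀ i j {r} → near i j ≡ false → Residue i j r → k < r × r + k < s
  far-bounds i j far res with ∣ toℕ i - toℕ j ∣ ≤? k | s ≤? ∣ toℕ i - toℕ j ∣ + k
  ... | yes h | _ = case trans (sym far)
      (cong (_∨ (s ≤ᵇ ∣ toℕ i - toℕ j ∣ + k)) (≤ᵇ-true {∣ toℕ i - toℕ j ∣} h)) of λ ()
  ... | no _ | yes h = case trans (sym far) (trans (cong ((∣ toℕ i - toℕ j ∣ ≤ᵇ k) ∨_) (≤ᵇ-true h)) (∨-zeroʳ _)) of λ ()
  far-bounds i j far (inj₁ (_ , refl)) | no h | no h′ = ≰⇒> h , ≰⇒> h′
  far-bounds i j {r} far (inj₂ (_ , e)) | no h | no h′ =
    (arith-227 (∣ toℕ i - toℕ j ∣) r s k e (≰⇒> h′)) , (arith-228 (∣ toℕ i - toℕ j ∣) r s k e (≰⇒> h))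

  near-bounds : ∀ i j {r} → near i j ≡ true → Residue i j r → i ≢ j → 1 ≤ r × r < s × (r ≤ k ⊎ s ≤ r + k)
  near-bounds i j {r} close res i≢j with positive r res | ∨-true {∣ toℕ i - toℕ j ∣ ≤ᵇ k}
      {s ≤ᵇ ∣ toℕ i - toℕ j ∣ + k} close
    where
    positive : ∀ r → Residue i j r → 1 ≤ r
    positive zero (inj₁ (e , _)) = ⊥-elim (i≢j (toℕ-injective (trans (sym (+-identityʳ _)) e)))
    positive zero (inj₂ (e , _)) = ⊥-elim (arith-229 (toℕ i) (toℕ j) s e (toℕ<n i))
    positive (suc r) _ = s≤s z≤n
    ∨-true : ∀ {b c} → b ∨ c ≡ true → b ≡ true ⊎ c ≡ true
    ∨-true {true} _ = inj₁ refl
    ∨-true {false} h = inj₂ h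
  near-bounds i j {r} close (inj₁ (e , refl)) i≢j | pos | inj₁ h = pos ,
      (arith-230 (toℕ i) r (toℕ j) s e (toℕ<n j)) , inj₁ (≤ᵇ-sound {∣ toℕ i - toℕ j ∣} h)
  near-bounds i j {r} close (inj₁ (e , refl)) i≢j | pos | inj₂ h = pos ,
      (arith-230 (toℕ i) r (toℕ j) s e (toℕ<n j)) , inj₂ (≤ᵇ-sound {s} h)
  near-bounds i j {r} close (inj₂ (e , e′)) i≢j | pos | inj₁ h = pos , r<s ,
      inj₂ (arith-231 (∣ toℕ i - toℕ j ∣) r s k e′ (≤ᵇ-sound {∣ toℕ i - toℕ j ∣} h))
    where
    r<s : r < s
    r<s = arith-232 (∣ toℕ i - toℕ j ∣) r s e′ (n≢0⇒n>0 (λ z → i≢j (toℕ-injective (∣m-n∣≡0⇒m≡n z))))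
  near-bounds i j {r} close (inj₂ (e , e′)) i≢j | pos | inj₂ h = pos , r<s ,
      inj₁ (arith-233 (∣ toℕ i - toℕ j ∣) r s k e′ (≤ᵇ-sound {s} h))
    where
    r<s : r < s
    r<s = arith-232 (∣ toℕ i - toℕ j ∣) r s e′ (n≢0⇒n>0 (λ z → i≢j (toℕ-injective (∣m-n∣≡0⇒m≡n z))))

  module Copy (b : Bool) (F : Fin (suc (2 * n)) → Node) (F-inj : ∀ i j → F i ≡ F j → i ≡ j)
              (F-adj : ∀ i j → Wheel (2 * n) i j → colour (F i) (F j) ≡ b) where

    hub : Node
    hub = F zero

    rim : Fin (2 * n) → Node
    rim i = F (suc i)

    rim-inj : ∀ i j → rim i ≡ rim j → i ≡ j
    rim-inj i j eq = Fin.suc-injective (F-inj (suc i) (suc j) eq)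

    spoke : ∀ i → colour hub (rim i) ≡ b
    spoke i = F-adj zero (suc i) tt

    -- The bound is irrelevant, so that different proofs of it give the same rim vertex.
    at : ∀ t → .(t < 2 * n) → Node
    at t lt = rim (fromℕ< lt)

    at-step : ∀ t (lt : suc t < 2 * n) → colour (at t (<-trans (n<1+n t) lt)) (at (suc t) lt) ≡ b
    at-step t lt = F-adj _ _ (inj₁ (trans (toℕ-fromℕ< lt) (cong suc (sym (toℕ-fromℕ< (<-trans (n<1+n t) lt))))))

  module RedCopy (F : Fin (suc (2 * n)) → Node) (F-inj : ∀ i j → F i ≡ F j → i ≡ j)
              (F-adj : ∀ i j → Wheel (2 * n) i j → colour (F i) (F j) ≡ true) where

    open Copy true F F-inj F-adj

    -- In red, the clique is a component with only 2n vertices. A vertex of the blue K_n has `s` red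
    -- neighbours, fewer than 2n, and a vertex of the circulant graph has n + (s - 1 - 2k), which is
    -- 2n - 1.
    by-hub : ∀ v → hub ≡ v → ⊥
    by-hub (inj₁ a) eq = no-injection ≤-refl (λ i → toℕ (proj₁ (inA i))) (λ i → toℕ<n (proj₁ (inA i)))
        (λ i j e → F-inj i j (trans (proj₂ (inA i)) (trans (cong inj₁ (toℕ-injective e)) (sym (proj₂ (inA j))))))
      where
      inA : ∀ i → ∃ λ a → F i ≡ inj₁ a
      inA zero = a , eq
      inA (suc i) with F (suc i) in e | spoke i
      ... | inj₁ a′ | _ = a′ , refl
      ... | inj₂ y | h = case trans (sym (cong (λ v → colour v (inj₂ y)) eq)) h of λ ()
    by-hub (inj₂ (inj₁ x)) eq = no-injection {s} (arith-234 δ k δ≤1) (λ i → toℕ (proj₁ (inC i)))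
        (λ i → toℕ<n (proj₁ (inC i)))
        (λ i j e → rim-inj i j (trans (proj₂ (inC i))
            (trans (cong (inj₂ ∘ inj₂) (toℕ-injective e)) (sym (proj₂ (inC j))))))
      where
      inC : ∀ i → ∃ λ c → rim i ≡ inj₂ (inj₂ c)
      inC i with F (suc i) in e | spoke i
      ... | inj₂ (inj₂ c) | _ = c , refl
      ... | inj₁ a | h = case trans (sym (cong (λ v → colour v (inj₁ a)) eq)) h of λ ()
      ... | inj₂ (inj₁ y) | h = case trans (sym (cong (λ v → colour v (inj₂ (inj₁ y))) eq)) h of λ ()
    by-hub (inj₂ (inj₂ c)) eq = no-injection {2 * k + δ + n} (arith-235 k δ) (λ i → proj₁ (code i))
        (λ i → proj₁ (proj₂ (code i)))
        (λ i j e → rim-inj i j (same (proj₂ (proj₂ (code i)))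
            (subst (λ g → Code g (rim j)) (sym e) (proj₂ (proj₂ (code j))))))
      where
      -- Red neighbours of `c` get distinct numbers below 2n - 1: residues from `k + 1` to
      -- `s - k - 1` come first, lowered by `k + 1`, and the n vertices of the other part follow
      -- from `2 * k + δ` on.
      Code : ℕ → Node → Set
      Code g v = (∃ λ j → v ≡ inj₂ (inj₂ j) × Residue c j (g + suc k) × g < 2 * k + δ) ⊎
          (∃ λ y → v ≡ inj₂ (inj₁ y) × g ≡ 2 * k + δ + toℕ y)
      same : ∀ {g v w} → Code g v → Code g w → v ≡ w
      same (inj₁ (j , refl , res , _)) (inj₁ (j′ , refl , res′ , _)) = cong (inj₂ ∘ inj₂)
          (residue-injective c j j′ res res′)
      same (inj₂ (y , refl , e)) (inj₂ (y′ , refl , e′)) = cong (inj₂ ∘ inj₁)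
          (toℕ-injective (+-cancelˡ-≡ (2 * k + δ) _ _ (trans (sym e) e′)))
      same (inj₁ (_ , _ , _ , lt)) (inj₂ (y , _ , refl)) =
          ⊥-elim (<-irrefl refl (≤-trans lt (m≤m+n (2 * k + δ) (toℕ y))))
      same (inj₂ (y , _ , refl)) (inj₁ (_ , _ , _ , lt)) =
          ⊥-elim (<-irrefl refl (≤-trans lt (m≤m+n (2 * k + δ) (toℕ y))))
      not-true : ∀ {b} → not b ≡ true → b ≡ false
      not-true {false} _ = refl
      code : ∀ i → ∃ λ g → g < 2 * k + δ + n × Code g (rim i)
      code i with F (suc i) in e | spoke i
      ... | inj₁ a | h = case trans (sym (cong (λ v → colour v (inj₁ a)) eq)) h of λ ()
      ... | inj₂ (inj₁ y) | h = 2 * k + δ + toℕ y , +-monoʳ-< (2 * k + δ) (toℕ<n y) , inj₂ (y , refl , refl)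
      ... | inj₂ (inj₂ j) | h = far (residue c j)
        where
        is-far : near c j ≡ false
        is-far = not-true (trans (sym (cong (λ v → colour v (inj₂ (inj₂ j))) eq)) h)
        far : ∃ (Residue c j) → ∃ λ g → g < 2 * k + δ + n × Code g (inj₂ (inj₂ j))
        far (r , res) = r ∸ suc k , ≤-trans g< (m≤m+n _ n) ,
            inj₁ (j , refl , subst (Residue c j) (sym (m∸n+n≡m (proj₁ bounds))) res , g<)
          where
          bounds = far-bounds c j is-far res
          g< : r ∸ suc k < 2 * k + δ
          g< = arith-236 (r ∸ suc k) k r δ (m∸n+n≡m (proj₁ bounds)) (proj₂ bounds)

  module BlueCopy (F : Fin (suc (2 * n)) → Node) (F-inj : ∀ i j → F i ≡ F j → i ≡ j)
              (F-adj : ∀ i j → Wheel (2 * n) i j → colour (F i) (F j) ≡ false) where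

    open Copy false F F-inj F-adj

    -- blue has no edges inside the red clique, so every second rim vertex lies outside it
    abstract
      pick : ∀ j → j < n → ∃ λ i → (toℕ i ≡ j + j ⊎ toℕ i ≡ suc (j + j)) × ∃ λ y → rim i ≡ inj₂ y
      pick j j<n = choose (at (j + j) (<-trans (n<1+n (j + j)) lt)) (at (suc (j + j)) lt) refl refl
        where
        lt : suc (j + j) < 2 * n
        lt = arith-237 j n j<n
        choose : ∀ v w → at (j + j) (<-trans (n<1+n (j + j)) lt) ≡ v → at (suc (j + j)) lt ≡ w →
          ∃ λ i → (toℕ i ≡ j + j ⊎ toℕ i ≡ suc (j + j)) × ∃ λ y → rim i ≡ inj₂ y
        choose (inj₂ y) _ eq _ = _ , inj₁ (toℕ-fromℕ< (<-trans (n<1+n (j + j)) lt)) , y , eq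
        choose (inj₁ _) (inj₂ y) _ eq = _ , inj₂ (toℕ-fromℕ< lt) , y , eq
        choose (inj₁ a) (inj₁ a′) eq eq′ = case trans (sym (cong₂ colour eq eq′)) (at-step (j + j) lt) of λ ()

      picked : Fin n → Fin (2 * n)
      picked j = proj₁ (pick (toℕ j) (toℕ<n j))

      picked-inj : ∀ i j → picked i ≡ picked j → i ≡ j
      picked-inj i j eq = toℕ-injective (halves-≡ (toℕ i) (toℕ j) (proj₁ (proj₂ (pick (toℕ i) (toℕ<n i))))
        (subst (λ q → toℕ q ≡ toℕ j + toℕ j ⊎ toℕ q ≡ suc (toℕ j + toℕ j)) (sym eq)
            (proj₁ (proj₂ (pick (toℕ j) (toℕ<n j))))))

      picked-node : ∀ j → ∃ λ y → rim (picked j) ≡ inj₂ y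
      picked-node j = proj₂ (proj₂ (pick (toℕ j) (toℕ<n j)))

    -- With its hub in the red clique, the wheel has its rim in one blue component of the rest,
    -- which has fewer than 2n vertices. With its hub elsewhere, at least n rim vertices lie outside
    -- the red clique, while the hub has at most n - 1 blue neighbours there.
    by-hub : ∀ v → hub ≡ v → ⊥
    by-hub (inj₁ a) eq = by-first (rim zero) refl
      where
      outside : ∀ i → ∃ λ y → rim i ≡ inj₂ y
      outside i with F (suc i) in e | spoke i
      ... | inj₂ y | _ = y , refl
      ... | inj₁ a′ | h = case trans (sym (cong (λ v → colour v (inj₁ a′)) eq)) h of λ ()
      2n>0 : 0 < 2 * n
      2n>0 = s≤s z≤n
      first : at 0 2n>0 ≡ rim zero
      first = refl
      -- Membership in one of the two blue components spreads from the first rim vertex along the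
      -- rim.
      onward : (P : Node → Set) → (∀ v w → P v → colour v w ≡ false → (∃ λ y → w ≡ inj₂ y) → P w) →
          P (rim zero) → ∀ t (lt : t < 2 * n) → P (at t lt)
      onward P closed p zero lt = p
      onward P closed p (suc t) lt = closed _ _ (onward P closed p t (<-trans (n<1+n t) lt)) (at-step t lt) (outside _)
      all-rim : ∀ {P : Node → Set} → (∀ t (lt : t < 2 * n) → P (at t lt)) → ∀ i → P (rim i)
      all-rim {P} h i = subst (λ i → P (rim i)) (fromℕ<-toℕ i (toℕ<n i)) (h (toℕ i) (toℕ<n i))
      by-first : ∀ v → rim zero ≡ v → ⊥
      by-first (inj₁ a′) e with outside zero
      ... | y , e′ = case trans (sym e) e′ of λ ()
      by-first (inj₂ (inj₁ x)) e = no-injection {n} (arith-238 k δ) (λ i → toℕ (proj₁ (inB i)))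
          (λ i → toℕ<n (proj₁ (inB i)))
          (λ i j e → rim-inj i j (trans (proj₂ (inB i))
              (trans (cong (inj₂ ∘ inj₁) (toℕ-injective e)) (sym (proj₂ (inB j))))))
        where
        B : Node → Set
        B v = ∃ λ x → v ≡ inj₂ (inj₁ x)
        closed : ∀ v w → B v → colour v w ≡ false → (∃ λ y → w ≡ inj₂ y) → B w
        closed _ _ (x , refl) h (inj₁ y , refl) = y , refl
        closed _ _ (x , refl) () (inj₂ y , refl)
        inB : ∀ i → B (rim i)
        inB = all-rim {B} (onward B closed (x , e))
      by-first (inj₂ (inj₂ x)) e = no-injection {s} (arith-234 δ k δ≤1) (λ i → toℕ (proj₁ (inC i)))
          (λ i → toℕ<n (proj₁ (inC i)))
          (λ i j e → rim-inj i j (trans (proj₂ (inC i))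
              (trans (cong (inj₂ ∘ inj₂) (toℕ-injective e)) (sym (proj₂ (inC j))))))
        where
        C : Node → Set
        C v = ∃ λ x → v ≡ inj₂ (inj₂ x)
        closed : ∀ v w → C v → colour v w ≡ false → (∃ λ y → w ≡ inj₂ y) → C w
        closed _ _ (x , refl) h (inj₂ y , refl) = y , refl
        closed _ _ (x , refl) () (inj₁ y , refl)
        inC : ∀ i → C (rim i)
        inC = all-rim {C} (onward C closed (x , e))
    by-hub (inj₂ (inj₁ x)) eq = no-injection ≤-refl code bound injective
      where
      inB : ∀ j → ∃ λ y → rim (picked j) ≡ inj₂ (inj₁ y)
      inB j with picked-node j
      ... | inj₁ y , e = y , e
      ... | inj₂ y , e = case trans (sym (cong₂ colour eq e)) (spoke (picked j)) of λ ()
      code : Fin (suc n) → ℕ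
      code zero = toℕ x
      code (suc j) = toℕ (proj₁ (inB j))
      bound : ∀ i → code i < n
      bound zero = toℕ<n x
      bound (suc j) = toℕ<n (proj₁ (inB j))
      not-hub : ∀ j → toℕ x ≡ toℕ (proj₁ (inB j)) → ⊥
      not-hub j e = case F-inj zero (suc (picked j))
          (trans eq (trans (cong (inj₂ ∘ inj₁) (toℕ-injective e)) (sym (proj₂ (inB j))))) of λ ()
      injective : ∀ i j → code i ≡ code j → i ≡ j
      injective zero zero _ = refl
      injective zero (suc j) e = ⊥-elim (not-hub j e)
      injective (suc i) zero e = ⊥-elim (not-hub i (sym e))
      injective (suc i) (suc j) e = cong suc
          (picked-inj i j (rim-inj _ _ (trans (proj₂ (inB i))
          (trans (cong (inj₂ ∘ inj₁) (toℕ-injective e)) (sym (proj₂ (inB j)))))))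
    by-hub (inj₂ (inj₂ c)) eq = no-injection {2 * k} (arith-239 k δ) (λ j → proj₁ (code j))
        (λ j → proj₁ (proj₂ (code j)))
        (λ i j e → picked-inj i j (rim-inj _ _
            (same (proj₂ (proj₂ (code i))) (subst (λ g → Code g (rim (picked j))) (sym e)
            (proj₂ (proj₂ (code j)))))))
      where
      -- Residues from 1 to `k` are numbered from 0, and those from `s - k` to `s - 1` continue from
      -- `k` on.
      Code : ℕ → Node → Set
      Code g v = ∃ λ j → v ≡ inj₂ (inj₂ j) × ∃ λ r → Residue c j r ×
          ((suc g ≡ r × r ≤ k) ⊎ (g + s ≡ r + 2 * k × s ≤ r + k))
      same : ∀ {g v w} → Code g v → Code g w → v ≡ w
      same {g} (j , refl , r , res , h) (j′ , refl , r′ , res′ , h′) = cong (inj₂ ∘ inj₂)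
          (residue-injective c j j′ res (subst (Residue c j′) (r≡ h′ h) res′))
        where
        r≡ : (suc g ≡ r′ × r′ ≤ k) ⊎ (g + s ≡ r′ + 2 * k × s ≤ r′ + k) → (suc g ≡ r × r ≤ k) ⊎
            (g + s ≡ r + 2 * k × s ≤ r + k) → r′ ≡ r
        r≡ (inj₁ (e , _)) (inj₁ (e′ , _)) = trans (sym e) e′
        r≡ (inj₂ (e , _)) (inj₂ (e′ , _)) = +-cancelʳ-≡ (2 * k) _ _ (trans (sym e) e′)
        r≡ (inj₁ (e , l)) (inj₂ (e′ , l′)) = ⊥-elim (arith-240 g r′ k s r e l e′ l′)
        r≡ (inj₂ (e , l)) (inj₁ (e′ , l′)) = ⊥-elim (arith-240 g r k s r′ e′ l′ e l)
      code : ∀ j → ∃ λ g → g < 2 * k × Code g (rim (picked j))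
      code j with picked-node j
      ... | inj₁ y , e = case trans (sym (cong₂ colour eq e)) (spoke (picked j)) of λ ()
      ... | inj₂ i , e = close (residue c i)
        where
        not-false : ∀ {b} → not b ≡ false → b ≡ true
        not-false {true} _ = refl
        distinct : c ≢ i
        distinct c≡i = case F-inj zero (suc (picked j)) (trans eq (trans (cong (inj₂ ∘ inj₂) c≡i) (sym e))) of λ ()
        close : ∃ (Residue c i) → ∃ λ g → g < 2 * k × Code g (rim (picked j))
        close (r , res) with near-bounds c i (not-false (trans (sym (cong₂ colour eq e)) (spoke (picked j))))
            res distinct
        ... | pos , _ , inj₁ r≤k = r ∸ 1 , (arith-241 (r ∸ 1) r k (m∸n+n≡m pos) r≤k pos) , i , e , r , res ,
            inj₁ (trans (+-comm 1 _) (m∸n+n≡m pos) , r≤k)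
        ... | _ , r<s , inj₂ s≤ = g , (arith-242 g s r k (m∸n+n≡m s≤′) r<s) , i , e , r , res , inj₂ (m∸n+n≡m s≤′ , s≤)
          where
          s≤′ : s ≤ r + 2 * k
          s≤′ = arith-243 s r k s≤
          g = r + 2 * k ∸ s

  -- Since `s` is 2n - 1 - δ, the total is 5n - 1 - δ.
  size : ℕ
  size = 2 * n + (n + s)

  node : Fin size → Node
  node v with splitAt (2 * n) v
  ... | inj₁ a = inj₁ a
  ... | inj₂ v′ = inj₂ (splitAt n v′)

  node-inj : ∀ v w → node v ≡ node w → v ≡ w
  node-inj v w eq with splitAt (2 * n) v in e | splitAt (2 * n) w in e′
  node-inj v w refl | inj₁ a | inj₁ .a = splitAt-injective (2 * n) v w (trans e (sym e′))
  ... | inj₂ v′ | inj₂ w′ = splitAt-injective (2 * n) v w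
      (trans e (trans (cong inj₂ (splitAt-injective n v′ w′ (inj₂-injective eq))) (sym e′)))

  colouring : Colouring size
  colouring = (λ v w → colour (node v) (node w)) , (λ v w → colour-sym (node v) (node w))

  no-copy : ¬ HasMonoCopy (Wheel (2 * n)) colouring
  no-copy (true , f , inj , adj) = RedCopy.by-hub (node ∘ f) (λ i j eq → inj (node-inj _ _ eq)) adj _ refl
  no-copy (false , f , inj , adj) = BlueCopy.by-hub (node ∘ f) (λ i j eq → inj (node-inj _ _ eq)) adj _ refl

-- Finite search

arith-244 : ∀ m k δ → m ≡ 2 * k + δ → suc (suc m) ≡ 2 * suc k + δ
arith-244 m k δ h1 = ≤-antisym (linear (m ∷ k ∷ δ ∷ []) 0 (con 1 ⊕ (con 1 ⊕ x0)) (con 2 ⊛ (con 1 ⊕ x1) ⊕ x2)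
    (equ (con 1) x0 (con 2 ⊛ x1 ⊕ x2) h1 ∷ []) refl) (linear (m ∷ k ∷ δ ∷ []) 0 (con 2 ⊛ (con 1 ⊕ x1) ⊕ x2)
        (con 1 ⊕ (con 1 ⊕ x0))
    (equ (con 1) (con 2 ⊛ x1 ⊕ x2) x0 (sym h1) ∷ []) refl)

arith-245 : ∀ R v1 δ k → R < v1 → v1 + δ ≡ 5 * suc (2 * k + δ) → R ≤ 2 * suc (2 * k + δ) +
    (suc (2 * k + δ) + suc (4 * k + δ))
arith-245 R v1 δ k h1 h2 = linear (R ∷ v1 ∷ δ ∷ k ∷ []) 0 x0
    (con 2 ⊛ (con 1 ⊕ (con 2 ⊛ x3 ⊕ x2)) ⊕ (con 1 ⊕ (con 2 ⊛ x3 ⊕ x2) ⊕ (con 1 ⊕ (con 4 ⊛ x3 ⊕ x2))))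
    (hyp (con 1) (con 1 ⊕ x0) x1 h1 ∷ equ (con 1) (x1 ⊕ x2) (con 5 ⊛ (con 1 ⊕ (con 2 ⊛ x3 ⊕ x2))) h2 ∷ []) refl

arith-246 : ∀ m → suc (8 * (m + 83)) ≤ 8 * suc m + 664
arith-246 m = linear (m ∷ []) 0 (con 1 ⊕ con 8 ⊛ (x0 ⊕ con 83)) (con 8 ⊛ (con 1 ⊕ x0) ⊕ con 664) [] refl

Searchable : (A : Set) → (A → A → Set) → Set₁
Searchable A _≈_ = {P : A → Set} → (∀ {x y} → x ≈ y → P x → P y) → (∀ x → Dec (P x)) → Dec (∃ P)

search-Bool : Searchable Bool _≡_
search-Bool _ P? with P? true | P? false
... | yes p | _ = yes (true , p)
... | no _ | yes p = yes (false , p)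
... | no p | no q = no λ { (true , h) → p h ; (false , h) → q h }

search-Fin : ∀ {n} → Searchable (Fin n) _≡_
search-Fin _ = Fin.any?

-- Without function extensionality, functions are searched up to pointwise equality.
search-functions : ∀ {A : Set} {_≈_ : A → A → Set} → (∀ {x} → x ≈ x) → Searchable A _≈_ →
  ∀ k → Searchable (Fin k → A) (λ f g → ∀ i → f i ≈ g i)
search-functions ≈-refl search zero {P} resp P? = map′ (λ p → Vector.[] , p)
    (λ (f , p) → resp {f} {Vector.[]} (λ ()) p) (P? Vector.[])
search-functions {A} {_≈_} ≈-refl search (suc k) {P} resp P? =
  map′ (λ (a , g , p) → a Vector.∷ g , p)
      (λ (f , p) → f zero , f ∘ suc , resp (λ { zero → ≈-refl ; (suc i) → ≈-refl }) p)
    (search {λ a → ∃ λ g → P (a Vector.∷ g)} (λ x≈y (g , p) → g , resp (λ { zero → x≈y ; (suc i) → ≈-refl }) p)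
      (λ a → search-functions {A} {_≈_} ≈-refl search k
          (λ f≈g → resp (λ { zero → ≈-refl ; (suc i) → f≈g i })) (λ g → P? (a Vector.∷ g))))

injective? : ∀ {m n} (f : Fin m → Fin n) → Dec (Injective _≡_ _≡_ f)
injective? f = map′ (λ h {x} {y} → h x y) (λ h x y → h) (all? λ x → all? λ y → (f x Fin.≟ f y) →-dec (x Fin.≟ y))

module _ {v : ℕ} (H : Graph v) (H? : ∀ i j → Dec (H i j)) where

  hasMonoCopy? : ∀ {N} (col : Colouring N) → Dec (HasMonoCopy H col)
  hasMonoCopy? {N} (c , c-sym) = search-Bool (λ { refl p → p }) λ b →
    search-functions {Fin N} {_≡_} refl search-Fin v
      (λ f≗g (inj , adj) → (λ {x} {y} eq → inj (trans (f≗g x) (trans eq (sym (f≗g y))))) ,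
        λ i j h → trans (cong₂ c (sym (f≗g i)) (sym (f≗g j))) (adj i j h))
      λ f → injective? f ×-dec all? λ i → all? λ j → H? i j →-dec (c (f i) (f j) Bool.≟ b)

  private
    -- Symmetry is made part of the property searched for, so that the search ranges over all
    -- functions of two arguments.
    Avoids : ∀ {N} → (Fin N → Fin N → Bool) → Set
    Avoids c = Σ (∀ x y → c x y ≡ c y x) λ c-sym → ¬ HasMonoCopy H (c , c-sym)

    avoids? : ∀ {N} (c : Fin N → Fin N → Bool) → Dec (Avoids c)
    avoids? c with all? (λ x → all? (λ y → c x y Bool.≟ c y x))
    ... | no asym = no (asym ∘ proj₁)
    ... | yes c-sym = map′ (c-sym ,_) proj₂ (¬? (hasMonoCopy? (c , c-sym)))

  arrows? : ∀ N → Dec (Arrows N H)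
  arrows? N = map′ {A = ¬ ∃ (Avoids {N})} (λ h col → decidable-stable (hasMonoCopy? col) λ none →
      h (proj₁ col , proj₂ col , none))
    (λ arr (c , c-sym , none) → none (arr (c , c-sym)))
    (¬? (search-functions {Fin N → Bool} {λ f g → ∀ j → f j ≡ g j} (λ _ → refl)
        (search-functions {Bool} {_≡_} refl search-Bool N) N
      {Avoids} (λ c≗d (c-sym , none) → (λ x y → trans (sym (c≗d x y)) (trans (c-sym x y) (c≗d y x))) ,
        λ (b , f , inj , adj) → none (b , f , inj , λ i j h → trans (c≗d (f i) (f j)) (adj i j h)))
      avoids?))

arrows-mono : ∀ {v M N} {H : Graph v} → M ≤ N → Arrows M H → Arrows N H
arrows-mono M≤N arr (c , c-sym) with arr ((λ x y → c (inject≤ x M≤N) (inject≤ y M≤N)) , λ x y → c-sym _ _)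
... | b , f , inj , adj = b , (λ i → inject≤ (f i) M≤N) , (λ eq → inj (inject≤-injective M≤N M≤N _ _ eq)) , adj

least : ∀ {P : ℕ → Set} → (∀ m → Dec (P m)) → ∀ N → P N → ∃ λ m → m ≤ N × P m × (∀ i → i < m → ¬ P i)
least {P} P? N p = case find-below (suc N) of λ
  { (inj₁ (m , m<1+N , q)) → m , ≤-pred m<1+N , q
  ; (inj₂ none) → ⊥-elim (none N ≤-refl p) }
  where
  find-below : ∀ j → (∃ λ m → m < j × P m × (∀ i → i < m → ¬ P i)) ⊎ (∀ i → i < j → ¬ P i)
  find-below zero = inj₂ λ _ ()
  find-below (suc j) with find-below j
  ... | inj₁ (m , m<j , q) = inj₁ (m , m≤n⇒m≤1+n m<j , q)
  ... | inj₂ none with P? j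
  ...   | yes q = inj₁ (j , ≤-refl , q , none)
  ...   | no ¬q = inj₂ λ i i<1+j q → case m≤n⇒m<n∨m≡n (≤-pred i<1+j) of
      λ { (inj₁ i<j) → none i i<j q ; (inj₂ refl) → ¬q q }

wheel-adjacent? : ∀ k i j → Dec (Wheel k i j)
wheel-adjacent? k zero zero = no λ ()
wheel-adjacent? k zero (suc j) = yes tt
wheel-adjacent? k (suc i) zero = yes tt
wheel-adjacent? k (suc i) (suc j) = (toℕ j ≟ suc (toℕ i)) ⊎-dec (toℕ i ≟ suc (toℕ j))
  ⊎-dec ((toℕ i ≟ 0 ×-dec suc (toℕ j) ≟ k) ⊎-dec (toℕ j ≟ 0 ×-dec suc (toℕ i) ≟ k))

-- For n = `suc m`, `δ` is 1 exactly when n is even; then n - 1 is odd and the even degree `2k` of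
-- the circulant graph falls one short of it. This is the parity term of the lower bound.
halving : ∀ m → ∃₂ λ k δ → δ ≤ 1 × m ≡ 2 * k + δ × suc m % 2 ≡ 1 ∸ δ
halving zero = 0 , 0 , z≤n , refl , refl
halving (suc zero) = 0 , 1 , ≤-refl , refl , refl
halving (suc (suc m)) with halving m
... | k , δ , δ≤1 , eq , mod = suc k , δ , δ≤1 , (arith-244 m k δ eq) , mod

lower-bound : ∀ m R → Arrows R (Wheel (2 * suc m)) → 5 * suc m ∸ (1 ∸ suc m % 2) ≤ R
lower-bound m R arr with halving m
... | k , δ , δ≤1 , refl , mod = subst (λ r → 5 * suc m ∸ (1 ∸ r) ≤ R) (sym mod)
  (subst (λ d → 5 * suc m ∸ d ≤ R) (sym (m∸[m∸n]≡n δ≤1)) (≮⇒≥ too-small))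
  where
  open LowerBound k δ δ≤1
  too-small : R < 5 * suc m ∸ δ → ⊥
  too-small R< = no-copy (arrows-mono
      (arith-245 R (5 * suc m ∸ δ) δ k R< (m∸n+n≡m {5 * suc m} {δ} (≤-trans δ≤1 (s≤s z≤n)))) arr colouring)

theorem1p1 : (n : ℕ) → 2 ≤ n →
    Σ ℕ (λ R → IsRamseyNumber (Wheel (2 * n)) R
      × (5 * n ∸ (1 ∸ n % 2) ≤ R) × (R ≤ 8 * n + 664))
theorem1p1 (suc m) 2≤n = R , (arr , minimal) , lower-bound m R arr , ≤-trans R≤ (arith-246 m)
  where
  H? = wheel-adjacent? (2 * suc m)
  -- In terms of n = `suc m` the number of vertices is 8n + 657.
  arr₀ : Arrows (suc (8 * (m + 83))) (Wheel (2 * suc m))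
  arr₀ col = decidable-stable (hasMonoCopy? (Wheel (2 * suc m)) H? col) (arrows m (≤-pred 2≤n) col)
  ramsey = least (arrows? (Wheel (2 * suc m)) H?) (suc (8 * (m + 83))) arr₀
  R = proj₁ ramsey
  R≤ = proj₁ (proj₂ ramsey)
  arr = proj₁ (proj₂ (proj₂ ramsey))
  minimal = proj₂ (proj₂ (proj₂ ramsey))
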